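{- Let $\sigma$ be a fixed finite vocabulary and let $\mathcal{C}$ be a class of finite ordered $\sigma$-structures. Then $\mathcal{C}$ is decidable by a random-access Turing machine working in polylogarithmic space with respect to $\hat n$, where $\hat n=|\mathrm{bin}(\mathbf{A})|$ is the size of the binary encoding of the input structure $\mathbf{A}$, if and only if $\mathcal{C}$ is decidable by a direct-access Turing machine in polylogarithmic space with respect to $n$, where $n=|A|$ is the size of the domain of the input structure.
   Context: **Structures.** A finite vocabulary $\sigma=\{R_1^{r_1},\dots,R_p^{r_p},c_1,\dots,c_q,f_1^{k_1},\dots,f_s^{k_s}\}$ consists of relation symbols ($R_i$ of arity $r_i$), constant symbols and function symbols ($f_i$ of arity $k_i$, interpreted by total functions). A finite ordered $\sigma$-structure $\mathbf{A}$ is a finite structure of vocabulary $\sigma\cup\{\le\}$, $\le\,\notin\sigma$, with $\le^{\mathbf{A}}$ a linear order on $A$. One assumes the domain is $A=\{0,\dots,n-1\}$ with its natural order. $\log$ is the binary logarithm. **Encoding.** $\mathrm{bin}(\mathbf{A})$ is the concatenation of the following binary strings, for all relations, then all constants, then all functions in $\sigma$: each relation $R_i^{\mathbf{A}}$ is encoded by a string of length $n^{r_i}$ whose $m$-th bit is $1$ iff the $m$-th tuple of $A^{r_i}$ (in lexicographic order) is in $R_i^{\mathbf{A}}$; each constant is encoded by its binary representation of length $\lceil\log n\rceil$; each function $f_i^{\mathbf{A}}$ is encoded by the encodings of $\lceil\log n\rceil$ many $k_i$-ary relations, the $m$-th of which indicates whether the $m$-th bit of the value of the function is $1$. (The order $\le^{\mathbf{A}}$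 is not encoded explicitly.) **Random-access Turing machine.** A deterministic multi-tape machine $(Q,\Sigma,\delta,q_0,F)$ with $\Sigma=\{0,1,\sqcup\}$, a finite state set $Q$, initial state $q_0$, accepting states $F\subseteq Q$, a read-only random-access input-tape, a sequential-access address-tape (over $\{0,1,\sqcup\}$), and a fixed number $k\ge 1$ of sequential-access work-tapes; all tapes have a leftmost cell and are infinite to the right, and a head on the leftmost cell may not move left. The (partial) transition function is $\delta: Q\times(\Sigma\cup\{\triangleleft\})\times\Sigma^{k+1}\to Q\times(\Sigma\times\{\leftarrow,\rightarrow,-\})^{k+1}$: depending on the state, the scanned input symbol and the symbols scanned on the address-tape and work-tapes, it gives the new state and the symbols written and head moves on the address-tape and work-tapes. The machine halts when $\delta$ is undefined. If the number written in binary (most significant bit leftmost) on the address-tape from its leftmost cell up to the first blank is $i$ (with $i=0$ if the leftmost cell is blank), then the scanned input symbol is the $(i+1)$-th symbol of the input string if $i$ is less than its length, and the end-marker $\triangleleft$ otherwise. Initially the state is $q_0$, the address-tape contains $0$, the work-tapes are blank and all sequential heads are on the leftmost cells. An input is accepted if a configuration with state in $F$ is reached. **Direct-access Turing machine (for $\sigma$).** A deterministic multi-tape machine over the alphabet $\Sigma=\{0,1,\sqcup\}$ taking $\sigma$-structures $\mathbf{A}$ as input, with: $r_1+\dots+r_p+k_1+\dots+k_s$ distinguished work-tapes called address-tapes ($r_i$ of them dedicated to $R_i$, and $k_i$ to $f_i$); $s$ read-only value-tapes, one for each function symbol; $q+1$ read-only constant-tapes; and one or more ordinary work-tapes. In each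 step the new state, the head move on each tape, and the symbol written on each address-tape and each ordinary work-tape are determined (by a fixed, possibly partial, transition function; undefined means halt) by the current state, the symbols scanned on all tapes, and, for each $R_i\in\sigma$, the answer bit ($0$ or $1$) to the query $(n_1,\dots,n_{r_i})\in R_i^{\mathbf{A}}$, where $n_j$ is the number written in binary on the $j$-th address-tape of $R_i$. After that, the content of the value-tape of each $f_i$ is updated to $f_i^{\mathbf{A}}(n_1,\dots,n_{k_i})$ written in binary, where $n_j$ is the number now written in binary on the $j$-th address-tape of $f_i$; if some $n_j$ is too large (i.e. $\ge n$), the value-tape is updated to contain only blanks. Initially the constant-tapes hold $c_1^{\mathbf{A}},\dots,c_q^{\mathbf{A}}$ in binary and one further constant-tape holds $n=|A|$ in binary; all other tapes are blank. Acceptance is by reaching a state in $F$. **Deciding in polylogarithmic space.** A random-access machine $M$ decides $\mathcal{C}$ in polylogarithmic space with respect to $\hat n$ if there is $k\in\mathbb{N}$ such that, for every finite ordered $\sigma$-structure $\mathbf{A}$, on input $\mathrm{bin}(\mathbf{A})$ the machine visits at most $O(\lceil\log\hat n\rceil^k)$ cells in each work-tape (including the address-tape) before accepting or rejecting, it always accepts or rejects, and it accepts iff $\mathbf{A}\in\mathcal{C}$. Likewise for a direct-access machine on input $\mathbf{A}$, with $n$ in place of $\hat n$ (address-tapes counted as work-tapes).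
   Formalization: The vocabulary must have a relation or function symbol of positive arity (otherwise bin(A) does not determine n and the claim fails), and heads on read-only value- and constant-tapes stay within the stored string and the following blank (else they are free unbounded counters). -}

module Defs where

open import Data.Bool.Base using (Bool; true; false; if_then_else_)
open import Data.Fin.Base using (Fin; toℕ; fromℕ<)
open import Data.List.Base using (List; []; _∷_; _++_; map; concat; concatMap; foldr; length; downFrom; allFin; cartesianProductWith)
open import Data.List.Relation.Unary.All as All using (All)
open import Data.List.Relation.Unary.Any using (Any)
open import Data.Maybe.Base as Maybe using (Maybe; just; nothing)
open import Data.Nat.Base using (ℕ; zero; suc; pred; _+_; _*_; _^_; _%_; _≡ᵇ_; _≤_; _<_; _⊔_; ⌊_/2⌋; NonZero)
open import Data.Nat.Logarithm using (⌊log₂_⌋; ⌈log₂_⌉)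
open import Data.Nat.Properties using (_<?_)
open import Data.Product.Base using (Σ; ∃; _×_; _,_; uncurry)
open import Data.Vec.Base as Vec using (Vec; []; _∷_)
open import Function.Base using (id)
open import Function.Bundles using (_⇔_; _↔_)
open import Level using (Level; 0ℓ) renaming (suc to lsuc; _⊔_ to _⊔ˡ_)
open import Relation.Binary.PropositionalEquality.Core using (_≡_)
open import Relation.Nullary.Decidable.Core using (dec⇒maybe)
open import Relation.Unary using (Pred)

private
  variable
    ℓ : Level

------------------------------------------------------------------------
-- Vocabularies and finite ordered structures

record Vocabulary : Set where
  field
    relations  : List ℕ   -- the arities r₁, …, rₚ
    #constants : ℕ
    functions  : List ℕ   -- the arities k₁, …, kₛ

open Vocabulary public

-- Without a relation or function symbol of positive arity, bin(A) has length
-- O(⌈log n⌉) and does not determine n = |A|.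

HasPositiveArity : Vocabulary → Set
HasPositiveArity σ = Any (0 <_) (relations σ ++ functions σ)

-- The domain is {0, …, size - 1}, nonempty, and the linear order is the
-- order of Fin size; being determined by size, it is not a field.

record OrderedStructure (σ : Vocabulary) : Set where
  field
    size     : ℕ
    nonEmpty : NonZero size
    relᴵ     : All (λ r → Vec (Fin size) r → Bool) (relations σ)
    constᴵ   : Vec (Fin size) (#constants σ)
    funᴵ     : All (λ k → Vec (Fin size) k → Fin size) (functions σ)

------------------------------------------------------------------------
-- Binary representations, most significant bit first

testBit : ℕ → ℕ → Bool
testBit v zero    = v % 2 ≡ᵇ 1
testBit v (suc j) = testBit ⌊ v /2⌋ j

binary : (len : ℕ) → ℕ → List Bool
binary len v = map (testBit v) (downFrom len)

-- No leading zeros, except that 0 is written "0" (⌊log₂ 0 ⌋ is 0).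

numeral : ℕ → List Bool
numeral v = binary (suc ⌊log₂ v ⌋) v

------------------------------------------------------------------------
-- The encoding bin(A)

-- All r-tuples, in lexicographic order.

tuples : (n r : ℕ) → List (Vec (Fin n) r)
tuples n zero    = [] ∷ []
tuples n (suc r) = cartesianProductWith _∷_ (allFin n) (tuples n r)

module _ {n : ℕ} where

  encodeRelation : ∀ {r} → (Vec (Fin n) r → Bool) → List Bool
  encodeRelation R = map R (tuples n _)

  encodeConstant : Fin n → List Bool
  encodeConstant c = binary ⌈log₂ n ⌉ (toℕ c)

  encodeFunction : ∀ {k} → (Vec (Fin n) k → Fin n) → List Bool
  encodeFunction f =
    concatMap (λ m → encodeRelation (λ t → testBit (toℕ (f t)) m))
              (downFrom ⌈log₂ n ⌉)

bin : ∀ {σ} → OrderedStructure σ → List Bool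
bin A = concat (All.reduce encodeRelation relᴵ)
     ++ concat (Vec.toList (Vec.map encodeConstant constᴵ))
     ++ concat (All.reduce encodeFunction funᴵ)
  where open OrderedStructure A

------------------------------------------------------------------------
-- Tapes

data Symbol : Set where
  bit   : Bool → Symbol
  blank : Symbol

data Move : Set where
  left right stay : Move

-- A tape that is infinite to the right: content lists its cells from the
-- leftmost one on, and all cells beyond the end of the list are blank.

record Tape : Set where
  constructor tape
  field
    content : List Symbol
    head    : ℕ

open Tape public

cell : List Symbol → ℕ → Symbol
cell []       _       = blank
cell (x ∷ _)  zero    = x
cell (_ ∷ xs) (suc i) = cell xs i

overwrite : List Symbol → ℕ → Symbol → List Symbol
overwrite []       zero    s = s ∷ []
overwrite []       (suc i) s = blank ∷ overwrite [] i s
overwrite (_ ∷ xs) zero    s = s ∷ xs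
overwrite (x ∷ xs) (suc i) s = x ∷ overwrite xs i s

scan : Tape → Symbol
scan t = cell (content t) (head t)

blankTape : Tape
blankTape = tape [] 0

holding : List Bool → List Symbol
holding = map bit

-- A left move on the leftmost cell leaves the head where it is.

move : Move → ℕ → ℕ
move left  = pred
move right = suc
move stay  = id

act : Symbol × Move → Tape → Tape
act (s , d) (tape xs h) = tape (overwrite xs h s) (move d h)

-- On a read-only tape the head stays within the stored string and the
-- blank following it: a right move on a blank cell leaves the head where
-- it is.  Read-only tapes are not charged for space, and with unconfined
-- heads they would provide unbounded counters for free.

moveReadOnly : Move → Tape → Tape
moveReadOnly right t with scan t
... | bit _ = tape (content t) (suc (head t))
... | blank = t
moveReadOnly d     t = tape (content t) (move d (head t))

-- The number written in binary from the leftmost cell up to the first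
-- blank, which is 0 if the leftmost cell is blank.

number : Tape → ℕ
number t = go 0 (content t)
  where
  go : ℕ → List Symbol → ℕ
  go acc []             = acc
  go acc (blank ∷ _)    = acc
  go acc (bit b ∷ xs)   = go (2 * acc + (if b then 1 else 0)) xs

-- On a tape whose head starts at the leftmost cell and moves by at most
-- one cell per step, the visited cells are those up to the rightmost head
-- position.  This is the largest head position plus one over a family of
-- tapes; `space` below takes the maximum over time as well.

cells : List Tape → ℕ
cells = foldr (λ t m → suc (head t) ⊔ m) 0

------------------------------------------------------------------------
-- Deterministic computations and polylogarithmic space

record System : Set₁ where
  field
    Config    : Set
    initial   : Config
    step      : Config → Maybe Config   -- nothing: the machine halts
    accepting : Config → Bool
    cellsOf   : Config → ℕ

module _ (S : System) where
  open System S

  -- Verdict c b: the computation from c ends by reaching an accepting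
  -- configuration (b = true), or by halting without having reached one
  -- (b = false).

  data Verdict (c : Config) : Bool → Set where
    accept   : accepting c ≡ true → Verdict c true
    reject   : accepting c ≡ false → step c ≡ nothing → Verdict c false
    continue : ∀ {c′ b} → accepting c ≡ false → step c ≡ just c′ →
               Verdict c′ b → Verdict c b

  space : ∀ {c b} → Verdict c b → ℕ
  space {c} (accept _)       = cellsOf c
  space {c} (reject _ _)     = cellsOf c
  space {c} (continue _ _ v) = cellsOf c ⊔ space v

-- `bounded` says that the space used is O(⌈log μ(x)⌉ ^ exponent).

record DecidesInPolylogSpace {Input : Set} (run : Input → System)
                             (μ : Input → ℕ) (𝒞 : Pred Input ℓ) : Set ℓ where
  open System
  field
    exponent factor threshold : ℕ
    halts   : ∀ x → ∃ λ b → Verdict (run x) (initial (run x)) b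
    correct : ∀ x → Verdict (run x) (initial (run x)) true ⇔ 𝒞 x
    bounded : ∀ x → threshold ≤ μ x →
              ∀ {b} (v : Verdict (run x) (initial (run x)) b) →
              space (run x) v ≤ factor * ⌈log₂ μ x ⌉ ^ exponent

------------------------------------------------------------------------
-- Random-access Turing machines

data InputSymbol : Set where
  symbol : Symbol → InputSymbol
  ◁      : InputSymbol

inputSymbol : List Bool → ℕ → InputSymbol
inputSymbol []       _       = ◁
inputSymbol (b ∷ _)  zero    = symbol (bit b)
inputSymbol (_ ∷ bs) (suc i) = inputSymbol bs i

-- The address-tape is the first of the 1 + k read-write tapes.

record RandomAccessMachine : Set₁ where
  field
    Q         : Set
    #Q        : ℕ
    finite    : Q ↔ Fin #Q
    q₀        : Q
    accepting : Q → Bool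
    k         : ℕ
    k≥1       : 1 ≤ k
    δ         : Q → InputSymbol → Vec Symbol (suc k) →
                Maybe (Q × Vec (Symbol × Move) (suc k))

module RandomAccess (M : RandomAccessMachine) (input : List Bool) where
  open RandomAccessMachine M

  record Config : Set where
    constructor config
    field
      state : Q
      tapes : Vec Tape (suc k)

  initial : Config
  initial = config q₀ (tape (holding (false ∷ [])) 0 ∷ Vec.replicate k blankTape)

  step : Config → Maybe Config
  step (config q ts) =
    Maybe.map (λ (q′ , actions) → config q′ (Vec.zipWith act actions ts))
              (δ q (inputSymbol input (number (Vec.head ts))) (Vec.map scan ts))

  system : System
  system = record
    { Config    = Config
    ; initial   = initial
    ; step      = step
    ; accepting = λ c → accepting (Config.state c)
    ; cellsOf   = λ c → cells (Vec.toList (Config.tapes c))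
    }

-- The size n̂ of the encoding of a structure.

n̂ : ∀ {σ} → OrderedStructure σ → ℕ
n̂ A = length (bin A)

RandomAccessDecidable : ∀ {σ} → Pred (OrderedStructure σ) ℓ → Set (lsuc 0ℓ ⊔ˡ ℓ)
RandomAccessDecidable 𝒞 =
  Σ RandomAccessMachine λ M →
    DecidesInPolylogSpace (λ A → RandomAccess.system M (bin A)) n̂ 𝒞

------------------------------------------------------------------------
-- Direct-access Turing machines

-- X and Y are the data per read-write tape and per read-only tape.  The
-- constant-tape holding n comes first, before those of the constants.

record PerTape (σ : Vocabulary) (k : ℕ) (X Y : Set) : Set where
  constructor perTape
  field
    relAddress : All (Vec X) (relations σ)
    funAddress : All (Vec X) (functions σ)
    value      : All (λ _ → Y) (functions σ)
    constant   : Vec Y (suc (#constants σ))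
    work       : Vec X k

-- The last argument of δ other than the state lists the query answers.

record DirectAccessMachine (σ : Vocabulary) : Set₁ where
  field
    Q         : Set
    #Q        : ℕ
    finite    : Q ↔ Fin #Q
    q₀        : Q
    accepting : Q → Bool
    k         : ℕ
    k≥1       : 1 ≤ k
    δ         : Q → PerTape σ k Symbol Symbol → All (λ _ → Bool) (relations σ) →
                Maybe (Q × PerTape σ k (Symbol × Move) Move)

module DirectAccess {σ : Vocabulary} (M : DirectAccessMachine σ)
                    (A : OrderedStructure σ) where
  open DirectAccessMachine M
  open OrderedStructure A
  open PerTape

  record Config : Set where
    constructor config
    field
      state : Q
      tapes : PerTape σ k Tape Tape

  element : ℕ → Maybe (Fin size)
  element i = Maybe.map (λ i<n → fromℕ< i<n) (dec⇒maybe (i <? size))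

  -- The tuple of elements addressed by some tapes, unless one of the
  -- numbers on them is too large.

  addressed : ∀ {r} → Vec Tape r → Maybe (Vec (Fin size) r)
  addressed []       = just []
  addressed (t ∷ ts) = Maybe.zipWith _∷_ (element (number t)) (addressed ts)

  answer : ∀ {r} → (Vec (Fin size) r → Bool) → Vec Tape r → Bool
  answer R ts = Maybe.maybe R false (addressed ts)

  valueContent : ∀ {r} → (Vec (Fin size) r → Fin size) → Vec Tape r → List Symbol
  valueContent f ts =
    Maybe.maybe (λ t → holding (numeral (toℕ (f t)))) [] (addressed ts)

  initial : Config
  initial = config q₀ (perTape
    (All.tabulate λ _ → Vec.replicate _ blankTape)
    (All.tabulate λ _ → Vec.replicate _ blankTape)
    (All.tabulate λ _ → blankTape)
    (Vec.map (λ v → tape (holding (numeral v)) 0) (size ∷ Vec.map toℕ constᴵ))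
    (Vec.replicate _ blankTape))

  scanAll : PerTape σ k Tape Tape → PerTape σ k Symbol Symbol
  scanAll (perTape rs fs vs cs ws) = perTape
    (All.map (Vec.map scan) rs)
    (All.map (Vec.map scan) fs)
    (All.map scan vs)
    (Vec.map scan cs)
    (Vec.map scan ws)

  answers : PerTape σ k Tape Tape → All (λ _ → Bool) (relations σ)
  answers ts = All.zipWith (uncurry answer) (relᴵ , relAddress ts)

  actAll : PerTape σ k (Symbol × Move) Move →
           PerTape σ k Tape Tape → PerTape σ k Tape Tape
  actAll (perTape ars afs avs acs aws) (perTape rs fs vs cs ws) = perTape
    (All.zipWith (uncurry (Vec.zipWith act)) (ars , rs))
    (All.zipWith (uncurry (Vec.zipWith act)) (afs , fs))
    (All.zipWith (uncurry moveReadOnly) (avs , vs))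
    (Vec.zipWith moveReadOnly acs cs)
    (Vec.zipWith act aws ws)

  -- Only the contents of the value-tapes change, not their heads.

  updateValues : PerTape σ k Tape Tape → PerTape σ k Tape Tape
  updateValues ts = record ts
    { value = All.zipWith (λ (xs , t) → tape xs (head t))
                (All.zipWith (uncurry valueContent) (funᴵ , funAddress ts) , value ts)
    }

  step : Config → Maybe Config
  step (config q ts) =
    Maybe.map (λ (q′ , actions) → config q′ (updateValues (actAll actions ts)))
              (δ q (scanAll ts) (answers ts))

  -- The tapes charged for space: address-tapes and ordinary work-tapes.

  charged : PerTape σ k Tape Tape → List Tape
  charged ts = concat (All.reduce Vec.toList (relAddress ts))
            ++ concat (All.reduce Vec.toList (funAddress ts))
            ++ Vec.toList (work ts)

  system : System
  system = record
    { Config    = Config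
    ; initial   = initial
    ; step      = step
    ; accepting = λ c → accepting (Config.state c)
    ; cellsOf   = λ c → cells (charged (Config.tapes c))
    }

DirectAccessDecidable : ∀ {σ} → Pred (OrderedStructure σ) ℓ → Set (lsuc 0ℓ ⊔ˡ ℓ)
DirectAccessDecidable {σ = σ} 𝒞 =
  Σ (DirectAccessMachine σ) λ M →
    DecidesInPolylogSpace (DirectAccess.system M) OrderedStructure.size 𝒞

{-# OPTIONS --safe #-}

-- A counter program all of whose values stay below 2 ^ β can be executed by
-- either kind of machine in space O(β), with the counters kept in binary on
-- work-tapes; time does not matter, so that counting up and down suffices.
-- Conversely, a configuration of a machine in space s is a list of numbers
-- below 2 ^ O(s): a tape is given by its content read as a number in base 3
-- and by the power of 3 belonging to its head position.  A step of the machine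
-- is then an arithmetic function with polynomially bounded intermediate values.
-- So are the answers to the queries: the bit of bin(A) for a tuple stands at
-- the sum of the lengths of the preceding strings and the rank of the tuple,
-- and division recovers the tuple from the position.  A random-access machine
-- finds n as the least number for which an encoding is as long as its input.
-- Since some symbol has positive arity, ⌈log n⌉ ≤ ⌈log n̂⌉ = O(⌈log n⌉).

module Submission where

open import Defs
open import Data.Bool.Base using (Bool; true; false; if_then_else_; not)
open import Data.Empty using (⊥)
open import Data.Fin.Base as Fin using (Fin; zero; suc; toℕ; fromℕ<; splitAt)
open import Data.Fin.Properties as Finₚ using (toℕ-fromℕ<; toℕ-injective; toℕ<n; 1↔⊤; 2↔Bool; +↔⊎)
open import Data.List.Base as List using (List; []; _∷_; _++_; _ʳ++_; map; concat; concatMap; length; downFrom; allFin; cartesianProductWith; replicate)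
open import Data.List.Properties using (++-assoc; ++-identityʳ; length-++; length-map; length-downFrom; length-tabulate)
open import Data.List.Membership.Propositional using (_∈_)
open import Data.List.Relation.Unary.All as All using (All; []; _∷_)
open import Data.List.Relation.Unary.All.Properties as Allₚ using ()
open import Data.List.Relation.Unary.Any as Any using (Any; here; there)
open import Data.List.Relation.Unary.Any.Properties as Anyₚ using ()
open import Data.Maybe.Base as Maybe using (Maybe; just; nothing; fromMaybe)
open import Data.Nat.Base hiding (parity; _≡ᵇ_; ∣_-_∣; _!)
open import Data.Nat.Base using (_≡ᵇ_)
open import Data.Nat.Properties
open import Data.Nat.Logarithm
open import Data.Nat.Tactic.RingSolver using (solve-∀)
open import Data.Nat.Induction using (<-rec)
open import Data.Product.Base using (Σ; ∃; ∃₂; _×_; _,_; proj₁; proj₂; uncurry)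
open import Data.Sum.Base as Sum using (_⊎_; inj₁; inj₂; [_,_]; [_,_]′)
open import Data.Sum.Function.Propositional using (_⊎-↔_)
open import Data.Sum.Properties using () renaming (≡-dec to ⊎-≡-dec)
open import Data.Product.Properties using () renaming (≡-dec to Σ-≡-dec)
open import Data.Vec.Properties using (tabulate-cong; lookup∘tabulate; lookup-zipWith; lookup-map; lookup-replicate; tabulate-∘)
open import Data.Unit.Base using (⊤; tt)
open import Data.Vec.Base as Vec using (Vec; []; _∷_)
open import Function.Base using (id; _∘_; case_of_; _∋_)
open import Function.Bundles using (_⇔_; _↔_; mk⇔; Equivalence; Inverse)
open import Function.Construct.Composition using (_↔-∘_)
open import Function.Construct.Symmetry using (↔-sym)
open import Level using (Level)
open import Relation.Binary.Definitions using (DecidableEquality)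
open import Relation.Binary.PropositionalEquality
open import Relation.Nullary using (Dec; yes; no; does; contradiction)
open import Relation.Unary using (Pred)
open import Relation.Nullary.Decidable.Core using (dec⇒maybe)

-- With counters as the only data, tapes, head positions and addresses all become numbers, and what
-- has to be controlled is the size of these numbers. The obstacle is that loops over numbers can
-- leave every polynomial: doubling a variable in each of `B` rounds yields a multiple of `2 ^ B`,
-- whose binary representation is far too long. Hence every arithmetic expression comes with an
-- exponent that bounds all numbers occurring in its evaluation, and every loop has to bring a
-- polynomial bound on its iterates, proved from a closed form or from a quantity that does not
-- grow. No other accounting of space is then necessary: values up to `2 ^ β` and an exponent `G`
-- call for counters of about `β * G` bits. Both simulations are proved in one direction only, from
-- verdicts of the simulated machine to verdicts of the simulating one. Since a decider halts on
-- every input and computations are deterministic, this yields both directions of correctness.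

private
  variable
    ℓ : Level

-- Computations of the two machine models

module _ {S : System} where
  open System S

  -- Simulations only carry verdicts forwards. Determinism turns this around: when the simulating
  -- machine accepts, the verdict obtained from the simulated machine cannot be a different one.
  verdict-unique : ∀ {c b b′} → Verdict S c b → Verdict S c b′ → b ≡ b′
  verdict-unique (accept _)       (accept _)          = refl
  verdict-unique (accept p)       (reject q _)        = contradiction (trans (sym p) q) λ ()
  verdict-unique (accept p)       (continue q _ _)    = contradiction (trans (sym p) q) λ ()
  verdict-unique (reject p _)     (accept q)          = contradiction (trans (sym p) q) λ ()
  verdict-unique (reject _ _)     (reject _ _)        = refl
  verdict-unique (reject _ s)     (continue _ s′ _)   = contradiction (trans (sym s) s′) λ ()
  verdict-unique (continue p _ _) (accept q)          = contradiction (trans (sym p) q) λ ()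
  verdict-unique (continue _ s _) (reject _ s′)       = contradiction (trans (sym s) s′) λ ()
  verdict-unique (continue _ s v) (continue _ s′ v′) with trans (sym s) s′
  ... | refl = verdict-unique v v′

  -- A space bound speaks of all verdicts on an input. By uniqueness it may be shown for a single
  -- one, namely the verdict that the simulation produces.
  space-unique : ∀ {c b b′} (v : Verdict S c b) (v′ : Verdict S c b′) → space S v ≡ space S v′
  space-unique (accept _)       (accept _)          = refl
  space-unique (accept p)       (reject q _)        = contradiction (trans (sym p) q) λ ()
  space-unique (accept p)       (continue q _ _)    = contradiction (trans (sym p) q) λ ()
  space-unique (reject p _)     (accept q)          = contradiction (trans (sym p) q) λ ()
  space-unique (reject _ _)     (reject _ _)        = refl
  space-unique (reject _ s)     (continue _ s′ _)   = contradiction (trans (sym s) s′) λ ()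
  space-unique (continue p _ _) (accept q)          = contradiction (trans (sym p) q) λ ()
  space-unique (continue _ s _) (reject _ s′)       = contradiction (trans (sym s) s′) λ ()
  space-unique {c} (continue _ s v) (continue _ s′ v′) with trans (sym s) s′
  ... | refl = cong (cellsOf c ⊔_) (space-unique v v′)

Finite : Set → Set
Finite A = ∃ λ n → A ↔ Fin n

finite-⊤ : Finite ⊤
finite-⊤ = 1 , ↔-sym 1↔⊤

finite-Bool : Finite Bool
finite-Bool = 2 , ↔-sym 2↔Bool

finite-⊎ : ∀ {A B} → Finite A → Finite B → Finite (A ⊎ B)
finite-⊎ (m , f) (n , g) = m + n , ↔-sym +↔⊎ ↔-∘ (f ⊎-↔ g)

-- Structured programs over instructions I and conditions C

infixr 5 _⨟_

data Prog (I C : Set) : Set where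
  prim : I → Prog I C
  _⨟_  : Prog I C → Prog I C → Prog I C
  test : C → Prog I C → Prog I C → Prog I C
  loop : C → Prog I C → Prog I C

mapProg : ∀ {I C I′ C′} → (I → I′) → (C → C′) → Prog I C → Prog I′ C′
mapProg f g (prim i)     = prim (f i)
mapProg f g (P ⨟ Q)      = mapProg f g P ⨟ mapProg f g Q
mapProg f g (test c P Q) = test (g c) (mapProg f g P) (mapProg f g Q)
mapProg f g (loop c P)   = loop (g c) (mapProg f g P)

record Semantics (I C : Set) : Set₁ where
  field
    State : Set
    nop   : I
    run   : I → State → State
    cond  : C → State → Bool

-- Exec ok P s t: the execution of P from s ends in t, and all states but
-- possibly t satisfy ok.  Evaluating a condition takes a step that performs nop.

module _ {I C : Set} (M : Semantics I C) where
  open Semantics M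

  data Exec (ok : State → Set) : Prog I C → State → State → Set where
    prim      : ∀ {i s} → ok s → Exec ok (prim i) s (run i s)
    _⨟_       : ∀ {P Q s t u} → Exec ok P s t → Exec ok Q t u → Exec ok (P ⨟ Q) s u
    test-yes  : ∀ {c P Q s t} → ok s → cond c s ≡ true →
                Exec ok P (run nop s) t → Exec ok (test c P Q) s t
    test-no   : ∀ {c P Q s t} → ok s → cond c s ≡ false →
                Exec ok Q (run nop s) t → Exec ok (test c P Q) s t
    loop-stop : ∀ {c P s} → ok s → cond c s ≡ false → Exec ok (loop c P) s (run nop s)
    loop-go   : ∀ {c P s t u} → ok s → cond c s ≡ true →
                Exec ok P (run nop s) t → Exec ok (loop c P) t u → Exec ok (loop c P) s u

module _ {I C I′ C′ : Set} (M : Semantics I C) (M′ : Semantics I′ C′)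
         (f : I → I′) (g : C → C′) where
  private
    module M  = Semantics M
    module M′ = Semantics M′

  module _ (R : M.State → M′.State → Set) {ok : M.State → Set} {ok′ : M′.State → Set}
           (R-ok   : ∀ {s s′} → R s s′ → ok s → ok′ s′)
           (R-nop  : ∀ {s s′} → R s s′ → R (M.run M.nop s) (M′.run M′.nop s′))
           (R-run  : ∀ i {s s′} → R s s′ → R (M.run i s) (M′.run (f i) s′))
           (R-cond : ∀ c {s s′} → R s s′ → M.cond c s ≡ M′.cond (g c) s′) where

    -- This lets a program for one or two tapes be verified in isolation and then be placed into a
    -- machine with many tapes: `R` says where the small state sits in the large one, and only
    -- instructions and conditions have to respect it.
    exec-map : ∀ {P s t} → Exec M ok P s t → ∀ {s′} → R s s′ →
               ∃ λ t′ → Exec M′ ok′ (mapProg f g P) s′ t′ × R t t′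
    exec-map (prim o) r = _ , prim (R-ok r o) , R-run _ r
    exec-map (e₁ ⨟ e₂) r with exec-map e₁ r
    ... | _ , e₁′ , r₁ with exec-map e₂ r₁
    ... | _ , e₂′ , r₂ = _ , e₁′ ⨟ e₂′ , r₂
    exec-map (test-yes o c e) r with exec-map e (R-nop r)
    ... | _ , e′ , r′ = _ , test-yes (R-ok r o) (trans (sym (R-cond _ r)) c) e′ , r′
    exec-map (test-no o c e) r with exec-map e (R-nop r)
    ... | _ , e′ , r′ = _ , test-no (R-ok r o) (trans (sym (R-cond _ r)) c) e′ , r′
    exec-map (loop-stop o c) r =
      _ , loop-stop (R-ok r o) (trans (sym (R-cond _ r)) c) , R-nop r
    exec-map (loop-go o c e₁ e₂) r with exec-map e₁ (R-nop r)
    ... | _ , e₁′ , r₁ with exec-map e₂ r₁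
    ... | _ , e₂′ , r₂ = _ , loop-go (R-ok r o) (trans (sym (R-cond _ r)) c) e₁′ e₂′ , r₂

-- Programs as transition functions

route : {I A B : Set} → (A → B) → B → Maybe A × I → B × I
route emb exit (p , i) = Maybe.maybe emb exit p , i

-- Positions of nested programs are routed once per level; fusing the routes restores the shape that
-- the induction in `exec-within` expects.
route-route : {I A B D : Set} {emb : B → D} {exit : D} {f : A → Maybe B} {e : Maybe B} →
              ∀ (r : Maybe A × I) → route emb exit (Maybe.maybe f e (proj₁ r) , proj₂ r) ≡
                    route (Maybe.maybe emb exit ∘ f) (Maybe.maybe emb exit e) r
route-route (just _ , _)  = refl
route-route (nothing , _) = refl

module _ {I C : Set} (nop : I) where

  Position : Prog I C → Set
  Position (prim _)     = ⊤
  Position (P ⨟ Q)      = Position P ⊎ Position Q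
  Position (test _ P Q) = ⊤ ⊎ (Position P ⊎ Position Q)
  Position (loop _ P)   = ⊤ ⊎ Position P

  position-finite : ∀ P → Finite (Position P)
  position-finite (prim _)     = finite-⊤
  position-finite (P ⨟ Q)      = finite-⊎ (position-finite P) (position-finite Q)
  position-finite (test _ P Q) = finite-⊎ finite-⊤ (finite-⊎ (position-finite P) (position-finite Q))
  position-finite (loop _ P)   = finite-⊎ finite-⊤ (position-finite P)

  entry : ∀ P → Position P
  entry (prim _)     = tt
  entry (P ⨟ _)      = inj₁ (entry P)
  entry (test _ _ _) = inj₁ tt
  entry (loop _ _)   = inj₁ tt

  -- A successor `nothing` means that the program is left. Conditions enter only through their
  -- current truth values, so that a machine can evaluate them from what it scans.
  next : ∀ P → Position P → (C → Bool) → Maybe (Position P) × I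
  next (prim i)     _               w = nothing , i
  next (P ⨟ Q)      (inj₁ p)        w = route (just ∘ inj₁) (just (inj₂ (entry Q))) (next P p w)
  next (P ⨟ Q)      (inj₂ q)        w = route (just ∘ inj₂) nothing (next Q q w)
  next (test c P Q) (inj₁ _)        w =
    just (inj₂ (if w c then inj₁ (entry P) else inj₂ (entry Q))) , nop
  next (test c P Q) (inj₂ (inj₁ p)) w = route (just ∘ inj₂ ∘ inj₁) nothing (next P p w)
  next (test c P Q) (inj₂ (inj₂ q)) w = route (just ∘ inj₂ ∘ inj₂) nothing (next Q q w)
  next (loop c P)   (inj₁ _)        w = (if w c then just (inj₂ (entry P)) else nothing) , nop
  next (loop c P)   (inj₂ p)        w = route (just ∘ inj₂) (just (inj₁ tt)) (next P p w)

  -- A control executes a program, evaluates a condition and halts,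
  -- accepting if and only if the condition holds.

  Control : Prog I C → Set
  Control P = Position P ⊎ (⊤ ⊎ Bool)

  control-finite : ∀ P → Finite (Control P)
  control-finite P = finite-⊎ (position-finite P) (finite-⊎ finite-⊤ finite-Bool)

  transition : ∀ P → C → Control P → (C → Bool) → Maybe (Control P × I)
  transition P c (inj₁ p)              w = just (route inj₁ (inj₂ (inj₁ tt)) (next P p w))
  transition P c (inj₂ (inj₁ _))       w = just (inj₂ (inj₂ (w c)) , nop)
  transition P c (inj₂ (inj₂ _))       w = nothing

  accepts : ∀ P → Control P → Bool
  accepts P (inj₂ (inj₂ b)) = b
  accepts P _               = false

module _ {I C : Set} (M : Semantics I C) where
  open Semantics M

  module _ (S : System) (P : Prog I C) (c : C) (conf : Control nop P → State → System.Config S)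
           (conf-step : ∀ q s → System.step S (conf q s) ≡
             Maybe.map (λ (q′ , i) → conf q′ (run i s)) (transition nop P c q (λ k → cond k s)))
           (conf-accepting : ∀ q s → System.accepting S (conf q s) ≡ accepts nop P q)
           {m : ℕ} {ok : State → Set}
           (conf-cells : ∀ q s → ok s → System.cellsOf S (conf q s) ≤ m) where

    private
      Within : Control nop P → State → Bool → Set
      Within q s b = Σ (Verdict S (conf q s) b) λ v → space S v ≤ m

      continue-within : ∀ q s {q′ i b} → accepts nop P q ≡ false → ok s →
                        transition nop P c q (λ k → cond k s) ≡ just (q′ , i) →
                        Within q′ (run i s) b → Within q s b
      continue-within q s n o t (v , le) =
        continue (trans (conf-accepting q s) n)
                 (trans (conf-step q s) (cong (Maybe.map _) t)) v ,
        ⊔-lub (conf-cells q s o) le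

      -- The verdict is built from its end: given one for the state in which `Q` is left, with
      -- control at `exit`, the steps of `Q` are put in front of it. The equation says that the
      -- whole control acts on the positions of `Q` as `Q` alone does, with leaving replaced by
      -- `exit`; it is what survives the descent into subprograms.
      exec-within : ∀ {Q s t} → Exec M ok Q s t →
        (emb : Position nop Q → Position nop P) (exit : Control nop P) →
        (∀ p w → transition nop P c (inj₁ (emb p)) w ≡
                 just (route (inj₁ ∘ emb) exit (next nop Q p w))) →
        ∀ {b} → Within exit t b → Within (inj₁ (emb (entry nop Q))) s b
      exec-within (prim {i} {s} o) emb exit eq v =
        continue-within (inj₁ (emb tt)) s {i = i} refl o (eq tt (λ k → cond k s)) v
      exec-within (_⨟_ {P = P₁} {P₂} e₁ e₂) emb exit eq v =
        exec-within e₁ (emb ∘ inj₁) (inj₁ (emb (inj₂ (entry nop P₂))))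
          (λ p w → trans (eq (inj₁ p) w) (cong just (route-route {emb = inj₁ ∘ emb} {f = just ∘ inj₁}
              {just (inj₂ (entry nop P₂))} (next nop P₁ p w))))
          (exec-within e₂ (emb ∘ inj₂) exit
            (λ p w → trans (eq (inj₂ p) w) (cong just (route-route {emb = inj₁ ∘ emb} {f = just ∘ inj₂}
                {nothing} (next nop P₂ p w)))) v)
      exec-within (test-yes {c = k} {P₁} {P₂} {s} o h e) emb exit eq v =
        continue-within (inj₁ (emb (inj₁ tt))) s refl o
          (trans (eq (inj₁ tt) _) (cong (λ b → just (inj₁ (emb (inj₂
            (if b then inj₁ (entry nop P₁) else inj₂ (entry nop P₂)))) , nop)) h))
          (exec-within e (emb ∘ inj₂ ∘ inj₁) exit
            (λ p w → trans (eq (inj₂ (inj₁ p)) w)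
                (cong just (route-route {emb = inj₁ ∘ emb} {f = just ∘ inj₂ ∘ inj₁} {nothing}
                (next nop P₁ p w)))) v)
      exec-within (test-no {c = k} {P₁} {P₂} {s} o h e) emb exit eq v =
        continue-within (inj₁ (emb (inj₁ tt))) s refl o
          (trans (eq (inj₁ tt) _) (cong (λ b → just (inj₁ (emb (inj₂
            (if b then inj₁ (entry nop P₁) else inj₂ (entry nop P₂)))) , nop)) h))
          (exec-within e (emb ∘ inj₂ ∘ inj₂) exit
            (λ p w → trans (eq (inj₂ (inj₂ p)) w)
                (cong just (route-route {emb = inj₁ ∘ emb} {f = just ∘ inj₂ ∘ inj₂} {nothing}
                (next nop P₂ p w)))) v)
      exec-within (loop-stop {P = P₁} {s} o h) emb exit eq v =
        continue-within (inj₁ (emb (inj₁ tt))) s refl o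
          (trans (eq (inj₁ tt) _) (cong (λ b → just (Maybe.maybe (inj₁ ∘ emb) exit
            (if b then just (inj₂ (entry nop P₁)) else nothing) , nop)) h)) v
      exec-within (loop-go {P = P₁} {s} o h e₁ e₂) emb exit eq v =
        continue-within (inj₁ (emb (inj₁ tt))) s refl o
          (trans (eq (inj₁ tt) _) (cong (λ b → just (Maybe.maybe (inj₁ ∘ emb) exit
            (if b then just (inj₂ (entry nop P₁)) else nothing) , nop)) h))
          (exec-within e₁ (emb ∘ inj₂) (inj₁ (emb (inj₁ tt)))
            (λ p w → trans (eq (inj₂ p) w) (cong just (route-route {emb = inj₁ ∘ emb} {f = just ∘ inj₂}
                {just (inj₁ tt)} (next nop P₁ p w))))
            (exec-within e₂ emb exit eq v))

    exec-verdict : ∀ {s t} → Exec M ok P s t → ok t → ok (run nop t) →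
                   Σ (Verdict S (conf (inj₁ (entry nop P)) s) (cond c t)) λ v → space S v ≤ m
    exec-verdict {s} {t} e o o′ =
      exec-within e id (inj₂ (inj₁ tt)) (λ _ _ → refl)
        (continue-within (inj₂ (inj₁ tt)) t refl o refl (halted (cond c t)))
      where
      halted : ∀ b → Within (inj₂ (inj₂ b)) (run nop t) b
      halted true  = accept (conf-accepting _ _) , conf-cells _ _ o′
      halted false = reject (conf-accepting _ _) (conf-step _ _) , conf-cells _ _ o′

-- Tapes up to the blank cells listed at the end of their contents

infix 4 _≈_

record _≈_ (t u : Tape) : Set where
  constructor alike
  field
    head-≡ : head t ≡ head u
    cell-≡ : ∀ i → cell (content t) i ≡ cell (content u) i

open _≈_ public

≈-refl : ∀ {t} → t ≈ t
≈-refl = alike refl λ _ → refl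

≈-sym : ∀ {t u} → t ≈ u → u ≈ t
≈-sym (alike h c) = alike (sym h) λ i → sym (c i)

≈-trans : ∀ {t u v} → t ≈ u → u ≈ v → t ≈ v
≈-trans (alike h c) (alike h′ c′) = alike (trans h h′) λ i → trans (c i) (c′ i)

scan-cong : ∀ {t u} → t ≈ u → scan t ≡ scan u
scan-cong {u = u} (alike refl c) = c (head u)

cell-overwrite : ∀ xs h s i → cell (overwrite xs h s) i ≡ (if i ≡ᵇ h then s else cell xs i)
cell-overwrite []       zero    s zero    = refl
cell-overwrite []       zero    s (suc i) = refl
cell-overwrite []       (suc h) s zero    = refl
cell-overwrite []       (suc h) s (suc i) = cell-overwrite [] h s i
cell-overwrite (x ∷ xs) zero    s zero    = refl
cell-overwrite (x ∷ xs) zero    s (suc i) = refl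
cell-overwrite (x ∷ xs) (suc h) s zero    = refl
cell-overwrite (x ∷ xs) (suc h) s (suc i) = cell-overwrite xs h s i

overwrite-scanned : ∀ xs h i → cell (overwrite xs h (cell xs h)) i ≡ cell xs i
overwrite-scanned []       zero    zero    = refl
overwrite-scanned []       zero    (suc i) = refl
overwrite-scanned []       (suc h) zero    = refl
overwrite-scanned []       (suc h) (suc i) = overwrite-scanned [] h i
overwrite-scanned (x ∷ xs) zero    zero    = refl
overwrite-scanned (x ∷ xs) zero    (suc i) = refl
overwrite-scanned (x ∷ xs) (suc h) zero    = refl
overwrite-scanned (x ∷ xs) (suc h) (suc i) = overwrite-scanned xs h i

data TapeIns : Set where
  wr : Symbol → Move → TapeIns
  mv : Move → TapeIns

runTape : TapeIns → Tape → Tape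
runTape (wr s d) t          = act (s , d) t
runTape (mv d)   (tape c h) = tape c (move d h)

tapeAction : TapeIns → Symbol → Symbol × Move
tapeAction (wr s d) _ = s , d
tapeAction (mv d)   s = s , d

act-cong : ∀ {t u} a → t ≈ u → act a t ≈ act a u
act-cong {t} {u} (s , d) (alike refl c) = alike refl λ i →
  trans (cell-overwrite (content t) (head t) s i)
    (trans (cong (if i ≡ᵇ head t then s else_) (c i))
      (sym (cell-overwrite (content u) (head t) s i)))

-- A machine step writes on every tape; a tape is left alone by writing back the scanned symbol.
-- Beyond the end of the list this appends blanks, so that equality holds only up to `≈`.
act-scanned : ∀ t d → act (scan t , d) t ≈ tape (content t) (move d (head t))
act-scanned t d = alike refl (overwrite-scanned (content t) (head t))

runTape-cong : ∀ {t u} i → t ≈ u → runTape i t ≈ runTape i u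
runTape-cong (wr s d) e            = act-cong (s , d) e
runTape-cong (mv d) (alike refl c) = alike refl c

tapeAction-correct : ∀ i t → act (tapeAction i (scan t)) t ≈ runTape i t
tapeAction-correct (wr s d) t = ≈-refl
tapeAction-correct (mv d)   t = act-scanned t d

-- Numbers on tapes

readNumber : ℕ → List Symbol → ℕ
readNumber acc []           = acc
readNumber acc (blank ∷ _)  = acc
readNumber acc (bit b ∷ xs) = readNumber (2 * acc + (if b then 1 else 0)) xs

-- The three equations are all that can be said about a local function that cannot be named; they
-- determine it.
readNumber-unique : ∀ (f : ℕ → List Symbol → ℕ) →
  (∀ a → f a [] ≡ a) → (∀ a xs → f a (blank ∷ xs) ≡ a) →
  (∀ a b xs → f a (bit b ∷ xs) ≡ f (2 * a + (if b then 1 else 0)) xs) →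
  ∀ a xs → f a xs ≡ readNumber a xs
readNumber-unique f f[] fblank fbit a []           = f[] a
readNumber-unique f f[] fblank fbit a (blank ∷ xs) = fblank a xs
readNumber-unique f f[] fblank fbit a (bit b ∷ xs) =
  trans (fbit a b xs) (readNumber-unique f f[] fblank fbit _ xs)

-- The local function that defines number has no name outside of its
-- definition; unification finds it.

mutual
  numberFrom : Tape → ℕ → List Symbol → ℕ
  numberFrom = _

  number-readNumber : ∀ t → number t ≡ readNumber 0 (content t)
  -- Abstracting both arguments leaves the local function applied to variables only, so that
  -- unification can read off the solution for `numberFrom`.
  number-readNumber t with 0 | content t
  ... | acc | xs = readNumber-unique (numberFrom t) (λ _ → refl) (λ _ _ → refl) (λ _ _ _ → refl) acc xs

readNumber-cong : ∀ a xs ys → (∀ i → cell xs i ≡ cell ys i) → readNumber a xs ≡ readNumber a ys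
readNumber-cong a []           []           e = refl
readNumber-cong a []           (blank ∷ _)  e = refl
readNumber-cong a []           (bit _ ∷ _)  e = contradiction (e 0) λ ()
readNumber-cong a (blank ∷ _)  []           e = refl
readNumber-cong a (bit _ ∷ _)  []           e = contradiction (e 0) λ ()
readNumber-cong a (blank ∷ _)  (blank ∷ _)  e = refl
readNumber-cong a (blank ∷ _)  (bit _ ∷ _)  e = contradiction (e 0) λ ()
readNumber-cong a (bit _ ∷ _)  (blank ∷ _)  e = contradiction (e 0) λ ()
readNumber-cong a (bit b ∷ xs) (bit c ∷ ys) e with e 0
... | refl = readNumber-cong _ xs ys (λ i → e (suc i))

number-cong : ∀ {t u} → t ≈ u → number t ≡ number u
number-cong {t} {u} (alike _ c) = trans (number-readNumber t)
  (trans (readNumber-cong 0 (content t) (content u) c) (sym (number-readNumber u)))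

-- Least significant bit first.

val : List Bool → ℕ
val []       = 0
val (b ∷ bs) = 2 * val bs + (if b then 1 else 0)

-- Reversal passes from the order of counters, least significant bit first, to the order of
-- address-tapes, most significant bit first.
readNumber-ʳ++ : ∀ bs ys → readNumber 0 (map bit bs ʳ++ ys) ≡ readNumber (val bs) ys
readNumber-ʳ++ []       ys = refl
readNumber-ʳ++ (b ∷ bs) ys = readNumber-ʳ++ bs (bit b ∷ ys)

incr : List Bool → List Bool
incr []           = true ∷ []
incr (false ∷ bs) = true ∷ bs
incr (true ∷ bs)  = false ∷ incr bs

decr : List Bool → List Bool
decr []           = []
decr (false ∷ bs) = true ∷ decr bs
decr (true ∷ bs)  = false ∷ bs

val-incr : ∀ bs → val (incr bs) ≡ suc (val bs)
val-incr []           = refl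
val-incr (false ∷ bs) = trans (+-comm (2 * val bs) 1) (cong suc (sym (+-identityʳ (2 * val bs))))
val-incr (true ∷ bs)  = begin
  2 * val (incr bs) + 0 ≡⟨ +-identityʳ _ ⟩
  2 * val (incr bs)     ≡⟨ cong (2 *_) (val-incr bs) ⟩
  2 * suc (val bs)      ≡⟨ *-suc 2 (val bs) ⟩
  2 + 2 * val bs        ≡⟨ cong suc (+-comm 1 (2 * val bs)) ⟩
  suc (2 * val bs + 1)  ∎
  where open ≡-Reasoning

val-decr : ∀ bs {v} → val bs ≡ suc v → val (decr bs) ≡ v
val-decr (true ∷ bs)  e = trans (+-identityʳ _) (suc-injective (trans (+-comm 1 (2 * val bs)) e))
val-decr (false ∷ bs) {v} e with val bs in eq
... | suc w = begin
  2 * val (decr bs) + 1 ≡⟨ cong (λ x → 2 * x + 1) (val-decr bs eq) ⟩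
  2 * w + 1             ≡⟨ +-comm (2 * w) 1 ⟩
  suc (2 * w)           ≡⟨ suc-injective (trans (sym (trans (+-identityʳ _) (*-suc 2 w))) e) ⟩
  v                     ∎
  where open ≡-Reasoning

length-decr : ∀ bs → length (decr bs) ≡ length bs
length-decr []           = refl
length-decr (false ∷ bs) = cong suc (length-decr bs)
length-decr (true ∷ bs)  = refl

length-incr-≥ : ∀ bs → length bs ≤ length (incr bs)
length-incr-≥ []           = z≤n
length-incr-≥ (false ∷ bs) = ≤-refl
length-incr-≥ (true ∷ bs)  = s≤s (length-incr-≥ bs)

-- A further bit is needed only if all bits are ones, and then the incremented value is a power of
-- two. So a bound on the values keeps all counters within `w` bits, although leading zeros are
-- never removed.
length-incr-≤ : ∀ bs w → length bs ≤ w → suc (val bs) < 2 ^ w → length (incr bs) ≤ w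
length-incr-≤ []           zero    l v = contradiction v λ { (s≤s ()) }
length-incr-≤ []           (suc w) l v = s≤s z≤n
length-incr-≤ (false ∷ bs) (suc w) l v = l
length-incr-≤ (true ∷ bs)  (suc w) (s≤s l) v = s≤s (length-incr-≤ bs w l (*-cancelˡ-< 2 _ _ (begin-strict
  2 * suc (val bs)     ≡⟨ *-suc 2 (val bs) ⟩
  2 + 2 * val bs       ≡⟨ cong suc (+-comm 1 (2 * val bs)) ⟩
  suc (2 * val bs + 1) <⟨ v ⟩
  2 * 2 ^ w            ∎)))
  where open ≤-Reasoning

-- Tapes as zippers: the symbols left of the head, nearest first, and the
-- symbols from the head on.  Moves within a zipper hold definitionally.

zip : List Symbol → List Symbol → Tape
zip L R = tape (L ʳ++ R) (length L)

cell-ʳ++ : ∀ L R i → cell (L ʳ++ R) (length L + i) ≡ cell R i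
cell-ʳ++ []      R i = refl
cell-ʳ++ (l ∷ L) R i = trans (cong (cell (L ʳ++ (l ∷ R))) (sym (+-suc (length L) i)))
    (cell-ʳ++ L (l ∷ R) (suc i))

scan-zip : ∀ L R → scan (zip L R) ≡ cell R 0
scan-zip L R = trans (cong (cell (L ʳ++ R)) (sym (+-identityʳ (length L)))) (cell-ʳ++ L R 0)

overwrite-ʳ++ : ∀ L R i s → overwrite (L ʳ++ R) (length L + i) s ≡ L ʳ++ overwrite R i s
overwrite-ʳ++ []      R i s = refl
overwrite-ʳ++ (l ∷ L) R i s =
  trans (cong (λ k → overwrite (L ʳ++ (l ∷ R)) k s) (sym (+-suc (length L) i)))
      (overwrite-ʳ++ L (l ∷ R) (suc i) s)

act-zip : ∀ L R s d → act (s , d) (zip L R) ≡ tape (L ʳ++ overwrite R 0 s) (move d (length L))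
act-zip L R s d = cong (λ c → tape c (move d (length L)))
  (trans (cong (λ k → overwrite (L ʳ++ R) k s) (sym (+-identityʳ (length L)))) (overwrite-ʳ++ L R 0 s))

-- A counter is a tape whose leftmost cell is a blank serving as end-marker,
-- followed by the bits, least significant bit first.  counterAt ps qs has
-- the head after the marker and the bits ps, listed in reverse.

counterAt : List Bool → List Bool → Tape
counterAt ps qs = zip (map bit ps ++ blank ∷ []) (map bit qs)

counter : List Bool → Tape
counter bs = zip [] (blank ∷ map bit bs)

isBit is0 is1 : Symbol → Bool
isBit (bit _)     = true
isBit blank       = false
is0 (bit b)       = not b
is0 blank         = false
is1 (bit b)       = b
is1 blank         = false

-- Programs for a counter tape next to a component E with instructions EI.

data LocalIns (EI : Set) : Set where
  nop : LocalIns EI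
  ctr : TapeIns → LocalIns EI
  ext : EI → LocalIns EI

localSemantics : (E EI : Set) → (EI → E → E) → Semantics (LocalIns EI) (Symbol → Bool)
localSemantics E EI erun = record
  { State = Tape × E
  ; nop   = nop
  ; run   = λ { nop s → s ; (ctr i) (u , e) → runTape i u , e ; (ext i) (u , e) → u , erun i e }
  ; cond  = λ f (u , _) → f (scan u)
  }

module _ {EI : Set} where

  LocalProg : Set
  LocalProg = Prog (LocalIns EI) (Symbol → Bool)

  step : TapeIns → LocalProg
  step i = prim (ctr i)

  home enter increment decrement : LocalProg
  home      = step (mv left) ⨟ loop isBit (step (mv left))
  enter     = step (mv right) ⨟ loop is0 (step (mv right))
  increment = step (mv right) ⨟ loop is1 (step (wr (bit false) right)) ⨟ step (wr (bit true) stay) ⨟ home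
  decrement = step (mv right) ⨟ loop is0 (step (wr (bit true) right)) ⨟ step (wr (bit false) stay) ⨟ home

  walk : LocalProg → LocalProg
  walk Q = step (mv right) ⨟ loop isBit (Q ⨟ step (mv right))

module _ {E EI : Set} (erun : EI → E → E) (eok : E → Set) (m : ℕ) where
  private
    M = localSemantics E EI erun

  LocalOk : Tape × E → Set
  LocalOk (u , e) = head u < m × eok e

  private
    _⊢_⇒_ : LocalProg → Tape × E → Tape × E → Set
    P ⊢ s ⇒ t = Exec M LocalOk P s t

  -- Besides the `w` bits, the head visits the end-marker and the blank cell behind the last bit,
  -- which accounts for the 2.
  Fits : ℕ → List Bool → List Bool → Set
  Fits w ps qs = length ps + length qs ≤ w × 2 + w ≤ m

  private
    fits-shift : ∀ {w} p ps qs → Fits w ps (p ∷ qs) → Fits w (p ∷ ps) qs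
    fits-shift p ps qs (f , g) = ≤-trans (≤-reflexive (sym (+-suc (length ps) (length qs)))) f , g

    fits-unshift : ∀ {w} p ps qs → Fits w (p ∷ ps) qs → Fits w ps (p ∷ qs)
    fits-unshift p ps qs (f , g) = ≤-trans (≤-reflexive (+-suc (length ps) (length qs))) f , g

  counterAt-head : ∀ {w} ps qs → Fits w ps qs → head (counterAt ps qs) < m
  counterAt-head ps qs (f , g) = ≤-trans (s≤s (≤-reflexive (trans (length-++ (map bit ps)) (trans (+-comm _ 1)
      (cong suc (length-map bit ps)))))) (≤-trans (s≤s (s≤s (≤-trans (m≤m+n _ _) f))) g)

  private
    0<m : ∀ {w} → 2 + w ≤ m → 0 < m
    0<m g = ≤-trans (s≤s z≤n) g

    at : ∀ {P u u′ e s} → u ≡ u′ → P ⊢ u′ , e ⇒ s → P ⊢ u , e ⇒ s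
    at refl x = x

    scan-at : ∀ ps qs → scan (counterAt ps qs) ≡ cell (map bit qs) 0
    scan-at ps qs = scan-zip (map bit ps ++ blank ∷ []) (map bit qs)

  home-exec : ∀ {w e} ps qs → Fits w ps qs → eok e →
              home ⊢ counterAt ps qs , e ⇒ (counter (ps ʳ++ qs) , e)
  home-exec ps qs f o = prim (counterAt-head ps qs f , o) ⨟ return ps qs f
    where
    return : ∀ ps qs → Fits _ ps qs →
             loop isBit (step (mv left)) ⊢ runTape (mv left) (counterAt ps qs) , _ ⇒ (counter (ps ʳ++ qs) , _)
    return []       qs f = loop-stop (0<m (proj₂ f) , o) refl
    return (p ∷ ps) qs f = loop-go (counterAt-head ps (p ∷ qs) f′ , o) (cong isBit (scan-at ps (p ∷ qs)))
      (prim (counterAt-head ps (p ∷ qs) f′ , o)) (return ps (p ∷ qs) f′)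
      where f′ = fits-unshift p ps qs f

  private
    write-at : ∀ ps q qs s d → runTape (wr (bit s) d) (counterAt ps (q ∷ qs)) ≡
               runTape (mv d) (counterAt ps (s ∷ qs))
    write-at ps q qs s d = act-zip (map bit ps ++ blank ∷ []) (bit q ∷ map bit qs) (bit s) d

    write-end : ∀ ps s → runTape (wr (bit s) stay) (counterAt ps []) ≡ counterAt ps (s ∷ [])
    write-end ps s = act-zip (map bit ps ++ blank ∷ []) [] (bit s) stay

    start : ∀ {w e P t} bs → Fits w [] bs → eok e → P ⊢ counterAt [] bs , e ⇒ t →
            (step (mv right) ⨟ P) ⊢ counter bs , e ⇒ t
    start bs f o x = prim (0<m (proj₂ f) , o) ⨟ x

  increment-exec : ∀ {w e} bs → length bs ≤ w → length (incr bs) ≤ w → 2 + w ≤ m → eok e →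
                   increment ⊢ counter bs , e ⇒ (counter (incr bs) , e)
  increment-exec {w} {e} bs l l′ g o = start bs (l , g) o (carry [] bs (l , g) (l′ , g))
    where
    carry : ∀ ps qs → Fits w ps qs → Fits w ps (incr qs) →
            (loop is1 (step (wr (bit false) right)) ⨟ step (wr (bit true) stay) ⨟ home) ⊢
            counterAt ps qs , e ⇒ (counter (ps ʳ++ incr qs) , e)
    carry ps [] f f′ =
      loop-stop (counterAt-head ps [] f , o) (cong is1 (scan-at ps [])) ⨟ prim (counterAt-head ps [] f , o) ⨟
      at (write-end ps true) (home-exec ps (true ∷ []) f′ o)
    carry ps (false ∷ qs) f f′ =
      loop-stop (counterAt-head ps (false ∷ qs) f , o) (cong is1 (scan-at ps (false ∷ qs))) ⨟
      prim (counterAt-head ps (false ∷ qs) f , o) ⨟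
      at (write-at ps false qs true stay) (home-exec ps (true ∷ qs) f′ o)
    carry ps (true ∷ qs) f f′ with carry (false ∷ ps) qs (fits-shift false ps qs f)
        (fits-shift false ps (incr qs) f′)
    ... | l ⨟ x = loop-go (counterAt-head ps (true ∷ qs) f , o) (cong is1 (scan-at ps (true ∷ qs)))
      (prim (counterAt-head ps (true ∷ qs) f , o))
      (at (write-at ps true qs false right) l) ⨟ x

  decrement-exec : ∀ {w e} bs {v} → val bs ≡ suc v → length bs ≤ w → 2 + w ≤ m → eok e →
                   decrement ⊢ counter bs , e ⇒ (counter (decr bs) , e)
  decrement-exec {w} {e} bs eq l g o = start bs (l , g) o (borrow [] bs eq (l , g))
    where
    borrow : ∀ ps qs {v} → val qs ≡ suc v → Fits w ps qs →
             (loop is0 (step (wr (bit true) right)) ⨟ step (wr (bit false) stay) ⨟ home) ⊢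
             counterAt ps qs , e ⇒ (counter (ps ʳ++ decr qs) , e)
    borrow ps (true ∷ qs) eq f =
      loop-stop (counterAt-head ps (true ∷ qs) f , o) (cong is0 (scan-at ps (true ∷ qs))) ⨟
      prim (counterAt-head ps (true ∷ qs) f , o) ⨟
      at (write-at ps true qs false stay) (home-exec ps (false ∷ qs) f o)
    borrow ps (false ∷ qs) {v} eq f with val qs in eq′
    ... | suc _ with borrow (true ∷ ps) qs eq′ (fits-shift true ps qs f)
    ... | l ⨟ x = loop-go (counterAt-head ps (false ∷ qs) f , o) (cong is0 (scan-at ps (false ∷ qs)))
      (prim (counterAt-head ps (false ∷ qs) f , o))
      (at (write-at ps false qs true right) l) ⨟ x

  -- Decrementing keeps high-order zeros, so that a counter with value 0 need not be empty. The test
  -- for 0 therefore searches for a bit 1; if there is none, the search ends on the blank behind the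
  -- bits.
  enter-exec : ∀ {w e} bs → length bs ≤ w → 2 + w ≤ m → eok e →
               ∃₂ λ ps qs → enter ⊢ counter bs , e ⇒ (counterAt ps qs , e) ×
                 bs ≡ ps ʳ++ qs × Fits w ps qs × is1 (scan (counterAt ps qs)) ≡ (0 <ᵇ val bs)
  enter-exec {w} {e} bs l g o =
    let ps , qs , x , eq , f , v = search [] bs (l , g) in  ps , qs , start {w} bs (l , g) o x , eq , f , v
    where
    search : ∀ ps qs → Fits w ps qs → ∃₂ λ ps′ qs′ →
             loop is0 (step (mv right)) ⊢ counterAt ps qs , e ⇒ (counterAt ps′ qs′ , e) ×
             ps ʳ++ qs ≡ ps′ ʳ++ qs′ × Fits w ps′ qs′ × is1 (scan (counterAt ps′ qs′)) ≡ (0 <ᵇ val qs)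
    search ps [] f = ps , [] , loop-stop (counterAt-head ps [] f , o) (cong is0 (scan-at ps [])) , refl , f ,
      cong is1 (scan-at ps [])
    search ps (true ∷ qs) f = ps , true ∷ qs ,
      loop-stop (counterAt-head ps (true ∷ qs) f , o) (cong is0 (scan-at ps (true ∷ qs))) , refl , f ,
      trans (cong is1 (scan-at ps (true ∷ qs))) (cong (0 <ᵇ_) (+-comm 1 (2 * val qs)))
    search ps (false ∷ qs) f =
      let ps′ , qs′ , x , eq , f′ , v = search (false ∷ ps) qs (fits-shift false ps qs f) in
      ps′ , qs′ , loop-go (counterAt-head ps (false ∷ qs) f , o) (cong is0 (scan-at ps (false ∷ qs)))
        (prim (counterAt-head ps (false ∷ qs) f , o)) x , eq , f′ , trans v (double (val qs))
      where
      double : ∀ n → (0 <ᵇ n) ≡ (0 <ᵇ 2 * n + 0)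
      double zero    = refl
      double (suc n) = refl

  -- The index of the invariant `I` is the number of bits still ahead of the head, so the length of
  -- the counter serves as the number of rounds.
  walk-exec : ∀ {w e Q} bs → length bs ≤ w → 2 + w ≤ m →
              (I : ℕ → E → Set) → (∀ {n e} → I n e → eok e) →
              (∀ {n e} u → head u < m → I (suc n) e → ∃ λ e′ → Q ⊢ u , e ⇒ (u , e′) × I n e′) →
              I (length bs) e →
              ∃₂ λ ps e′ → walk Q ⊢ counter bs , e ⇒ (counterAt ps [] , e′) × I 0 e′ ×
                bs ≡ ps ʳ++ [] × Fits w ps []
  walk-exec {w} {Q = Q} bs l g I ok body i =
    let ps , e′ , x , r = go [] bs (l , g) i in ps , e′ , start {w} bs (l , g) (ok i) x , r
    where
    go : ∀ {e} ps qs → Fits w ps qs → I (length qs) e →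
         ∃₂ λ ps′ e′ → loop isBit (Q ⨟ step (mv right)) ⊢ counterAt ps qs , e ⇒ (counterAt ps′ [] , e′) ×
           I 0 e′ × ps ʳ++ qs ≡ ps′ ʳ++ [] × Fits w ps′ []
    go ps [] f i = ps , _ , loop-stop (counterAt-head ps [] f , ok i) (cong isBit (scan-at ps [])) , i ,
        refl , f
    go ps (q ∷ qs) f i =
      let h = counterAt-head ps (q ∷ qs) f
          _ , x , i′ = body (counterAt ps (q ∷ qs)) h i
          ps′ , e′ , y , r = go (q ∷ ps) qs (fits-shift q ps qs f) i′ in
      ps′ , e′ , loop-go (h , ok i) (cong isBit (scan-at ps (q ∷ qs))) (x ⨟ prim (h , ok i′)) y , r

-- Programs for a counter and an address-tape holding the same bits, with
-- the most significant bit leftmost and the head to the right of them.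

addressTape : List Bool → Tape
addressTape bs = zip (map bit bs) []

put clear : Prog (LocalIns TapeIns) (Symbol → Bool)
put = walk (prim nop) ⨟ step (mv left) ⨟
      loop isBit (test is1 (prim (ext (wr (bit true) right))) (prim (ext (wr (bit false) right))) ⨟ step
          (mv left))
clear = walk (prim (ext (mv left)) ⨟ prim (ext (wr blank stay))) ⨟ home

module _ {m w : ℕ} (w≤m : 2 + w ≤ m) where
  private
    ok : Tape → Set
    ok u = head u < m

    _⊢_⇒_ : LocalProg → Tape × Tape → Tape × Tape → Set
    P ⊢ s ⇒ t = Exec (localSemantics Tape TapeIns runTape) (LocalOk runTape ok m) P s t

    address< : ∀ bs → length bs ≤ w → head (addressTape bs) < m
    address< bs l = ≤-trans (s≤s (≤-trans (≤-reflexive (length-map bit bs)) (m≤n⇒m≤1+n l))) w≤m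

  -- Copying goes from the far end of the counter back to its marker. The most significant bit is
  -- met first and thus becomes the leftmost one on the address-tape.
  put-exec : ∀ bs → length bs ≤ w → put ⊢ counter bs , addressTape [] ⇒ (counter bs , addressTape bs)
  put-exec bs l with walk-exec runTape ok m {w} {Q = prim nop} bs l w≤m (λ _ e → e ≡ addressTape [])
                     (λ { refl → ≤-trans (s≤s z≤n) w≤m })
                     (λ { u h refl → _ , prim (h , ≤-trans (s≤s z≤n) w≤m) , refl }) refl
  ... | ps , _ , x , refl , refl , f , _ =
    x ⨟ prim (at< {[]} ps (subst (_≤ w) (+-identityʳ _) f) , ≤-trans (s≤s z≤n) w≤m) ⨟ copy ps [] f
    where
    at< : ∀ {qs} ps → length ps ≤ w → head (counterAt ps qs) < m
    at< ps f = ≤-trans (s≤s (≤-reflexive (trans (length-++ (map bit ps)) (trans (+-comm _ 1)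
      (cong suc (length-map bit ps)))))) (≤-trans (s≤s (s≤s f)) w≤m)

    append : ∀ qs b → runTape (wr (bit b) right) (addressTape qs) ≡ addressTape (b ∷ qs)
    append qs b = act-zip (map bit qs) [] (bit b) right

    copy : ∀ ps qs → length ps + length qs ≤ w →
           loop isBit (test is1 (prim (ext (wr (bit true) right))) (prim (ext (wr (bit false) right))) ⨟
               step (mv left)) ⊢
           runTape (mv left) (counterAt ps qs) , addressTape qs ⇒ (counter (ps ʳ++ qs) , addressTape
               (ps ʳ++ qs))
    copy [] qs f = loop-stop (≤-trans (s≤s z≤n) w≤m , address< qs f) refl
    copy (p ∷ ps) qs f = loop-go o (cong isBit sc) (write p sc) (copy ps (p ∷ qs) f′)
      where
      f′ = ≤-trans (≤-reflexive (+-suc (length ps) (length qs))) f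
      h = at< {p ∷ qs} ps (≤-trans (m≤m+n (length ps) (suc (length qs))) f′)
      o = h , address< qs (≤-trans (m≤n+m (length qs) (suc (length ps))) f)
      sc : scan (counterAt ps (p ∷ qs)) ≡ bit p
      sc = scan-zip (map bit ps ++ blank ∷ []) (bit p ∷ map bit qs)
      o′ = h , address< (p ∷ qs) (≤-trans (m≤n+m (suc (length qs)) (length ps)) f′)
      done : ∀ {b} → p ≡ b → step (mv left) ⊢ counterAt ps (p ∷ qs) , runTape (wr (bit b) right)
          (addressTape qs) ⇒
             (runTape (mv left) (counterAt ps (p ∷ qs)) , addressTape (p ∷ qs))
      done refl rewrite append qs p = prim o′
      write : ∀ b → scan (counterAt ps (p ∷ qs)) ≡ bit b →
              (test is1 (prim (ext (wr (bit true) right))) (prim (ext (wr (bit false) right))) ⨟ step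
                  (mv left)) ⊢
              counterAt ps (p ∷ qs) , addressTape qs ⇒ (runTape (mv left) (counterAt ps (p ∷ qs)) ,
                  addressTape (p ∷ qs))
      write b sc′ with trans (sym sc) sc′
      write true  sc′ | refl = test-yes o (cong is1 sc) (prim o) ⨟ done refl
      write false sc′ | refl = test-no o (cong is1 sc) (prim o) ⨟ done refl

  private
    Erased : ℕ → Tape → Set
    Erased n u = ∃₂ λ L R → u ≡ zip L R × All (_≡ blank) R × length L ≤ n × length L ≤ w

    erased-ok : ∀ {n u} → Erased n u → head u < m
    erased-ok (L , R , refl , _ , _ , f) = ≤-trans (s≤s (m≤n⇒m≤1+n f)) w≤m

    erase : ∀ {n e} u → head u < m → Erased (suc n) e →
            ∃ λ e′ → (prim (ext (mv left)) ⨟ prim (ext (wr blank stay))) ⊢ u , e ⇒ (u , e′) × Erased n e′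
    erase u h i@([] , [] , refl , r , _ , f) =
      _ , prim (h , erased-ok i) ⨟ prim (h , erased-ok i) , ([] , blank ∷ [] , refl , refl ∷ [] , z≤n , f)
    erase u h i@([] , _ ∷ R , refl , _ ∷ r , _ , f) =
      _ , prim (h , erased-ok i) ⨟ prim (h , erased-ok i) , ([] , blank ∷ R , refl , refl ∷ r , z≤n , f)
    erase {n} u h i@(s ∷ L , R , refl , r , g , f) =
      _ , prim (h , erased-ok i) ⨟ prim (h , ≤-trans (n≤1+n _) (erased-ok i)) ,
      (L , blank ∷ R , act-zip L (s ∷ R) blank stay , refl ∷ r , s≤s⁻¹ g , m+n≤o⇒n≤o 1 f)

    blanks : ∀ R → All (_≡ blank) R → ∀ i → cell R i ≡ blank
    blanks []      []       _       = refl
    blanks (_ ∷ _) (e ∷ _)  zero    = e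
    blanks (_ ∷ R) (_ ∷ es) (suc i) = blanks R es i

  -- An address-tape cannot carry an end-marker, since its number is read from the leftmost cell on.
  -- The counter instead measures out how many cells are erased; surplus left moves stay on the
  -- leftmost cell, so a counter at least as long as the number suffices.
  clear-exec : ∀ bs cs → length bs ≤ w → length cs ≤ length bs →
               ∃ λ u → clear ⊢ counter bs , addressTape cs ⇒ (counter bs , u) × u ≈ addressTape []
  clear-exec bs cs l l′ with walk-exec runTape ok m {w} bs l w≤m Erased erased-ok erase
      (map bit cs , [] , refl , [] , ≤-trans (≤-reflexive (length-map bit cs)) l′ ,
       ≤-trans (≤-reflexive (length-map bit cs)) (≤-trans l′ l))
  ... | ps , u , x , i@([] , R , refl , r , _) , refl , f =
    _ , x ⨟ home-exec runTape ok m ps [] f (erased-ok i) , alike refl (blanks R r)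

-- Changing a function at one argument

module _ {A B : Set} (_≟_ : DecidableEquality A) where

  update : (A → B) → A → B → A → B
  update f a b x = if does (x ≟ a) then b else f x

  update-same : ∀ f a b → update f a b a ≡ b
  update-same f a b with a ≟ a
  ... | yes _  = refl
  ... | no a≢a = contradiction refl a≢a

  update-other : ∀ f {a} b {x} → x ≢ a → update f a b x ≡ f x
  update-other f {a} b {x} x≢a with x ≟ a
  ... | yes x≡a = contradiction x≡a x≢a
  ... | no _    = refl

  update-all : ∀ {ℓ} (P : A → B → Set ℓ) {f a b} → P a b → (∀ x → x ≢ a → P x (f x)) →
               ∀ x → P x (update f a b x)
  update-all P {f} {a} p q x with x ≟ a
  ... | yes refl = p
  ... | no x≢a   = q x x≢a

-- The operations that a machine offers on its input: a question is answered
-- by a number and a read-only tape holds a string of bits, both depending on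
-- the numbers on some address-tapes.

record Signature : Set₁ where
  field
    Ask Read : Set
    askArity : Ask → ℕ
    readArity : Read → ℕ
    _≟ᴬ_ : DecidableEquality Ask
    _≟ᴿ_ : DecidableEquality Read

  Op : Set
  Op = Ask ⊎ Read

  arity : Op → ℕ
  arity (inj₁ a) = askArity a
  arity (inj₂ r) = readArity r

  Address : Set
  Address = Σ Op (Fin ∘ arity)

  _≟ᵃ_ : DecidableEquality Address
  _≟ᵃ_ = Σ-≡-dec (⊎-≡-dec _≟ᴬ_ _≟ᴿ_) Finₚ._≟_

horner : List Bool → ℕ
horner bs = readNumber 0 (holding bs)

record Interpretation (Sg : Signature) : Set where
  open Signature Sg
  field
    askᴵ  : (a : Ask) → Vec ℕ (askArity a) → ℕ
    readᴵ : (r : Read) → Vec ℕ (readArity r) → List Bool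

  ⟦_⟧ᵒ : (o : Op) → Vec ℕ (arity o) → ℕ
  ⟦ inj₁ a ⟧ᵒ vs = askᴵ a vs
  ⟦ inj₂ r ⟧ᵒ vs = horner (readᴵ r vs)

-- A platform is a machine of either kind, with the transitions left open; it
-- has K counter tapes, the address-tapes and read-only tapes of the signature.

module Platforms (Sg : Signature) (K : ℕ) where
  open Signature Sg

  Name : Set
  Name = Fin K ⊎ Address

  _≟ⁿ_ : DecidableEquality Name
  _≟ⁿ_ = ⊎-≡-dec Finₚ._≟_ _≟ᵃ_

  data Ins : Set where
    nop : Ins
    on  : Name → TapeIns → Ins
    ro  : Read → Move → Ins

  data Condition : Set where
    scanned   : Name → (Symbol → Bool) → Condition
    scannedRo : Read → (Symbol → Bool) → Condition
    answered  : Ask → ℕ → Condition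

  effect : Ins → Name → Symbol → Symbol × Move
  effect nop      y s = s , stay
  effect (on x i) y s = if does (y ≟ⁿ x) then tapeAction i s else (s , stay)
  effect (ro _ _) y s = s , stay

  readEffect : Ins → Read → Move
  readEffect (ro x d) y = if does (y ≟ᴿ x) then d else stay
  readEffect _        y = stay

  record Platform (I : Interpretation Sg) : Set₁ where
    open Interpretation I
    field
      State   : Set
      run     : Ins → State → State
      cond    : Condition → State → Bool
      cellsOf : State → ℕ
      tapeOf  : State → Name → Tape
      headOf  : State → Read → ℕ
      -- The value-tapes of a direct-access machine start out blank, whatever is addressed, and show
      -- the values only after a first step. `Fresh` expresses that the read-only tapes agree with
      -- the address-tapes.
      Fresh   : State → Set

    numbers : (o : Op) → State → Vec ℕ (arity o)
    numbers o t = Vec.tabulate λ i → number (tapeOf t (inj₂ (o , i)))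

    field
      cellsOf-≤ : ∀ {m} t → (∀ x → head (tapeOf t x) < m) → cellsOf t ≤ m
      tape-run  : ∀ i t x → tapeOf (run i t) x ≡ act (effect i x (scan (tapeOf t x))) (tapeOf t x)
      head-run  : ∀ i t y → Fresh t → headOf (run i t) y ≡
                    head (moveReadOnly (readEffect i y) (tape (holding (readᴵ y (numbers (inj₂ y) t)))
                        (headOf t y)))
      fresh-run : ∀ i t → Fresh t → Fresh (run i t)
      cond-sym  : ∀ x f t → cond (scanned x f) t ≡ f (scan (tapeOf t x))
      cond-ros  : ∀ y f t → Fresh t → cond (scannedRo y f) t ≡
                    f (cell (holding (readᴵ y (numbers (inj₂ y) t))) (headOf t y))
      cond-ans  : ∀ a v t → cond (answered a v) t ≡ (askᴵ a (numbers (inj₁ a) t) ≡ᵇ v)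

    semantics : Semantics Ins Condition
    semantics = record { State = State ; nop = nop ; run = run ; cond = cond }

-- Commands on counters

module Commands (Sg : Signature) where
  infixr 5 _⨾_
  open Signature Sg

  data Cmd : Set where
    skip    : Cmd
    inc dec : ℕ → Cmd
    _⨾_     : Cmd → Cmd → Cmd
    while   : ℕ → Cmd → Cmd
    at      : ℕ → Address → Cmd → Cmd
    ifAns   : Ask → ℕ → Cmd → Cmd
    moveRo  : Read → Move → Cmd
    ifRo    : Read → (Symbol → Bool) → Cmd → Cmd
    whileRo : Read → (Symbol → Bool) → Cmd → Cmd

  Below : ℕ → Cmd → Set
  Below K skip            = ⊤
  Below K (inc x)         = x < K
  Below K (dec x)         = x < K
  Below K (c ⨾ c′)        = Below K c × Below K c′
  Below K (while x c)     = x < K × Below K c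
  Below K (at x _ c)      = x < K × Below K c
  Below K (ifAns _ _ c)   = Below K c
  Below K (moveRo _ _)    = ⊤
  Below K (ifRo _ _ c)    = Below K c
  Below K (whileRo _ _ c) = Below K c

  registers : Cmd → ℕ
  registers skip            = 0
  registers (inc x)         = suc x
  registers (dec x)         = suc x
  registers (c ⨾ c′)        = registers c ⊔ registers c′
  registers (while x c)     = suc x ⊔ registers c
  registers (at x _ c)      = suc x ⊔ registers c
  registers (ifAns _ _ c)   = registers c
  registers (moveRo _ _)    = 0
  registers (ifRo _ _ c)    = registers c
  registers (whileRo _ _ c) = registers c

  below-registers : ∀ {K} c → registers c ≤ K → Below K c
  below-registers skip            l = tt
  below-registers (inc x)         l = l
  below-registers (dec x)         l = l
  below-registers (c ⨾ c′)        l = below-registers c (m⊔n≤o⇒m≤o _ _ l) , below-registers c′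
      (m⊔n≤o⇒n≤o (registers c) _ l)
  below-registers (while x c)     l = m⊔n≤o⇒m≤o (suc x) (registers c) l , below-registers c
      (m⊔n≤o⇒n≤o (suc x) (registers c) l)
  below-registers (at x _ c)      l = m⊔n≤o⇒m≤o (suc x) (registers c) l , below-registers c
      (m⊔n≤o⇒n≤o (suc x) (registers c) l)
  below-registers (ifAns _ _ c)   l = below-registers c l
  below-registers (moveRo _ _)    l = tt
  below-registers (ifRo _ _ c)    l = below-registers c l
  below-registers (whileRo _ _ c) l = below-registers c l

  Env : Set
  Env = ℕ → ℕ

  _[_≔_] : Env → ℕ → ℕ → Env
  _[_≔_] = update _≟_

  -- Address-tapes not in use are blank and are mapped to nothing.

  Addressing : Set
  Addressing = Address → Maybe ℕ

  addressed-numbers : Addressing → (o : Op) → Vec ℕ (arity o)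
  addressed-numbers ν o = Vec.tabulate λ i → fromMaybe 0 (ν (o , i))

  Conf : Set
  Conf = Env × (Read → ℕ)

  module _ (I : Interpretation Sg) where
    open Interpretation I

    content-of : Addressing → Read → List Symbol
    content-of ν y = holding (readᴵ y (addressed-numbers ν (inj₂ y)))

  -- Runs in which no increment exceeds B.

  module _ (I : Interpretation Sg) (B : ℕ) where
    open Interpretation I

    data Run (ν : Addressing) : Cmd → Conf → Conf → Set where
      skip       : ∀ {s} → Run ν skip s s
      inc        : ∀ {x ρ η} → suc (ρ x) ≤ B → Run ν (inc x) (ρ , η) (ρ [ x ≔ suc (ρ x) ] , η)
      dec        : ∀ {x v ρ η} → ρ x ≡ suc v → Run ν (dec x) (ρ , η) (ρ [ x ≔ v ] , η)
      _⨾_        : ∀ {c c′ s t u} → Run ν c s t → Run ν c′ t u → Run ν (c ⨾ c′) s u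
      while-stop : ∀ {x c ρ η} → ρ x ≡ 0 → Run ν (while x c) (ρ , η) (ρ , η)
      while-go   : ∀ {x c v ρ η t u} → ρ x ≡ suc v → Run ν c (ρ , η) t → Run ν (while x c) t u →
                   Run ν (while x c) (ρ , η) u
      at         : ∀ {x a c ρ η t} → ν a ≡ nothing →
                   Run (update _≟ᵃ_ ν a (just (ρ x))) c (ρ , η) t → Run ν (at x a c) (ρ , η) t
      ans-yes    : ∀ {a v c s t} → (askᴵ a (addressed-numbers ν (inj₁ a)) ≡ᵇ v) ≡ true →
                   Run ν c s t → Run ν (ifAns a v c) s t
      ans-no     : ∀ {a v c s} → (askᴵ a (addressed-numbers ν (inj₁ a)) ≡ᵇ v) ≡ false →
                   Run ν (ifAns a v c) s s
      moveRo     : ∀ {y d ρ η η′} → η′ y ≡ head (moveReadOnly d (tape (content-of I ν y) (η y))) →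
                   (∀ z → z ≢ y → η′ z ≡ η z) → Run ν (moveRo y d) (ρ , η) (ρ , η′)
      ro-yes     : ∀ {y f c ρ η t} → f (cell (content-of I ν y) (η y)) ≡ true →
                   Run ν c (ρ , η) t → Run ν (ifRo y f c) (ρ , η) t
      ro-no      : ∀ {y f c ρ η} → f (cell (content-of I ν y) (η y)) ≡ false →
                   Run ν (ifRo y f c) (ρ , η) (ρ , η)
      ro-stop    : ∀ {y f c ρ η} → f (cell (content-of I ν y) (η y)) ≡ false →
                   Run ν (whileRo y f c) (ρ , η) (ρ , η)
      ro-go      : ∀ {y f c ρ η t u} → f (cell (content-of I ν y) (η y)) ≡ true →
                   Run ν c (ρ , η) t → Run ν (whileRo y f c) t u → Run ν (whileRo y f c) (ρ , η) u

-- Commands as programs of a platform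

module Compile (Sg : Signature) (K′ : ℕ) where
  open Signature Sg
  open Commands Sg
  private K = suc K′
  open Platforms Sg K

  -- Numbers out of range get a default, for which `K` has to be positive; `Below` excludes them
  -- wherever correctness is claimed.
  register : ℕ → Fin K
  register x with x <? K
  ... | yes x<K = fromℕ< x<K
  ... | no _    = zero

  toℕ-register : ∀ {x} → x < K → toℕ (register x) ≡ x
  toℕ-register {x} l with x <? K
  ... | yes x<K = toℕ-fromℕ< x<K
  ... | no x≮K  = contradiction l x≮K

  counterIns : Fin K → LocalIns ⊥ → Ins
  counterIns j nop     = nop
  counterIns j (ctr i) = on (inj₁ j) i

  addressIns : Fin K → Address → LocalIns TapeIns → Ins
  addressIns j a nop     = nop
  addressIns j a (ctr i) = on (inj₁ j) i
  addressIns j a (ext i) = on (inj₂ a) i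

  noIns : ⊥ → ⊤ → ⊤
  noIns ()

  onCounter : Fin K → Prog (LocalIns ⊥) (Symbol → Bool) → Prog Ins Condition
  onCounter j = mapProg (counterIns j) (scanned (inj₁ j))

  onAddress : Fin K → Address → Prog (LocalIns TapeIns) (Symbol → Bool) → Prog Ins Condition
  onAddress j a = mapProg (addressIns j a) (scanned (inj₁ j))

  prog : Cmd → Prog Ins Condition
  prog skip            = prim nop
  prog (inc x)         = onCounter (register x) increment
  prog (dec x)         = onCounter (register x) decrement
  prog (c ⨾ c′)        = prog c ⨟ prog c′
  -- The test leaves the head inside the counter, so `home` comes at the start of the body as well
  -- as behind the loop.
  prog (while x c)     = onCounter j enter ⨟ loop (scanned (inj₁ j) is1) (onCounter j home ⨟ prog c ⨟
      onCounter j enter) ⨟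
                         onCounter j home
    where j = register x
  prog (at x a c)      = onAddress (register x) a put ⨟ prog c ⨟ onAddress (register x) a clear
  prog (ifAns a v c)   = test (answered a v) (prog c) (prim nop)
  prog (moveRo y d)    = prim (ro y d)
  prog (ifRo y f c)    = test (scannedRo y f) (prog c) (prim nop)
  prog (whileRo y f c) = loop (scannedRo y f) (prog c)

  module _ {I : Interpretation Sg} (Pl : Platform I) where
    open Interpretation I
    open Platform Pl

    record At (U : Name → Tape) (η : Read → ℕ) (t : State) : Set where
      constructor located
      field
        tapes : ∀ x → tapeOf t x ≈ U x
        heads : ∀ y → headOf t y ≡ η y
        fresh : Fresh t

    open At

    at-resp : ∀ {U U′ η t} → (∀ x → U x ≈ U′ x) → At U η t → At U′ η t
    at-resp e (located a h f) = located (λ x → ≈-trans (a x) (e x)) h f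

    private
      kept : ∀ {t t′ u} → t′ ≡ act (scan t , stay) t → t ≈ u → t′ ≈ u
      kept {t} refl (alike h c) = ≈-trans (act-scanned t stay) (alike h c)

    at-nop : ∀ {U η t} → At U η t → At U η (run nop t)
    at-nop {t = t} (located a h f) = located
      (λ x → kept (tape-run nop t x) (a x))
      (λ y → trans (head-run nop t y f) (h y)) (fresh-run nop t f)

    at-on : ∀ {U η t} x i → At U η t → At (update _≟ⁿ_ U x (runTape i (U x))) η (run (on x i) t)
    at-on {U} {t = t} x i (located a h f) = located
      (update-all _≟ⁿ_ (λ y u → tapeOf (run (on x i) t) y ≈ u)
        (subst (_≈ _) (sym (trans (tape-run (on x i) t x) (cong (λ e → act e (tapeOf t x))
            (here-effect (scan (tapeOf t x))))))
          (≈-trans (tapeAction-correct i (tapeOf t x)) (runTape-cong i (a x))))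
        (λ y y≢x → kept (trans (tape-run (on x i) t y) (cong (λ e → act e (tapeOf t y))
            (there-effect y≢x (scan (tapeOf t y))))) (a y)))
      (λ y → trans (head-run (on x i) t y f) (h y)) (fresh-run (on x i) t f)
      where
      here-effect : ∀ s → effect (on x i) x s ≡ tapeAction i s
      here-effect s with x ≟ⁿ x
      ... | yes _  = refl
      ... | no x≢x = contradiction refl x≢x
      there-effect : ∀ {y} → y ≢ x → ∀ s → effect (on x i) y s ≡ (s , stay)
      there-effect {y} y≢x s with y ≟ⁿ x
      ... | yes y≡x = contradiction y≡x y≢x
      ... | no _    = refl

    ≡⇒≈ : ∀ {t u} → t ≡ u → t ≈ u
    ≡⇒≈ refl = ≈-refl

    at-on-updated : ∀ {U η t u} x i → At (update _≟ⁿ_ U x u) η t →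
                    At (update _≟ⁿ_ U x (runTape i u)) η (run (on x i) t)
    at-on-updated {U} {u = u} x i a = at-resp (λ y → ≡⇒≈ (again y)) (at-on x i a)
      where
      again : ∀ y → update _≟ⁿ_ (update _≟ⁿ_ U x u) x (runTape i (update _≟ⁿ_ U x u x)) y ≡ update _≟ⁿ_ U x
          (runTape i u) y
      again y with y ≟ⁿ x
      ... | yes refl = cong (runTape i) (update-same _≟ⁿ_ U x u)
      ... | no _     = refl

    at-numbers : ∀ {U η t} → At U η t → ∀ o → numbers o t ≡ Vec.tabulate λ i → number (U (inj₂ (o , i)))
    at-numbers a o = tabulate-cong λ i → number-cong (tapes a (inj₂ (o , i)))

    at-ro : ∀ {U η η′ t} y d → At U η t →
            η′ y ≡ head (moveReadOnly d (tape
                (holding (readᴵ y (Vec.tabulate λ i → number (U (inj₂ (inj₂ y , i)))))) (η y))) →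
            (∀ z → z ≢ y → η′ z ≡ η z) → At U η′ (run (ro y d) t)
    at-ro {U} {η} {η′} {t} y d p@(located a h f) e e′ = located
      (λ x → kept (tape-run (ro y d) t x) (a x))
      moved (fresh-run (ro y d) t f)
      where
      moved : ∀ z → headOf (run (ro y d) t) z ≡ η′ z
      moved z with z ≟ᴿ y | head-run (ro y d) t z f
      ... | yes refl | q = trans q (trans
          (cong₂ (λ vs k → head (moveReadOnly d (tape (holding (readᴵ y vs)) k)))
                             (at-numbers p (inj₂ y)) (h y)) (sym e))
      ... | no z≢y   | q = trans q (trans (h z) (sym (e′ z z≢y)))

    module _ {m w : ℕ} (w≤m : 2 + w ≤ m) where

      ok : State → Set
      ok t = cellsOf t ≤ m

      Short : (Name → Tape) → Set
      Short U = ∀ x → head (U x) < m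

      at-ok : ∀ {U η t} → Short U → At U η t → ok t
      at-ok s a = cellsOf-≤ _ λ x → subst (_< m) (sym (head-≡ (tapes a x))) (s x)

      onCounter-exec : ∀ {U η t P u u′} j → Short U →
        Exec (localSemantics ⊤ ⊥ λ ()) (LocalOk noIns (λ _ → ⊤) m) P (u , tt) (u′ , tt) →
        At (update _≟ⁿ_ U (inj₁ j) u) η t →
        ∃ λ t′ → Exec semantics ok (onCounter j P) t t′ × At (update _≟ⁿ_ U (inj₁ j) u′) η t′
      onCounter-exec {U} {η} j short e a =
        exec-map (localSemantics ⊤ ⊥ noIns) semantics (counterIns j) (scanned (inj₁ j))
            (λ (u , _) t → At (update _≟ⁿ_ U (inj₁ j) u) η t)
          (λ r (l , _) → at-ok (update-all _≟ⁿ_ (λ _ v → head v < m) {U} l (λ x _ → short x)) r)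
          at-nop
          (λ { nop r → at-nop r ; (ctr i) r → at-on-updated (inj₁ j) i r })
          (λ f r → sym (trans (cond-sym (inj₁ j) f _) (cong f (trans (scan-cong (tapes r (inj₁ j)))
            (cong scan (update-same _≟ⁿ_ U (inj₁ j) _))))))
          e a

      onAddress-exec : ∀ {U η t P u u′ v v′} j a → Short U →
        Exec (localSemantics Tape TapeIns runTape) (LocalOk runTape (λ u → head u < m) m) P (u , v)
            (u′ , v′) →
        At (update _≟ⁿ_ (update _≟ⁿ_ U (inj₂ a) v) (inj₁ j) u) η t →
        ∃ λ t′ → Exec semantics ok (onAddress j a P) t t′ × At (update _≟ⁿ_ (update _≟ⁿ_ U (inj₂ a) v′)
            (inj₁ j) u′) η t′
      onAddress-exec {U} {η} j a short e r =
        exec-map (localSemantics Tape TapeIns runTape) semantics (addressIns j a) (scanned (inj₁ j))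
          (λ (u , v) t → At (update _≟ⁿ_ (update _≟ⁿ_ U (inj₂ a) v) (inj₁ j) u) η t)
          (λ {s} r (l , l′) → at-ok (update-all _≟ⁿ_ (λ _ v → head v < m) {update _≟ⁿ_ U (inj₂ a) (proj₂ s)} l
            (λ x _ → update-all _≟ⁿ_ (λ _ v → head v < m) {U} l′ (λ x _ → short x) x)) r)
          at-nop
          (λ { nop r → at-nop r
             ; (ctr i) r → at-on-updated (inj₁ j) i r
             ; (ext i) r → at-resp (λ x → ≡⇒≈ (swap x)) (at-on-updated (inj₂ a) i
                 (at-resp (λ x → ≡⇒≈ (sym (swap {u = _} {_} x))) r)) })
          (λ f {s} r → sym (trans (cond-sym (inj₁ j) f _) (cong f (trans (scan-cong (tapes r (inj₁ j)))
            (cong scan (update-same _≟ⁿ_ (update _≟ⁿ_ U (inj₂ a) (proj₂ s)) (inj₁ j) (proj₁ s)))))))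
          e r
        where
        swap : ∀ {u v} x → update _≟ⁿ_ (update _≟ⁿ_ U (inj₁ j) u) (inj₂ a) v x ≡
                           update _≟ⁿ_ (update _≟ⁿ_ U (inj₂ a) v) (inj₁ j) u x
        swap x with x ≟ⁿ inj₂ a | x ≟ⁿ inj₁ j
        ... | yes refl | yes ()
        ... | yes refl | no _ = refl
        ... | no _     | yes refl = refl
        ... | no _     | no _ = refl

      -- The tapes while counters hold β and address-tapes hold ω.

      layout : (Fin K → List Bool) → (Address → List Bool) → Name → Tape
      layout β ω (inj₁ j) = counter (β j)
      layout β ω (inj₂ a) = addressTape (ω a)

      record Holds (ν : Addressing) (ω : Address → List Bool) (c : Conf) (β : Fin K → List Bool)
          (t : State) : Set where
        constructor holds
        field
          placed     : At (layout β ω) (proj₂ c) t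
          values     : ∀ j → proj₁ c (toℕ j) ≡ val (β j)
          short      : ∀ j → length (β j) ≤ w

      record Addressed (ν : Addressing) (ω : Address → List Bool) : Set where
        constructor addressed
        field
          addresses : ∀ a → fromMaybe 0 (ν a) ≡ val (ω a)
          free      : ∀ a → ν a ≡ nothing → ω a ≡ []
          shortᵃ    : ∀ a → length (ω a) ≤ w

      open Holds
      open Addressed

      number-addressTape : ∀ bs → number (addressTape bs) ≡ val bs
      number-addressTape bs = trans (number-readNumber (addressTape bs)) (readNumber-ʳ++ bs [])

      private
        0<m : 0 < m
        0<m = ≤-trans (s≤s z≤n) w≤m

        short-layout : ∀ {ν ω β} → Addressed ν ω → Short (layout β ω)
        short-layout         d (inj₁ j) = 0<m
        short-layout {ω = ω} d (inj₂ a) =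
          ≤-trans (s≤s (≤-trans (≤-reflexive (length-map bit (ω a))) (m≤n⇒m≤1+n (shortᵃ d a)))) w≤m

        set-counter : ∀ β ω j bs x → update _≟ⁿ_ (layout β ω) (inj₁ j) (counter bs) x ≡
                                     layout (update Finₚ._≟_ β j bs) ω x
        set-counter β ω j bs = update-all _≟ⁿ_ (λ x u → u ≡ layout (update Finₚ._≟_ β j bs) ω x)
          (cong counter (sym (update-same Finₚ._≟_ β j bs)))
          λ { (inj₁ i) i≢j → cong counter (sym (update-other Finₚ._≟_ β bs λ { refl → i≢j refl }))
            ; (inj₂ _) _   → refl }

        set-address : ∀ β ω a bs x → update _≟ⁿ_ (layout β ω) (inj₂ a) (addressTape bs) x ≡
                                     layout β (update _≟ᵃ_ ω a bs) x
        set-address β ω a bs = update-all _≟ⁿ_ (λ x u → u ≡ layout β (update _≟ᵃ_ ω a bs) x)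
          (cong addressTape (sym (update-same _≟ᵃ_ ω a bs)))
          λ { (inj₁ _) _   → refl
            ; (inj₂ b) b≢a → cong addressTape (sym (update-other _≟ᵃ_ ω bs λ { refl → b≢a refl })) }

        update-self : ∀ (U : Name → Tape) x {u} → U x ≡ u → ∀ y → U y ≡ update _≟ⁿ_ U x u y
        update-self U x e y with y ≟ⁿ x
        ... | yes refl = e
        ... | no _     = refl

        update-cong : ∀ {U U′ : Name → Tape} x u → (∀ y → y ≢ x → U y ≈ U′ y) →
                      ∀ y → update _≟ⁿ_ U x u y ≈ update _≟ⁿ_ U′ x u y
        update-cong x u e y with y ≟ⁿ x
        ... | yes _  = ≈-refl
        ... | no y≢x = e y y≢x

        set-both : ∀ β ω j a cs x → update _≟ⁿ_ (update _≟ⁿ_ (layout β ω) (inj₂ a) (addressTape cs))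
            (inj₁ j) (counter (β j)) x ≈
                                    layout β (update _≟ᵃ_ ω a cs) x
        set-both β ω j a cs x = ≈-trans (update-cong (inj₁ j) (counter (β j))
            (λ y _ → ≡⇒≈ (set-address β ω a cs y)) x)
          (≡⇒≈ (sym (update-self (layout β (update _≟ᵃ_ ω a cs)) (inj₁ j) refl x)))

      -- That counters do not get shorter is recorded for the sake of `at`: the register may change
      -- while its former value is on the address-tape, and it must still be long enough to measure
      -- out the erasure.
      Outcome : Addressing → (Address → List Bool) → (Fin K → List Bool) → Prog Ins Condition → State → Conf
          → Set
      Outcome ν ω β P t s = ∃₂ λ t′ β′ → Exec semantics ok P t t′ × Holds ν ω s β′ t′ ×
          (∀ j → length (β j) ≤ length (β′ j))

      private
        set-value : ∀ {ν ω ρ η β t t′ x v} bs → x < K → val bs ≡ v → length bs ≤ w → Holds ν ω (ρ , η) β t →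
                    At (update _≟ⁿ_ (layout β ω) (inj₁ (register x)) (counter bs)) η t′ →
                    Holds ν ω (ρ [ x ≔ v ] , η) (update Finₚ._≟_ β (register x) bs) t′
        set-value {ω = ω} {ρ} {β = β} {x = x} {v} bs x<K e l (holds _ vs ls) a = holds
          (at-resp (λ y → ≡⇒≈ (set-counter β ω _ bs y)) a)
          (update-all Finₚ._≟_ (λ i cs → (ρ [ x ≔ v ]) (toℕ i) ≡ val cs)
            (trans (cong (ρ [ x ≔ v ]) (toℕ-register x<K)) (trans (update-same _≟_ ρ x v) (sym e)))
            λ i i≢j → trans (update-other _≟_ ρ v λ { refl → i≢j (toℕ-injective (sym (toℕ-register x<K))) })
                (vs i))
          (update-all Finₚ._≟_ (λ _ cs → length cs ≤ w) l λ i _ → ls i)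

        value-at : ∀ {ν ω ρ η β t x} → x < K → Holds ν ω (ρ , η) β t → ρ x ≡ val (β (register x))
        value-at {ρ = ρ} {x = x} x<K h = trans (cong ρ (sym (toℕ-register x<K))) (values h (register x))

        lengths-after : ∀ (β : Fin K → List Bool) j bs → length (β j) ≤ length bs →
                        ∀ i → length (β i) ≤ length (update Finₚ._≟_ β j bs i)
        lengths-after β j bs l = update-all Finₚ._≟_ (λ i cs → length (β i) ≤ length cs) l λ _ _ → ≤-refl

        focus : ∀ {ν ω ρ η β t} j → Holds ν ω (ρ , η) β t → At (update _≟ⁿ_ (layout β ω) (inj₁ j)
            (counter (β j))) η t
        focus {ω = ω} {β = β} j h = at-resp (λ x → ≡⇒≈ (update-self (layout β ω) (inj₁ j) refl x)) (placed h)

        unfocus : ∀ {ν ω ρ η β t t′} j → Holds ν ω (ρ , η) β t →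
                  At (update _≟ⁿ_ (layout β ω) (inj₁ j) (counter (β j))) η t′ → Holds ν ω (ρ , η) β t′
        unfocus {ω = ω} {β = β} j h a =
          holds (at-resp (λ x → ≡⇒≈ (sym (update-self (layout β ω) (inj₁ j) refl x))) a) (values h) (short h)

        hold-nop : ∀ {ν ω s β t} → Holds ν ω s β t → Holds ν ω s β (run nop t)
        hold-nop h = holds (at-nop (placed h)) (values h) (short h)

        hold-ok : ∀ {ν ω s β t} → Addressed ν ω → Holds ν ω s β t → ok t
        hold-ok d h = at-ok (short-layout d) (placed h)

        hold-numbers : ∀ {ν ω s β t} → Addressed ν ω → Holds ν ω s β t → ∀ o → numbers o t ≡
            addressed-numbers ν o
        hold-numbers {ω = ω} d h o = trans (at-numbers (placed h) o)
          (tabulate-cong λ i → trans (number-addressTape (ω (o , i))) (sym (addresses d (o , i))))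

        hold-ros : ∀ {ν ω ρ η β t} → Addressed ν ω → Holds ν ω (ρ , η) β t → ∀ y f →
                   cond (scannedRo y f) t ≡ f (cell (content-of I ν y) (η y))
        hold-ros d h y f = trans (cond-ros y f _ (fresh (placed h)))
          (cong₂ (λ vs k → f (cell (holding (readᴵ y vs)) k)) (hold-numbers d h (inj₂ y))
              (heads (placed h) y))

      scanned-at : ∀ {U η t u} j → At (update _≟ⁿ_ U (inj₁ j) u) η t → cond (scanned (inj₁ j) is1) t ≡ is1
          (scan u)
      scanned-at {U} {u = u} j a = trans (cond-sym _ is1 _)
        (cong is1 (trans (scan-cong (tapes a (inj₁ j))) (cong scan (update-same _≟ⁿ_ U (inj₁ j) u))))

      module _ {B : ℕ} (B<2^w : B < 2 ^ w) where

        run-exec : ∀ {ν ω c s s′ β t} → Run I B ν c s s′ → Below K c → Addressed ν ω → Holds ν ω s β t →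
                   Outcome ν ω β (prog c) t s′
        run-exec skip _ d h = _ , _ , prim (hold-ok d h) , hold-nop h , λ _ → ≤-refl
        run-exec {ω = ω} {β = β} (inc {x} {ρ} l) x<K d h =
          let bs = β (register x)
              e = value-at x<K h
              l′ = length-incr-≤ bs w (short h _) (≤-<-trans (subst (λ v → suc v ≤ B) e l) B<2^w)
              _ , ex , a = onCounter-exec (register x) (short-layout d)
                (increment-exec noIns (λ _ → ⊤) m bs (short h _) l′ w≤m tt) (focus _ h)
          in _ , _ , ex , set-value (incr bs) x<K (trans (val-incr bs) (cong suc (sym e))) l′ h a ,
             lengths-after β _ _ (length-incr-≥ bs)
        run-exec {β = β} (dec {x} e) x<K d h =
          let bs = β (register x)
              e′ = trans (sym (value-at x<K h)) e
              _ , ex , a = onCounter-exec (register x) (short-layout d)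
                (decrement-exec noIns (λ _ → ⊤) m bs e′ (short h _) w≤m tt) (focus _ h)
          in _ , _ , ex , set-value (decr bs) x<K (val-decr bs e′) (≤-trans (≤-reflexive (length-decr bs))
                  (short h _)) h a ,
             lengths-after β _ _ (≤-reflexive (sym (length-decr bs)))
        run-exec (r ⨾ r′) (b , b′) d h =
          let _ , _ , ex , h′ , l = run-exec r b d h
              _ , _ , ex′ , h″ , l′ = run-exec r′ b′ d h′
          in _ , _ , ex ⨟ ex′ , h″ , λ j → ≤-trans (l j) (l′ j)
        run-exec {β = β} (while-stop {x} e) (x<K , b) d h
          with enter-exec noIns (λ _ → ⊤) m {w} (β (register x)) (short h _) w≤m tt
        ... | ps , qs , en , eq , f , v =
          let _ , ex₁ , a₁ = onCounter-exec (register x) (short-layout d) en (focus _ h)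
              o = at-ok (update-all _≟ⁿ_ (λ _ u → head u < m) {layout β _} (counterAt-head noIns (λ _ → ⊤) m
                  ps qs f) (λ y _ → short-layout d y)) a₁
              _ , ex₂ , a₂ = onCounter-exec (register x) (short-layout d) (home-exec noIns (λ _ → ⊤) m ps qs
                  f tt) (at-nop a₁)
          in _ , _ , ex₁ ⨟ loop-stop o (trans (scanned-at (register x) a₁)
                  (trans v (cong (0 <ᵇ_) (trans (sym (value-at x<K h)) e)))) ⨟ ex₂ ,
             unfocus _ h (at-resp (λ y → ≡⇒≈ (cong (λ bs → update _≟ⁿ_ (layout _ _) _ (counter bs) y)
                 (sym eq))) a₂) , λ _ → ≤-refl
        run-exec {β = β} (while-go {x} e r r′) (x<K , b) d h
          with enter-exec noIns (λ _ → ⊤) m {w} (β (register x)) (short h _) w≤m tt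
        ... | ps , qs , en , eq , f , v =
          let _ , ex₁ , a₁ = onCounter-exec (register x) (short-layout d) en (focus _ h)
              o = at-ok (update-all _≟ⁿ_ (λ _ u → head u < m) {layout β _} (counterAt-head noIns (λ _ → ⊤) m
                  ps qs f) (λ y _ → short-layout d y)) a₁
              _ , ex₂ , a₂ = onCounter-exec (register x) (short-layout d) (home-exec noIns (λ _ → ⊤) m ps qs
                  f tt) (at-nop a₁)
              h₂ = unfocus _ h (at-resp (λ y → ≡⇒≈ (cong (λ bs → update _≟ⁿ_ (layout _ _) _ (counter bs) y)
                  (sym eq))) a₂)
              _ , _ , ex₃ , h₃ , l₃ = run-exec r b d h₂
              _ , _ , ex₄ , h₄ , l₄ = run-exec r′ (x<K , b) d h₃
          in _ , _ , continue-loop ex₁ o (trans (scanned-at (register x) a₁)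
                  (trans v (cong (0 <ᵇ_) (trans (sym (value-at x<K h)) e)))) ex₂ ex₃ ex₄ ,
             h₄ , λ j → ≤-trans (l₃ j) (l₄ j)
          where
          -- The execution of the remaining rounds starts with an `enter` of its own; this one
          -- becomes the end of the body of the round just completed.
          continue-loop : ∀ {E H C k t t₁ t₂ t₃ t₄} → Exec semantics ok E t t₁ → ok t₁ → cond k t₁ ≡ true →
            Exec semantics ok H (run nop t₁) t₂ → Exec semantics ok C t₂ t₃ →
            Exec semantics ok (E ⨟ loop k (H ⨟ C ⨟ E) ⨟ H) t₃ t₄ →
            Exec semantics ok (E ⨟ loop k (H ⨟ C ⨟ E) ⨟ H) t t₄
          continue-loop ex₁ o q ex₂ ex₃ (e ⨟ l ⨟ h) = ex₁ ⨟ loop-go o q (ex₂ ⨟ ex₃ ⨟ e) l ⨟ h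
        run-exec {ν} {ω} {β = β} (at {x} {a} {ρ = ρ} n r) (x<K , b) d h =
          let j = register x
              bs = β j
              ω′ = update _≟ᵃ_ ω a bs
              _ , ex₁ , a₁ = onAddress-exec j a (short-layout d) (put-exec w≤m bs (short h j))
                (at-resp (λ y → ≈-sym (≈-trans (set-both β ω j a [] y) (≡⇒≈ (unset β (free d a n) y))))
                    (placed h))
              d′ = addressed
                (λ a′ → update-rel a′ (λ v cs → fromMaybe 0 v ≡ val cs) (value-at x<K h) (addresses d a′))
                (λ a′ → update-rel a′ (λ v cs → v ≡ nothing → cs ≡ []) (λ ()) (free d a′))
                (update-all _≟ᵃ_ (λ _ cs → length cs ≤ w) (short h j) (λ a′ _ → shortᵃ d a′))
              h₁ = holds (at-resp (set-both β ω j a bs) a₁) (values h) (short h)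
              _ , β′ , ex₂ , h₂ , l = run-exec r b d′ h₁
              _ , cl , cleared = clear-exec w≤m (β′ j) bs (short h₂ j) (l j)
              _ , ex₃ , a₃ = onAddress-exec j a (short-layout d) cl
                (at-resp (λ y → ≈-sym (set-both β′ ω j a bs y)) (placed h₂))
          in _ , β′ , ex₁ ⨟ ex₂ ⨟ ex₃ ,
             holds (at-resp (λ y → ≈-trans (erase (counter (β′ j)) (update-rel-≈ (layout β′ ω) {inj₂ a}
                 cleared) (inj₁ j) y)
               (≈-trans (set-both β′ ω j a [] y) (≡⇒≈ (unset β′ (free d a n) y)))) a₃) (values h₂)
                   (short h₂) , l
          where
          unset : ∀ β → ω a ≡ [] → ∀ y → layout β (update _≟ᵃ_ ω a []) y ≡ layout β ω y
          unset β e (inj₁ _)  = refl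
          unset β e (inj₂ a′) with a′ ≟ᵃ a
          ... | yes refl = cong addressTape (sym e)
          ... | no _     = refl
          update-rel : ∀ a′ (P : Maybe ℕ → List Bool → Set) {v cs} → P v cs → P (ν a′) (ω a′) →
                       P (update _≟ᵃ_ ν a v a′) (update _≟ᵃ_ ω a cs a′)
          update-rel a′ P p q with a′ ≟ᵃ a
          ... | yes _ = p
          ... | no _  = q
          update-rel-≈ : ∀ U {x u u′} → u ≈ u′ → ∀ y → update _≟ⁿ_ U x u y ≈ update _≟ⁿ_ U x u′ y
          update-rel-≈ U {x} e y with y ≟ⁿ x
          ... | yes _ = e
          ... | no _  = ≈-refl
          erase : ∀ {U U′} v → (∀ y → U y ≈ U′ y) → ∀ x y → update _≟ⁿ_ U x v y ≈ update _≟ⁿ_ U′ x v y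
          erase v e x = update-cong x v λ y _ → e y
        run-exec {ν} (ans-yes {a} {v} e r) b d h =
          let _ , _ , ex , h′ , l = run-exec r b d (hold-nop h)
          in _ , _ , test-yes (hold-ok d h)
                  (trans (cond-ans a v _) (trans (cong (λ vs → askᴵ a vs ≡ᵇ v) (hold-numbers d h (inj₁ a)))
                  e)) ex , h′ , l
        run-exec (ans-no {a} {v} e) b d h =
          _ , _ , test-no (hold-ok d h) (trans (cond-ans a v _)
              (trans (cong (λ vs → askᴵ a vs ≡ᵇ v) (hold-numbers d h (inj₁ a))) e))
            (prim (hold-ok d (hold-nop h))) , hold-nop (hold-nop h) , λ _ → ≤-refl
        run-exec {ν} {ω} (moveRo {y} {d = dir} e e′) b d h =
          _ , _ , prim (hold-ok d h) ,
          holds (at-ro y dir (placed h) (trans e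
              (cong (λ vs → head (moveReadOnly dir (tape (holding (readᴵ y vs)) _)))
            (tabulate-cong λ i → trans (addresses d (inj₂ y , i))
                (sym (number-addressTape (ω (inj₂ y , i))))))) e′) (values h) (short h) , λ _ → ≤-refl
        run-exec (ro-yes {y} {f} e r) b d h =
          let _ , _ , ex , h′ , l = run-exec r b d (hold-nop h)
          in _ , _ , test-yes (hold-ok d h) (trans (hold-ros d h y f) e) ex , h′ , l
        run-exec (ro-no {y} {f} e) b d h =
          _ , _ , test-no (hold-ok d h) (trans (hold-ros d h y f) e) (prim (hold-ok d (hold-nop h))) ,
          hold-nop (hold-nop h) , λ _ → ≤-refl
        run-exec (ro-stop {y} {f} e) b d h =
          _ , _ , loop-stop (hold-ok d h) (trans (hold-ros d h y f) e) , hold-nop h , λ _ → ≤-refl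
        run-exec (ro-go {y} {f} e r r′) b d h =
          let _ , _ , ex , h′ , l = run-exec r b d (hold-nop h)
              _ , _ , ex′ , h″ , l′ = run-exec r′ b d h′
          in _ , _ , loop-go (hold-ok d h) (trans (hold-ros d h y f) e) ex ex′ , h″ , λ j → ≤-trans (l j)
                  (l′ j)

-- Terms denoting functions on ℕ.  In loop c is b o, the numbers given by is
-- are transformed simultaneously by b as often as c says; o selects the result.

iterate : ∀ {A : Set} → (A → A) → A → ℕ → A
iterate f x zero    = x
iterate f x (suc n) = f (iterate f x n)

module Terms (Sg : Signature) where
  open Signature Sg
  open Commands Sg

  data Tm (V : Set) : Set where
    var  : V → Tm V
    zer  : Tm V
    suc  : Tm V → Tm V
    loop : ∀ {m} → Tm V → (Fin m → Tm V) → (Fin m → Tm (Fin m)) → Fin m → Tm V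
    op   : ∀ o → (Fin (arity o) → Tm V) → Tm V

  module _ (I : Interpretation Sg) where
    open Interpretation I

    ⟦_⟧ : ∀ {V} → Tm V → (V → ℕ) → ℕ
    ⟦ var v ⟧ ρ         = ρ v
    ⟦ zer ⟧ ρ           = 0
    ⟦ suc e ⟧ ρ         = suc (⟦ e ⟧ ρ)
    ⟦ loop c is b o ⟧ ρ = iterate (λ s i → ⟦ b i ⟧ s) (λ i → ⟦ is i ⟧ ρ) (⟦ c ⟧ ρ) o
    ⟦ op o es ⟧ ρ       = ⟦ o ⟧ᵒ (Vec.tabulate λ i → ⟦ es i ⟧ ρ)

    states : ∀ {V m} → Tm V → (Fin m → Tm V) → (Fin m → Tm (Fin m)) → (V → ℕ) → ℕ → Fin m → ℕ
    states c is b ρ = iterate (λ s i → ⟦ b i ⟧ s) (λ i → ⟦ is i ⟧ ρ)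

    Safe : ∀ {V} → ℕ → Tm V → (V → ℕ) → Set
    Safe B (var v)         ρ = ρ v ≤ B
    Safe B zer             ρ = ⊤
    Safe B (suc e)         ρ = Safe B e ρ × suc (⟦ e ⟧ ρ) ≤ B
    Safe B (loop c is b o) ρ = Safe B c ρ × (∀ i → Safe B (is i) ρ) ×
                               (∀ k → k < ⟦ c ⟧ ρ → ∀ i → Safe B (b i) (states c is b ρ k))
    Safe B (op o es)       ρ = (∀ i → Safe B (es i) ρ) × ⟦ op o es ⟧ ρ ≤ B

    safe-value : ∀ {V B} (e : Tm V) {ρ} → Safe B e ρ → ⟦ e ⟧ ρ ≤ B
    states-≤ : ∀ {V m B} (c : Tm V) (is : Fin m → Tm V) b {ρ} → (∀ i → Safe B (is i) ρ) →
               (∀ k → k < ⟦ c ⟧ ρ → ∀ i → Safe B (b i) (states c is b ρ k)) →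
               ∀ k → k ≤ ⟦ c ⟧ ρ → ∀ i → states c is b ρ k i ≤ B

    safe-value (var v)         s           = s
    safe-value zer             s           = z≤n
    safe-value (suc e)         (_ , s)     = s
    safe-value (loop c is b o) (_ , s , t) = states-≤ c is b s t _ ≤-refl o
    safe-value (op o es)       (_ , s)     = s

    states-≤ c is b s t zero    l i = safe-value (is i) (s i)
    states-≤ c is b s t (suc k) l i = safe-value (b i) (t k l i)

  -- Translation to commands: the result is put into register d, and
  -- registers below d are left unchanged.

  clr : ℕ → Cmd
  clr x = while x (dec x)

  drain : ℕ → ℕ → Cmd
  drain x y = while x (dec x ⨾ inc y)

  copy : ℕ → ℕ → ℕ → Cmd
  copy x d z = clr d ⨾ clr z ⨾ while x (dec x ⨾ inc d ⨾ inc z) ⨾ drain z x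

  copies : ℕ → ℕ → ℕ → ℕ → Cmd
  copies zero    src dst z = skip
  copies (suc m) src dst z = copy src dst z ⨾ copies m (suc src) (suc dst) z

  many : ∀ m → (Fin m → ℕ → Cmd) → ℕ → Cmd
  many zero    f d = skip
  many (suc m) f d = f zero d ⨾ many m (f ∘ suc) (suc d)

  ats : ∀ n → (Fin n → ℕ) → (Fin n → Address) → Cmd → Cmd
  ats zero    x a c = c
  ats (suc n) x a c = at (x zero) (a zero) (ats n (x ∘ suc) (a ∘ suc) c)

  double : ℕ → ℕ → Cmd
  double d z = while d (dec d ⨾ inc z ⨾ inc z) ⨾ drain z d

  -- The value of a string of bits is not smaller than its length minus one,
  -- which bounds the number of moves needed to return to the leftmost cell.

  inquire : Op → ℕ → ℕ → Cmd
  inquire (inj₁ a) d z = ifAns a 1 (inc d) ⨾ ifAns a 2 (inc d ⨾ inc d)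
  inquire (inj₂ r) d z =
    whileRo r isBit (double d z ⨾ ifRo r is1 (inc d) ⨾ moveRo r right) ⨾
    moveRo r left ⨾ while d (dec d ⨾ inc z ⨾ moveRo r left) ⨾ drain z d

  compile : ∀ {V} → Tm V → (V → ℕ) → ℕ → Cmd
  compile (var v) loc d = copy (loc v) d (suc d)
  compile zer     loc d = clr d
  compile (suc e) loc d = compile e loc d ⨾ inc d
  -- Register `suc d` counts down and the `m` values start at `2 + d`. Since the update is
  -- simultaneous, the new values are computed in a separate block from `2 + d + m` on, while the
  -- old ones remain readable, and are copied down afterwards.
  compile (loop {m} c is b o) loc d =
    compile c loc (suc d) ⨾
    many m (λ i → compile (is i) loc) (2 + d) ⨾
    while (suc d) (dec (suc d) ⨾
                   many m (λ i → compile (b i) (λ j → 2 + d + toℕ j)) (2 + d + m) ⨾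
                   copies m (2 + d + m) (2 + d) (2 + d + m + m)) ⨾
    copy (2 + d + toℕ o) d (2 + d + m)
  compile (op o es) loc d =
    many (arity o) (λ i → compile (es i) loc) (2 + d) ⨾ clr d ⨾ clr (suc d) ⨾
    ats (arity o) (λ i → 2 + d + toℕ i) (λ i → o , i) (inquire o d (suc d))

  module Correctness (I : Interpretation Sg) (B : ℕ)
      (ask≤2   : ∀ a vs → Interpretation.askᴵ I a vs ≤ 2)
      (compact : ∀ r vs → length (Interpretation.readᴵ I r vs) ≤ suc (horner (Interpretation.readᴵ I r vs)))
          where
    open Interpretation I

    Agree : ℕ → Env → Env → Set
    Agree d ρ ρ′ = ∀ i → i < d → ρ′ i ≡ ρ i

    private
      set : ∀ ρ x v → (ρ [ x ≔ v ]) x ≡ v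
      set = update-same _≟_

      unset : ∀ ρ {x} v {i} → i ≢ x → (ρ [ x ≔ v ]) i ≡ ρ i
      unset = update-other _≟_

    module _ {ν : Addressing} {η : Read → ℕ} where
      private
        infix 4 _⊢_⇒_
        _⊢_⇒_ : Cmd → Env → Env → Set
        c ⊢ ρ ⇒ ρ′ = Run I B ν c (ρ , η) (ρ′ , η)

      clr-run : ∀ x ρ → ∃ λ ρ′ → clr x ⊢ ρ ⇒ ρ′ × ρ′ x ≡ 0 × (∀ i → i ≢ x → ρ′ i ≡ ρ i)
      clr-run x ρ = go (ρ x) ρ refl
        where
        go : ∀ v ρ → ρ x ≡ v → ∃ λ ρ′ → clr x ⊢ ρ ⇒ ρ′ × ρ′ x ≡ 0 × (∀ i → i ≢ x → ρ′ i ≡ ρ i)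
        go zero    ρ e = ρ , while-stop e , e , λ _ _ → refl
        go (suc v) ρ e =
          let ρ′ , r , z , o = go v (ρ [ x ≔ v ]) (set ρ x v)
          in ρ′ , while-go e (dec e) r , z , λ i n → trans (o i n) (unset ρ v n)

      drain-run : ∀ x y ρ → x ≢ y → ρ x + ρ y ≤ B →
        ∃ λ ρ′ → drain x y ⊢ ρ ⇒ ρ′ × ρ′ x ≡ 0 × ρ′ y ≡ ρ x + ρ y × (∀ i → i ≢ x → i ≢ y → ρ′ i ≡ ρ i)
      drain-run x y ρ x≢y l = go (ρ x) ρ refl l
        where
        go : ∀ v ρ → ρ x ≡ v → v + ρ y ≤ B →
             ∃ λ ρ′ → drain x y ⊢ ρ ⇒ ρ′ × ρ′ x ≡ 0 × ρ′ y ≡ v + ρ y × (∀ i → i ≢ x → i ≢ y → ρ′ i ≡ ρ i)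
        go zero    ρ e l = ρ , while-stop e , e , refl , λ _ _ _ → refl
        go (suc v) ρ e l =
          let ρ₁ = ρ [ x ≔ v ]
              e₁ = unset ρ v (x≢y ∘ sym)
              ρ₂ = ρ₁ [ y ≔ suc (ρ₁ y) ]
              e₂ = trans (set ρ₁ y (suc (ρ₁ y))) (cong suc e₁)
              e₃ = trans (cong (v +_) e₂) (+-suc v (ρ y))
              ρ′ , r , z , f , o = go v ρ₂ (trans (unset ρ₁ _ x≢y) (set ρ x v)) (subst (_≤ B) (sym e₃) l)
          in ρ′ , while-go e (dec e ⨾ inc (≤-trans (s≤s (≤-trans (≤-reflexive e₁) (m≤n+m (ρ y) v))) l)) r ,
             z , trans f e₃ , λ i n m → trans (o i n m) (trans (unset ρ₁ _ m) (unset ρ v n))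

      copy-run : ∀ x d z ρ → x ≢ d → x ≢ z → d ≢ z → ρ x ≤ B →
        ∃ λ ρ′ → copy x d z ⊢ ρ ⇒ ρ′ × ρ′ d ≡ ρ x × (∀ i → i ≢ d → i ≢ z → ρ′ i ≡ ρ i)
      copy-run x d z ρ x≢d x≢z d≢z l =
        let ρ₁ , r₁ , zero₁ , o₁ = clr-run d ρ
            ρ₂ , r₂ , zero₂ , o₂ = clr-run z ρ₁
            x₂ = trans (o₂ x x≢z) (o₁ x x≢d)
            ρ₃ , r₃ , x₃ , d₃ , z₃ , o₃ = go (ρ x) ρ₂ x₂ (trans (o₂ d d≢z) zero₁) zero₂ l
            ρ₄ , r₄ , z₄ , x₄ , o₄ = drain-run z x ρ₃ (x≢z ∘ sym)
              (≤-trans (≤-reflexive (trans (cong₂ _+_ z₃ x₃) (+-identityʳ (ρ x)))) l)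
            x₅ = trans x₄ (trans (cong₂ _+_ z₃ x₃) (+-identityʳ (ρ x)))
        in ρ₄ , r₁ ⨾ r₂ ⨾ r₃ ⨾ r₄ , trans (o₄ d d≢z (x≢d ∘ sym)) d₃ ,
           λ i n m → case i ≟ x of λ
             { (yes refl) → x₅
             ; (no i≢x)   → trans (o₄ i m i≢x) (trans (o₃ i i≢x n m) (trans (o₂ i m) (o₁ i n))) }
        where
        go′ : ∀ v ρ {a b} → ρ x ≡ v → ρ d ≡ a → ρ z ≡ b → v + a ≤ B → v + b ≤ B →
             ∃ λ ρ′ → while x (dec x ⨾ inc d ⨾ inc z) ⊢ ρ ⇒ ρ′ × ρ′ x ≡ 0 × ρ′ d ≡ v + a × ρ′ z ≡ v + b ×
               (∀ i → i ≢ x → i ≢ d → i ≢ z → ρ′ i ≡ ρ i)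
        go′ zero    ρ e p q l m = ρ , while-stop e , e , p , q , λ _ _ _ _ → refl
        go′ (suc v) ρ {a} {b} e p q l m =
          let ρ₁ = ρ [ x ≔ v ]
              d₁ = trans (unset ρ v (x≢d ∘ sym)) p
              ρ₂ = ρ₁ [ d ≔ suc (ρ₁ d) ]
              z₂ = trans (unset ρ₁ (suc (ρ₁ d)) (d≢z ∘ sym)) (trans (unset ρ v (x≢z ∘ sym)) q)
              ρ₃ = ρ₂ [ z ≔ suc (ρ₂ z) ]
              ρ′ , r , x′ , d′ , z′ , o = go′ v ρ₃
                (trans (unset ρ₂ _ x≢z) (trans (unset ρ₁ _ x≢d) (set ρ x v)))
                (trans (unset ρ₂ _ d≢z) (trans (set ρ₁ d _) (cong suc d₁)))
                (trans (set ρ₂ z _) (cong suc z₂))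
                (subst (_≤ B) (sym (+-suc v a)) l) (subst (_≤ B) (sym (+-suc v b)) m)
          in ρ′ , while-go e (dec e ⨾ inc (≤-trans (s≤s (≤-trans (≤-reflexive d₁) (m≤n+m a v))) l)
                                    ⨾ inc (≤-trans (s≤s (≤-trans (≤-reflexive z₂) (m≤n+m b v))) m)) r ,
             x′ , trans d′ (+-suc v a) , trans z′ (+-suc v b) ,
             λ i n₁ n₂ n₃ → trans (o i n₁ n₂ n₃)
                 (trans (unset ρ₂ _ n₃) (trans (unset ρ₁ _ n₂) (unset ρ v n₁)))
        go : ∀ v ρ → ρ x ≡ v → ρ d ≡ 0 → ρ z ≡ 0 → v ≤ B →
             ∃ λ ρ′ → while x (dec x ⨾ inc d ⨾ inc z) ⊢ ρ ⇒ ρ′ × ρ′ x ≡ 0 × ρ′ d ≡ v × ρ′ z ≡ v ×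
               (∀ i → i ≢ x → i ≢ d → i ≢ z → ρ′ i ≡ ρ i)
        go v ρ e p q l =
          let ρ′ , r , x′ , d′ , z′ , o = go′ v ρ e p q l′ l′
          in ρ′ , r , x′ , trans d′ (+-identityʳ v) , trans z′ (+-identityʳ v) , o
          where l′ = subst (_≤ B) (sym (+-identityʳ v)) l

      -- Copying proceeds upwards. With the destination below the source and the scratch register
      -- above the block, no source is overwritten before its turn, even if the blocks overlap.
      copies-run : ∀ m src dst z ρ → dst < src → src + m ≤ z → (∀ (i : Fin m) → ρ (src + toℕ i) ≤ B) →
        ∃ λ ρ′ → copies m src dst z ⊢ ρ ⇒ ρ′ × (∀ (i : Fin m) → ρ′ (dst + toℕ i) ≡ ρ (src + toℕ i)) × Agree
            dst ρ ρ′
      copies-run zero    src dst z ρ l k s = ρ , skip , (λ ()) , λ _ _ → refl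
      copies-run (suc m) src dst z ρ l k s =
        let src≡ = +-identityʳ src
            src<z = ≤-trans (s≤s (m≤m+n src m)) (subst (_≤ z) (+-suc src m) k)
            ρ₁ , r₁ , d₁ , o₁ = copy-run src dst z ρ (>⇒≢ l) (<⇒≢ src<z) (<⇒≢ (<-trans l src<z))
                (subst (λ x → ρ x ≤ B) src≡ (s zero))
            moved = λ (i : Fin m) → trans (o₁ (suc src + toℕ i)
                      (>⇒≢ (≤-trans l (≤-trans (n≤1+n src) (m≤m+n (suc src) (toℕ i)))))
                      (<⇒≢ (≤-trans (subst (_< src + suc m) (+-suc src (toℕ i))
                          (+-monoʳ-< src (s≤s (toℕ<n i)))) k)))
                      (cong ρ (sym (+-suc src (toℕ i))))
            ρ₂ , r₂ , d₂ , o₂ = copies-run m (suc src) (suc dst) z ρ₁ (s≤s l) (subst (_≤ z) (+-suc src m) k)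
              (λ i → subst (_≤ B) (sym (moved i)) (s (suc i)))
        in ρ₂ , r₁ ⨾ r₂ ,
           (λ { zero    → trans (cong ρ₂ (+-identityʳ dst))
               (trans (o₂ dst ≤-refl) (trans d₁ (cong ρ (sym src≡))))
              ; (suc i) → trans (cong ρ₂ (+-suc dst (toℕ i))) (trans (d₂ i) (moved i)) }) ,
           λ i i<dst → trans (o₂ i (m≤n⇒m≤1+n i<dst))
             (o₁ i (<⇒≢ i<dst) (<⇒≢ (<-trans i<dst (<-trans l src<z))))

      Result : Cmd → Env → ℕ → ℕ → Set
      Result c ρ d v = ∃ λ ρ′ → c ⊢ ρ ⇒ ρ′ × ρ′ d ≡ v × Agree d ρ ρ′

      many-run : ∀ m (f : Fin m → ℕ → Cmd) (vs : Fin m → ℕ) d ρ →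
        (∀ i d′ ρ′ → d ≤ d′ → Agree d ρ ρ′ → Result (f i d′) ρ′ d′ (vs i)) →
        ∃ λ ρ′ → many m f d ⊢ ρ ⇒ ρ′ × (∀ i → ρ′ (d + toℕ i) ≡ vs i) × Agree d ρ ρ′
      many-run zero    f vs d ρ h = ρ , skip , (λ ()) , λ _ _ → refl
      many-run (suc m) f vs d ρ h =
        let ρ₁ , r₁ , v₁ , a₁ = h zero d ρ ≤-refl λ _ _ → refl
            ρ₂ , r₂ , v₂ , a₂ = many-run m (f ∘ suc) (vs ∘ suc) (suc d) ρ₁
              λ i d′ ρ′ l a → h (suc i) d′ ρ′ (≤-trans (n≤1+n d) l) λ j j<d → trans (a j (m≤n⇒m≤1+n j<d))
                  (a₁ j j<d)
        in ρ₂ , r₁ ⨾ r₂ ,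
           (λ { zero    → trans (cong ρ₂ (+-identityʳ d)) (trans (a₂ d ≤-refl) v₁)
              ; (suc i) → trans (cong ρ₂ (+-suc d (toℕ i))) (v₂ i) }) ,
           λ j j<d → trans (a₂ j (m≤n⇒m≤1+n j<d)) (a₁ j j<d)

      double-run : ∀ d z ρ → d ≢ z → ρ z ≡ 0 → 2 * ρ d ≤ B →
        ∃ λ ρ′ → double d z ⊢ ρ ⇒ ρ′ × ρ′ d ≡ 2 * ρ d × ρ′ z ≡ 0 × (∀ i → i ≢ d → i ≢ z → ρ′ i ≡ ρ i)
      double-run d z ρ d≢z z≡0 l =
        let ρ₁ , r₁ , d₁ , z₁ , o₁ = go (ρ d) ρ refl z≡0 (subst (_≤ B) (sym (+-identityʳ _)) l)
            e = trans (cong₂ _+_ (trans z₁ (+-identityʳ _)) d₁) (+-identityʳ _)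
            ρ₂ , r₂ , z₂ , d₂ , o₂ = drain-run z d ρ₁ (d≢z ∘ sym) (≤-trans (≤-reflexive e) l)
        in ρ₂ , r₁ ⨾ r₂ , trans d₂ e , z₂ , λ i n m → trans (o₂ i m n) (o₁ i n m)
        where
        go : ∀ v ρ {a} → ρ d ≡ v → ρ z ≡ a → 2 * v + a ≤ B →
             ∃ λ ρ′ → while d (dec d ⨾ inc z ⨾ inc z) ⊢ ρ ⇒ ρ′ × ρ′ d ≡ 0 × ρ′ z ≡ 2 * v + a ×
               (∀ i → i ≢ d → i ≢ z → ρ′ i ≡ ρ i)
        go zero    ρ e f l = ρ , while-stop e , e , f , λ _ _ _ → refl
        go (suc v) ρ {a} e f l =
          let ρ₁ = ρ [ d ≔ v ]
              z₁ = trans (unset ρ v (d≢z ∘ sym)) f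
              ρ₂ = ρ₁ [ z ≔ suc (ρ₁ z) ]
              z₂ = trans (set ρ₁ z (suc (ρ₁ z))) (cong suc z₁)
              ρ₃ = ρ₂ [ z ≔ suc (ρ₂ z) ]
              e₃ : 2 * suc v + a ≡ 2 * v + (2 + a)
              e₃ = trans (cong (_+ a) (trans (*-suc 2 v) (+-comm 2 (2 * v)))) (+-assoc (2 * v) 2 a)
              l₃ = subst (_≤ B) e₃ l
              ρ′ , r , d′ , z′ , o = go v ρ₃ (trans (unset ρ₂ _ d≢z) (trans (unset ρ₁ _ d≢z) (set ρ d v)))
                (trans (set ρ₂ z _) (cong suc z₂)) l₃
              b = ≤-trans (m≤n+m (2 + a) (2 * v)) l₃
          in ρ′ , while-go e (dec e ⨾ inc (≤-trans (s≤s (≤-reflexive z₁)) (≤-trans (n≤1+n _) b))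
                                    ⨾ inc (≤-trans (s≤s (≤-reflexive z₂)) b)) r ,
             d′ , trans z′ (sym e₃) ,
             λ i n m → trans (o i n m) (trans (unset ρ₂ _ m) (trans (unset ρ₁ _ m) (unset ρ v n)))

    readNumber-≥ : ∀ a bs → a ≤ readNumber a (holding bs)
    readNumber-≥ a []       = ≤-refl
    readNumber-≥ a (b ∷ bs) = ≤-trans (≤-trans (m≤m+n a (a + 0)) (m≤m+n (2 * a) _)) (readNumber-≥ _ bs)

    rest : Read → ℕ
    rest _ = 0

    -- The left end of a read-only tape cannot be recognised, as nothing marks it. Rewinding counts
    -- instead: the number just read is at least the distance left to go, and further left moves do
    -- no harm. All read-only heads are thus at rest again between inquiries.
    inquire-run : ∀ o {ν} d z ρ → d ≢ z → ρ d ≡ 0 → ρ z ≡ 0 → ⟦ o ⟧ᵒ (addressed-numbers ν o) ≤ B →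
      ∃ λ ρ′ → Run I B ν (inquire o d z) (ρ , rest) (ρ′ , rest) ×
        ρ′ d ≡ ⟦ o ⟧ᵒ (addressed-numbers ν o) × (∀ i → i ≢ d → i ≢ z → ρ′ i ≡ ρ i)
    inquire-run (inj₁ a) {ν} d z ρ d≢z d≡0 z≡0 l with askᴵ a (addressed-numbers ν (inj₁ a)) in eq | ask≤2 a
        (addressed-numbers ν (inj₁ a))
    ... | 0 | _ = ρ , ans-no (cong (_≡ᵇ 1) eq) ⨾ ans-no (cong (_≡ᵇ 2) eq) , d≡0 , λ _ _ _ → refl
    ... | 1 | _ = _ , ans-yes (cong (_≡ᵇ 1) eq) (inc (≤-trans (s≤s (≤-reflexive d≡0)) l)) ⨾ ans-no
        (cong (_≡ᵇ 2) eq) ,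
      trans (set ρ d _) (cong suc d≡0) , λ i n _ → unset ρ _ n
    ... | 2 | _ = _ , ans-no (cong (_≡ᵇ 1) eq) ⨾ ans-yes (cong (_≡ᵇ 2) eq)
        (inc (≤-trans (s≤s (≤-trans (≤-reflexive d≡0) z≤n)) l) ⨾
         inc (≤-trans (s≤s (≤-reflexive (trans (set ρ d _) (cong suc d≡0)))) l)) ,
      trans (set (ρ [ d ≔ suc (ρ d) ]) d _) (cong suc (trans (set ρ d _) (cong suc d≡0))) ,
      λ i n _ → trans (unset (ρ [ d ≔ suc (ρ d) ]) _ n) (unset ρ _ n)
    ... | suc (suc (suc _)) | s≤s (s≤s ())
    inquire-run (inj₂ r) {ν} d z ρ d≢z d≡0 z≡0 l =
      let ρ₁ , r₁ , d₁ , z₁ , o₁ = read [] bs ρ refl d≡0 z≡0 l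
          ρ₂ , r₂ , d₂ , z₂ , o₂ = rewind v ρ₁ (pred (length bs)) d₁ z₁
              (≤-trans (≤-reflexive (+-identityʳ _)) l)
          e₃ = trans (cong₂ _+_ z₂ d₂) (trans (+-identityʳ _) (+-identityʳ _))
          ρ₃ , r₃ , _ , d₃ , o₃ = drain-run z d ρ₂ (d≢z ∘ sym) (≤-trans (≤-reflexive e₃) l)
          back = m≤n⇒m∸n≡0 (pred-mono-≤ (compact r (addressed-numbers ν (inj₂ r))))
      in ρ₃ , r₁ ⨾ move-run {left} {length bs} refl ⨾
         arrive back r₂ ⨾ r₃ ,
         trans d₃ e₃ , λ i n m → trans (o₃ i m n) (trans (o₂ i n m) (o₁ i n m))
      where
      bs = readᴵ r (addressed-numbers ν (inj₂ r))
      v = horner bs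
      C = content-of I ν r

      -- For head position 0 this is `rest` itself, not an update that merely agrees with it at
      -- every argument: the final state has to be the pair with `rest`, and pointwise equal
      -- functions are not identified.
      position : ℕ → Read → ℕ
      position zero    = rest
      position (suc h) = update _≟ᴿ_ rest r (suc h)

      position-at : ∀ h → position h r ≡ h
      position-at zero    = refl
      position-at (suc h) = update-same _≟ᴿ_ rest r (suc h)

      position-off : ∀ h s → s ≢ r → position h s ≡ 0
      position-off zero    s s≢r = refl
      position-off (suc h) s s≢r = update-other _≟ᴿ_ rest (suc h) s≢r

      move-run : ∀ {d h h′ ρ} → h′ ≡ head (moveReadOnly d (tape C h)) → Run I B ν (moveRo r d)
          (ρ , position h) (ρ , position h′)
      move-run {d} {h} {h′} e = moveRo
          (trans (position-at h′) (trans e (cong (λ k → head (moveReadOnly d (tape C k)))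
          (sym (position-at h)))))
        λ s s≢r → trans (position-off h′ s s≢r) (sym (position-off h s s≢r))

      arrive : ∀ {c s ρ h h′} → h ≡ h′ → Run I B ν c s (ρ , position h) → Run I B ν c s (ρ , position h′)
      arrive refl r = r

      right-of : ∀ {c h b} → cell c h ≡ bit b → suc h ≡ head (moveReadOnly right (tape c h))
      right-of {c} {h} e with cell c h
      right-of refl | bit _ = refl

      read : ∀ L bs ρ {a} → C ≡ L ʳ++ holding bs → ρ d ≡ a → ρ z ≡ 0 → readNumber a (holding bs) ≤ B →
             ∃ λ ρ′ → Run I B ν (whileRo r isBit (double d z ⨾ ifRo r is1 (inc d) ⨾ moveRo r right))
                        (ρ , position (length L)) (ρ′ , position (length L + length bs)) ×
               ρ′ d ≡ readNumber a (holding bs) × ρ′ z ≡ 0 × (∀ i → i ≢ d → i ≢ z → ρ′ i ≡ ρ i)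
      read L [] ρ e f g l =
        ρ , arrive (sym (+-identityʳ (length L)))
              (ro-stop (cong isBit (trans (cong₂ cell e (position-at (length L))) (scan-zip L [])))) ,
        f , g , λ _ _ _ → refl
      read L (b ∷ bs) ρ {a} e f g l =
        let 2a≤B = ≤-trans (≤-trans (m≤m+n (2 * a) _) (readNumber-≥ _ bs)) l
            ρ₁ , r₁ , d₁ , z₁ , o₁ = double-run d z ρ d≢z g (subst (λ x → 2 * x ≤ B) (sym f) 2a≤B)
            ρ₂ , r₂ , d₂ , o₂ = add b ρ₁ scanned-bit (trans d₁ (cong (2 *_) f)) (≤-trans (readNumber-≥ _ bs)
                l)
            ρ₃ , r₃ , d₃ , z₃ , o₃ = read (bit b ∷ L) bs ρ₂ e d₂ (trans (o₂ z (d≢z ∘ sym)) z₁) l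
        in ρ₃ , ro-go (cong isBit (trans (cong (cell C) (position-at (length L))) scanned-bit))
                  (r₁ ⨾ r₂ ⨾ move-run {right} {length L} (right-of {C} scanned-bit))
                  (arrive (sym (+-suc (length L) (length bs))) r₃) ,
           d₃ , z₃ , λ i n m → trans (o₃ i n m) (trans (o₂ i n) (o₁ i n m))
        where
        scanned-bit : cell C (length L) ≡ bit b
        scanned-bit = trans (cong (λ c → cell c (length L)) e) (scan-zip L (bit b ∷ holding bs))
        add : ∀ b ρ {h x} → cell C h ≡ bit b → ρ d ≡ x → x + (if b then 1 else 0) ≤ B →
              ∃ λ ρ′ → Run I B ν (ifRo r is1 (inc d)) (ρ , position h) (ρ′ , position h) ×
                ρ′ d ≡ x + (if b then 1 else 0) × (∀ i → i ≢ d → ρ′ i ≡ ρ i)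
        add true  ρ {h} {x} c f l = _ , ro-yes (cong is1 (trans (cong (cell C) (position-at h)) c))
          (inc (subst (λ y → suc y ≤ B) (sym f) (subst (_≤ B) (+-comm x 1) l))) ,
          trans (set ρ d _) (trans (cong suc f) (+-comm 1 x)) , λ i n → unset ρ _ n
        add false ρ {h} {x} c f l = _ , ro-no (cong is1 (trans (cong (cell C) (position-at h)) c)) ,
          trans f (sym (+-identityʳ x)) , λ _ _ → refl

      rewind : ∀ v ρ h {a} → ρ d ≡ v → ρ z ≡ a → v + a ≤ B →
               ∃ λ ρ′ → Run I B ν (while d (dec d ⨾ inc z ⨾ moveRo r left)) (ρ , position h)
                   (ρ′ , position (h ∸ v)) ×
                 ρ′ d ≡ 0 × ρ′ z ≡ v + a × (∀ i → i ≢ d → i ≢ z → ρ′ i ≡ ρ i)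
      rewind zero    ρ h e f l = ρ , while-stop e , e , f , λ _ _ _ → refl
      rewind (suc v) ρ h {a} e f l =
        let ρ₁ = ρ [ d ≔ v ]
            z₁ = trans (unset ρ v (d≢z ∘ sym)) f
            ρ₂ = ρ₁ [ z ≔ suc (ρ₁ z) ]
            ρ₃ , r₃ , d₃ , z₃ , o₃ = rewind v ρ₂ (pred h) (trans (unset ρ₁ _ d≢z) (set ρ d v))
              (trans (set ρ₁ z _) (cong suc z₁)) (subst (_≤ B) (sym (+-suc v a)) l)
        in ρ₃ , while-go e (dec e ⨾ inc (≤-trans (s≤s (≤-trans (≤-reflexive z₁) (m≤n+m a v))) l) ⨾ move-run
                {left} {h} refl)
                  (arrive (pred[h]∸v h v) r₃) ,
           d₃ , trans z₃ (+-suc v a) , λ i n m → trans (o₃ i n m) (trans (unset ρ₁ _ m) (unset ρ v n))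
        where
        pred[h]∸v : ∀ h v → pred h ∸ v ≡ h ∸ suc v
        pred[h]∸v zero    v = 0∸n≡0 v
        pred[h]∸v (suc h) v = refl

    extend : ∀ n → (Fin n → ℕ) → (Fin n → Address) → Env → Addressing → Addressing
    extend zero    x a ρ ν = ν
    extend (suc n) x a ρ ν = extend n (x ∘ suc) (a ∘ suc) ρ (update _≟ᵃ_ ν (a zero) (just (ρ (x zero))))

    extend-other : ∀ n x a ρ ν b → (∀ i → a i ≢ b) → extend n x a ρ ν b ≡ ν b
    extend-other zero    x a ρ ν b h = refl
    extend-other (suc n) x a ρ ν b h =
      trans (extend-other n (x ∘ suc) (a ∘ suc) ρ _ b (h ∘ suc)) (update-other _≟ᵃ_ ν _ (h zero ∘ sym))

    extend-at : ∀ n x a ρ ν → (∀ {i j} → a i ≡ a j → i ≡ j) → ∀ i → extend n x a ρ ν (a i) ≡ just (ρ (x i))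
    extend-at (suc n) x a ρ ν inj zero =
      trans (extend-other n (x ∘ suc) (a ∘ suc) ρ _ (a zero) λ i e → case inj e of λ ())
          (update-same _≟ᵃ_ ν _ _)
    extend-at (suc n) x a ρ ν inj (suc i) =
      extend-at n (x ∘ suc) (a ∘ suc) ρ _ (λ e → Finₚ.suc-injective (inj e)) i

    ats-run : ∀ n x a {ρ ν c s′} → (∀ {i j} → a i ≡ a j → i ≡ j) → (∀ i → ν (a i) ≡ nothing) →
              Run I B (extend n x a ρ ν) c (ρ , rest) s′ → Run I B ν (ats n x a c) (ρ , rest) s′
    ats-run zero    x a inj free r = r
    ats-run (suc n) x a {ν = ν} inj free r = at (free zero) (ats-run n (x ∘ suc) (a ∘ suc)
        (λ e → Finₚ.suc-injective (inj e))
      (λ i → trans (update-other _≟ᵃ_ ν _ λ e → case inj e of λ ()) (free (suc i))) r)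

    idle : Addressing
    idle _ = nothing

    compile-run : ∀ {V} (e : Tm V) loc d ρ σ → (∀ v → loc v < d) → (∀ v → ρ (loc v) ≡ σ v) → Safe I B e σ →
                  Result {idle} {rest} (compile e loc d) ρ d (⟦_⟧ I e σ)

    many-compile : ∀ {V m} (es : Fin m → Tm V) loc d ρ σ → (∀ v → loc v < d) → (∀ v → ρ (loc v) ≡ σ v) →
                   (∀ i → Safe I B (es i) σ) →
                   ∃ λ ρ′ → Run I B idle (many m (λ i → compile (es i) loc) d) (ρ , rest) (ρ′ , rest) ×
                     (∀ i → ρ′ (d + toℕ i) ≡ ⟦_⟧ I (es i) σ) × Agree d ρ ρ′
    many-compile {m = m} es loc d ρ σ l e s = many-run m (λ i → compile (es i) loc) (λ i → ⟦_⟧ I (es i) σ) d ρ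
      λ i d′ ρ′ d≤ a → compile-run (es i) loc d′ ρ′ σ (λ v → ≤-trans (l v) d≤)
          (λ v → trans (a (loc v) (l v)) (e v)) (s i)

    compile-run (var v) loc d ρ σ l e s =
      let ρ′ , r , d′ , o = copy-run (loc v) d (suc d) ρ (<⇒≢ (l v)) (<⇒≢ (m≤n⇒m≤1+n (l v))) (<⇒≢ ≤-refl)
              (subst (_≤ B) (sym (e v)) s)
      in ρ′ , r , trans d′ (e v) , λ i i<d → o i (<⇒≢ i<d) (<⇒≢ (m≤n⇒m≤1+n i<d))
    compile-run zer loc d ρ σ l e s =
      let ρ′ , r , d′ , o = clr-run d ρ in ρ′ , r , d′ , λ i i<d → o i (<⇒≢ i<d)
    compile-run (suc t) loc d ρ σ l e (s , b) =
      let ρ′ , r , d′ , o = compile-run t loc d ρ σ l e s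
      in _ , r ⨾ inc (subst (λ x → suc x ≤ B) (sym d′) b) , trans (set ρ′ d _) (cong suc d′) ,
         λ i i<d → trans (unset ρ′ _ (<⇒≢ i<d)) (o i i<d)
    compile-run (loop {m} c is b o) loc d ρ σ l e (sc , si , sb) =
      let ρ₁ , r₁ , c₁ , a₁ = compile-run c loc (suc d) ρ σ (λ v → m≤n⇒m≤1+n (l v)) e sc
          ρ₂ , r₂ , v₂ , a₂ = many-compile is loc (2 + d) ρ₁ σ (λ v → m≤n⇒m≤1+n (m≤n⇒m≤1+n (l v)))
            (λ v → trans (a₁ (loc v) (m≤n⇒m≤1+n (l v))) (e v)) si
          ρ₃ , r₃ , v₃ , a₃ = repeat (⟦_⟧ I c σ) 0 ρ₂ (+-identityʳ _) (trans (a₂ (suc d) ≤-refl) c₁) v₂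
          acc = 2 + d + toℕ o
          acc< = +-monoʳ-< (2 + d) (toℕ<n o)
          d<acc = ≤-trans (n≤1+n (suc d)) (m≤m+n (2 + d) (toℕ o))
          ρ₄ , r₄ , d₄ , o₄ = copy-run acc d (2 + d + m) ρ₃ (>⇒≢ d<acc) (<⇒≢ acc<) (<⇒≢ (<-trans d<acc acc<))
            (subst (_≤ B) (sym (v₃ o)) (states-≤ I c is b si sb _ ≤-refl o))
      in ρ₄ , r₁ ⨾ r₂ ⨾ r₃ ⨾ r₄ , trans d₄ (v₃ o) ,
         λ i i<d → trans (o₄ i (<⇒≢ i<d) (<⇒≢ (<-trans i<d (<-trans d<acc acc<))))
           (trans (a₃ i (m≤n⇒m≤1+n i<d)) (trans (a₂ i (m≤n⇒m≤1+n (m≤n⇒m≤1+n i<d))) (a₁ i (m≤n⇒m≤1+n i<d))))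
      where
      S = states I c is b σ
      body = dec (suc d) ⨾ many m (λ i → compile (b i) (λ j → 2 + d + toℕ j)) (2 + d + m) ⨾
             copies m (2 + d + m) (2 + d) (2 + d + m + m)
      repeat : ∀ n k ρ → n + k ≡ ⟦_⟧ I c σ → ρ (suc d) ≡ n → (∀ i → ρ (2 + d + toℕ i) ≡ S k i) →
        ∃ λ ρ′ → Run I B idle (while (suc d) body) (ρ , rest) (ρ′ , rest) ×
          (∀ i → ρ′ (2 + d + toℕ i) ≡ S (⟦_⟧ I c σ) i) × Agree (suc d) ρ ρ′
      repeat zero    k ρ refl e v = ρ , while-stop e , v , λ _ _ → refl
      repeat (suc n) k ρ eq   e v =
        let k< = subst (suc k ≤_) eq (s≤s (m≤n+m k n))
            ρ₁ = ρ [ suc d ≔ n ]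
            ρ₂ , r₂ , v₂ , a₂ = many-compile b (λ j → 2 + d + toℕ j) (2 + d + m) ρ₁ (S k)
              (λ j → +-monoʳ-< (2 + d) (toℕ<n j))
              (λ j → trans (unset ρ n (>⇒≢ (s≤s (m≤m+n (suc d) (toℕ j))))) (v j)) (sb k k<)
            ρ₃ , r₃ , v₃ , a₃ = shift m ρ₂ (λ i → subst (_≤ B) (sym (v₂ i)) (safe-value I (b i) (sb k k< i)))
            ρ′ , r , v′ , a′ = repeat n (suc k) ρ₃ (trans (+-suc n k) eq)
              (trans (a₃ (suc d) ≤-refl) (trans (a₂ (suc d) (m≤m+n (2 + d) m)) (set ρ (suc d) n)))
              (λ i → trans (v₃ i) (v₂ i))
        in ρ′ , while-go e (dec e ⨾ r₂ ⨾ r₃) r , v′ ,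
           λ i i<d → trans (a′ i i<d) (trans (a₃ i (m≤n⇒m≤1+n i<d))
               (trans (a₂ i (≤-trans (m≤n⇒m≤1+n i<d) (m≤m+n (2 + d) m))) (unset ρ n (<⇒≢ i<d))))
        where
        shift : ∀ m ρ → (∀ (i : Fin m) → ρ (2 + d + m + toℕ i) ≤ B) →
          ∃ λ ρ′ → Run I B idle (copies m (2 + d + m) (2 + d) (2 + d + m + m)) (ρ , rest) (ρ′ , rest) ×
            (∀ (i : Fin m) → ρ′ (2 + d + toℕ i) ≡ ρ (2 + d + m + toℕ i)) × Agree (2 + d) ρ ρ′
        -- The condition `dst < src` of `copies-run` fails for an empty block, where both ends
        -- coincide.
        shift zero    ρ h = ρ , skip , (λ ()) , λ _ _ → refl
        shift (suc m) ρ h = copies-run (suc m) (2 + d + suc m) (2 + d) (2 + d + suc m + suc m) ρ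
            (m<m+n (2 + d) (s≤s z≤n)) ≤-refl h
    compile-run (op o es) loc d ρ σ l e (s , sv) =
      let l₂ = λ v → m≤n⇒m≤1+n (m≤n⇒m≤1+n (l v))
          ρ₁ , r₁ , v₁ , a₁ = many-compile es loc (2 + d) ρ σ l₂ e s
          ρ₂ , r₂ , d₂ , o₂ = clr-run d ρ₁
          ρ₃ , r₃ , z₃ , o₃ = clr-run (suc d) ρ₂
          x = λ (i : Fin (arity o)) → 2 + d + toℕ i
          ν = extend (arity o) x (λ i → o , i) ρ₃ idle
          inj : ∀ {i j : Fin (arity o)} → (o , i) ≡ (o , j) → i ≡ j
          inj = λ { refl → refl }
          nums : addressed-numbers ν o ≡ Vec.tabulate λ i → ⟦_⟧ I (es i) σ
          nums = tabulate-cong λ i → trans (cong (fromMaybe 0) (extend-at (arity o) x (λ i → o , i) ρ₃ idle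
              inj i))
            (trans (o₃ (x i) (>⇒≢ (m≤m+n (2 + d) (toℕ i))))
                (trans (o₂ (x i) (>⇒≢ (≤-trans (n≤1+n (suc d)) (m≤m+n (2 + d) (toℕ i))))) (v₁ i)))
          ρ₄ , r₄ , d₄ , o₄ = inquire-run o {ν} d (suc d) ρ₃ (<⇒≢ ≤-refl) (trans (o₃ d (<⇒≢ ≤-refl)) d₂) z₃
            (subst (λ vs → ⟦ o ⟧ᵒ vs ≤ B) (sym nums) sv)
      in ρ₄ , r₁ ⨾ r₂ ⨾ r₃ ⨾ ats-run (arity o) x (λ i → o , i) inj (λ _ → refl) r₄ ,
         trans d₄ (cong ⟦ o ⟧ᵒ nums) ,
         λ i i<d → trans (o₄ i (<⇒≢ i<d) (<⇒≢ (m≤n⇒m≤1+n i<d))) (trans (o₃ i (<⇒≢ (m≤n⇒m≤1+n i<d)))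
           (trans (o₂ i (<⇒≢ i<d)) (a₁ i (m≤n⇒m≤1+n (m≤n⇒m≤1+n i<d)))))

-- Enumerated variables and the main loop of a program

record Enumeration (V : Set) : Set where
  field
    count      : ℕ
    elem       : Fin count → V
    index      : V → Fin count
    elem-index : ∀ v → elem (index v) ≡ v

-- A program with state V → ℕ, which is transformed by stepTm as long as going
-- is positive; it then accepts if and only if verdict is positive.

module Programs (Sg : Signature) where
  open Signature Sg
  open Commands Sg
  open Terms Sg

  record Program : Set₁ where
    field
      Var     : Set
      vars    : Enumeration Var
      initTm   : Var → Tm ⊥
      stepTm    : Var → Tm Var
      going   : Tm Var
      verdict : Tm Var

    open Enumeration vars public

    location : Var → ℕ
    location v = toℕ (index v)

    main : Cmd
    main =
      many count (λ i → compile (initTm (elem i)) λ ()) 0 ⨾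
      compile going location count ⨾
      while count (many count (λ i → compile (stepTm (elem i)) location) (suc count) ⨾
                   copies count (suc count) 0 (suc count + count) ⨾
                   compile going location count) ⨾
      compile verdict location count

    data Trace (I : Interpretation Sg) (B : ℕ) (s : Var → ℕ) (b : Bool) : Set where
      stop : Safe I B going s → ⟦_⟧ I going s ≡ 0 → Safe I B verdict s →
             (0 <ᵇ ⟦_⟧ I verdict s) ≡ b → Trace I B s b
      go   : ∀ {k} → Safe I B going s → ⟦_⟧ I going s ≡ suc k → (∀ v → Safe I B (stepTm v) s) →
             Trace I B (λ v → ⟦_⟧ I (stepTm v) s) b → Trace I B s b

    module _ (I : Interpretation Sg) (B : ℕ)
        (ask≤2   : ∀ a vs → Interpretation.askᴵ I a vs ≤ 2)
        (compact : ∀ r vs → length (Interpretation.readᴵ I r vs) ≤ suc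
            (horner (Interpretation.readᴵ I r vs))) where
      open Correctness I B ask≤2 compact

      main-run : ∀ {b} ρ → (∀ v → Safe I B (initTm v) λ ()) → Trace I B (λ v → ⟦_⟧ I (initTm v) λ ()) b →
                 ∃ λ ρ′ → Run I B idle main (ρ , rest) (ρ′ , rest) × (0 <ᵇ ρ′ count) ≡ b
      main-run ρ s t =
        let ρ₁ , r₁ , v₁ , _ = many-compile (initTm ∘ elem) (λ ()) 0 ρ (λ ()) (λ ()) (λ ()) (s ∘ elem)
            ρ₂ , r₂ , g , a₂ = compile-run going location count ρ₁ _ (λ v → toℕ<n (index v))
              (λ v → trans (v₁ (index v)) (cong (λ u → ⟦_⟧ I (initTm u) λ ()) (elem-index v))) (going-safe t)
            ρ₃ , r₃ , ρ₄ , r₄ , e = loop-run ρ₂ g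
              (λ v → trans (a₂ (location v) (toℕ<n (index v)))
                  (trans (v₁ (index v)) (cong (λ u → ⟦_⟧ I (initTm u) λ ()) (elem-index v)))) t
        in ρ₄ , r₁ ⨾ r₂ ⨾ r₃ ⨾ r₄ , e
        where
        going-safe : ∀ {s b} → Trace I B s b → Safe I B going s
        going-safe (stop g _ _ _) = g
        going-safe (go g _ _ _)   = g

        loop-run : ∀ {s b} ρ → ρ count ≡ ⟦_⟧ I going s → (∀ v → ρ (location v) ≡ s v) → Trace I B s b →
          ∃ λ ρ′ → Run I B idle (while count _) (ρ , rest) (ρ′ , rest) ×
          ∃ λ ρ″ → Run I B idle (compile verdict location count) (ρ′ , rest) (ρ″ , rest) × (0 <ᵇ ρ″ count) ≡ b
        loop-run ρ g l (stop _ e s q) =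
          let ρ′ , r , v , _ = compile-run verdict location count ρ _ (λ v → toℕ<n (index v)) l s
          in ρ , while-stop (trans g e) , ρ′ , r , trans (cong (0 <ᵇ_) v) q
        loop-run {s} ρ g l (go _ e ss t) =
          let ρ₁ , r₁ , v₁ , _ = many-compile (stepTm ∘ elem) location (suc count) ρ s
                (λ v → m≤n⇒m≤1+n (toℕ<n (index v))) l (ss ∘ elem)
              ρ₂ , r₂ , v₂ , _ = copies-run count (suc count) 0 (suc count + count) ρ₁ (s≤s z≤n) ≤-refl
                (λ i → subst (_≤ B) (sym (v₁ i)) (safe-value I (stepTm (elem i)) (ss (elem i))))
              l₂ = λ v → trans (v₂ (index v)) (trans (v₁ (index v)) (cong (λ u → ⟦_⟧ I (stepTm u) s)
                  (elem-index v)))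
              ρ₃ , r₃ , g₃ , a₃ = compile-run going location count ρ₂ _ (λ v → toℕ<n (index v)) l₂
                  (going-safe t)
              ρ₄ , r₄ , ρ₅ , r₅ , q = loop-run ρ₃ g₃ (λ v → trans (a₃ (location v) (toℕ<n (index v)))
                  (l₂ v)) t
          in ρ₄ , while-go (trans g e) (r₁ ⨾ r₂ ⨾ r₃) r₄ , ρ₅ , r₅ , q

  module Execute (Pr : Program) where
    open Program Pr
    K′ : ℕ
    K′ = count ⊔ registers main
    open Platforms Sg (suc K′) public
    open Compile Sg K′ public

    accepting : Condition
    accepting = scanned (inj₁ (register count)) is1

    -- The verdict is a number in register `count`. The final `enter` turns its being positive into
    -- a scanned 1, which `accepting` can test.
    control : Ins → Prog Ins Condition
    control setup = prim setup ⨟ prog main ⨟ onCounter (register count) enter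

    module _ {I : Interpretation Sg} (Pl : Platform I) (B w : ℕ) (B<2^w : B < 2 ^ w)
        (ask≤2   : ∀ a vs → Interpretation.askᴵ I a vs ≤ 2)
        (compact : ∀ r vs → length (Interpretation.readᴵ I r vs) ≤ suc
            (horner (Interpretation.readᴵ I r vs))) where
      open Platform Pl
      open Correctness I B ask≤2 compact using (idle; rest)

      private
        Ok : State → Set
        Ok = ok Pl {w = w} ≤-refl

        blankLayout : Name → Tape
        blankLayout = layout Pl {w = w} ≤-refl (λ _ → []) (λ _ → [])

      control-exec : ∀ {b} setup t → (∀ v → Safe I B (initTm v) λ ()) → Trace I B
          (λ v → ⟦_⟧ I (initTm v) λ ()) b →
        Ok t → At Pl blankLayout rest (run setup t) →
        ∃ λ t′ → Exec semantics Ok (control setup) t t′ × cond accepting t′ ≡ b × Ok t′ × Ok (run nop t′)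
      control-exec setup t s tr o a
        with main-run I B ask≤2 compact (λ _ → 0) s tr
      ... | ρ , r , e
        with run-exec Pl ≤-refl B<2^w r (below-registers main (m≤n⇒m≤1+n (m≤n⊔m count (registers main)))) d
            (holds a (λ _ → refl) λ _ → z≤n)
        where
        d : Addressed Pl ≤-refl idle λ _ → []
        d = addressed (λ _ → refl) (λ _ _ → refl) (λ _ → z≤n)
      ... | t₁ , β , ex , holds pl vs sh , _
        with enter-exec noIns (λ _ → ⊤) (2 + w) {w} (β (register count)) (sh (register count)) ≤-refl tt
      ... | ps , qs , en , _ , f , v
        with onCounter-exec Pl {w = w} ≤-refl (register count) short en
          (at-resp Pl (λ x → ≡⇒≈ Pl (focused x)) pl)
        where
        short : Short Pl {w = w} ≤-refl (layout Pl {w = w} ≤-refl β (λ _ → []))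
        short (inj₁ _) = s≤s z≤n
        short (inj₂ _) = s≤s z≤n
        focused : ∀ x → layout Pl {w = w} ≤-refl β (λ _ → []) x ≡
                        update _≟ⁿ_ (layout Pl {w = w} ≤-refl β (λ _ → [])) (inj₁ (register count))
                            (counter (β (register count))) x
        focused x with x ≟ⁿ inj₁ (register count)
        ... | yes refl = refl
        ... | no _     = refl
      ... | t′ , ex′ , a′ =
        t′ , prim o ⨟ ex ⨟ ex′ ,
        trans (cond-sym _ is1 t′) (trans (cong is1 (trans (scan-cong (At.tapes a′ (inj₁ (register count))))
            (cong scan (update-same _≟ⁿ_ (layout Pl {w = w} ≤-refl β (λ _ → [])) (inj₁ (register count))
            (counterAt ps qs)))))
          (trans v (trans (cong (0 <ᵇ_) (trans (sym (vs (register count)))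
              (cong ρ (toℕ-register (s≤s (m≤m⊔n count (registers main))))))) e))) ,
        at-ok Pl {w = w} ≤-refl short′ a′ , at-ok Pl {w = w} ≤-refl short′ (at-nop Pl a′)
        where
        short′ : Short Pl {w = w} ≤-refl (update _≟ⁿ_ (layout Pl {w = w} ≤-refl β (λ _ → []))
            (inj₁ (register count)) (counterAt ps qs))
        short′ = update-all _≟ⁿ_ (λ _ u → head u < 2 + w) {layout Pl {w = w} ≤-refl β (λ _ → [])}
          (counterAt-head noIns (λ _ → ⊤) (2 + w) ps qs f) λ { (inj₁ _) _ → s≤s z≤n ; (inj₂ _) _ → s≤s z≤n }

  record Controller (Pr : Program) : Set₁ where
    open Program Pr
    field
      K : ℕ
    open Platforms Sg (suc K)
    open Platform
    field
      control   : Ins → Prog Ins Condition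
      accepting : Condition
      executes  : ∀ {I} (Pl : Platform I) B w → B < 2 ^ w →
        (∀ a vs → Interpretation.askᴵ I a vs ≤ 2) →
        (∀ r vs → length (Interpretation.readᴵ I r vs) ≤ suc (horner (Interpretation.readᴵ I r vs))) →
        ∀ {b} setup t → (∀ v → Safe I B (initTm v) λ ()) → Trace I B (λ v → ⟦_⟧ I (initTm v) λ ()) b →
        cellsOf Pl t ≤ 2 + w →
        (∀ j → tapeOf Pl (run Pl setup t) (inj₁ j) ≈ counter []) → (∀ a → tapeOf Pl (run Pl setup t)
            (inj₂ a) ≈ addressTape []) →
        (∀ y → headOf Pl (run Pl setup t) y ≡ 0) → Fresh Pl (run Pl setup t) →
        ∃ λ t′ → Exec (semantics Pl) (λ t → cellsOf Pl t ≤ 2 + w) (control setup) t t′ × cond Pl accepting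
            t′ ≡ b ×
          cellsOf Pl t′ ≤ 2 + w × cellsOf Pl (run Pl nop t′) ≤ 2 + w

  abstract
    -- Kept abstract: from here on only the specification in `Controller` is used and the compiled
    -- program is never unfolded.
    controller : ∀ Pr → Controller Pr
    controller Pr = record
      { K = Execute.K′ Pr ; control = Execute.control Pr ; accepting = Execute.accepting Pr
      ; executes = λ Pl B w l q r setup t s tr o ct at hd f → Execute.control-exec Pr Pl B w l q r setup t s
          tr o
          (Compile.located (λ { (inj₁ j) → ct j ; (inj₂ a) → at a }) hd f) }

-- Terms together with the function that they denote and a polynomial bound
-- on the numbers in their evaluation.

ifz : ∀ {A : Set} → ℕ → A → A → A
ifz zero    x y = x
ifz (suc _) x y = y

-- Powers

^-mono : ∀ {b m n} → 2 ≤ b → m ≤ n → b ^ m ≤ b ^ n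
^-mono {suc b} _ l = ^-monoʳ-≤ (suc b) l

^-≥1 : ∀ {b} n → 2 ≤ b → 1 ≤ b ^ n
^-≥1 n h = ^-mono h (z≤n {n})

n<b^n : ∀ {b} → 2 ≤ b → ∀ n → n < b ^ n
n<b^n h zero    = s≤s z≤n
n<b^n {b} h (suc n) = ≤-trans (+-mono-≤ (^-≥1 n h) (n<b^n h n))
  (≤-trans (≤-reflexive (cong (b ^ n +_) (sym (+-identityʳ (b ^ n))))) (*-monoˡ-≤ (b ^ n) h))

≤^ : ∀ {B x} n → 2 ≤ B → x ≤ B → x ≤ B ^ suc n
≤^ {B} n h l = ≤-trans l (≤-trans (≤-reflexive (sym (*-identityʳ B))) (^-mono {n = suc n} h (s≤s z≤n)))

-- Since `2 ≤ B`, an addition costs one more power of `B`. The growth exponents of the loops below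
-- are counted in this way.
+≤^ : ∀ {B x y} n → 2 ≤ B → x ≤ B ^ n → y ≤ B ^ n → x + y ≤ B ^ suc n
+≤^ {B} n h l m = ≤-trans (+-mono-≤ l m)
  (≤-trans (≤-reflexive (cong (B ^ n +_) (sym (+-identityʳ (B ^ n))))) (*-monoˡ-≤ (B ^ n) h))

n≤2^n : ∀ n → n ≤ 2 ^ n
n≤2^n n = <⇒≤ (n<b^n ≤-refl n)

-- Division by repeated counting.  Dividing by 0 gives an unspecified result.

quotRem : ℕ → ℕ → ℕ × ℕ
quotRem zero    y = 0 , 0
quotRem (suc k) y = let q , r = quotRem k y in
  ifz (y ∸ suc r) (suc q) q , ifz (y ∸ suc r) 0 (suc r)

quot rem : ℕ → ℕ → ℕ
quot k y = proj₁ (quotRem k y)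
rem k y = proj₂ (quotRem k y)

quotRem-spec : ∀ k y → 0 < y → k ≡ rem k y + quot k y * y × rem k y < y
quotRem-spec zero    y       l = refl , l
quotRem-spec (suc k) (suc y) l with quotRem k (suc y) | quotRem-spec k (suc y) l
... | q , r | e , s≤s r≤y with y ∸ r in eq
... | zero  = trans (cong suc e) (cong (λ x → suc x + q * suc y) (≤-antisym r≤y (m∸n≡0⇒m≤n eq))) , s≤s z≤n
... | suc _ = cong suc e , s≤s (≰⇒> λ y≤r → case trans (sym eq) (m≤n⇒m∸n≡0 y≤r) of λ ())

division-unique : ∀ {y} q r q′ r′ → r < y → r′ < y → r + q * y ≡ r′ + q′ * y → q ≡ q′ × r ≡ r′
division-unique {y} zero r zero r′ l l′ e = refl , trans (sym (+-identityʳ r)) (trans e (+-identityʳ r′))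
division-unique {y} zero r (suc q′) r′ l l′ e = contradiction
    (≤-trans l (≤-trans (m≤m+n y (q′ * y))
    (≤-trans (m≤n+m _ r′) (≤-reflexive (trans (sym e) (+-identityʳ r)))))) (<-irrefl refl)
division-unique {y} (suc q) r zero r′ l l′ e = contradiction
    (≤-trans l′ (≤-trans (m≤m+n y (q * y)) (≤-trans (m≤n+m _ r) (≤-reflexive (trans e (+-identityʳ r′))))))
    (<-irrefl refl)
division-unique {y} (suc q) r (suc q′) r′ l l′ e
  with division-unique q r q′ r′ l l′
      (+-cancelˡ-≡ y _ _ (trans (sym (shuffle r q)) (trans e (shuffle r′ q′))))
  where
  shuffle : ∀ r q → r + (y + q * y) ≡ y + (r + q * y)
  shuffle r q = trans (sym (+-assoc r y (q * y))) (trans (cong (_+ q * y) (+-comm r y)) (+-assoc y r (q * y)))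
... | refl , refl = refl , refl

quotRem-unique : ∀ {y} q {r} → r < y → quot (r + q * y) y ≡ q × rem (r + q * y) y ≡ r
quotRem-unique {y} q {r} l =
  let e , l′ = quotRem-spec (r + q * y) y (≤-trans (s≤s z≤n) l)
      p , s = division-unique q r (quot (r + q * y) y) (rem (r + q * y) y) l l′ e
  in sym p , sym s

-- Arithmetic with polynomially bounded evaluation

module Arithmetic (Sg : Signature) where
  open Signature Sg
  open Commands Sg
  open Terms Sg

  Bounded : Interpretation Sg → ℕ → Set
  Bounded I b = 2 ≤ b × (∀ o vs → Interpretation.⟦_⟧ᵒ I o vs ≤ b)

  record Ex (V : Set) : Set where
    no-eta-equality
    field
      tm      : Tm V
      deg     : ℕ
      sem     : Interpretation Sg → (V → ℕ) → ℕ
      correct : ∀ I ρ → ⟦_⟧ I tm ρ ≡ sem I ρ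
      poly    : ∀ I b ρ → Bounded I b → (∀ v → ρ v ≤ b) → Safe I (b ^ deg) tm ρ

    sem-≤ : ∀ I b ρ → Bounded I b → (∀ v → ρ v ≤ b) → sem I ρ ≤ b ^ deg
    sem-≤ I b ρ h l = subst (_≤ b ^ deg) (correct I ρ) (safe-value I tm (poly I b ρ h l))

  open Ex public

  module _ (I : Interpretation Sg) where

    iterate-cong : ∀ {m} (b : Fin m → Tm (Fin m)) → (∀ i {ρ σ} → (∀ v → ρ v ≡ σ v) → ⟦_⟧ I (b i) ρ ≡ ⟦_⟧ I
        (b i) σ) →
                   ∀ {s t : Fin m → ℕ} → (∀ i → s i ≡ t i) →
                   ∀ k i → iterate (λ s i → ⟦_⟧ I (b i) s) s k i ≡ iterate (λ s i → ⟦_⟧ I (b i) s) t k i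
    iterate-cong b h e zero    i = e i
    iterate-cong b h e (suc k) i = h i (iterate-cong b h e k)

    -- Valuations are functions, and the ones compared below agree only pointwise: the states of a
    -- loop come as functions from the terms and as `Vec.lookup` of a vector from `sem`.
    ⟦⟧-cong : ∀ {V} (e : Tm V) {ρ σ} → (∀ v → ρ v ≡ σ v) → ⟦_⟧ I e ρ ≡ ⟦_⟧ I e σ
    ⟦⟧-cong (var v) h = h v
    ⟦⟧-cong zer     h = refl
    ⟦⟧-cong (suc e) h = cong suc (⟦⟧-cong e h)
    ⟦⟧-cong (loop c is b o) {ρ} {σ} h = trans
      (cong (λ k → iterate (λ s i → ⟦_⟧ I (b i) s) (λ i → ⟦_⟧ I (is i) ρ) k o) (⟦⟧-cong c h))
      (iterate-cong b (λ i → ⟦⟧-cong (b i)) (λ i → ⟦⟧-cong (is i) h) (⟦_⟧ I c σ) o)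
    ⟦⟧-cong (op o es) h = cong (Interpretation.⟦_⟧ᵒ I o) (tabulate-cong λ i → ⟦⟧-cong (es i) h)

    safe-cong : ∀ {V B} (e : Tm V) {ρ σ} → (∀ v → ρ v ≡ σ v) → Safe I B e ρ → Safe I B e σ
    safe-cong (var v) h s = subst (_≤ _) (h v) s
    safe-cong zer     h s = tt
    safe-cong (suc e) h (s , l) = safe-cong e h s , subst (λ x → suc x ≤ _) (⟦⟧-cong e h) l
    safe-cong (loop c is b o) h (s , t , u) = safe-cong c h s , (λ i → safe-cong (is i) h (t i)) ,
      λ k l i → safe-cong (b i) (iterate-cong b (λ j → ⟦⟧-cong (b j)) (λ j → ⟦⟧-cong (is j) h) k)
        (u k (subst (k <_) (sym (⟦⟧-cong c h)) l) i)
    safe-cong (op o es) h (s , l) = (λ i → safe-cong (es i) h (s i)) , subst (_≤ _) (⟦⟧-cong (op o es) h) l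

    safe-mono : ∀ {V B B′} (e : Tm V) {ρ} → B ≤ B′ → Safe I B e ρ → Safe I B′ e ρ
    safe-mono (var v) h s = ≤-trans s h
    safe-mono zer     h s = tt
    safe-mono (suc e) h (s , l) = safe-mono e h s , ≤-trans l h
    safe-mono (loop c is b o) h (s , t , u) = safe-mono c h s , (λ i → safe-mono (is i) h (t i)) ,
      λ k l i → safe-mono (b i) h (u k l i)
    safe-mono (op o es) h (s , l) = (λ i → safe-mono (es i) h (s i)) , ≤-trans l h

  degs : ∀ {V m} → Vec (Ex V) m → ℕ
  degs es = Vec.sum (Vec.map deg es)

  deg≤degs : ∀ {V m} (es : Vec (Ex V) m) i → deg (Vec.lookup es i) ≤ degs es
  deg≤degs (e ∷ es) zero    = m≤m+n (deg e) (degs es)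
  deg≤degs (e ∷ es) (suc i) = ≤-trans (deg≤degs es i) (m≤n+m (degs es) (deg e))

  varE : ∀ {V} → V → Ex V
  varE v = record
    { tm = var v ; deg = 1 ; sem = λ _ ρ → ρ v ; correct = λ _ _ → refl
    ; poly = λ I b ρ h l → ≤-trans (l v) (≤-reflexive (sym (*-identityʳ b))) }

  sucE : ∀ {V} → Ex V → Ex V
  sucE e = record
    { tm = suc (tm e) ; deg = suc (deg e) ; sem = λ I ρ → suc (sem e I ρ) ; correct = λ I ρ → cong suc
        (correct e I ρ)
    ; poly = λ I b ρ h l → safe-mono I (tm e) (^-mono (proj₁ h) (n≤1+n (deg e))) (poly e I b ρ h l) ,
        ≤-trans (+-mono-≤ (^-≥1 (deg e) (proj₁ h)) (safe-value I (tm e) (poly e I b ρ h l)))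
          (≤-trans (≤-reflexive (cong (b ^ deg e +_) (sym (+-identityʳ (b ^ deg e)))))
              (*-monoˡ-≤ (b ^ deg e) (proj₁ h))) }

  constE : ∀ {V} → ℕ → Ex V
  constE n = record
    { tm = tm′ n ; deg = n ; sem = λ _ _ → n ; correct = λ I ρ → value n I ρ
    ; poly = λ I b ρ h l → safe n I ρ (<⇒≤ (n<b^n (proj₁ h) n)) }
    where
    tm′ : ∀ {V} → ℕ → Tm V
    tm′ zero    = zer
    tm′ (suc n) = suc (tm′ n)
    value : ∀ {V} n I (ρ : V → ℕ) → ⟦_⟧ I (tm′ n) ρ ≡ n
    value zero    I ρ = refl
    value (suc n) I ρ = cong suc (value n I ρ)
    safe : ∀ {V B} n I (ρ : V → ℕ) → n ≤ B → Safe I B (tm′ n) ρ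
    safe zero    I ρ l = tt
    safe (suc n) I ρ l = safe n I ρ (≤-trans (n≤1+n n) l) , subst (λ x → suc x ≤ _) (sym (value n I ρ)) l

  opE : ∀ {V} o → Vec (Ex V) (arity o) → Ex V
  opE o es = record
    { tm = op o λ i → tm (Vec.lookup es i)
    ; deg = suc (degs es)
    ; sem = λ I ρ → Interpretation.⟦_⟧ᵒ I o (Vec.map (λ e → sem e I ρ) es)
    ; correct = λ I ρ → cong (Interpretation.⟦_⟧ᵒ I o) (values I ρ es)
    ; poly = λ I b ρ h l → (λ i → safe-mono I (tm (Vec.lookup es i))
        (^-mono (proj₁ h) (m≤n⇒m≤1+n (deg≤degs es i))) (poly (Vec.lookup es i) I b ρ h l)) ,
        ≤-trans (proj₂ h o _) (≤-trans (≤-reflexive (sym (*-identityʳ b))) (^-mono {n = suc (degs es)}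
            (proj₁ h) (s≤s z≤n))) }
    where
    values : ∀ {V n} I (ρ : V → ℕ) (es : Vec (Ex V) n) →
             Vec.tabulate (λ i → ⟦_⟧ I (tm (Vec.lookup es i)) ρ) ≡ Vec.map (λ e → sem e I ρ) es
    values I ρ []       = refl
    values I ρ (e ∷ es) = cong₂ _∷_ (correct e I ρ) (values I ρ es)

  stepFn : ∀ {m n} → Vec (Ex (Fin m)) n → Interpretation Sg → Vec ℕ m → Vec ℕ n
  stepFn body I xs = Vec.map (λ e → sem e I (Vec.lookup xs)) body

  -- A polynomial bound on the body alone says nothing about its iterates, since repeated doubling
  -- already leaves every polynomial. The bound on the iterates is therefore part of a loop,
  -- relative to a `B` that also bounds the number of rounds.
  record Loop (m : ℕ) : Set where
    field
      body   : Vec (Ex (Fin m)) m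
      growth : ℕ
      bound  : ∀ I B xs k → Bounded I B → (∀ i → Vec.lookup xs i ≤ B) → k ≤ B →
               ∀ i → Vec.lookup (iterate (stepFn body I) xs k) i ≤ B ^ suc growth

  loopE : ∀ {V m} → Loop m → Ex V → Vec (Ex V) m → Fin m → Ex V
  loopE {V} {m} L c is o = record
    { tm = loop (tm c) inits bodies o
    ; deg = D + E
    ; sem = λ I ρ → Vec.lookup (iterate (stepFn body I) (Vec.map (λ e → sem e I ρ) is) (sem c I ρ)) o
    ; correct = λ I ρ → trans (states-vec I ρ (⟦_⟧ I (tm c) ρ) o)
        (cong (λ k → Vec.lookup (iterate (stepFn body I) (Vec.map (λ e → sem e I ρ) is) k) o) (correct c I ρ))
    ; poly = λ I b ρ h l →
        safe-mono I (tm c) (^-mono (proj₁ h) (≤-trans (m≤n⇒m≤1+n (m≤m+n (deg c) _)) (m≤m+n D E)))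
            (poly c I b ρ h l) ,
        (λ i → safe-mono I (inits i) (^-mono (proj₁ h)
            (≤-trans (≤-trans (deg≤degs is i) (m≤n+m (degs is) (suc (deg c)))) (m≤m+n D E)))
                 (poly (Vec.lookup is i) I b ρ h l)) ,
        λ k k< i → safe-cong I (bodies i) (λ j → sym (states-vec I ρ k j))
          (safe-mono I (bodies i) (^-mono (proj₁ h) (m≤n+m E D)) (body-safe I b ρ h l k (<⇒≤ k<) i))
    }
    where
    open Loop L
    inits : Fin m → Tm V
    inits i = tm (Vec.lookup is i)
    bodies : Fin m → Tm (Fin m)
    bodies i = tm (Vec.lookup body i)
    -- `b ^ D` bounds the number of rounds and the initial values, and its `suc` makes it at least
    -- `b`. All iterates are then at most `(b ^ D) ^ suc growth`; evaluating the bodies there raises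
    -- this to the power `degs body`, which gives `b ^ E`.
    D = suc (deg c) + degs is
    E = D * suc growth * degs body

    states-vec : ∀ I ρ k i → states I (tm c) inits bodies ρ k i ≡
                 Vec.lookup (iterate (stepFn body I) (Vec.map (λ e → sem e I ρ) is) k) i
    states-vec I ρ zero    i = trans (correct (Vec.lookup is i) I ρ) (sym (lookup-map i (λ e → sem e I ρ) is))
    states-vec I ρ (suc k) i = trans (⟦⟧-cong I (bodies i) (states-vec I ρ k))
      (trans (correct (Vec.lookup body i) I _) (sym (lookup-map i (λ e → sem e I _) body)))

    body-safe : ∀ I b ρ → Bounded I b → (∀ v → ρ v ≤ b) → ∀ k → k ≤ ⟦_⟧ I (tm c) ρ → ∀ i →
      Safe I (b ^ E) (bodies i) (Vec.lookup (iterate (stepFn body I) (Vec.map (λ e → sem e I ρ) is) k))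
    body-safe I b ρ h l k k≤ i = safe-mono I (bodies i) (≤-trans (^-mono B≥2 (deg≤degs body i))
        (≤-reflexive (b^E)))
      (poly (Vec.lookup body i) I B _ (B≥2 , λ o vs → ≤-trans (proj₂ h o vs) b≤B)
        (bound I (b ^ D) _ k (≤-trans (proj₁ h) b≤b^D , λ o vs → ≤-trans (proj₂ h o vs) b≤b^D)
          (λ j → subst (_≤ b ^ D) (sym (lookup-map j (λ e → sem e I ρ) is))
            (≤-trans (sem-≤ (Vec.lookup is j) I b ρ h l)
                (^-mono (proj₁ h) (≤-trans (deg≤degs is j) (m≤n+m (degs is) (suc (deg c)))))))
          (≤-trans k≤ (≤-trans (safe-value I (tm c) (poly c I b ρ h l))
              (^-mono (proj₁ h) (m≤n⇒m≤1+n (m≤m+n (deg c) _)))))))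
      where
      B = (b ^ D) ^ suc growth
      b≤b^D : b ≤ b ^ D
      b≤b^D = ≤-trans (≤-reflexive (sym (*-identityʳ b))) (^-mono {n = D} (proj₁ h) (s≤s z≤n))
      b≤B : b ≤ B
      b≤B = ≤-trans b≤b^D (≤-trans (≤-reflexive (sym (*-identityʳ (b ^ D))))
          (^-mono {n = suc growth} (≤-trans (proj₁ h) b≤b^D) (s≤s z≤n)))
      B≥2 = ≤-trans (proj₁ h) b≤B
      b^E : B ^ degs body ≡ b ^ E
      b^E = trans (cong (_^ degs body) (^-*-assoc b D (suc growth))) (^-*-assoc b (D * suc growth)
          (degs body))

  v₀ : ∀ {n} → Ex (Fin (suc n))
  v₀ = varE zero
  v₁ : ∀ {n} → Ex (Fin (2 + n))
  v₁ = varE (suc zero)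
  v₂ : ∀ {n} → Ex (Fin (3 + n))
  v₂ = varE (suc (suc zero))
  v₃ : ∀ {n} → Ex (Fin (4 + n))
  v₃ = varE (suc (suc (suc zero)))

  private
    iterated : ∀ {m B} {xs ys : Vec ℕ m} → xs ≡ ys → (∀ i → Vec.lookup ys i ≤ B) → ∀ i → Vec.lookup xs i ≤ B
    iterated refl h = h

    -- Replaces the iteration by its closed form, so that later proofs do not see the loop.
    recast : ∀ {V} (e : Ex V) (f : Interpretation Sg → (V → ℕ) → ℕ) → (∀ I ρ → sem e I ρ ≡ f I ρ) → Ex V
    recast e f h = record { tm = tm e ; deg = deg e ; sem = f ; correct = λ I ρ → trans (correct e I ρ)
        (h I ρ) ; poly = poly e }

    addBody : Vec (Ex (Fin 1)) 1
    addBody = sucE v₀ ∷ []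

    adding : ∀ I x k → iterate (stepFn addBody I) (x ∷ []) k ≡ k + x ∷ []
    adding I x zero    = refl
    adding I x (suc k) = cong (stepFn addBody I) (adding I x k)

    addLoop : Loop 1
    addLoop = record { body = addBody ; growth = 1 ; bound = λ { I B (x ∷ []) k (h , _) l k≤ →
      iterated (adding I x k) λ { zero → +≤^ 1 h (≤^ 0 h k≤) (≤^ 0 h (l zero)) } } }

  infixl 6 _⊕_ _⊖_
  infixl 7 _⊗_

  _⊕_ : ∀ {V} → Ex V → Ex V → Ex V
  a ⊕ b = recast (loopE addLoop a (b ∷ []) zero) (λ I ρ → sem a I ρ + sem b I ρ)
    λ I ρ → cong (λ xs → Vec.lookup xs zero) (adding I (sem b I ρ) (sem a I ρ))

  private
    mulBody : Vec (Ex (Fin 2)) 2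
    mulBody = v₁ ⊕ v₀ ∷ v₁ ∷ []

    multiplying : ∀ I x y k → iterate (stepFn mulBody I) (x ∷ y ∷ []) k ≡ k * y + x ∷ y ∷ []
    multiplying I x y zero    = refl
    multiplying I x y (suc k) = trans (cong (stepFn mulBody I) (multiplying I x y k))
      (cong (_∷ y ∷ []) (sym (+-assoc y (k * y) x)))

    mulLoop : Loop 2
    mulLoop = record { body = mulBody ; growth = 2 ; bound = λ { I B (x ∷ y ∷ []) k (h , _) l k≤ →
      iterated (multiplying I x y k) λ
        { zero → +≤^ 2 h (≤-trans (*-mono-≤ k≤ (l (suc zero)))
            (≤-reflexive (cong (B *_) (sym (*-identityʳ B))))) (≤^ 1 h (l zero))
        ; (suc zero) → ≤^ 2 h (l (suc zero)) } } }

  _⊗_ : ∀ {V} → Ex V → Ex V → Ex V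
  a ⊗ b = recast (loopE mulLoop a (constE 0 ∷ b ∷ []) zero) (λ I ρ → sem a I ρ * sem b I ρ)
    λ I ρ → trans (cong (λ xs → Vec.lookup xs zero) (multiplying I 0 (sem b I ρ) (sem a I ρ))) (+-identityʳ _)

  private
    predBody : Vec (Ex (Fin 2)) 2
    predBody = v₁ ∷ sucE v₁ ∷ []

    -- The predecessor as in primitive recursion: the first component stays one round behind the
    -- counter.
    counting : ∀ I k → iterate (stepFn predBody I) (0 ∷ 0 ∷ []) k ≡ pred k ∷ k ∷ []
    counting I zero    = refl
    counting I (suc k) = cong (stepFn predBody I) (counting I k)

    -- The bound of a loop has to hold for all initial values, whereas the closed form `counting`
    -- starts from zeros. The same applies to the other loops with a separate estimate of this kind.
    counting-≤ : ∀ I x y k → Vec.lookup (iterate (stepFn predBody I) (x ∷ y ∷ []) k) zero ≤ k + (x + y) ×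
                             Vec.lookup (iterate (stepFn predBody I) (x ∷ y ∷ []) k) (suc zero) ≤ k + (x + y)
    counting-≤ I x y zero    = m≤m+n x y , m≤n+m y x
    counting-≤ I x y (suc k) = m≤n⇒m≤1+n (proj₂ (counting-≤ I x y k)) , s≤s (proj₂ (counting-≤ I x y k))

    predLoop : Loop 2
    predLoop = record { body = predBody ; growth = 2 ; bound = λ { I B (x ∷ y ∷ []) k (h , _) l k≤ →
      let total = +≤^ 2 h (≤^ 1 h k≤) (+≤^ 1 h (≤^ 0 h (l zero)) (≤^ 0 h (l (suc zero)))) in
      λ { zero → ≤-trans (proj₁ (counting-≤ I x y k)) total
        ; (suc zero) → ≤-trans (proj₂ (counting-≤ I x y k)) total } } }

    predE : ∀ {V} → Ex V → Ex V
    predE a = recast (loopE predLoop a (constE 0 ∷ constE 0 ∷ []) zero) (λ I ρ → pred (sem a I ρ))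
      λ I ρ → cong (λ xs → Vec.lookup xs zero) (counting I (sem a I ρ))

    subBody : Vec (Ex (Fin 1)) 1
    subBody = predE v₀ ∷ []

    decreasing : ∀ I x k → iterate (stepFn subBody I) (x ∷ []) k ≡ x ∸ k ∷ []
    decreasing I x zero    = refl
    decreasing I x (suc k) = trans (cong (stepFn subBody I) (decreasing I x k))
        (cong (_∷ []) (pred[m∸n]≡m∸[1+n] x k))

    subLoop : Loop 1
    subLoop = record { body = subBody ; growth = 0 ; bound = λ { I B (x ∷ []) k (h , _) l k≤ →
      iterated (decreasing I x k) λ { zero → ≤^ 0 h (≤-trans (m∸n≤m x k) (l zero)) } } }

  _⊖_ : ∀ {V} → Ex V → Ex V → Ex V
  a ⊖ b = recast (loopE subLoop b (a ∷ []) zero) (λ I ρ → sem a I ρ ∸ sem b I ρ)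
    λ I ρ → cong (λ xs → Vec.lookup xs zero) (decreasing I (sem a I ρ) (sem b I ρ))

  private
    ifBody : Vec (Ex (Fin 2)) 2
    ifBody = v₁ ∷ v₁ ∷ []

    choosing : ∀ I x y k → iterate (stepFn ifBody I) (x ∷ y ∷ []) k ≡ ifz k x y ∷ y ∷ []
    choosing I x y zero    = refl
    choosing I x y (suc k) = cong (stepFn ifBody I) (choosing I x y k)

    ifLoop : Loop 2
    ifLoop = record { body = ifBody ; growth = 0 ; bound = λ { I B (x ∷ y ∷ []) k (h , _) l k≤ →
      iterated (choosing I x y k) λ { zero → ≤^ 0 h (either k (l zero) (l (suc zero))) ; (suc zero) → ≤^ 0 h
          (l (suc zero)) } } }
      where
      either : ∀ {x y B} k → x ≤ B → y ≤ B → ifz k x y ≤ B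
      either zero    l m = l
      either (suc _) l m = m

  ifE : ∀ {V} → Ex V → Ex V → Ex V → Ex V
  ifE c a b = recast (loopE ifLoop c (a ∷ b ∷ []) zero) (λ I ρ → ifz (sem c I ρ) (sem a I ρ) (sem b I ρ))
    λ I ρ → cong (λ xs → Vec.lookup xs zero) (choosing I (sem a I ρ) (sem b I ρ) (sem c I ρ))

  private
    divBody : Vec (Ex (Fin 3)) 3
    divBody = ifE (v₂ ⊖ sucE v₁) (sucE v₀) v₀ ∷ ifE (v₂ ⊖ sucE v₁) (constE 0) (sucE v₁) ∷ v₂ ∷ []

    dividing : ∀ I y k → iterate (stepFn divBody I) (0 ∷ 0 ∷ y ∷ []) k ≡ quot k y ∷ rem k y ∷ y ∷ []
    dividing I y zero    = refl
    dividing I y (suc k) = cong (stepFn divBody I) (dividing I y k)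

    dividing-≤ : ∀ I q r y k → let xs = iterate (stepFn divBody I) (q ∷ r ∷ y ∷ []) k in
      Vec.lookup xs zero ≤ k + q × Vec.lookup xs (suc zero) ≤ k + r × Vec.lookup xs (suc (suc zero)) ≤ y
    dividing-≤ I q r y zero = ≤-refl , ≤-refl , ≤-refl
    dividing-≤ I q r y (suc k) with iterate (stepFn divBody I) (q ∷ r ∷ y ∷ []) k | dividing-≤ I q r y k
    ... | q′ ∷ r′ ∷ y′ ∷ [] | a , b , c with y′ ∸ suc r′
    ... | zero  = s≤s a , z≤n , c
    ... | suc _ = m≤n⇒m≤1+n a , s≤s b , c

    divLoop : Loop 3
    divLoop = record { body = divBody ; growth = 1 ; bound = λ { I B (q ∷ r ∷ y ∷ []) k (h , _) l k≤ →
      let a , b , c = dividing-≤ I q r y k in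
      λ { zero → ≤-trans a (+≤^ 1 h (≤^ 0 h k≤) (≤^ 0 h (l zero)))
        ; (suc zero) → ≤-trans b (+≤^ 1 h (≤^ 0 h k≤) (≤^ 0 h (l (suc zero))))
        ; (suc (suc zero)) → ≤-trans c (≤^ 1 h (l (suc (suc zero)))) } } }

  quotE remE : ∀ {V} → Ex V → Ex V → Ex V
  quotE a b = recast (loopE divLoop a (constE 0 ∷ constE 0 ∷ b ∷ []) zero) (λ I ρ → quot (sem a I ρ)
      (sem b I ρ))
    λ I ρ → cong (λ xs → Vec.lookup xs zero) (dividing I (sem b I ρ) (sem a I ρ))
  remE a b = recast (loopE divLoop a (constE 0 ∷ constE 0 ∷ b ∷ []) (suc zero))
      (λ I ρ → rem (sem a I ρ) (sem b I ρ))
    λ I ρ → cong (λ xs → Vec.lookup xs (suc zero)) (dividing I (sem b I ρ) (sem a I ρ))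

-- Tapes as numbers: the content in base 3, the leftmost cell being the least
-- significant digit, and 3 ^ h for a head in position h.

digit : Symbol → ℕ
digit blank       = 0
digit (bit false) = 1
digit (bit true)  = 2

digit<3 : ∀ s → digit s < 3
digit<3 blank       = s≤s z≤n
digit<3 (bit false) = s≤s (s≤s z≤n)
digit<3 (bit true)  = s≤s (s≤s (s≤s z≤n))

code : List Symbol → ℕ
code []       = 0
code (s ∷ xs) = digit s + code xs * 3

code-< : ∀ xs → code xs < 3 ^ length xs
code-< []       = s≤s z≤n
code-< (s ∷ xs) = begin-strict
  digit s + code xs * 3 <⟨ +-monoˡ-< (code xs * 3) (digit<3 s) ⟩
  suc (code xs) * 3     ≤⟨ *-monoˡ-≤ 3 (code-< xs) ⟩
  3 ^ length xs * 3     ≡⟨ *-comm (3 ^ length xs) 3 ⟩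
  3 ^ suc (length xs)   ∎
  where open ≤-Reasoning

-- The digit at position `h` sits between the lower digits `lo` and the higher ones `hi`, which are
-- the same for every symbol written there. Blank being the digit 0, positions beyond the listed
-- content need no special treatment.
code-split : ∀ xs h → ∃₂ λ lo hi → lo < 3 ^ h × code xs ≡ lo + (digit (cell xs h) + hi * 3) * 3 ^ h ×
             (∀ s → code (overwrite xs h s) ≡ lo + (digit s + hi * 3) * 3 ^ h)
code-split []       zero    = 0 , 0 , s≤s z≤n , refl , λ s → sym (*-identityʳ _)
code-split (x ∷ xs) zero    = 0 , code xs , s≤s z≤n , sym (*-identityʳ _) , λ s → sym (*-identityʳ _)
code-split []       (suc h) with code-split [] h
... | lo , hi , l , e , f = lo * 3 , hi , ≤-trans (s≤s (m≤n+m (lo * 3) 2))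
    (≤-trans (*-monoˡ-≤ 3 l) (≤-reflexive (*-comm (3 ^ h) 3))) ,
  trans (cong (_* 3) e) (scale lo (hi * 3) (3 ^ h)) , λ s → trans (cong (_* 3) (f s))
      (scale lo (digit s + hi * 3) (3 ^ h))
  where
  scale : ∀ lo m p → (lo + m * p) * 3 ≡ lo * 3 + m * (3 * p)
  scale = solve-∀
code-split (x ∷ xs) (suc h) with code-split xs h
... | lo , hi , l , e , f = digit x + lo * 3 , hi ,
  (≤-trans (+-monoˡ-< (lo * 3) (digit<3 x)) (≤-trans (*-monoˡ-≤ 3 l) (≤-reflexive (*-comm (3 ^ h) 3)))) ,
  trans (cong (λ c → digit x + c * 3) e) (scale (digit x) lo (digit (cell xs h) + hi * 3) (3 ^ h)) ,
  λ s → trans (cong (λ c → digit x + c * 3) (f s)) (scale (digit x) lo (digit s + hi * 3) (3 ^ h))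
  where
  scale : ∀ d lo m p → d + (lo + m * p) * 3 ≡ d + lo * 3 + m * (3 * p)
  scale = solve-∀

code-scan : ∀ xs h → rem (quot (code xs) (3 ^ h)) 3 ≡ digit (cell xs h)
code-scan xs h with code-split xs h
... | lo , hi , l , e , _ = begin
  rem (quot (code xs) (3 ^ h)) 3   ≡⟨ cong (λ c → rem (quot c (3 ^ h)) 3) e ⟩
  rem (quot (lo + m * 3 ^ h) (3 ^ h)) 3 ≡⟨ cong (λ q → rem q 3) (proj₁ (quotRem-unique m l)) ⟩
  rem m 3                          ≡⟨ proj₂ (quotRem-unique hi (digit<3 (cell xs h))) ⟩
  digit (cell xs h)                ∎
  where
  open ≡-Reasoning
  m = digit (cell xs h) + hi * 3

-- The new digit is added before the old one is taken away, so that the truncated subtraction is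
-- exact.
code-overwrite : ∀ xs h s → code xs + digit s * 3 ^ h ∸ digit (cell xs h) * 3 ^ h ≡ code (overwrite xs h s)
code-overwrite xs h s with code-split xs h
... | lo , hi , _ , e , f = trans (cong (λ c → c + digit s * 3 ^ h ∸ digit (cell xs h) * 3 ^ h) e)
  (trans (exchange lo (digit (cell xs h)) (digit s) (hi * 3) (3 ^ h)) (sym (f s)))
  where
  exchange : ∀ l a b h p → l + (a + h) * p + b * p ∸ a * p ≡ l + (b + h) * p
  exchange l a b h p = trans (cong (_∸ a * p) (shuffle l a b h p)) (m+n∸n≡m _ (a * p))
    where
    shuffle : ∀ l a b h p → l + (a + h) * p + b * p ≡ l + (b + h) * p + a * p
    shuffle = solve-∀

-- On the leftmost cell the power is 1 and its quotient by 3 is 0; the case distinction then keeps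
-- the head where it is.
moved : Move → ℕ → ℕ
moved left  p = ifz (quot p 3) 1 (quot p 3)
moved right p = p * 3
moved stay  p = p

moved-head : ∀ d h → moved d (3 ^ h) ≡ 3 ^ move d h
moved-head left  zero    = refl
moved-head left  (suc h) with 3 ^ h in eq | quotRem-unique {3} (3 ^ h) {0} (s≤s z≤n)
... | zero  | _     = contradiction (sym eq) (<⇒≢ (m^n>0 3 h))
... | suc p | e , _ = trans (cong (λ q → ifz q 1 q) (trans (cong (λ x → quot x 3) (*-comm 3 (suc p))) e)) refl
moved-head right h = *-comm (3 ^ h) 3
moved-head stay  h = refl

-- Bits and logarithms

bitℕ : Bool → ℕ
bitℕ b = if b then 1 else 0

parity : ∀ v → v ≡ bitℕ (testBit v 0) + ⌊ v /2⌋ * 2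
parity zero          = refl
parity (suc zero)    = refl
parity (suc (suc v)) = trans (cong (2 +_) (parity v))
  (trans (sym (+-assoc 2 b _)) (trans (cong (_+ ⌊ v /2⌋ * 2) (+-comm 2 b)) (+-assoc b 2 _)))
  where b = bitℕ (testBit v 0)

bitℕ<2 : ∀ b → bitℕ b < 2
bitℕ<2 true  = s≤s (s≤s z≤n)
bitℕ<2 false = s≤s z≤n

quot-2 : ∀ v → quot v 2 ≡ ⌊ v /2⌋
quot-2 v = trans (cong (λ x → quot x 2) (parity v)) (proj₁ (quotRem-unique ⌊ v /2⌋ (bitℕ<2 (testBit v 0))))

rem-2 : ∀ v → rem v 2 ≡ bitℕ (testBit v 0)
rem-2 v = trans (cong (λ x → rem x 2) (parity v)) (proj₂ (quotRem-unique ⌊ v /2⌋ (bitℕ<2 (testBit v 0))))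

iterate-suc : ∀ {A : Set} (f : A → A) x n → iterate f x (suc n) ≡ iterate f (f x) n
iterate-suc f x zero    = refl
iterate-suc f x (suc n) = cong f (iterate-suc f x n)

-- Ceilings and floors of logarithms

⌈log₂⌉-half : ∀ n → 2 ≤ n → ⌈log₂ n ⌉ ≡ suc ⌈log₂ ⌈ n /2⌉ ⌉
⌈log₂⌉-half n l with ⌈log₂ n ⌉ in eq | ⌈log₂⌈n/2⌉⌉≡⌈log₂n⌉∸1 n
... | zero  | _ = contradiction (≤-trans (⌈log₂⌉-mono-≤ l) (≤-reflexive eq)) λ ()
... | suc k | e = cong suc (sym e)

⌈log₂⌉-≥ : ∀ n → n ≤ 2 ^ ⌈log₂ n ⌉
⌈log₂⌉-≥ = <-rec _ go
  where
  open ≤-Reasoning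
  go : ∀ n → (∀ {m} → m < n → m ≤ 2 ^ ⌈log₂ m ⌉) → n ≤ 2 ^ ⌈log₂ n ⌉
  go zero            _ = z≤n
  go (suc zero)      _ = s≤s z≤n
  go n@(suc (suc k)) h = begin
    n                        ≡⟨ sym (⌊n/2⌋+⌈n/2⌉≡n n) ⟩
    ⌊ n /2⌋ + ⌈ n /2⌉        ≤⟨ +-monoˡ-≤ ⌈ n /2⌉ (⌊n/2⌋≤⌈n/2⌉ n) ⟩
    ⌈ n /2⌉ + ⌈ n /2⌉        ≡⟨ cong (⌈ n /2⌉ +_) (sym (+-identityʳ _)) ⟩
    2 * ⌈ n /2⌉              ≤⟨ *-monoʳ-≤ 2 (h (⌈n/2⌉<n k)) ⟩
    2 ^ suc ⌈log₂ ⌈ n /2⌉ ⌉  ≡⟨ cong (2 ^_) (sym (⌈log₂⌉-half n (s≤s (s≤s z≤n)))) ⟩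
    2 ^ ⌈log₂ n ⌉            ∎

⌈log₂⌉-< : ∀ {n L} → 2 ^ L < n → L < ⌈log₂ n ⌉
⌈log₂⌉-< {n} {L} l = ≰⇒> λ h → <⇒≱ l (≤-trans (⌈log₂⌉-≥ n) (^-monoʳ-≤ 2 h))

⌈log₂⌉-≤ : ∀ {n L} → n ≤ 2 ^ L → ⌈log₂ n ⌉ ≤ L
⌈log₂⌉-≤ {n} {L} l = ≤-trans (⌈log₂⌉-mono-≤ l) (≤-reflexive (⌈log₂2^n⌉≡n L))

⌊log₂⌋-half : ∀ n → 2 ≤ n → ⌊log₂ n ⌋ ≡ suc ⌊log₂ ⌊ n /2⌋ ⌋
⌊log₂⌋-half n l with ⌊log₂ n ⌋ in eq | ⌊log₂⌊n/2⌋⌋≡⌊log₂n⌋∸1 n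
... | zero  | _ = contradiction (≤-trans (⌊log₂⌋-mono-≤ l) (≤-reflexive eq)) λ ()
... | suc k | e = cong suc (sym e)

⌊log₂⌋<⇒ : ∀ v → v < 2 ^ suc ⌊log₂ v ⌋
⌊log₂⌋<⇒ = <-rec _ go
  where
  go : ∀ n → (∀ {m} → m < n → m < 2 ^ suc ⌊log₂ m ⌋) → n < 2 ^ suc ⌊log₂ n ⌋
  go zero          _ = s≤s z≤n
  go (suc zero)    _ = s≤s (s≤s z≤n)
  go n@(suc (suc k)) h = begin-strict
    n                                ≡⟨ parity n ⟩
    bitℕ (testBit n 0) + ⌊ n /2⌋ * 2 <⟨ +-monoˡ-< (⌊ n /2⌋ * 2) (bitℕ<2 (testBit n 0)) ⟩
    suc ⌊ n /2⌋ * 2                  ≤⟨ *-monoˡ-≤ 2 (h (⌊n/2⌋<n (suc k))) ⟩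
    2 ^ suc ⌊log₂ ⌊ n /2⌋ ⌋ * 2      ≡⟨ *-comm (2 ^ suc ⌊log₂ ⌊ n /2⌋ ⌋) 2 ⟩
    2 ^ suc (suc ⌊log₂ ⌊ n /2⌋ ⌋)    ≡⟨ cong (λ l → 2 ^ suc l) (sym (⌊log₂⌋-half n (s≤s (s≤s z≤n)))) ⟩
    2 ^ suc ⌊log₂ n ⌋                ∎
    where open ≤-Reasoning

⌊log₂⌋-≤ : ∀ v → 0 < v → 2 ^ ⌊log₂ v ⌋ ≤ v
⌊log₂⌋-≤ = <-rec _ go
  where
  go : ∀ n → (∀ {m} → m < n → 0 < m → 2 ^ ⌊log₂ m ⌋ ≤ m) → 0 < n → 2 ^ ⌊log₂ n ⌋ ≤ n
  go (suc zero)      _ _ = s≤s z≤n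
  go n@(suc (suc k)) h _ = begin
    2 ^ ⌊log₂ n ⌋               ≡⟨ cong (2 ^_) (⌊log₂⌋-half n (s≤s (s≤s z≤n))) ⟩
    2 * 2 ^ ⌊log₂ ⌊ n /2⌋ ⌋     ≤⟨ *-monoʳ-≤ 2 (h (⌊n/2⌋<n (suc k)) (s≤s z≤n)) ⟩
    2 * ⌊ n /2⌋                 ≡⟨ *-comm 2 ⌊ n /2⌋ ⟩
    ⌊ n /2⌋ * 2                 ≤⟨ m≤n+m _ (bitℕ (testBit n 0)) ⟩
    bitℕ (testBit n 0) + ⌊ n /2⌋ * 2 ≡⟨ sym (parity n) ⟩
    n                           ∎
    where open ≤-Reasoning

-- Strings of bits as numbers

readNumber-++ : ∀ a bs cs → readNumber a (holding (bs ++ cs)) ≡ readNumber (readNumber a (holding bs))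
    (holding cs)
readNumber-++ a []       cs = refl
readNumber-++ a (b ∷ bs) cs = readNumber-++ _ bs cs

binary-snoc : ∀ L v → binary (suc L) v ≡ binary L ⌊ v /2⌋ ++ testBit v 0 ∷ []
binary-snoc zero    v = refl
binary-snoc (suc L) v = cong (testBit v (suc L) ∷_) (binary-snoc L v)

horner-binary : ∀ L v → v < 2 ^ L → horner (binary L v) ≡ v
horner-binary zero    zero v< = refl
horner-binary zero    (suc v) (s≤s ())
horner-binary (suc L) v    v< = begin
  horner (binary (suc L) v)                     ≡⟨ cong horner (binary-snoc L v) ⟩
  horner (binary L ⌊ v /2⌋ ++ testBit v 0 ∷ []) ≡⟨ readNumber-++ 0 (binary L ⌊ v /2⌋) _ ⟩
  2 * horner (binary L ⌊ v /2⌋) + b             ≡⟨ cong (λ x → 2 * x + b) (horner-binary L ⌊ v /2⌋ half<) ⟩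
  2 * ⌊ v /2⌋ + b                               ≡⟨ cong₂ _+_ (*-comm 2 ⌊ v /2⌋) refl ⟩
  ⌊ v /2⌋ * 2 + b                               ≡⟨ +-comm _ b ⟩
  b + ⌊ v /2⌋ * 2                               ≡⟨ sym (parity v) ⟩
  v                                             ∎
  where
  open ≡-Reasoning
  b = bitℕ (testBit v 0)
  half< : ⌊ v /2⌋ < 2 ^ L
  half< = *-cancelˡ-< 2 _ _ (≤-<-trans (≤-trans (≤-reflexive (*-comm 2 ⌊ v /2⌋))
      (≤-trans (m≤n+m _ b) (≤-reflexive (sym (parity v))))) v<)

horner-numeral : ∀ v → horner (numeral v) ≡ v
horner-numeral v = horner-binary (suc ⌊log₂ v ⌋) v (⌊log₂⌋<⇒ v)

length-numeral : ∀ v → length (numeral v) ≡ suc ⌊log₂ v ⌋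
length-numeral v = trans (length-map (testBit v) (downFrom (suc ⌊log₂ v ⌋))) (length-downFrom (suc ⌊log₂ v ⌋))

-- Without leading zeros a string is hardly longer than the logarithm of its value. The numeral of 0
-- has length 1, which is why the successor of the value appears. Rewinding read-only tapes depends
-- on this.
numeral-compact : ∀ v → length (numeral v) ≤ suc (horner (numeral v))
numeral-compact v = subst₂ _≤_ (sym (length-numeral v)) (cong suc (sym (horner-numeral v))) (s≤s (log≤ v))
  where
  log≤ : ∀ v → ⌊log₂ v ⌋ ≤ v
  log≤ zero    = z≤n
  log≤ (suc v) = <⇒≤ (<-≤-trans (n<b^n ≤-refl ⌊log₂ suc v ⌋) (⌊log₂⌋-≤ (suc v) (s≤s z≤n)))

cell-binary-< : ∀ L v h → h < L → cell (holding (binary L v)) h ≡ bit (testBit v (L ∸ suc h))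
cell-binary-< (suc L) v zero    l       = refl
cell-binary-< (suc L) v (suc h) (s≤s l) = cell-binary-< L v h l

cell-binary-≥ : ∀ L v h → L ≤ h → cell (holding (binary L v)) h ≡ blank
cell-binary-≥ zero    v h       l       = refl
cell-binary-≥ (suc L) v (suc h) (s≤s l) = cell-binary-≥ L v h l

half : ℕ → ℕ → ℕ
half v zero    = v
half v (suc k) = ⌊ half v k /2⌋

half-≤ : ∀ v k → half v k ≤ v
half-≤ v zero    = ≤-refl
half-≤ v (suc k) = ≤-trans (⌊n/2⌋≤n (half v k)) (half-≤ v k)

half-testBit : ∀ v j → testBit (half v j) 0 ≡ testBit v j
half-testBit v zero    = refl
half-testBit v (suc j) = trans (cong (λ x → testBit x 0) (half-suc v j)) (half-testBit ⌊ v /2⌋ j)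
  where
  half-suc : ∀ v j → ⌊ half v j /2⌋ ≡ half ⌊ v /2⌋ j
  half-suc v zero    = refl
  half-suc v (suc j) = cong ⌊_/2⌋ (half-suc v j)

-- Terms for tapes, bits and logarithms, and case distinctions

module Toolbox (Sg : Signature) where
  open Signature Sg
  open Terms Sg using (Tm)
  open Arithmetic Sg public

  private
    head≡ : ∀ {n} {xs ys : Vec ℕ (suc n)} → xs ≡ ys → Vec.lookup xs zero ≡ Vec.lookup ys zero
    head≡ = cong λ xs → Vec.lookup xs zero

  module _ {V : Set} where

    scanE : Ex V → Ex V → Ex V
    scanE N p = remE (quotE N p) (constE 3)

    writeE : Ex V → Ex V → Ex V → Ex V
    writeE N p d = N ⊕ d ⊗ p ⊖ scanE N p ⊗ p

    movedE : Move → Ex V → Ex V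
    movedE left  p = ifE (quotE p (constE 3)) (constE 1) (quotE p (constE 3))
    movedE right p = p ⊗ constE 3
    movedE stay  p = p

    sem-movedE : ∀ d p I ρ → sem (movedE d p) I ρ ≡ moved d (sem p I ρ)
    sem-movedE left  p I ρ = refl
    sem-movedE right p I ρ = refl
    sem-movedE stay  p I ρ = refl

    caseSym : Ex V → (Symbol → Ex V) → Ex V
    caseSym e k = ifE e (k blank) (ifE (e ⊖ constE 1) (k (bit false)) (k (bit true)))

    sem-caseSym : ∀ {e k I ρ} s → sem e I ρ ≡ digit s → sem (caseSym e k) I ρ ≡ sem (k s) I ρ
    sem-caseSym {e} {k} {I} {ρ} s h = trans (cong choose h) (chosen s)
      where
      choose : ℕ → ℕ
      choose x = ifz x (sem (k blank) I ρ) (ifz (x ∸ 1) (sem (k (bit false)) I ρ) (sem (k (bit true)) I ρ))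
      chosen : ∀ s → choose (digit s) ≡ sem (k s) I ρ
      chosen blank       = refl
      chosen (bit false) = refl
      chosen (bit true)  = refl

    caseFin : ∀ n → Ex V → (Fin n → Ex V) → Ex V
    caseFin zero    e k = constE 0
    caseFin (suc n) e k = ifE e (k zero) (caseFin n (e ⊖ constE 1) (k ∘ suc))

    sem-caseFin : ∀ n {e k I ρ} i → sem e I ρ ≡ toℕ i → sem (caseFin n e k) I ρ ≡ sem (k i) I ρ
    sem-caseFin (suc n) {e} {k} {I} {ρ} zero h =
      cong (λ x → ifz x (sem (k zero) I ρ) (sem (caseFin n (e ⊖ constE 1) (k ∘ suc)) I ρ)) h
    sem-caseFin (suc n) {e} {k} {I} {ρ} (suc i) h =
      trans (cong (λ x → ifz x (sem (k zero) I ρ) (sem (caseFin n (e ⊖ constE 1) (k ∘ suc)) I ρ)) h)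
        (sem-caseFin n i (cong (_∸ 1) h))

    -- Serves to write a transition function, which depends on finite data only, as one finite term.
    caseVec : ∀ {n} → Vec (Ex V) n → (Vec Symbol n → Ex V) → Ex V
    caseVec []       k = k []
    caseVec (e ∷ es) k = caseSym e λ s → caseVec es (k ∘ (s ∷_))

    sem-caseVec : ∀ {n} (es : Vec (Ex V) n) {k I ρ} ss → (∀ i → sem (Vec.lookup es i) I ρ ≡ digit
        (Vec.lookup ss i)) →
                  sem (caseVec es k) I ρ ≡ sem (k ss) I ρ
    sem-caseVec []       []       h = refl
    sem-caseVec (e ∷ es) {k} (s ∷ ss) h =
      trans (sem-caseSym {e = e} {λ s → caseVec es (k ∘ (s ∷_))} s (h zero)) (sem-caseVec es ss (h ∘ suc))

  private
    readBody : Vec (Ex (Fin 2)) 2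
    readBody = ifE (remE v₀ (constE 3)) v₀ (quotE v₀ (constE 3)) ∷
               ifE (remE v₀ (constE 3)) v₁ (v₁ ⊕ v₁ ⊕ (remE v₀ (constE 3) ⊖ constE 1)) ∷ []

    -- The accumulator is doubled in every round, but the code is divided by 3 at the same time. The
    -- product of the two successors does not grow, because `2 * suc q ≤ suc N` for the quotient `q`
    -- of a code `N` whose last digit is not 0.
    reading-≤ : ∀ I N a k → let xs = iterate (stepFn readBody I) (N ∷ a ∷ []) k in
      suc (Vec.lookup xs zero) * suc (Vec.lookup xs (suc zero)) ≤ suc N * suc a
    reading-≤ I N a zero = ≤-refl
    reading-≤ I N a (suc k) with iterate (stepFn readBody I) (N ∷ a ∷ []) k | reading-≤ I N a k
    ... | N′ ∷ a′ ∷ [] | l with rem N′ 3 | quotRem-spec N′ 3 (s≤s z≤n)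
    ... | zero  | _ = l
    ... | suc r | e , s≤s r<2 = ≤-trans
        (≤-trans (*-monoʳ-≤ (suc (quot N′ 3)) (s≤s (+-monoʳ-≤ (a′ + a′) (s≤s⁻¹ r<2))))
          (≤-reflexive (shuffle (quot N′ 3) a′)))
        (≤-trans (*-monoˡ-≤ (suc a′) (≤-trans (smaller (quot N′ 3) r) (≤-reflexive (cong suc (sym e))))) l)
      where
      shuffle : ∀ q a → suc q * suc (a + a + 1) ≡ (2 * suc q) * suc a
      shuffle = solve-∀
      smaller : ∀ q r → 2 * suc q ≤ suc (suc (r + q * 3))
      smaller q r = s≤s (≤-trans (≤-reflexive (+-suc q (q + 0)))
          (s≤s (≤-trans (≤-trans (≤-reflexive (lemma q)) (*-monoʳ-≤ q (s≤s (s≤s (z≤n {1})))))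
          (m≤n+m (q * 3) r))))
        where
        lemma : ∀ q → q + (q + 0) ≡ q * 2
        lemma = solve-∀

    -- Every bit read makes the code smaller, so the code itself is a sufficient number of rounds.
    -- Blank as digit 0 stops the reading.
    reading : ∀ I xs a k → code xs ≤ k → Vec.lookup (iterate (stepFn readBody I) (code xs ∷ a ∷ []) k)
        (suc zero) ≡ readNumber a xs
    reading I [] a k l = cong (λ xs → Vec.lookup xs (suc zero)) (fixed k)
      where
      fixed : ∀ k → iterate (stepFn readBody I) (0 ∷ a ∷ []) k ≡ 0 ∷ a ∷ []
      fixed zero    = refl
      fixed (suc k) = cong (stepFn readBody I) (fixed k)
    reading I (blank ∷ xs) a k l = cong (λ xs → Vec.lookup xs (suc zero)) (fixed k)
      where
      fixed : ∀ k → iterate (stepFn readBody I) (code xs * 3 ∷ a ∷ []) k ≡ code xs * 3 ∷ a ∷ []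
      fixed zero    = refl
      fixed (suc k) = trans (cong (stepFn readBody I) (fixed k))
        (cong (λ r → ifz r (code xs * 3) (quot (code xs * 3) 3) ∷ ifz r a (a + a + (r ∸ 1)) ∷ [])
            (proj₂ (quotRem-unique {3} (code xs) {0} (s≤s z≤n))))
    reading I (bit false ∷ xs) a zero ()
    reading I (bit true ∷ xs) a zero ()
    reading I (bit b ∷ xs) a (suc k) l =
      trans (cong (λ ys → Vec.lookup ys (suc zero)) (trans (iterate-suc (stepFn readBody I) _ k)
        (cong (λ ys → iterate (stepFn readBody I) ys k) (first b))))
        (reading I xs _ k (s≤s⁻¹ (≤-trans (s≤s (≤-trans (m≤m*n (code xs) 3) (≤-reflexive refl)))
            (≤-trans (+-monoˡ-≤ (code xs * 3) (1≤digit b)) l))))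
      where
      1≤digit : ∀ b → 1 ≤ digit (bit b)
      1≤digit true  = s≤s z≤n
      1≤digit false = s≤s z≤n
      doubled : ∀ b → a + a + (digit (bit b) ∸ 1) ≡ 2 * a + (if b then 1 else 0)
      doubled true  = cong (_+ 1) (cong (a +_) (sym (+-identityʳ a)))
      doubled false = cong (_+ 0) (cong (a +_) (sym (+-identityʳ a)))
      first : ∀ b → stepFn readBody I (code (bit b ∷ xs) ∷ a ∷ []) ≡ code xs ∷ 2 * a + (if b then 1 else 0)
          ∷ []
      first b with quotRem-unique {3} (code xs) (digit<3 (bit b))
      ... | q , r = trans (cong₂ (λ q r → ifz r (code (bit b ∷ xs)) q ∷ ifz r a (a + a + (r ∸ 1)) ∷ []) q r)
        (trans (nonzero b) (cong (λ x → code xs ∷ x ∷ []) (doubled b)))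
        where
        nonzero : ∀ b {A B C D : ℕ} → (Vec ℕ 2 ∋ (ifz (digit (bit b)) A B ∷ ifz (digit (bit b)) C D ∷ [])) ≡
            B ∷ D ∷ []
        nonzero true  = refl
        nonzero false = refl

    readLoop : Loop 2
    readLoop = record { body = readBody ; growth = 3 ; bound = λ { I B (N ∷ a ∷ []) k (h , _) l k≤ →
      let total = ≤-trans (reading-≤ I N a k) (≤-trans (*-mono-≤ (suc≤ h (l zero)) (suc≤ h (l (suc zero))))
              (≤-reflexive (sym (^-distribˡ-+-* B 2 2)))) in
      λ { zero → ≤-trans (≤-trans (n≤1+n _)
          (m≤m*n (suc (Vec.lookup (iterate (stepFn readBody I) (N ∷ a ∷ []) k) zero)) _)) total
        ; (suc zero) → ≤-trans (≤-trans (n≤1+n _)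
            (m≤n*m (suc (Vec.lookup (iterate (stepFn readBody I) (N ∷ a ∷ []) k) (suc zero)))
            (suc (Vec.lookup (iterate (stepFn readBody I) (N ∷ a ∷ []) k) zero)))) total } } }
      where
      suc≤ : ∀ {B x} → 2 ≤ B → x ≤ B → suc x ≤ B ^ 2
      suc≤ h l = +≤^ 1 h (≤^ 0 h (≤-trans (s≤s z≤n) h)) (≤^ 0 h l)

  numberE : ∀ {V} → Ex V → Ex V
  numberE N = loopE readLoop N (N ∷ constE 0 ∷ []) (suc zero)

  sem-numberE : ∀ {V} {N : Ex V} {I ρ} t → sem N I ρ ≡ code (content t) → sem (numberE N) I ρ ≡ number t
  sem-numberE {I = I} t h = trans (cong (λ c → Vec.lookup (iterate (stepFn readBody I) (c ∷ 0 ∷ []) c)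
      (suc zero)) h)
    (trans (reading I (content t) 0 (code (content t)) ≤-refl) (sym (number-readNumber t)))

  private
    halfBody : Vec (Ex (Fin 1)) 1
    halfBody = quotE v₀ (constE 2) ∷ []

    halving : ∀ I v k → iterate (stepFn halfBody I) (v ∷ []) k ≡ half v k ∷ []
    halving I v zero    = refl
    halving I v (suc k) = trans (cong (stepFn halfBody I) (halving I v k)) (cong (_∷ []) (quot-2 (half v k)))

    halfLoop : Loop 1
    halfLoop = record { body = halfBody ; growth = 0 ; bound = λ { I B (v ∷ []) k (h , _) l k≤ zero →
      ≤^ 0 h (≤-trans (≤-reflexive (head≡ (halving I v k))) (≤-trans (half-≤ v k) (l zero))) } }

  testBitE : ∀ {V} → Ex V → Ex V → Ex V
  testBitE v j = remE (loopE halfLoop j (v ∷ []) zero) (constE 2)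

  sem-testBitE : ∀ {V} (v j : Ex V) I ρ → sem (testBitE v j) I ρ ≡ bitℕ (testBit (sem v I ρ) (sem j I ρ))
  sem-testBitE v j I ρ = trans (cong (λ x → rem x 2) (head≡ (halving I (sem v I ρ) (sem j I ρ))))
    (trans (rem-2 (half (sem v I ρ) (sem j I ρ))) (cong bitℕ (half-testBit (sem v I ρ) (sem j I ρ))))

  private
    ceilBody : Vec (Ex (Fin 3)) 3
    ceilBody = ifE (v₂ ⊖ v₁) v₀ (sucE v₀) ∷ ifE (v₂ ⊖ v₁) v₁ (v₁ ⊕ v₁) ∷ v₂ ∷ []

    -- The power is doubled only while it is below `n`, so it never exceeds its initial value plus
    -- `2 * n`, however many rounds follow.
    ceil-≤ : ∀ I L p n k → let xs = iterate (stepFn ceilBody I) (L ∷ p ∷ n ∷ []) k in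
      Vec.lookup xs zero ≤ k + L × Vec.lookup xs (suc zero) ≤ p + (n + n) × Vec.lookup xs (suc (suc zero)) ≡ n
    ceil-≤ I L p n zero = ≤-refl , m≤m+n p (n + n) , refl
    ceil-≤ I L p n (suc k) with iterate (stepFn ceilBody I) (L ∷ p ∷ n ∷ []) k | ceil-≤ I L p n k
    ... | L′ ∷ p′ ∷ n′ ∷ [] | a , b , refl with n′ ∸ p′ in eq
    ... | zero  = m≤n⇒m≤1+n a , b , refl
    ... | suc _ = s≤s a , ≤-trans (+-mono-≤ p′≤n′ p′≤n′) (m≤n+m (n′ + n′) p) , refl
      where
      p′≤n′ : p′ ≤ n′
      p′≤n′ = ≮⇒≥ λ n<p → case trans (sym eq) (m≤n⇒m∸n≡0 (<⇒≤ n<p)) of λ ()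

    Ceiling : ℕ → ℕ → Vec ℕ 3 → Set
    Ceiling n k xs = ∃ λ L → xs ≡ L ∷ 2 ^ L ∷ n ∷ [] × L ≤ ⌈log₂ n ⌉ × (n ≤ 2 ^ L ⊎ L ≡ k)

    ceiling : ∀ I n k → Ceiling n k (iterate (stepFn ceilBody I) (0 ∷ 1 ∷ n ∷ []) k)
    ceiling I n zero = 0 , refl , z≤n , inj₂ refl
    ceiling I n (suc k) with iterate (stepFn ceilBody I) (0 ∷ 1 ∷ n ∷ []) k | ceiling I n k
    ... | _ | L , refl , l , d with n ∸ 2 ^ L in eq
    ... | zero  = L , refl , l , inj₁ (m∸n≡0⇒m≤n eq)
    ... | suc _ = suc L , cong (λ x → suc L ∷ x ∷ n ∷ []) (cong (2 ^ L +_) (sym (+-identityʳ _))) , ⌈log₂⌉-<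
        2^L<n ,
      inj₂ (cong suc (case d of λ { (inj₁ n≤) → contradiction 2^L<n (≤⇒≯ n≤) ; (inj₂ e) → e }))
      where
      2^L<n : 2 ^ L < n
      2^L<n = ≰⇒> λ n≤ → case trans (sym eq) (m≤n⇒m∸n≡0 n≤) of λ ()

    ceilLoop : Loop 3
    ceilLoop = record { body = ceilBody ; growth = 2 ; bound = λ { I B (L ∷ p ∷ n ∷ []) k (h , _) l k≤ →
      let a , b , c = ceil-≤ I L p n k in
      λ { zero → ≤-trans a (+≤^ 2 h (≤^ 1 h k≤) (≤^ 1 h (l zero)))
        ; (suc zero) → ≤-trans b (+≤^ 2 h (≤^ 1 h (l (suc zero))) (+≤^ 1 h (≤^ 0 h (l (suc (suc zero))))
            (≤^ 0 h (l (suc (suc zero))))))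
        ; (suc (suc zero)) → ≤-trans (≤-reflexive c) (≤^ 2 h (l (suc (suc zero)))) } } }

  clogE : ∀ {V} → Ex V → Ex V
  clogE n = loopE ceilLoop n (constE 0 ∷ constE 1 ∷ n ∷ []) zero

  sem-clogE : ∀ {V} (n : Ex V) I ρ → sem (clogE n) I ρ ≡ ⌈log₂ sem n I ρ ⌉
  sem-clogE n I ρ with iterate (stepFn ceilBody I) (0 ∷ 1 ∷ sem n I ρ ∷ []) (sem n I ρ) | ceiling I
      (sem n I ρ) (sem n I ρ)
  ... | _ | L , refl , l , inj₁ n≤ = ≤-antisym l (⌈log₂⌉-≤ n≤)
  -- If the exponent has grown in every round it equals `n`, and `n ≤ 2 ^ n`; so `n` rounds are
  -- enough.
  ... | _ | L , refl , l , inj₂ e  = ≤-antisym l (⌈log₂⌉-≤ (subst (λ x → x ≤ 2 ^ L) e (<⇒≤ (n<b^n ≤-refl L))))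

  private
    lengthBody : Vec (Ex (Fin 2)) 2
    lengthBody = ifE (quotE v₁ (constE 2)) v₀ (sucE v₀) ∷ quotE v₁ (constE 2) ∷ []

    length-≤ : ∀ I L v k → let xs = iterate (stepFn lengthBody I) (L ∷ v ∷ []) k in
      Vec.lookup xs zero ≤ k + L × Vec.lookup xs (suc zero) ≤ v
    length-≤ I L v zero = ≤-refl , ≤-refl
    length-≤ I L v (suc k) with iterate (stepFn lengthBody I) (L ∷ v ∷ []) k | length-≤ I L v k
    ... | L′ ∷ v′ ∷ [] | a , b = chosen (quot v′ 2) , ≤-trans (≤-reflexive (quot-2 v′))
        (≤-trans (⌊n/2⌋≤n v′) b)
      where
      chosen : ∀ q → ifz q L′ (suc L′) ≤ suc (k + L)
      chosen zero    = m≤n⇒m≤1+n a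
      chosen (suc _) = s≤s a

    measuring : ∀ I k v L → v ≤ k → Vec.lookup (iterate (stepFn lengthBody I) (L ∷ v ∷ []) k) zero ≡ ⌊log₂ v
        ⌋ + L
    measuring I k zero L l = head≡ (fixed k)
      where
      fixed : ∀ k → iterate (stepFn lengthBody I) (L ∷ 0 ∷ []) k ≡ L ∷ 0 ∷ []
      fixed zero    = refl
      fixed (suc k) = cong (stepFn lengthBody I) (fixed k)
    measuring I (suc k) (suc zero) L l =
      trans (cong (λ ys → Vec.lookup ys zero) (iterate-suc (stepFn lengthBody I) _ k)) (measuring I k 0 L z≤n)
    measuring I (suc k) v@(suc (suc w)) L l =
      trans (cong (λ ys → Vec.lookup ys zero) (trans (iterate-suc (stepFn lengthBody I) _ k)
        (cong (λ q → iterate (stepFn lengthBody I) (ifz q L (suc L) ∷ q ∷ []) k) (quot-2 v))))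
        (trans (measuring I k ⌊ v /2⌋ (suc L) (s≤s⁻¹ (≤-trans (⌊n/2⌋<n (suc w)) l)))
          (trans (+-suc ⌊log₂ ⌊ v /2⌋ ⌋ L) (cong (_+ L) (sym (⌊log₂⌋-half v (s≤s (s≤s z≤n)))))))

    lengthLoop : Loop 2
    lengthLoop = record { body = lengthBody ; growth = 1 ; bound = λ { I B (L ∷ v ∷ []) k (h , _) l k≤ →
      let a , b = length-≤ I L v k in
      λ { zero → ≤-trans a (+≤^ 1 h (≤^ 0 h k≤) (≤^ 0 h (l zero))) ; (suc zero) → ≤-trans b
          (≤^ 1 h (l (suc zero))) } } }

  bitsE : ∀ {V} → Ex V → Ex V
  bitsE v = loopE lengthLoop v (constE 1 ∷ v ∷ []) zero

  sem-bitsE : ∀ {V} (v : Ex V) I ρ → sem (bitsE v) I ρ ≡ suc ⌊log₂ sem v I ρ ⌋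
  sem-bitsE v I ρ = trans (measuring I (sem v I ρ) (sem v I ρ) 1 ≤-refl) (+-comm _ 1)

  powE : ∀ {V} → Ex V → ℕ → Ex V
  powE e zero    = constE 1
  powE e (suc k) = e ⊗ powE e k

  sem-powE : ∀ {V} (e : Ex V) k I ρ → sem (powE e k) I ρ ≡ sem e I ρ ^ k
  sem-powE e zero    I ρ = refl
  sem-powE e (suc k) I ρ = cong (sem e I ρ *_) (sem-powE e k I ρ)

-- Visited cells and head positions

cells-≤ : ∀ {m} ts → All (λ t → head t < m) ts → cells ts ≤ m
cells-≤ []       []       = z≤n
cells-≤ (t ∷ ts) (h ∷ hs) = ⊔-lub h (cells-≤ ts hs)

cells-head : ∀ {m} ts → cells ts ≤ m → All (λ t → head t < m) ts
cells-head []       l = []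
cells-head (t ∷ ts) l = m⊔n≤o⇒m≤o (suc (head t)) (cells ts) l ∷ cells-head ts (m⊔n≤o⇒n≤o (suc (head t))
    (cells ts) l)

all-toList : ∀ {A : Set} {P : A → Set} {n} (xs : Vec A n) → (∀ i → P (Vec.lookup xs i)) → All P
    (Vec.toList xs)
all-toList []       h = []
all-toList (x ∷ xs) h = h zero ∷ all-toList xs (h ∘ suc)

all-fromList : ∀ {A : Set} {P : A → Set} {n} (xs : Vec A n) → All P (Vec.toList xs) → ∀ i → P
    (Vec.lookup xs i)
all-fromList (x ∷ xs) (p ∷ ps) zero    = p
all-fromList (x ∷ xs) (p ∷ ps) (suc i) = all-fromList xs ps i

map-map : ∀ {A B C : Set} {f : A → B} {g : B → C} (x : Maybe A) → Maybe.map g (Maybe.map f x) ≡ Maybe.map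
    (g ∘ f) x
map-map (just _) = refl
map-map nothing  = refl

-- Programs on random-access machines

inputSignature : Signature
inputSignature = record
  { Ask = ⊤ ; Read = ⊥ ; askArity = λ _ → 1 ; readArity = λ ()
  ; _≟ᴬ_ = λ _ _ → yes refl ; _≟ᴿ_ = λ () }

inputCode : InputSymbol → ℕ
inputCode (symbol (bit b)) = bitℕ b
inputCode (symbol blank)   = 0
inputCode ◁                = 2

inputCode≤2 : ∀ x → inputCode x ≤ 2
inputCode≤2 (symbol (bit b)) = <⇒≤ (bitℕ<2 b)
inputCode≤2 (symbol blank)   = z≤n
inputCode≤2 ◁                = ≤-refl

inputInterpretation : List Bool → Interpretation inputSignature
inputInterpretation w = record
  { askᴵ = λ { _ (i ∷ []) → inputCode (inputSymbol w i) } ; readᴵ = λ () }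

module RandomAccessPlatform (K : ℕ) where
  open Signature inputSignature
  open Platforms inputSignature (suc K)

  nameOf : Fin (2 + K) → Name
  nameOf zero    = inj₂ (inj₁ tt , zero)
  nameOf (suc j) = inj₁ j

  indexOf : Name → Fin (2 + K)
  indexOf (inj₁ j) = suc j
  indexOf (inj₂ _) = zero

  name-index : ∀ x → nameOf (indexOf x) ≡ x
  name-index (inj₁ j)                = refl
  name-index (inj₂ (inj₁ tt , zero)) = refl

  index-name : ∀ j → indexOf (nameOf j) ≡ j
  index-name zero    = refl
  index-name (suc j) = refl

  holds? : InputSymbol → Vec Symbol (2 + K) → Condition → Bool
  holds? x ss (scanned y f)  = f (Vec.lookup ss (indexOf y))
  holds? x ss (answered _ v) = inputCode x ≡ᵇ v

  actions : Ins → Vec Symbol (2 + K) → Vec (Symbol × Move) (2 + K)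
  actions i ss = Vec.tabulate λ j → effect i (nameOf j) (Vec.lookup ss j)

  -- The address-tape initially contains the symbol 0, whereas programs expect an address-tape that
  -- is not in use to be blank.
  setup : Ins
  setup = on (inj₂ (inj₁ tt , zero)) (wr blank stay)

  platform : ∀ w → Platform (inputInterpretation w)
  platform w = record
    { State     = Vec Tape (2 + K)
    ; run       = λ i ts → Vec.zipWith act (actions i (Vec.map scan ts)) ts
    ; cond      = λ c ts → holds? (inputSymbol w (number (Vec.head ts))) (Vec.map scan ts) c
    ; cellsOf   = λ ts → cells (Vec.toList ts)
    ; tapeOf    = λ ts x → Vec.lookup ts (indexOf x)
    ; headOf    = λ _ ()
    ; Fresh     = λ _ → ⊤
    ; cellsOf-≤ = λ ts h → cells-≤ (Vec.toList ts)
        (all-toList ts λ j → subst (λ i → head (Vec.lookup ts i) < _) (index-name j) (h (nameOf j)))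
    ; tape-run  = λ i ts x → trans (lookup-zipWith act (indexOf x) (actions i (Vec.map scan ts)) ts)
        (cong (λ e → act e (Vec.lookup ts (indexOf x)))
          (trans (lookup∘tabulate (λ j → effect i (nameOf j) (Vec.lookup (Vec.map scan ts) j)) (indexOf x))
            (cong₂ (effect i) (name-index x) (lookup-map (indexOf x) scan ts))))
    ; head-run  = λ _ _ ()
    ; fresh-run = λ _ _ _ → tt
    ; cond-sym  = λ x f ts → cong f (lookup-map (indexOf x) scan ts)
    ; cond-ros  = λ ()
    ; cond-ans  = λ { _ v (t ∷ ts) → refl }
    }

  initialTapes : Vec Tape (2 + K)
  initialTapes = tape (holding (false ∷ [])) 0 ∷ Vec.replicate (suc K) blankTape

  initial-cells : ∀ {m} → 0 < m → cells (Vec.toList initialTapes) ≤ m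
  initial-cells {m} l = cells-≤ (Vec.toList initialTapes) (all-toList initialTapes λ
    { zero → l ; (suc i) → subst (λ t → head t < m) (sym (lookup-replicate i blankTape)) l })

  initial-tapes : ∀ w x → Platform.tapeOf (platform w) (Platform.run (platform w) setup initialTapes) x ≈ [
      (λ _ → counter []) , (λ _ → addressTape []) ]′ x
  initial-tapes w (inj₁ j) = subst (_≈ counter []) (sym (Platform.tape-run (platform w) setup initialTapes
      (inj₁ j)))
    (blanked (lookup-replicate j blankTape))
    where
    blanked : ∀ {t} → t ≡ blankTape → act (scan t , stay) t ≈ counter []
    blanked refl = alike refl λ { zero → refl ; (suc _) → refl }
  initial-tapes w (inj₂ (inj₁ tt , zero)) = alike refl λ { zero → refl ; (suc _) → refl }

  module _ (P : Prog Ins Condition) (c : Condition) where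

    machine : RandomAccessMachine
    machine = record
      { Q         = Control nop P
      ; #Q        = proj₁ (control-finite nop P)
      ; finite    = proj₂ (control-finite nop P)
      ; q₀        = inj₁ (entry nop P)
      ; accepting = accepts nop P
      ; k         = suc K
      ; k≥1       = s≤s z≤n
      ; δ         = λ q x ss → Maybe.map (λ (q′ , i) → q′ , actions i ss) (transition nop P c q (holds? x ss))
      }

    machine-verdict : ∀ w {m t} → Exec (Platform.semantics (platform w)) (λ ts → cells (Vec.toList ts) ≤ m)
        P initialTapes t →
      cells (Vec.toList t) ≤ m → cells (Vec.toList (Platform.run (platform w) nop t)) ≤ m →
      Σ (Verdict (RandomAccess.system machine w) (RandomAccess.initial machine w)
          (Platform.cond (platform w) c t)) λ v →
        space (RandomAccess.system machine w) v ≤ m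
    machine-verdict w ex o o′ = exec-verdict (Platform.semantics (platform w)) (RandomAccess.system machine
        w) P c
      (RandomAccess.config {machine} {w}) (λ q ts → map-map (transition nop P c q _)) (λ _ _ → refl)
          (λ _ _ h → h) ex o o′

module OnRandomAccess (Pr : Programs.Program inputSignature) where
  open Programs inputSignature
  open Program Pr
  open Controller (controller Pr)
  open RandomAccessPlatform K

  raMachine : RandomAccessMachine
  raMachine = machine (control setup) accepting

  ra-decides : ∀ w {b} B v → B < 2 ^ v →
    (∀ x → Terms.Safe inputSignature (inputInterpretation w) B (initTm x) λ ()) →
    Trace (inputInterpretation w) B (λ x → Terms.⟦_⟧ inputSignature (inputInterpretation w) (initTm x) λ ())
        b →
    Σ (Verdict (RandomAccess.system raMachine w) (RandomAccess.initial raMachine w) b) λ d →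
      space (RandomAccess.system raMachine w) d ≤ 2 + v
  ra-decides w {b} B v l s t =
    let t′ , ex , c , o , o′ = executes (platform w) B v l
            (λ { _ (i ∷ []) → inputCode≤2 (inputSymbol w i) }) (λ ())
          setup initialTapes s t (initial-cells (s≤s z≤n)) (initial-tapes w ∘ inj₁) (initial-tapes w ∘ inj₂)
              (λ ()) tt
    in subst (λ b → Σ (Verdict (RandomAccess.system raMachine w) (RandomAccess.initial raMachine w) b) λ d →
          space (RandomAccess.system raMachine w) d ≤ 2 + v) c (machine-verdict (control setup) accepting w
              ex o o′)

-- Components of lists indexed by numbers

private
  variable
    X Y : Set

component : ∀ {A : Set} {P : A → Set} {xs : List A} → All P xs → (i : Fin (length xs)) → P (List.lookup xs i)
component (p ∷ ps) zero    = p
component (p ∷ ps) (suc i) = component ps i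

assemble : ∀ {A : Set} {P : A → Set} (xs : List A) → (∀ i → P (List.lookup xs i)) → All P xs
assemble []       f = []
assemble (x ∷ xs) f = f zero ∷ assemble xs (f ∘ suc)

component-assemble : ∀ {A : Set} {P : A → Set} (xs : List A) (f : ∀ i → P (List.lookup xs i)) i →
                     component (assemble {P = P} xs f) i ≡ f i
component-assemble (x ∷ xs) f zero    = refl
component-assemble (x ∷ xs) f (suc i) = component-assemble xs (f ∘ suc) i

component-map : ∀ {A : Set} {P Q : A → Set} (f : ∀ {x} → P x → Q x) {xs} (ps : All P xs) i →
                component (All.map f ps) i ≡ f (component ps i)
component-map f (p ∷ ps) zero    = refl
component-map f (p ∷ ps) (suc i) = component-map f ps i

component-zipWith : ∀ {A : Set} {P Q R : A → Set} (f : ∀ {x} → P x × Q x → R x) {xs} (ps : All P xs)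
    (qs : All Q xs) i →
                    component (All.zipWith {Q = Q} f (ps , qs)) i ≡ f (component ps i , component qs i)
component-zipWith f (p ∷ ps) (q ∷ qs) zero    = refl
component-zipWith f (p ∷ ps) (q ∷ qs) (suc i) = component-zipWith f ps qs i

component-tabulate : ∀ {A : Set} {P : A → Set} (xs : List A) (f : ∀ {x} → x ∈ xs → P x) i →
                     ∃ λ m → component (All.tabulate {P = P} f) i ≡ f {List.lookup xs i} m
component-tabulate (x ∷ xs) f zero    = here refl , refl
component-tabulate (x ∷ xs) f (suc i) = let m , e = component-tabulate xs (f ∘ there) i in there m , e

all-concat : ∀ {A : Set} {P : A → Set} {xss : List (List A)} → All (All P) xss → All P (concat xss)
all-concat []         = []
all-concat (ps ∷ pss) = Allₚ.++⁺ ps (all-concat pss)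

all-reduce : ∀ {A X : Set} {P : A → Set} {R : X → Set} (f : ∀ {x} → P x → List X) {xs} (ps : All P xs) →
             (∀ i → All R (f (component ps i))) → All (All R) (All.reduce f ps)
all-reduce f []       h = []
all-reduce f (p ∷ ps) h = h zero ∷ all-reduce f ps (h ∘ suc)

all-unreduce : ∀ {A X : Set} {P : A → Set} {R : X → Set} (f : ∀ {x} → P x → List X) {xs} (ps : All P xs) →
               All R (concat (All.reduce f ps)) → ∀ i → All R (f (component ps i))
all-unreduce f (p ∷ ps) r zero    = Allₚ.++⁻ˡ (f p) r
all-unreduce f (p ∷ ps) r (suc i) = all-unreduce f ps (Allₚ.++⁻ʳ (f p) r) i

-- The operations on a structure

element : ∀ n → ℕ → Maybe (Fin n)
element n i = Maybe.map (λ i<n → fromℕ< i<n) (dec⇒maybe (i <? n))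

elements : ∀ n {r} → Vec ℕ r → Maybe (Vec (Fin n) r)
elements n []       = just []
elements n (v ∷ vs) = Maybe.zipWith _∷_ (element n v) (elements n vs)

module _ (σ : Vocabulary) where

  private
    rels = relations σ
    funs = functions σ

  structureSignature : Signature
  structureSignature = record
    { Ask = Fin (length rels) ; Read = Fin (suc (#constants σ)) ⊎ Fin (length funs)
    ; askArity = List.lookup rels
    ; readArity = [ (λ _ → 0) , List.lookup funs ]′
    ; _≟ᴬ_ = Finₚ._≟_ ; _≟ᴿ_ = ⊎-≡-dec Finₚ._≟_ Finₚ._≟_ }

  open Signature structureSignature

  module _ (A : OrderedStructure σ) where
    open OrderedStructure A

    structureInterpretation : Interpretation structureSignature
    structureInterpretation = record
      { askᴵ  = λ i vs → Maybe.maybe (bitℕ ∘ component relᴵ i) 0 (elements size vs)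
      ; readᴵ = λ { (inj₁ c) _  → numeral (Vec.lookup (size ∷ Vec.map toℕ constᴵ) c)
                  ; (inj₂ f) vs → Maybe.maybe (numeral ∘ toℕ ∘ component funᴵ f) [] (elements size vs) } }

    private
      module I = Interpretation structureInterpretation

    structure-ask : ∀ a vs → I.askᴵ a vs ≤ 1
    structure-ask a vs with elements size vs
    ... | just xs = s≤s⁻¹ (bitℕ<2 (component relᴵ a xs))
    ... | nothing = z≤n

    structure-compact : ∀ r vs → length (I.readᴵ r vs) ≤ suc (horner (I.readᴵ r vs))
    structure-compact (inj₁ c) vs = numeral-compact (Vec.lookup (size ∷ Vec.map toℕ constᴵ) c)
    structure-compact (inj₂ f) vs with elements size vs
    ... | just xs = numeral-compact (toℕ (component funᴵ f xs))
    ... | nothing = z≤n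

    structure-bounded : ∀ {b} → 2 ≤ b → size ≤ b → Arithmetic.Bounded structureSignature
        structureInterpretation b
    structure-bounded {b} h l = h , bounded
      where
      bounded : ∀ o vs → I.⟦ o ⟧ᵒ vs ≤ b
      bounded (inj₁ a) vs = ≤-trans (structure-ask a vs) (≤-trans (s≤s z≤n) h)
      bounded (inj₂ (inj₁ zero)) vs = ≤-trans (≤-reflexive (horner-numeral size)) l
      bounded (inj₂ (inj₁ (suc c))) vs = ≤-trans
          (≤-reflexive (horner-numeral (Vec.lookup (Vec.map toℕ constᴵ) c)))
        (≤-trans (≤-reflexive (lookup-map c toℕ constᴵ)) (≤-trans (<⇒≤ (toℕ<n (Vec.lookup constᴵ c))) l))
      bounded (inj₂ (inj₂ f)) vs with elements size vs
      ... | just xs = ≤-trans (≤-reflexive (horner-numeral (toℕ (component funᴵ f xs))))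
          (≤-trans (<⇒≤ (toℕ<n (component funᴵ f xs))) l)
      ... | nothing = z≤n

-- The tapes of a direct-access machine

module DirectAccessTapes (σ : Vocabulary) (k : ℕ) where
  open Signature (structureSignature σ)
  open PerTape

  Writable : Set
  Writable = Fin k ⊎ Address

  writable : PerTape σ k X Y → Writable → X
  writable t (inj₁ j)                = Vec.lookup (work t) j
  writable t (inj₂ (inj₁ i , j))     = Vec.lookup (component (relAddress t) i) j
  writable t (inj₂ (inj₂ (inj₂ f) , j)) = Vec.lookup (component (funAddress t) f) j

  readable : PerTape σ k X Y → Read → Y
  readable t (inj₁ c) = Vec.lookup (constant t) c
  readable t (inj₂ f) = component (value t) f

  build : (Writable → X) → (Read → Y) → PerTape σ k X Y
  build f g = perTape
    (assemble (relations σ) λ i → Vec.tabulate λ j → f (inj₂ (inj₁ i , j)))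
    (assemble (functions σ) λ i → Vec.tabulate λ j → f (inj₂ (inj₂ (inj₂ i) , j)))
    (assemble (functions σ) λ i → g (inj₂ i))
    (Vec.tabulate λ c → g (inj₁ c))
    (Vec.tabulate λ j → f (inj₁ j))

  writable-build : ∀ (f : Writable → X) (g : Read → Y) x → writable (build f g) x ≡ f x
  writable-build f g (inj₁ j) = lookup∘tabulate (f ∘ inj₁) j
  writable-build f g (inj₂ (inj₁ i , j)) = trans
    (cong (λ v → Vec.lookup v j) (component-assemble (relations σ) (λ i → Vec.tabulate λ j → f
        (inj₂ (inj₁ i , j))) i))
    (lookup∘tabulate (λ j → f (inj₂ (inj₁ i , j))) j)
  writable-build f g (inj₂ (inj₂ (inj₂ i) , j)) = trans
    (cong (λ v → Vec.lookup v j) (component-assemble (functions σ) (λ i → Vec.tabulate λ j → f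
        (inj₂ (inj₂ (inj₂ i) , j))) i))
    (lookup∘tabulate (λ j → f (inj₂ (inj₂ (inj₂ i) , j))) j)

  readable-build : ∀ (f : Writable → X) (g : Read → Y) y → readable (build f g) y ≡ g y
  readable-build f g (inj₁ c) = lookup∘tabulate (g ∘ inj₁) c
  readable-build f g (inj₂ i) = component-assemble (functions σ) (g ∘ inj₂) i

-- Programs on direct-access machines

module DirectAccessStep {σ : Vocabulary} (M : DirectAccessMachine σ) (A : OrderedStructure σ) where
  private
    module D = DirectAccess M A
  open DirectAccessMachine M using (k)
  open DirectAccessTapes σ k
  open Signature (structureSignature σ)
  open Interpretation (structureInterpretation σ A)
  open OrderedStructure A
  open PerTape

  tapeNumbers : (o : Op) → PerTape σ k Tape Tape → Vec ℕ (arity o)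
  tapeNumbers o t = Vec.tabulate λ i → number (writable t (inj₂ (o , i)))

  addressed-elements : ∀ {r} (ts : Vec Tape r) → D.addressed ts ≡ elements size (Vec.map number ts)
  addressed-elements []       = refl
  addressed-elements (t ∷ ts) = cong (Maybe.zipWith _∷_ (element size (number t))) (addressed-elements ts)

  map-tabulate : ∀ {A B : Set} {n} (f : A → B) (xs : Vec A n) → Vec.map f xs ≡ Vec.tabulate
      (f ∘ Vec.lookup xs)
  map-tabulate f []       = refl
  map-tabulate f (x ∷ xs) = cong (f x ∷_) (map-tabulate f xs)

  answers-ask : ∀ t a → component (D.answers t) a ≡ Maybe.maybe (component relᴵ a) false
      (elements size (tapeNumbers (inj₁ a) t))
  answers-ask t a = trans (component-zipWith (uncurry D.answer) relᴵ (relAddress t) a)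
    (cong (Maybe.maybe (component relᴵ a) false) (trans (addressed-elements (component (relAddress t) a))
      (cong (elements size) (map-tabulate number (component (relAddress t) a)))))

  writable-scan : ∀ t x → writable (D.scanAll t) x ≡ scan (writable t x)
  writable-scan t (inj₁ j) = lookup-map j scan (work t)
  writable-scan t (inj₂ (inj₁ i , j)) = trans (cong (λ v → Vec.lookup v j) (component-map (Vec.map scan)
      (relAddress t) i))
    (lookup-map j scan (component (relAddress t) i))
  writable-scan t (inj₂ (inj₂ (inj₂ i) , j)) = trans (cong (λ v → Vec.lookup v j)
      (component-map (Vec.map scan) (funAddress t) i))
    (lookup-map j scan (component (funAddress t) i))

  readable-scan : ∀ t y → readable (D.scanAll t) y ≡ scan (readable t y)
  readable-scan t (inj₁ c) = lookup-map c scan (constant t)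
  readable-scan t (inj₂ f) = component-map scan (value t) f

  after : PerTape σ k (Symbol × Move) Move → PerTape σ k Tape Tape → PerTape σ k Tape Tape
  after a t = D.updateValues (D.actAll a t)

  writable-after : ∀ a t x → writable (after a t) x ≡ act (writable a x) (writable t x)
  writable-after a t (inj₁ j) = lookup-zipWith act j (work a) (work t)
  writable-after a t (inj₂ (inj₁ i , j)) = trans
    (cong (λ v → Vec.lookup v j) (component-zipWith (uncurry (Vec.zipWith act)) (relAddress a)
        (relAddress t) i))
    (lookup-zipWith act j (component (relAddress a) i) (component (relAddress t) i))
  writable-after a t (inj₂ (inj₂ (inj₂ i) , j)) = trans
    (cong (λ v → Vec.lookup v j) (component-zipWith (uncurry (Vec.zipWith act)) (funAddress a)
        (funAddress t) i))
    (lookup-zipWith act j (component (funAddress a) i) (component (funAddress t) i))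

  head-after : ∀ a t y → head (readable (after a t) y) ≡ head (moveReadOnly (readable a y) (readable t y))
  head-after a t (inj₁ c) = cong head (lookup-zipWith moveReadOnly c (constant a) (constant t))
  head-after a t (inj₂ f) = trans
    (cong head (component-zipWith (λ (xs , t) → tape xs (head t))
      (All.zipWith (uncurry D.valueContent) (funᴵ , funAddress (D.actAll a t))) (value (D.actAll a t)) f))
    (cong head (component-zipWith (uncurry moveReadOnly) (value a) (value t) f))

  Constants : PerTape σ k Tape Tape → Set
  Constants t = ∀ c → content (readable t (inj₁ c)) ≡ holding (readᴵ (inj₁ c) [])

  moveReadOnly-content : ∀ d t → content (moveReadOnly d t) ≡ content t
  moveReadOnly-content left  t = refl
  moveReadOnly-content stay  t = refl
  moveReadOnly-content right t with scan t
  ... | bit _ = refl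
  ... | blank = refl

  constants-after : ∀ a t → Constants t → Constants (after a t)
  constants-after a t h c = trans (cong content (lookup-zipWith moveReadOnly c (constant a) (constant t)))
    (trans (moveReadOnly-content (Vec.lookup (constant a) c) (Vec.lookup (constant t) c)) (h c))

  Contents : PerTape σ k Tape Tape → Set
  Contents t = ∀ y → content (readable t y) ≡ holding (readᴵ y (tapeNumbers (inj₂ y) t))

  -- Whatever the step does, the value-tapes are rewritten at its end according to the new
  -- addresses. Only the constant-tapes must have been right before it, which they are from the
  -- start.
  contents-after : ∀ a t → Constants t → Contents (after a t)
  contents-after a t h (inj₁ c) = constants-after a t h c
  contents-after a t h (inj₂ f) = trans
    (cong content (component-zipWith (λ (xs , t) → tape xs (head t))
      (All.zipWith (uncurry D.valueContent) (funᴵ , funAddress (D.actAll a t))) (value (D.actAll a t)) f))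
    (trans (component-zipWith (uncurry D.valueContent) funᴵ (funAddress (D.actAll a t)) f)
      (trans (cong (Maybe.maybe (λ xs → holding (numeral (toℕ (component funᴵ f xs)))) [])
        (trans (addressed-elements (component (funAddress (D.actAll a t)) f))
          (cong (elements size) (map-tabulate number (component (funAddress (D.actAll a t)) f)))))
        (distribute (elements size (tapeNumbers (inj₂ (inj₂ f)) (after a t))))))
    where
    distribute : ∀ m → Maybe.maybe (λ xs → holding (numeral (toℕ (component funᴵ f xs)))) [] m ≡
                 holding (Maybe.maybe (numeral ∘ toℕ ∘ component funᴵ f) [] m)
    distribute (just _) = refl
    distribute nothing  = refl

  initialTapes : PerTape σ k Tape Tape
  initialTapes = D.Config.tapes D.initial

  initial-writable : ∀ x → writable initialTapes x ≡ blankTape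
  initial-writable (inj₁ j) = lookup-replicate j blankTape
  initial-writable (inj₂ (inj₁ i , j)) =
    let m , e = component-tabulate {P = Vec Tape} (relations σ) (λ _ → Vec.replicate _ blankTape) i
    in trans (cong (λ v → Vec.lookup v j) e) (lookup-replicate j blankTape)
  initial-writable (inj₂ (inj₂ (inj₂ i) , j)) =
    let m , e = component-tabulate {P = Vec Tape} (functions σ) (λ _ → Vec.replicate _ blankTape) i
    in trans (cong (λ v → Vec.lookup v j) e) (lookup-replicate j blankTape)

  initial-constant : ∀ c → readable initialTapes (inj₁ c) ≡ tape (holding (readᴵ (inj₁ c) [])) 0
  initial-constant c = lookup-map c (λ v → tape (holding (numeral v)) 0) (size ∷ Vec.map toℕ constᴵ)

  initial-value : ∀ f → readable initialTapes (inj₂ f) ≡ blankTape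
  initial-value f = proj₂ (component-tabulate {P = λ _ → Tape} (functions σ) (λ _ → blankTape) f)

  initial-constants : Constants initialTapes
  initial-constants c = cong content (initial-constant c)

  charged-heads : ∀ {m} t → (∀ x → head (writable t x) < m) → cells (D.charged t) ≤ m
  charged-heads t h = cells-≤ (D.charged t) (Allₚ.++⁺
    (all-concat (all-reduce Vec.toList (relAddress t) λ i → all-toList (component (relAddress t) i) λ j → h
        (inj₂ (inj₁ i , j))))
    (Allₚ.++⁺
      (all-concat (all-reduce Vec.toList (funAddress t) λ i → all-toList (component (funAddress t) i) λ j →
          h (inj₂ (inj₂ (inj₂ i) , j))))
      (all-toList (work t) (h ∘ inj₁))))

  heads-charged : ∀ {m} t → cells (D.charged t) ≤ m → ∀ x → head (writable t x) < m
  heads-charged {m} t l = go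
    where
    rs = concat (All.reduce Vec.toList (relAddress t))
    fs = concat (All.reduce Vec.toList (funAddress t))
    all = cells-head (D.charged t) l
    go : ∀ x → head (writable t x) < m
    go (inj₁ j) = all-fromList (work t) (Allₚ.++⁻ʳ fs (Allₚ.++⁻ʳ rs all)) j
    go (inj₂ (inj₁ i , j)) = all-fromList (component (relAddress t) i)
        (all-unreduce Vec.toList (relAddress t) (Allₚ.++⁻ˡ rs all) i) j
    go (inj₂ (inj₂ (inj₂ i) , j)) = all-fromList (component (funAddress t) i)
      (all-unreduce Vec.toList (funAddress t) (Allₚ.++⁻ˡ fs (Allₚ.++⁻ʳ rs all)) i) j

module DirectAccessPlatform (σ : Vocabulary) (K : ℕ) where
  open Signature (structureSignature σ)
  open Platforms (structureSignature σ) (suc K)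
  open DirectAccessTapes σ (suc K)

  holds? : PerTape σ (suc K) Symbol Symbol → All (λ _ → Bool) (relations σ) → Condition → Bool
  holds? ss as (scanned x f)   = f (writable ss x)
  holds? ss as (scannedRo y f) = f (readable ss y)
  holds? ss as (answered a v)  = bitℕ (component as a) ≡ᵇ v

  actions : Ins → PerTape σ (suc K) Symbol Symbol → PerTape σ (suc K) (Symbol × Move) Move
  actions i ss = build (λ x → effect i x (writable ss x)) (readEffect i)

  module _ (P : Prog Ins Condition) (c : Condition) where

    machine : DirectAccessMachine σ
    machine = record
      { Q         = Control nop P
      ; #Q        = proj₁ (control-finite nop P)
      ; finite    = proj₂ (control-finite nop P)
      ; q₀        = inj₁ (entry nop P)
      ; accepting = accepts nop P
      ; k         = suc K
      ; k≥1       = s≤s z≤n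
      ; δ         = λ q ss as → Maybe.map (λ (q′ , i) → q′ , actions i ss)
          (transition nop P c q (holds? ss as))
      }

    module _ (A : OrderedStructure σ) where
      open OrderedStructure A
      open DirectAccessStep machine A
      private
        module D = DirectAccess machine A

      platform : Platform (structureInterpretation σ A)
      platform = record
        { State     = PerTape σ (suc K) Tape Tape
        ; run       = λ i t → after (actions i (D.scanAll t)) t
        ; cond      = λ c t → holds? (D.scanAll t) (D.answers t) c
        ; cellsOf   = λ t → cells (D.charged t)
        ; tapeOf    = writable
        ; headOf    = λ t y → head (readable t y)
        ; Fresh     = Contents
        ; cellsOf-≤ = λ t h → charged-heads t h
        ; tape-run  = λ i t x → trans (writable-after (actions i (D.scanAll t)) t x)
            (cong (λ e → act e (writable t x))
                (trans (writable-build (λ x → effect i x (writable (D.scanAll t) x)) (readEffect i) x)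
              (cong (effect i x) (writable-scan t x))))
        ; head-run  = λ i t y f → trans (head-after (actions i (D.scanAll t)) t y)
            (cong₂ (λ d u → head (moveReadOnly d u))
                (readable-build (λ x → effect i x (writable (D.scanAll t) x)) (readEffect i) y)
              (cong (λ xs → tape xs (head (readable t y))) (f y)))
        ; fresh-run = λ i t f → contents-after (actions i (D.scanAll t)) t (f ∘ inj₁)
        ; cond-sym  = λ x f t → cong f (writable-scan t x)
        ; cond-ros  = λ y f t h → cong f (trans (readable-scan t y)
            (cong (λ xs → cell xs (head (readable t y))) (h y)))
        ; cond-ans  = λ a v t → cong (_≡ᵇ v) (trans (cong bitℕ (answers-ask t a))
            (distribute a (elements size (tapeNumbers (inj₁ a) t))))
        }
        where
        distribute : ∀ a m → bitℕ (Maybe.maybe (component relᴵ a) false m) ≡ Maybe.maybe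
            (bitℕ ∘ component relᴵ a) 0 m
        distribute a (just _) = refl
        distribute a nothing  = refl

      machine-verdict : ∀ {m t} → Exec (Platform.semantics platform) (λ t → cells (D.charged t) ≤ m) P
          initialTapes t →
        cells (D.charged t) ≤ m → cells (D.charged (Platform.run platform nop t)) ≤ m →
        Σ (Verdict D.system D.initial (Platform.cond platform c t)) λ v → space D.system v ≤ m
      machine-verdict ex o o′ = exec-verdict (Platform.semantics platform) D.system P c D.config
        (λ q ts → map-map (transition nop P c q _)) (λ _ _ → refl) (λ _ _ h → h) ex o o′

module OnDirectAccess (σ : Vocabulary) (Pr : Programs.Program (structureSignature σ)) where
  open Programs (structureSignature σ)
  open Program Pr
  open Controller (controller Pr)
  open Platforms (structureSignature σ) (suc K)
  open DirectAccessPlatform σ K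

  daMachine : DirectAccessMachine σ
  daMachine = machine (control nop) accepting

  da-decides : ∀ A {b} B v → B < 2 ^ v →
    (∀ x → Terms.Safe (structureSignature σ) (structureInterpretation σ A) B (initTm x) λ ()) →
    Trace (structureInterpretation σ A) B (λ x → Terms.⟦_⟧ (structureSignature σ) (structureInterpretation σ
        A) (initTm x) λ ()) b →
    Σ (Verdict (DirectAccess.system daMachine A) (DirectAccess.initial daMachine A) b) λ d →
      space (DirectAccess.system daMachine A) d ≤ 2 + v
  da-decides A {b} B v l s t =
    let t′ , ex , c , o , o′ = executes pl B v l (λ a vs → ≤-trans (structure-ask σ A a vs) (s≤s z≤n))
            (structure-compact σ A)
          -- As a setup, `nop` changes no address; it is the step after which the value-tapes show
          -- the values.
          nop initialTapes s t (charged-heads initialTapes λ x → subst (λ u → head u < 2 + v)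
              (sym (initial-writable x)) (s≤s z≤n))
          (λ j → start (inj₁ j) (alike refl λ { zero → refl ; (suc _) → refl }))
          (λ a → start (inj₂ a) (alike refl λ { zero → refl ; (suc _) → refl }))
          heads (contents-after (actions nop (D.scanAll initialTapes)) initialTapes initial-constants)
    in subst (λ b → Σ (Verdict D.system D.initial b) λ d → space D.system d ≤ 2 + v) c
         (machine-verdict (control nop) accepting A ex o o′)
    where
    open DirectAccessStep daMachine A
    open DirectAccessTapes σ (suc K)
    module D = DirectAccess daMachine A
    pl = platform (control nop) accepting A
    start : ∀ x {u} → act (blank , stay) blankTape ≈ u → Platform.tapeOf pl
        (Platform.run pl nop initialTapes) x ≈ u
    start x e = subst (_≈ _) (sym (trans (Platform.tape-run pl nop initialTapes x)
      (cong (λ t → act (scan t , stay) t) (initial-writable x)))) e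
    heads : ∀ y → head (readable (after (actions nop (D.scanAll initialTapes)) initialTapes) y) ≡ 0
    heads y = trans (head-after (actions nop (D.scanAll initialTapes)) initialTapes y)
      (trans (cong (λ d → head (moveReadOnly d (readable initialTapes y)))
        (readable-build (λ x → effect nop x (writable (D.scanAll initialTapes) x)) (readEffect nop) y))
            (zero-head y))
      where
      zero-head : ∀ y → head (readable initialTapes y) ≡ 0
      zero-head (inj₁ c) = cong head (initial-constant c)
      zero-head (inj₂ f) = cong head (initial-value f)

-- Enumerations of finite sets, unions and indexed sums

enum-Fin : ∀ n → Enumeration (Fin n)
enum-Fin n = record { count = n ; elem = id ; index = id ; elem-index = λ _ → refl }

enum-image : ∀ {A B : Set} (f : A → B) (g : B → A) → (∀ b → f (g b) ≡ b) → Enumeration A → Enumeration B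
enum-image f g h E = record
  { count = count ; elem = f ∘ elem ; index = index ∘ g ; elem-index = λ b → trans
      (cong f (elem-index (g b))) (h b) }
  where open Enumeration E

enum-⊎ : ∀ {A B : Set} → Enumeration A → Enumeration B → Enumeration (A ⊎ B)
enum-⊎ E F = record
  { count = E.count + F.count
  ; elem = Sum.map E.elem F.elem ∘ splitAt E.count
  ; index = Fin.join E.count F.count ∘ Sum.map E.index F.index
  ; elem-index = λ { (inj₁ a) → trans (cong (Sum.map E.elem F.elem) (Finₚ.splitAt-join E.count F.count
      (inj₁ (E.index a)))) (cong inj₁ (E.elem-index a))
                   ; (inj₂ b) → trans (cong (Sum.map E.elem F.elem) (Finₚ.splitAt-join E.count F.count
                       (inj₂ (F.index b)))) (cong inj₂ (F.elem-index b)) } }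
  where
  module E = Enumeration E
  module F = Enumeration F

enum-Σ : ∀ {n} {F : Fin n → Set} → (∀ i → Enumeration (F i)) → Enumeration (Σ (Fin n) F)
enum-Σ {zero}  E = record { count = 0 ; elem = λ () ; index = λ () ; elem-index = λ () }
enum-Σ {suc n} {F} E = enum-image to from (λ { (zero , x) → refl ; (suc i , x) → refl })
    (enum-⊎ (E zero) (enum-Σ (E ∘ suc)))
  where
  to : F zero ⊎ Σ (Fin n) (F ∘ suc) → Σ (Fin (suc n)) F
  to (inj₁ x)       = zero , x
  to (inj₂ (i , x)) = suc i , x
  from : Σ (Fin (suc n)) F → F zero ⊎ Σ (Fin n) (F ∘ suc)
  from (zero , x)  = inj₁ x
  from (suc i , x) = inj₂ (i , x)

-- Programs given by terms

module Plans (Sg : Signature) where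
  open Signature Sg
  open Terms Sg
  open Programs Sg
  open Toolbox Sg

  record Plan : Set₁ where
    field
      Var      : Set
      vars     : Enumeration Var
      initE    : Var → Ex ⊥
      stepE    : Var → Ex Var
      goingE   : Ex Var
      verdictE : Ex Var

    program : Program
    program = record
      { Var = Var ; vars = vars ; initTm = tm ∘ initE ; stepTm = tm ∘ stepE
      ; going = tm goingE ; verdict = tm verdictE }

    open Enumeration vars

    total : (Var → ℕ) → ℕ
    total f = Vec.sum (Vec.tabulate (f ∘ elem))

    component≤total : ∀ f v → f v ≤ total f
    component≤total f v = ≤-trans (≤-reflexive (cong f (sym (elem-index v)))) (component≤sum (f ∘ elem)
        (index v))
      where
      component≤sum : ∀ {n} (g : Fin n → ℕ) i → g i ≤ Vec.sum (Vec.tabulate g)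
      component≤sum g zero    = m≤m+n (g zero) _
      component≤sum g (suc i) = ≤-trans (component≤sum (g ∘ suc) i) (m≤n+m _ (g zero))

    degree : ℕ
    degree = (total (deg ∘ initE) + total (deg ∘ stepE)) + (deg goingE + deg verdictE)

    controls≤ : deg goingE + deg verdictE ≤ degree
    controls≤ = m≤n+m _ (total (deg ∘ initE) + total (deg ∘ stepE))

    data Path (I : Interpretation Sg) (b : ℕ) (s : Var → ℕ) (r : Bool) : Set where
      stop : (∀ v → s v ≤ b) → sem goingE I s ≡ 0 → (0 <ᵇ sem verdictE I s) ≡ r → Path I b s r
      go   : ∀ {k} → (∀ v → s v ≤ b) → sem goingE I s ≡ suc k → Path I b (λ v → sem (stepE v) I s) r → Path
          I b s r

    module _ (I : Interpretation Sg) (b : ℕ) (bd : Bounded I b) where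

      safely : ∀ {V} (e : Ex V) {s} → deg e ≤ degree → (∀ v → s v ≤ b) → Safe I (b ^ degree) (tm e) s
      safely e d l = safe-mono I (tm e) (^-mono (proj₁ bd) d) (poly e I b _ bd l)

      init-safe : ∀ v → Safe I (b ^ degree) (tm (initE v)) λ ()
      init-safe v = safely (initE v) (≤-trans (component≤total (deg ∘ initE) v)
          (≤-trans (m≤m+n _ (total (deg ∘ stepE))) (m≤m+n _ _))) λ ()

      -- A path bounds the values only between two steps; the degrees take care of everything inside
      -- a step. Traces run through values of terms and paths through `sem`, which agree pointwise
      -- only, and so `s′` is carried along with `s`.
      path-trace : ∀ {s s′ r} → Path I b s r → (∀ v → s′ v ≡ s v) → Program.Trace program I (b ^ degree) s′ r
      path-trace {s} {s′} (stop l g v) e = Program.stop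
        (safely goingE (≤-trans (m≤m+n (deg goingE) (deg verdictE)) controls≤) l′)
            (trans (⟦⟧-cong I (tm goingE) e) (trans (correct goingE I s) g))
        (safely verdictE (≤-trans (m≤n+m _ (deg goingE)) controls≤) l′)
        (trans (cong (0 <ᵇ_) (trans (⟦⟧-cong I (tm verdictE) e) (correct verdictE I s))) v)
        where
        l′ : ∀ v → s′ v ≤ b
        l′ v = ≤-trans (≤-reflexive (e v)) (l v)
      path-trace {s} {s′} (go l g p) e = Program.go
        (safely goingE (≤-trans (m≤m+n (deg goingE) (deg verdictE)) controls≤) l′)
            (trans (⟦⟧-cong I (tm goingE) e) (trans (correct goingE I s) g))
        (λ v → safely (stepE v) (≤-trans (component≤total (deg ∘ stepE) v)
            (≤-trans (m≤n+m _ (total (deg ∘ initE))) (m≤m+n _ _))) l′)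
        (path-trace p λ v → trans (⟦⟧-cong I (tm (stepE v)) e) (correct (stepE v) I s))
        where
        l′ : ∀ v → s′ v ≤ b
        l′ v = ≤-trans (≤-reflexive (e v)) (l v)

    path-trace₀ : ∀ I b {r} → Bounded I b → Path I b (λ v → sem (initE v) I λ ()) r →
                  Program.Trace program I (b ^ degree) (λ v → ⟦_⟧ I (tm (initE v)) λ ()) r
    path-trace₀ I b bd p = path-trace I b bd p λ v → correct (initE v) I λ ()

-- The extra bit makes the inequality strict. Together with the two further cells of a counter tape
-- it is the origin of the 3 in the space bounds.
pow-< : ∀ β G → (2 ^ β) ^ G < 2 ^ suc (β * G)
pow-< β G = ≤-<-trans (≤-reflexive (^-*-assoc 2 β G)) (^-monoʳ-< 2 (s≤s (s≤s z≤n)) (n<1+n (β * G)))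

-- The machines executing a plan and their space

module _ (p : Plans.Plan inputSignature) where
  open Plans inputSignature
  open Plan p

  planMachineʳ : RandomAccessMachine
  planMachineʳ = OnRandomAccess.raMachine program

  plan-decidesʳ : ∀ w {r} β → 1 ≤ β → Path (inputInterpretation w) (2 ^ β) (λ v → Toolbox.sem (initE v)
      (inputInterpretation w) λ ()) r →
    Σ (Verdict (RandomAccess.system planMachineʳ w) (RandomAccess.initial planMachineʳ w) r) λ d →
      space (RandomAccess.system planMachineʳ w) d ≤ 3 + β * degree
  plan-decidesʳ w β l path = OnRandomAccess.ra-decides program w ((2 ^ β) ^ degree) (suc (β * degree))
      (pow-< β degree)
    (init-safe (inputInterpretation w) (2 ^ β) bd) (path-trace₀ (inputInterpretation w) (2 ^ β) bd path)
    where
    bd : Toolbox.Bounded inputSignature (inputInterpretation w) (2 ^ β)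
    bd = ^-monoʳ-≤ 2 l , λ { (inj₁ tt) (i ∷ []) → ≤-trans (inputCode≤2 (inputSymbol w i)) (^-monoʳ-≤ 2 l) }

module _ (σ : Vocabulary) (p : Plans.Plan (structureSignature σ)) where
  open Plans (structureSignature σ)
  open Plan p

  planMachineᵈ : DirectAccessMachine σ
  planMachineᵈ = OnDirectAccess.daMachine σ program

  plan-decidesᵈ : ∀ A {r} β → 1 ≤ β → OrderedStructure.size A ≤ 2 ^ β →
    Path (structureInterpretation σ A) (2 ^ β) (λ v → Toolbox.sem (initE v) (structureInterpretation σ A)
        λ ()) r →
    Σ (Verdict (DirectAccess.system planMachineᵈ A) (DirectAccess.initial planMachineᵈ A) r) λ d →
      space (DirectAccess.system planMachineᵈ A) d ≤ 3 + β * degree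
  plan-decidesᵈ A β l n≤ path = OnDirectAccess.da-decides σ program A ((2 ^ β) ^ degree) (suc (β * degree))
      (pow-< β degree)
    (init-safe (structureInterpretation σ A) (2 ^ β) bd) (path-trace₀ (structureInterpretation σ A) (2 ^ β)
        bd path)
    where
    bd : Toolbox.Bounded (structureSignature σ) (structureInterpretation σ A) (2 ^ β)
    bd = structure-bounded σ A (^-monoʳ-≤ 2 l) n≤

-- The encoding of a structure as a concatenation

bitAt : List Bool → ℕ → ℕ
bitAt w i = inputCode (inputSymbol w i)

bitAt-< : ∀ xs ys i → i < length xs → bitAt (xs ++ ys) i ≡ bitAt xs i
bitAt-< (x ∷ xs) ys zero    l       = refl
bitAt-< (x ∷ xs) ys (suc i) (s≤s l) = bitAt-< xs ys i l

bitAt-≥ : ∀ xs ys i → bitAt (xs ++ ys) (length xs + i) ≡ bitAt ys i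
bitAt-≥ []       ys i = refl
bitAt-≥ (x ∷ xs) ys i = bitAt-≥ xs ys i

at? : ∀ {A : Set} → List A → ℕ → Maybe A
at? []       _       = nothing
at? (x ∷ xs) zero    = just x
at? (x ∷ xs) (suc i) = at? xs i

at?-< : ∀ {A : Set} (xs ys : List A) i → i < length xs → at? (xs ++ ys) i ≡ at? xs i
at?-< (x ∷ xs) ys zero    l       = refl
at?-< (x ∷ xs) ys (suc i) (s≤s l) = at?-< xs ys i l

at?-≥ : ∀ {A : Set} (xs ys : List A) i → at? (xs ++ ys) (length xs + i) ≡ at? ys i
at?-≥ []       ys i = refl
at?-≥ (x ∷ xs) ys i = at?-≥ xs ys i

at?-map : ∀ {A B : Set} (f : A → B) xs i → at? (map f xs) i ≡ Maybe.map f (at? xs i)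
at?-map f []       i       = refl
at?-map f (x ∷ xs) zero    = refl
at?-map f (x ∷ xs) (suc i) = at?-map f xs i

bitAt-map : ∀ {A : Set} (f : A → Bool) xs i → bitAt (map f xs) i ≡ Maybe.maybe (bitℕ ∘ f) 2 (at? xs i)
bitAt-map f []       i       = refl
bitAt-map f (x ∷ xs) zero    = refl
bitAt-map f (x ∷ xs) (suc i) = bitAt-map f xs i

bitAt-cell : ∀ w i {b} → cell (holding w) i ≡ bit b → bitAt w i ≡ bitℕ b
bitAt-cell (x ∷ w) zero    refl = refl
bitAt-cell (x ∷ w) (suc i) e    = bitAt-cell w i e

+-swap : ∀ j m n → j + (m + n) ≡ m + (j + n)
+-swap = solve-∀

at?-product : ∀ {A B C : Set} (f : A → B → C) xs ys a j → j < length ys →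
              at? (cartesianProductWith f xs ys) (j + a * length ys) ≡ Maybe.zipWith f (at? xs a) (at? ys j)
at?-product f [] ys a j l = refl
at?-product f (x ∷ xs) ys zero j l = trans (cong (at? (map (f x) ys ++ _)) (+-identityʳ j))
  (trans (at?-< (map (f x) ys) _ j (subst (j <_) (sym (length-map (f x) ys)) l)) (trans (at?-map (f x) ys j)
      (lift (at? ys j))))
  where
  lift : ∀ m → Maybe.map (f x) m ≡ Maybe.zipWith f (just x) m
  lift (just _) = refl
  lift nothing  = refl
at?-product f (x ∷ xs) ys (suc a) j l = trans
  (cong (at? (map (f x) ys ++ cartesianProductWith f xs ys)) (trans (+-swap j (length ys) (a * length ys))
      (cong (_+ (j + a * length ys)) (sym (length-map (f x) ys)))))
  (trans (at?-≥ (map (f x) ys) (cartesianProductWith f xs ys) (j + a * length ys))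
      (at?-product f xs ys a j l))

at?-allFin : ∀ n i → i < n → ∃ λ j → at? (allFin n) i ≡ just j × toℕ j ≡ i
at?-allFin n i l = fromℕ< l , go n id i l , toℕ-fromℕ< l
  where
  go : ∀ {A : Set} n (f : Fin n → A) i (l : i < n) → at? (List.tabulate f) i ≡ just (f (fromℕ< l))
  go (suc n) f zero    l       = refl
  go (suc n) f (suc i) (s≤s l) = go n (f ∘ suc) i l

length-tuples : ∀ n r → length (tuples n r) ≡ n ^ r
length-tuples n zero    = refl
length-tuples n (suc r) = trans (length-product (allFin n) (tuples n r))
    (cong₂ _*_ (length-tabulate {n = n} id) (length-tuples n r))
  where
  length-product : ∀ {A B C : Set} {f : A → B → C} xs ys → length (cartesianProductWith f xs ys) ≡ length xs
      * length ys
  length-product []       ys = refl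
  length-product {f = f} (x ∷ xs) ys = trans (length-++ (map (f x) ys)) (cong₂ _+_ (length-map (f x) ys)
      (length-product xs ys))

element-< : ∀ n i (l : i < n) → element n i ≡ just (fromℕ< l)
element-< n i l with i <? n
... | yes l′ = refl
... | no i≮n = contradiction l i≮n

element-≥ : ∀ n i → n ≤ i → element n i ≡ nothing
element-≥ n i l with i <? n
... | yes l′ = contradiction l′ (≤⇒≯ l)
... | no _   = refl

-- The position of a tuple in the lexicographic order

rank : ∀ {r} → ℕ → Vec ℕ r → ℕ
rank         n []       = 0
rank {suc r} n (v ∷ vs) = rank n vs + v * n ^ r

rank-< : ∀ {r} n (vs : Vec ℕ r) → (∀ i → Vec.lookup vs i < n) → rank n vs < n ^ r
rank-< n []       h = s≤s z≤n
rank-< {suc r} n (v ∷ vs) h = ≤-trans (+-monoˡ-< (v * n ^ r) (rank-< n vs (h ∘ suc)))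
    (*-monoˡ-≤ (n ^ r) (h zero))

rank-elements : ∀ {r} n (vs : Vec ℕ r) → (∀ i → Vec.lookup vs i < n) →
                ∃ λ xs → at? (tuples n r) (rank n vs) ≡ just xs × elements n vs ≡ just xs
rank-elements n []       h = [] , refl , refl
rank-elements {suc r} n (v ∷ vs) h =
  let xs , e , f = rank-elements n vs (h ∘ suc)
      j , a , q = at?-allFin n v (h zero)
      j≡ : fromℕ< (h zero) ≡ j
      j≡ = toℕ-injective (trans (toℕ-fromℕ< (h zero)) (sym q))
  in j ∷ xs ,
     trans (cong (λ m → at? (tuples n (suc r)) (rank n vs + v * m)) (sym (length-tuples n r)))
       (trans (at?-product _∷_ (allFin n) (tuples n r) v (rank n vs)
           (subst (rank n vs <_) (sym (length-tuples n r)) (rank-< n vs (h ∘ suc))))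
         (cong₂ (Maybe.zipWith _∷_) a e)) ,
     trans (cong₂ (Maybe.zipWith _∷_) (element-< n v (h zero)) f) (cong (λ k → just (k ∷ xs)) j≡)

unrank : ∀ r → ℕ → ℕ → Vec ℕ r
unrank zero    n i = []
unrank (suc r) n i = quot i (n ^ r) ∷ unrank r n (rem i (n ^ r))

unrank-rank : ∀ r n i → 0 < n → i < n ^ r → rank n (unrank r n i) ≡ i × (∀ j → Vec.lookup (unrank r n i) j <
    n)
unrank-rank zero    n i 0<n l = sym (n<1⇒n≡0 l) , λ ()
unrank-rank (suc r) n@(suc _) i 0<n l =
  let N>0 = m^n>0 n r
      e , m = quotRem-spec i (n ^ r) N>0
      e′ , h = unrank-rank r n (rem i (n ^ r)) 0<n m
  in trans (cong (_+ quot i (n ^ r) * n ^ r) e′) (sym e) ,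
     λ { zero → *-cancelʳ-< (n ^ r) (quot i (n ^ r)) n (≤-<-trans (m≤n+m _ (rem i (n ^ r)))
         (subst (_< n * n ^ r) e l))
       ; (suc j) → h j }

-- Concatenations of finitely many strings

concatFin : ∀ m → (Fin m → List Bool) → List Bool
concatFin zero    f = []
concatFin (suc m) f = f zero ++ concatFin m (f ∘ suc)

offset : ∀ {m} → (Fin m → ℕ) → Fin m → ℕ
offset f zero    = 0
offset f (suc i) = f zero + offset (f ∘ suc) i

sumFin : ∀ {m} → (Fin m → ℕ) → ℕ
sumFin {zero}  f = 0
sumFin {suc m} f = f zero + sumFin (f ∘ suc)

length-concatFin : ∀ m f → length (concatFin m f) ≡ sumFin (length ∘ f)
length-concatFin zero    f = refl
length-concatFin (suc m) f = trans (length-++ (f zero)) (cong (length (f zero) +_)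
    (length-concatFin m (f ∘ suc)))

bitAt-offset : ∀ m f w i j → j < length (f i) → bitAt (concatFin m f ++ w) (offset (length ∘ f) i + j) ≡
    bitAt (f i) j
bitAt-offset (suc m) f w zero    j l = trans (bitAt-< (f zero ++ concatFin m (f ∘ suc)) w j
  (≤-trans l (≤-trans (m≤m+n _ _) (≤-reflexive (sym (length-++ (f zero))))))) (bitAt-< (f zero) _ j l)
bitAt-offset (suc m) f w (suc i) j l = trans
  (cong₂ bitAt (++-assoc (f zero) (concatFin m (f ∘ suc)) w) (+-assoc (length (f zero))
      (offset (length ∘ f ∘ suc) i) j))
  (trans (bitAt-≥ (f zero) (concatFin m (f ∘ suc) ++ w) _) (bitAt-offset m (f ∘ suc) w i j l))

concat-reduce : ∀ {P : ℕ → Set} (enc : ∀ {x} → P x → List Bool) {xs} (ps : All P xs) →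
                concat (All.reduce enc ps) ≡ concatFin (length xs) (λ i → enc (component ps i))
concat-reduce enc []       = refl
concat-reduce enc (p ∷ ps) = cong (enc p ++_) (concat-reduce enc ps)

concat-toList : ∀ {A : Set} (enc : A → List Bool) {n} (v : Vec A n) →
                concat (Vec.toList (Vec.map enc v)) ≡ concatFin n (λ i → enc (Vec.lookup v i))
concat-toList enc []      = refl
concat-toList enc (x ∷ v) = cong (enc x ++_) (concat-toList enc v)

-- `downFrom` puts the block of the most significant bit first, so block number `q` belongs to bit
-- `L ∸ suc q`.
bitAt-blocks : ∀ N (g : ℕ → List Bool) L q j → (∀ m → length (g m) ≡ N) → j < N → q < L →
               bitAt (concatMap g (downFrom L)) (j + q * N) ≡ bitAt (g (L ∸ suc q)) j
bitAt-blocks N g (suc L) zero    j h l (s≤s m) = trans (cong (bitAt (g L ++ _)) (+-identityʳ j))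
  (bitAt-< (g L) _ j (subst (j <_) (sym (h L)) l))
bitAt-blocks N g (suc L) (suc q) j h l (s≤s m) = trans
  (cong (bitAt (g L ++ concatMap g (downFrom L))) (trans (+-swap j N (q * N))
      (cong (_+ (j + q * N)) (sym (h L)))))
  (trans (bitAt-≥ (g L) _ (j + q * N)) (bitAt-blocks N g L q j h l m))

length-blocks : ∀ N (g : ℕ → List Bool) L → (∀ m → length (g m) ≡ N) → length (concatMap g (downFrom L)) ≡ L
    * N
length-blocks N g zero    h = refl
length-blocks N g (suc L) h = trans (length-++ (g L)) (cong₂ _+_ (h L) (length-blocks N g L h))

-- The place of every bit in the encoding

module _ {σ : Vocabulary} (A : OrderedStructure σ) where
  open OrderedStructure A
  open Interpretation (structureInterpretation σ A)
  private
    n = size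
    L = ⌈log₂ n ⌉
    rels = relations σ
    funs = functions σ

    0<n : 0 < n
    0<n = >-nonZero⁻¹ n {{nonEmpty}}

  relationSegment : Fin (length rels) → List Bool
  relationSegment i = encodeRelation (component relᴵ i)

  constantSegment : Fin (#constants σ) → List Bool
  constantSegment c = encodeConstant (Vec.lookup constᴵ c)

  functionSegment : Fin (length funs) → List Bool
  functionSegment f = encodeFunction (component funᴵ f)

  -- The final `[]` gives also the last group the form of a concatenation followed by a remaining
  -- string, as `bitAt-offset` and `sem-pick` expect.
  bin-segments : bin A ≡ concatFin (length rels) relationSegment ++
                         (concatFin (#constants σ) constantSegment ++
                             (concatFin (length funs) functionSegment ++ []))
  bin-segments = cong₂ _++_ (concat-reduce encodeRelation relᴵ)
    (cong₂ _++_ (concat-toList encodeConstant constᴵ)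
      (trans (concat-reduce encodeFunction funᴵ) (sym (++-identityʳ _))))

  length-encodeRelation : ∀ {r} (R : Vec (Fin n) r → Bool) → length (encodeRelation R) ≡ n ^ r
  length-encodeRelation {r} R = trans (length-map R (tuples n r)) (length-tuples n r)

  length-relation : ∀ i → length (relationSegment i) ≡ n ^ List.lookup rels i
  length-relation i = length-encodeRelation (component relᴵ i)

  length-constant : ∀ c → length (constantSegment c) ≡ L
  length-constant c = trans (length-map (testBit (toℕ (Vec.lookup constᴵ c))) (downFrom L))
      (length-downFrom L)

  length-function : ∀ f → length (functionSegment f) ≡ L * n ^ List.lookup funs f
  length-function f = length-blocks (n ^ List.lookup funs f) _ L
    λ m → length-encodeRelation (λ t → testBit (toℕ (component funᴵ f t)) m)

  bitAt-encodeRelation : ∀ {r} (R : Vec (Fin n) r → Bool) vs → (∀ i → Vec.lookup vs i < n) →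
    ∃ λ xs → elements n vs ≡ just xs × bitAt (encodeRelation R) (rank n vs) ≡ bitℕ (R xs)
  bitAt-encodeRelation {r} R vs h =
    let xs , e , f = rank-elements n vs h
    in xs , f , trans (bitAt-map R (tuples n r) (rank n vs)) (cong (Maybe.maybe (bitℕ ∘ R) 2) e)

  bitAt-relation : ∀ i vs → (∀ j → Vec.lookup vs j < n) → bitAt (relationSegment i) (rank n vs) ≡ askᴵ i vs
  bitAt-relation i vs h =
    let xs , e , f = bitAt-encodeRelation (component relᴵ i) vs h
    in trans f (sym (cong (Maybe.maybe (bitℕ ∘ component relᴵ i) 0) e))

  bitAt-binary : ∀ l v j → j < l → bitAt (binary l v) j ≡ bitℕ (testBit v (l ∸ suc j))
  bitAt-binary l v j j<l = bitAt-cell (binary l v) j (cell-binary-< l v j j<l)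

  bitAt-constant : ∀ c j → j < L → bitAt (constantSegment c) j ≡ bitℕ (testBit (toℕ (Vec.lookup constᴵ c))
      (L ∸ suc j))
  bitAt-constant c j j<L = bitAt-binary L (toℕ (Vec.lookup constᴵ c)) j j<L

  function-value : ∀ f vs {xs} → elements n vs ≡ just xs → ⟦ inj₂ (inj₂ f) ⟧ᵒ vs ≡ toℕ (component funᴵ f xs)
  function-value f vs {xs} e = trans (cong (horner ∘ Maybe.maybe (numeral ∘ toℕ ∘ component funᴵ f) []) e)
    (horner-numeral (toℕ (component funᴵ f xs)))

  bitAt-function : ∀ f vs q → (∀ j → Vec.lookup vs j < n) → q < L →
    bitAt (functionSegment f) (rank n vs + q * n ^ List.lookup funs f) ≡ bitℕ
        (testBit (⟦ inj₂ (inj₂ f) ⟧ᵒ vs) (L ∸ suc q))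
  bitAt-function f vs q h q<L =
    let R = λ m t → testBit (toℕ (component funᴵ f t)) m
        xs , e , g = bitAt-encodeRelation (R (L ∸ suc q)) vs h
    in trans (bitAt-blocks (n ^ List.lookup funs f) (λ m → encodeRelation (R m)) L q (rank n vs)
         (λ m → length-encodeRelation (R m)) (rank-< n vs h) q<L)
         (trans g (cong (λ v → bitℕ (testBit v (L ∸ suc q))) (sym (function-value f vs e))))

-- The input of a random-access machine, computed from the structure

module InputTerm (σ : Vocabulary) where
  open Signature (structureSignature σ)
  open Toolbox (structureSignature σ)
  private
    rels = relations σ
    funs = functions σ

  module _ {V : Set} where

    pick : ∀ m → (Fin m → Ex V) → (Fin m → Ex V → Ex V) → (Ex V → Ex V) → Ex V → Ex V
    pick zero    len bits rest i = rest i
    pick (suc m) len bits rest i = ifE (sucE i ⊖ len zero) (bits zero i) (pick m (len ∘ suc) (bits ∘ suc)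
        rest (i ⊖ len zero))

    -- The hypotheses concern arbitrary terms `e` because the position is replaced by the term
    -- `i ⊖ len zero` on the way to the next segment, and by yet another one in the following group.
    sem-pick : ∀ m {len bits rest I ρ} (f : Fin m → List Bool) w → (∀ j → length (f j) ≡ sem (len j) I ρ) →
      (∀ j e → sem e I ρ < length (f j) → sem (bits j e) I ρ ≡ bitAt (f j) (sem e I ρ)) →
      (∀ e → sem (rest e) I ρ ≡ bitAt w (sem e I ρ)) →
      ∀ i → sem (pick m len bits rest i) I ρ ≡ bitAt (concatFin m f ++ w) (sem i I ρ)
    sem-pick zero    f w h g r i = r i
    sem-pick (suc m) {len} {bits} {rest} {I} {ρ} f w h g r i = choose (suc (sem i I ρ) ∸ sem (len zero) I ρ)
        refl
      where
      choose : ∀ d → suc (sem i I ρ) ∸ sem (len zero) I ρ ≡ d →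
               ifz d (sem (bits zero i) I ρ) (sem (pick m (len ∘ suc) (bits ∘ suc) rest (i ⊖ len zero)) I ρ) ≡
               bitAt (concatFin (suc m) f ++ w) (sem i I ρ)
      choose zero    eq = trans (g zero i i<)
          (sym (trans (bitAt-< (f zero ++ concatFin m (f ∘ suc)) w (sem i I ρ)
          (≤-trans i< (≤-trans (m≤m+n _ _) (≤-reflexive (sym (length-++ (f zero)))))))
              (bitAt-< (f zero) _ _ i<)))
        where
        i< : sem i I ρ < length (f zero)
        i< = ≤-trans (m∸n≡0⇒m≤n eq) (≤-reflexive (sym (h zero)))
      choose (suc d) eq = trans (sem-pick m (f ∘ suc) w (h ∘ suc) (g ∘ suc) r (i ⊖ len zero))
        (trans (sym (bitAt-≥ (f zero) (concatFin m (f ∘ suc) ++ w) (sem i I ρ ∸ sem (len zero) I ρ)))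
          (cong₂ bitAt (sym (++-assoc (f zero) (concatFin m (f ∘ suc)) w))
              (trans (cong (_+ (sem i I ρ ∸ sem (len zero) I ρ)) (h zero)) (m+[n∸m]≡n len≤))))
        where
        len≤ : sem (len zero) I ρ ≤ sem i I ρ
        len≤ = ≮⇒≥ λ l → case trans (sym eq) (m≤n⇒m∸n≡0 l) of λ ()

    unrankE : ∀ r → Ex V → Ex V → Vec (Ex V) r
    unrankE zero    n i = []
    unrankE (suc r) n i = quotE i (powE n r) ∷ unrankE r n (remE i (powE n r))

    sem-unrankE : ∀ r n i I ρ → Vec.map (λ e → sem e I ρ) (unrankE r n i) ≡ unrank r (sem n I ρ) (sem i I ρ)
    sem-unrankE zero    n i I ρ = refl
    sem-unrankE (suc r) n i I ρ = cong₂ _∷_ (cong (quot (sem i I ρ)) (sem-powE n r I ρ))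
      (trans (sem-unrankE r n (remE i (powE n r)) I ρ)
          (cong (λ N → unrank r (sem n I ρ) (rem (sem i I ρ) N)) (sem-powE n r I ρ)))

    sizeE : Ex V
    sizeE = opE (inj₂ (inj₁ zero)) []

    relationLength functionLength : ℕ → Ex V
    relationLength r = powE sizeE r
    functionLength r = clogE sizeE ⊗ powE sizeE r

    relationBit : ∀ i → Ex V → Ex V
    relationBit i e = opE (inj₁ i) (unrankE (List.lookup rels i) sizeE e)

    constantBit : Fin (#constants σ) → Ex V → Ex V
    constantBit c e = testBitE (opE (inj₂ (inj₁ (suc c))) []) (clogE sizeE ⊖ sucE e)

    functionBlock functionValue functionIndex : ∀ f → Ex V → Ex V
    functionBlock f e = powE sizeE (List.lookup funs f)
    functionValue f e = opE (inj₂ (inj₂ f)) (unrankE (List.lookup funs f) sizeE (remE e (functionBlock f e)))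
    functionIndex f e = clogE sizeE ⊖ sucE (quotE e (functionBlock f e))

    functionBit : ∀ f → Ex V → Ex V
    functionBit f e = testBitE (functionValue f e) (functionIndex f e)

    abstract
      inputE : Ex V → Ex V
      inputE = pick (length rels) (relationLength ∘ List.lookup rels) relationBit
              (pick (#constants σ) (λ _ → clogE sizeE) constantBit
              (pick (length funs) (functionLength ∘ List.lookup funs) functionBit
              -- Behind the last segment the input shows the end-marker, whose code is 2.
              (λ _ → constE 2)))

      sem-inputE : ∀ A e ρ → sem (inputE e) (structureInterpretation σ A) ρ ≡ bitAt (bin A)
          (sem e (structureInterpretation σ A) ρ)
      sem-inputE A e ρ = trans
        (sem-pick (length rels) (relationSegment A) _ (λ i → trans (length-relation A i)
            (sym (size^ (List.lookup rels i)))) relation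
          (sem-pick (#constants σ) (constantSegment A) _ (λ c → trans (length-constant A c) (sym clog≡))
              constant
            (sem-pick (length funs) (functionSegment A) [] (λ f → trans (length-function A f)
                (sym (cong₂ _*_ clog≡ (size^ (List.lookup funs f))))) function
              (λ _ → refl))) e)
        (cong (λ w → bitAt w (sem e I ρ)) (sym (bin-segments A)))
        where
        open OrderedStructure A
        I : Interpretation (structureSignature σ)
        I = structureInterpretation σ A
        L : ℕ
        L = ⌈log₂ size ⌉
        open Interpretation I using (⟦_⟧ᵒ; askᴵ)

        0<n : 0 < size
        0<n = >-nonZero⁻¹ size {{nonEmpty}}

        size≡ : sem (sizeE) I ρ ≡ size
        size≡ = horner-numeral size

        clog≡ : sem (clogE (sizeE)) I ρ ≡ L
        clog≡ = trans (sem-clogE sizeE I ρ) (cong ⌈log₂_⌉ size≡)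

        size^ : ∀ r → sem (powE (sizeE) r) I ρ ≡ size ^ r
        size^ r = trans (sem-powE sizeE r I ρ) (cong (_^ r) size≡)

        relation : ∀ i (e : Ex V) → sem e I ρ < length (relationSegment A i) → sem (relationBit i e) I ρ ≡
            bitAt (relationSegment A i) (sem e I ρ)
        relation i e l =
          let r = List.lookup rels i
              u , h = unrank-rank r size (sem e I ρ) 0<n (≤-trans l (≤-reflexive (length-relation A i)))
          in trans (cong (askᴵ i) (trans (sem-unrankE r sizeE e I ρ) (cong (λ n → unrank r n (sem e I ρ))
                  size≡)))
             (trans (sym (bitAt-relation A i (unrank r size (sem e I ρ)) h))
                 (cong (bitAt (relationSegment A i)) u))

        constant : ∀ c (e : Ex V) → sem e I ρ < length (constantSegment A c) → sem (constantBit c e) I ρ ≡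
            bitAt (constantSegment A c) (sem e I ρ)
        constant c e l = trans (sem-testBitE (opE (inj₂ (inj₁ (suc c))) []) (clogE sizeE ⊖ sucE e) I ρ)
          (trans (cong₂ (λ v l → bitℕ (testBit v (l ∸ suc (sem e I ρ))))
              (trans (horner-numeral (Vec.lookup (Vec.map toℕ constᴵ) c)) (lookup-map c toℕ constᴵ)) clog≡)
            (sym (bitAt-constant A c (sem e I ρ) (≤-trans l (≤-reflexive (length-constant A c))))))

        value : ∀ f (e : Ex V) → sem (functionValue f e) I ρ ≡
                ⟦ inj₂ (inj₂ f) ⟧ᵒ (unrank (List.lookup funs f) size
                    (rem (sem e I ρ) (size ^ List.lookup funs f)))
        value f e = cong ⟦ inj₂ (inj₂ f) ⟧ᵒ
            (trans (sem-unrankE (List.lookup funs f) sizeE (remE e (functionBlock f e)) I ρ)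
          (cong₂ (λ n N → unrank (List.lookup funs f) n (rem (sem e I ρ) N)) size≡
              (size^ (List.lookup funs f))))

        index : ∀ f (e : Ex V) → sem (functionIndex f e) I ρ ≡ L ∸ suc
            (quot (sem e I ρ) (size ^ List.lookup funs f))
        index f e = cong₂ (λ l N → l ∸ suc (quot (sem e I ρ) N)) clog≡ (size^ (List.lookup funs f))

        function : ∀ f (e : Ex V) → sem e I ρ < length (functionSegment A f) → sem (functionBit f e) I ρ ≡
            bitAt (functionSegment A f) (sem e I ρ)
        function f e l =
          let k = List.lookup funs f
              N = size ^ k
              i = sem e I ρ
              eq , j<N = quotRem-spec i N (m^n>0 size {{nonEmpty}} k)
              u , h = unrank-rank k size (rem i N) 0<n j<N
              q<L = *-cancelʳ-< N (quot i N) L (≤-<-trans (m≤n+m _ (rem i N))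
                  (subst (_< L * N) eq (≤-trans l (≤-reflexive (length-function A f)))))
          in trans (sem-testBitE (functionValue f e) (functionIndex f e) I ρ)
             (trans (cong₂ (λ v j → bitℕ (testBit v j)) (value f e) (index f e))
             (trans (sym (bitAt-function A f (unrank k size (rem i N)) (quot i N) h q<L))
               (cong (bitAt (functionSegment A f)) (trans (cong (_+ quot i N * N) u) (sym eq)))))

-- Numbers representing tapes

cells≤space : ∀ {S : System} {c b} (v : Verdict S c b) → System.cellsOf S c ≤ space S v
cells≤space (accept _)       = ≤-refl
cells≤space (reject _ _)     = ≤-refl
cells≤space (continue _ _ _) = m≤m⊔n _ _

length-overwrite : ∀ xs h s {T} → length xs ≤ T → h < T → length (overwrite xs h s) ≤ T
length-overwrite []       zero    s l         m         = m
length-overwrite []       (suc h) s l         (s≤s m)   = s≤s (length-overwrite [] h s z≤n m)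
length-overwrite (x ∷ xs) zero    s l         m         = l
length-overwrite (x ∷ xs) (suc h) s (s≤s l)   (s≤s m)   = s≤s (length-overwrite xs h s l m)

-- By `3 ≤ 2 ^ 2` two bits per cell are enough; hence the `T + T` in the bounds of both simulations.
3^≤ : ∀ {h T} → h ≤ T → 3 ^ h ≤ 2 ^ (T + T)
3^≤ {h} {T} l = ≤-trans (^-monoʳ-≤ 3 l) (≤-trans (^-monoˡ-≤ T (s≤s (s≤s (s≤s (z≤n {1})))))
  (≤-reflexive (trans (^-*-assoc 2 2 T) (cong (λ x → 2 ^ (T + x)) (+-identityʳ T)))))

record Represents (N p : ℕ) (t : Tape) : Set where
  constructor represents
  field
    number≡ : N ≡ code (content t)
    power≡  : p ≡ 3 ^ head t

open Represents public

module TapeTerms (Sg : Signature) where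
  open Toolbox Sg

  sem-scanE : ∀ {V} {N p : Ex V} {I ρ t} → Represents (sem N I ρ) (sem p I ρ) t → sem (scanE N p) I ρ ≡
      digit (scan t)
  sem-scanE {t = t} (represents e f) = trans (cong₂ (λ N p → rem (quot N p) 3) e f)
      (code-scan (content t) (head t))

  actedE : ∀ {V} → Ex V → Ex V → Symbol × Move → Ex V × Ex V
  actedE N p (s , d) = writeE N p (constE (digit s)) , movedE d p

  sem-actedE : ∀ {V} {N p : Ex V} {I ρ t} a → Represents (sem N I ρ) (sem p I ρ) t →
               Represents (sem (proj₁ (actedE N p a)) I ρ) (sem (proj₂ (actedE N p a)) I ρ) (act a t)
  sem-actedE {N = N} {p} {I} {ρ} {t} (s , d) r@(represents e f) = represents
    (trans (cong₂ (λ x y → x ∸ y * sem p I ρ) (cong₂ (λ N p → N + digit s * p) e f) (sem-scanE {N = N} {p} r))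
      (trans (cong (λ p → code (content t) + digit s * 3 ^ head t ∸ digit (scan t) * p) f)
          (code-overwrite (content t) (head t) s)))
    (trans (sem-movedE d p I ρ) (trans (cong (moved d) f) (moved-head d (head t))))

represents-≤ : ∀ {N p t T} → Represents N p t → length (content t) ≤ T → head t < T → N ≤ 2 ^ (T + T) × p ≤
    2 ^ (T + T)
represents-≤ {t = t} (represents refl refl) l h =
  ≤-trans (<⇒≤ (code-< (content t))) (3^≤ l) , 3^≤ (<⇒≤ h)

-- A direct-access machine simulates a random-access machine.

module SimulateRandomAccess (σ : Vocabulary) (M : RandomAccessMachine) where
  open RandomAccessMachine M
  open Plans (structureSignature σ)
  open Toolbox (structureSignature σ)
  open TapeTerms (structureSignature σ)
  open InputTerm σ

  data Var : Set where
    st     : Var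
    nm pos : Fin (suc k) → Var

  vars : Enumeration Var
  vars = enum-image to from (λ { st → refl ; (nm _) → refl ; (pos _) → refl })
    (enum-⊎ (enum-Fin 1) (enum-⊎ (enum-Fin (suc k)) (enum-Fin (suc k))))
    where
    to : Fin 1 ⊎ (Fin (suc k) ⊎ Fin (suc k)) → Var
    to (inj₁ _)        = st
    to (inj₂ (inj₁ j)) = nm j
    to (inj₂ (inj₂ j)) = pos j
    from : Var → Fin 1 ⊎ (Fin (suc k) ⊎ Fin (suc k))
    from st      = inj₁ zero
    from (nm j)  = inj₂ (inj₁ j)
    from (pos j) = inj₂ (inj₂ j)

  toQ : Fin #Q → Q
  toQ = Inverse.from finite

  fromQ : Q → Fin #Q
  fromQ = Inverse.to finite

  toQ-fromQ : ∀ q → toQ (fromQ q) ≡ q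
  toQ-fromQ q = Inverse.strictlyInverseʳ finite q

  -- Listed in the order of `inputCode`. A blank is never scanned on the input-tape.
  inputSymbolOf : Fin 3 → InputSymbol
  inputSymbolOf zero             = symbol (bit false)
  inputSymbolOf (suc zero)       = symbol (bit true)
  inputSymbolOf (suc (suc zero)) = ◁

  scans : ∀ {n} → (Fin n → Fin (suc k)) → Vec (Ex Var) n
  scans {zero}  f = []
  scans {suc n} f = scanE (varE (nm (f zero))) (varE (pos (f zero))) ∷ scans (f ∘ suc)

  -- The input symbol is not stored but recomputed in every step from the number on tape 0, which is
  -- the address-tape of the simulated machine.
  tree : (Q → InputSymbol → Vec Symbol (suc k) → Ex Var) → Ex Var
  tree f = caseFin #Q (varE st) λ q → caseFin 3 (inputE (numberE (varE (nm zero)))) λ x → caseVec (scans id)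
      (f (toQ q) (inputSymbolOf x))

  record Sim (s : Var → ℕ) (q : Q) (ts : Vec Tape (suc k)) : Set where
    constructor sim
    field
      state≡ : s st ≡ toℕ (fromQ q)
      tapes≡ : ∀ j → Represents (s (nm j)) (s (pos j)) (Vec.lookup ts j)

  open Sim

  module _ (A : OrderedStructure σ) where
    private
      I : Interpretation (structureSignature σ)
      I = structureInterpretation σ A
      module R = RandomAccess M (bin A)

    decode : ∀ w i → ∃ λ c → inputSymbolOf c ≡ inputSymbol w i × toℕ c ≡ bitAt w i
    decode []          i       = suc (suc zero) , refl , refl
    decode (false ∷ w) zero    = zero , refl , refl
    decode (true ∷ w)  zero    = suc zero , refl , refl
    decode (b ∷ w)     (suc i) = decode w i

    sem-scans : ∀ {n s q ts} (f : Fin n → Fin (suc k)) → Sim s q ts → ∀ i →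
                sem (Vec.lookup (scans f) i) I s ≡ digit
                    (Vec.lookup (Vec.tabulate (λ j → scan (Vec.lookup ts (f j)))) i)
    sem-scans {s = s} f r zero    = sem-scanE {N = varE (nm (f zero))} {varE (pos (f zero))} {I} {s}
        (tapes≡ r (f zero))
    sem-scans f r (suc i) = sem-scans (f ∘ suc) r i

    sem-tree : ∀ {s q ts} f → Sim s q ts → sem (tree f) I s ≡ sem
        (f q (inputSymbol (bin A) (number (Vec.head ts))) (Vec.map scan ts)) I s
    sem-tree {s} {q} {t ∷ ts} f r =
      let c , e , d = decode (bin A) (number t)
      in trans (sem-caseFin #Q {varE st} {λ q → caseFin 3 (inputE (numberE (varE (nm zero)))) λ x → caseVec
              (scans id) (f (toQ q) (inputSymbolOf x))} {I} {s} (fromQ q) (state≡ r))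
        (trans (sem-caseFin 3 {inputE (numberE (varE (nm zero)))} {λ x → caseVec (scans id)
            (f (toQ (fromQ q)) (inputSymbolOf x))} {I} {s} c
            (trans (sem-inputE A (numberE (varE (nm zero))) s)
            (trans (cong (bitAt (bin A)) (sem-numberE {N = varE (nm zero)} {I} {s} t
                (number≡ (tapes≡ r zero)))) (sym d))))
        (trans (sem-caseVec (scans id) {f (toQ (fromQ q)) (inputSymbolOf c)}
            (Vec.tabulate λ j → scan (Vec.lookup (t ∷ ts) j)) (sem-scans id r))
          (cong (λ g → sem g I s) (trans (cong₂
              (λ q x → f q x (Vec.tabulate λ j → scan (Vec.lookup (t ∷ ts) j))) (toQ-fromQ q) e)
            (cong (f q (inputSymbol (bin A) (number t))) (tabulate-scan (t ∷ ts)))))))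
      where
      tabulate-scan : ∀ {n} (ts : Vec Tape n) → Vec.tabulate (λ j → scan (Vec.lookup ts j)) ≡ Vec.map scan ts
      tabulate-scan []       = refl
      tabulate-scan (t ∷ ts) = cong (scan t ∷_) (tabulate-scan ts)

  Actions : Set
  Actions = Maybe (Q × Vec (Symbol × Move) (suc k))

  -- Acceptance means that an accepting state is reached, so the simulation has to end there even if
  -- the transition function would lead on.
  goingOn : Q → Actions → Ex Var
  goingOn q m = if accepting q then constE 0 else constE (Maybe.maybe′ (λ _ → 1) 0 m)

  nextOf : Var → Actions → Ex Var
  nextOf v        nothing         = constE 0
  nextOf st       (just (q , as)) = constE (toℕ (fromQ q))
  nextOf (nm j)   (just (q , as)) = proj₁ (actedE (varE (nm j)) (varE (pos j)) (Vec.lookup as j))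
  nextOf (pos j)  (just (q , as)) = proj₂ (actedE (varE (nm j)) (varE (pos j)) (Vec.lookup as j))

  initial-value : Var → ℕ
  initial-value st            = toℕ (fromQ q₀)
  -- The address-tape starts with the symbol 0, whose digit is 1. Head positions start as `3 ^ 0`.
  initial-value (nm zero)     = 1
  initial-value (nm (suc j))  = 0
  initial-value (pos j)       = 1

  plan : Plan
  plan = record
    { Var      = Var
    ; vars     = vars
    ; initE    = λ v → constE (initial-value v)
    ; stepE    = λ v → tree λ q x ss → nextOf v (δ q x ss)
    ; goingE   = tree λ q x ss → goingOn q (δ q x ss)
    ; verdictE = caseFin #Q (varE st) λ q → constE (bitℕ (accepting (toQ q)))
    }

  open Plan plan using (Path; stop; go; goingE; verdictE; stepE)

  module _ (A : OrderedStructure σ) (T : ℕ) where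
    private
      I : Interpretation (structureSignature σ)
      I = structureInterpretation σ A
      module R = RandomAccess M (bin A)
      S = R.system
      -- The first summand covers the codes of tapes and heads, `#Q` the number of the state by
      -- `#Q ≤ 2 ^ #Q`, and the logarithm the answers and values of the structure.
      β = (T + T) + (#Q + ⌈log₂ OrderedStructure.size A ⌉)

    Short : Vec Tape (suc k) → Set
    Short ts = ∀ j → length (content (Vec.lookup ts j)) ≤ T

    sim-≤ : ∀ {s q ts} → Sim s q ts → Short ts → cells (Vec.toList ts) ≤ T → ∀ v → s v ≤ 2 ^ β
    sim-≤ {q = q} r l h st = ≤-trans (≤-reflexive (state≡ r)) (≤-trans (<⇒≤ (toℕ<n (fromQ q)))
      (≤-trans (n≤2^n #Q) (^-monoʳ-≤ 2 (≤-trans (m≤m+n #Q _) (m≤n+m _ (T + T))))))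
    sim-≤ {ts = ts} r l h (nm j)  = ≤-trans
        (proj₁ (represents-≤ (tapes≡ r j) (l j) (all-fromList ts (cells-head (Vec.toList ts) h) j)))
        (^-monoʳ-≤ 2 (m≤m+n (T + T) _))
    sim-≤ {ts = ts} r l h (pos j) = ≤-trans
        (proj₂ (represents-≤ (tapes≡ r j) (l j) (all-fromList ts (cells-head (Vec.toList ts) h) j)))
        (^-monoʳ-≤ 2 (m≤m+n (T + T) _))

    verdict-sem : ∀ {s q ts} → Sim s q ts → sem verdictE I s ≡ bitℕ (accepting q)
    verdict-sem {q = q} r = trans (sem-caseFin #Q (fromQ q) (state≡ r))
        (cong (bitℕ ∘ accepting) (toQ-fromQ q))

    observed : Q → Vec Tape (suc k) → Actions
    observed q ts = δ q (inputSymbol (bin A) (number (Vec.head ts))) (Vec.map scan ts)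

    going-sem : ∀ {s q ts} → Sim s q ts → sem goingE I s ≡ sem (goingOn q (observed q ts)) I s
    going-sem r = sem-tree A (λ q x ss → goingOn q (δ q x ss)) r

    going-on : ∀ q m s → accepting q ≡ false → sem (goingOn q m) I s ≡ Maybe.maybe′ (λ _ → 1) 0 m
    going-on q m s e = cong (λ b → sem (if b then constE 0 else constE (Maybe.maybe′ (λ _ → 1) 0 m)) I s) e

    step-sim : ∀ {s q ts q′ as} → Sim s q ts → observed q ts ≡ just (q′ , as) →
               Sim (λ v → sem (stepE v) I s) q′ (Vec.zipWith act as ts)
    step-sim {s} {q} {ts} {q′} {as} r e = sim (stepped st) λ j →
      let represents a b = sem-actedE {N = varE (nm j)} {varE (pos j)} {I} {s} (Vec.lookup as j) (tapes≡ r j)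
          t≡ = lookup-zipWith act j as ts
      in represents (trans (stepped (nm j)) (trans a (cong (code ∘ content) (sym t≡))))
              (trans (stepped (pos j)) (trans b (cong (λ t → 3 ^ head t) (sym t≡))))
      where
      stepped : ∀ v → sem (stepE v) I s ≡ sem (nextOf v (just (q′ , as))) I s
      stepped v = trans (sem-tree A (λ q x ss → nextOf v (δ q x ss)) r) (cong (λ m → sem (nextOf v m) I s) e)

    short-step : ∀ {ts} (as : Vec (Symbol × Move) (suc k)) → Short ts → cells (Vec.toList ts) ≤ T → Short
        (Vec.zipWith act as ts)
    short-step {ts} as l h j = subst (λ t → length (content t) ≤ T) (sym (lookup-zipWith act j as ts))
      (length-overwrite (content (Vec.lookup ts j)) (head (Vec.lookup ts j)) (proj₁ (Vec.lookup as j)) (l j)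
          (all-fromList ts (cells-head (Vec.toList ts) h) j))

    path : ∀ {q ts s b} (v : Verdict S (R.config q ts) b) → space S v ≤ T → Sim s q ts → Short ts → Path I
        (2 ^ β) s b
    path {q} {ts} {s} d@(accept a) l r sh = stop (sim-≤ r sh (≤-trans (cells≤space d) l))
      (trans (going-sem r) (cong (λ b → sem (if b then constE 0 else constE (Maybe.maybe′ (λ _ → 1) 0
          (observed q ts))) I s) a))
      (cong (0 <ᵇ_) (trans (verdict-sem r) (cong bitℕ a)))
    path {q} {ts} {s} d@(reject a h) l r sh = stop (sim-≤ r sh (≤-trans (cells≤space d) l))
      (trans (going-sem r) (trans (going-on q (observed q ts) s a) (halted (observed q ts) h)))
      (cong (0 <ᵇ_) (trans (verdict-sem r) (cong bitℕ a)))
      where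
      halted : ∀ m → Maybe.map (λ (q′ , as) → R.config q′ (Vec.zipWith act as ts)) m ≡ nothing →
          Maybe.maybe′ (λ _ → 1) 0 m ≡ 0
      halted nothing _ = refl
    path {q} {ts} {s} {b} d@(continue a h v) l r sh = goes (observed q ts) refl h v (≤-trans (m≤n⊔m _ _) l)
      where
      here≤ = ≤-trans (cells≤space d) l
      goes : ∀ m {c} → observed q ts ≡ m → Maybe.map (λ (q′ , as) → R.config q′ (Vec.zipWith act as ts)) m ≡
          just c →
             (v : Verdict S c b) → space S v ≤ T → Path I (2 ^ β) s b
      goes (just (q′ , as)) e refl v l′ = go (sim-≤ r sh here≤)
        (trans (going-sem r) (trans (going-on q (observed q ts) s a) (cong (Maybe.maybe′ (λ _ → 1) 0) e)))
        (path v l′ (step-sim r e) (short-step as sh here≤))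

  simulation : ∀ A {b} (v : Verdict (RandomAccess.system M (bin A)) (RandomAccess.initial M (bin A)) b) →
    let β = (space (RandomAccess.system M (bin A)) v + space (RandomAccess.system M (bin A)) v) +
            (#Q + ⌈log₂ OrderedStructure.size A ⌉) in
    Σ (Verdict (DirectAccess.system (planMachineᵈ σ plan) A) (DirectAccess.initial (planMachineᵈ σ plan) A)
        b) λ d →
      space (DirectAccess.system (planMachineᵈ σ plan) A) d ≤ 3 + β * Plan.degree plan
  simulation A v = plan-decidesᵈ σ plan A _
    (≤-trans 0<space (≤-trans (m≤m+n T T) (m≤m+n (T + T) _)))
    (≤-trans (⌈log₂⌉-≥ (OrderedStructure.size A)) (^-monoʳ-≤ 2 (≤-trans (m≤n+m _ #Q) (m≤n+m _ (T + T)))))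
    (path A T v ≤-refl initially short)
    where
    T : ℕ
    T = space (RandomAccess.system M (bin A)) v
    0<space : 1 ≤ T
    0<space = ≤-trans (s≤s z≤n) (≤-trans (m≤m⊔n 1 (cells (Vec.toList (Vec.replicate k blankTape))))
        (cells≤space v))
    initially : Sim (λ v → initial-value v) q₀ (RandomAccess.Config.tapes (RandomAccess.initial M (bin A)))
    initially = sim refl λ
      { zero    → represents refl refl
      ; (suc j) → represents (cong (code ∘ content) (sym (lookup-replicate j blankTape)))
          (cong (λ t → 3 ^ head t) (sym (lookup-replicate j blankTape))) }
    short : Short A T (RandomAccess.Config.tapes (RandomAccess.initial M (bin A)))
    short zero    = 0<space
    short (suc j) = subst (λ t → length (content t) ≤ T) (sym (lookup-replicate j blankTape)) z≤n

-- The encoding, queried from the size of the structure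

encodingLength : Vocabulary → ℕ → ℕ
encodingLength σ n =
  sumFin (λ i → n ^ List.lookup (relations σ) i) +
  (sumFin {#constants σ} (λ _ → ⌈log₂ n ⌉) + sumFin (λ f → ⌈log₂ n ⌉ * n ^ List.lookup (functions σ) f))

sumFin-cong : ∀ {m} {f g : Fin m → ℕ} → (∀ i → f i ≡ g i) → sumFin f ≡ sumFin g
sumFin-cong {zero}  h = refl
sumFin-cong {suc m} h = cong₂ _+_ (h zero) (sumFin-cong (h ∘ suc))

offset-cong : ∀ {m} {f g : Fin m → ℕ} → (∀ i → f i ≡ g i) → ∀ i → offset f i ≡ offset g i
offset-cong h zero    = refl
offset-cong h (suc i) = cong₂ _+_ (h zero) (offset-cong (h ∘ suc) i)

length-bin : ∀ {σ} (A : OrderedStructure σ) → n̂ A ≡ encodingLength σ (OrderedStructure.size A)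
length-bin {σ} A = trans (cong length (bin-segments A))
  (trans (length-++ R) (cong₂ _+_ (trans (length-concatFin _ (relationSegment A))
      (sumFin-cong (length-relation A)))
    (trans (length-++ C) (cong₂ _+_ (trans (length-concatFin _ (constantSegment A))
        (sumFin-cong (length-constant A)))
      (trans (length-++ F) (trans (+-identityʳ _) (trans (length-concatFin _ (functionSegment A))
          (sumFin-cong (length-function A)))))))))
  where
  R = concatFin (length (relations σ)) (relationSegment A)
  C = concatFin (#constants σ) (constantSegment A)
  F = concatFin (length (functions σ)) (functionSegment A)

-- Reconstructing a number from its bits, most significant bit first.

half-0 : ∀ v L → v < 2 ^ L → half v L ≡ 0
half-0 v L l = n<1⇒n≡0 (*-cancelʳ-< (2 ^ L) (half v L) 1
    (≤-<-trans (shifted v L) (≤-trans l (≤-reflexive (sym (*-identityˡ _))))))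
  where
  shifted : ∀ v L → half v L * 2 ^ L ≤ v
  shifted v zero    = ≤-reflexive (*-identityʳ v)
  shifted v (suc L) = ≤-trans (≤-reflexive (sym (*-assoc ⌊ half v L /2⌋ 2 (2 ^ L))))
    (≤-trans (*-monoˡ-≤ (2 ^ L) (≤-trans (m≤n+m _ (bitℕ (testBit (half v L) 0)))
        (≤-reflexive (sym (parity (half v L)))))) (shifted v L))

half-step : ∀ v m → half v m ≡ half v (suc m) + half v (suc m) + bitℕ (testBit v m)
half-step v m = trans (parity (half v m)) (trans (+-comm _ (⌊ half v m /2⌋ * 2))
  (cong₂ _+_ (doubled ⌊ half v m /2⌋) (cong bitℕ (half-testBit v m))))
  where
  doubled : ∀ x → x * 2 ≡ x + x
  doubled = solve-∀

module QueryTerms (σ : Vocabulary) where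
  open Signature inputSignature
  open Toolbox inputSignature
  private
    rels = relations σ
    funs = functions σ

  queryE : ∀ {V} → Ex V → Ex V
  queryE e = opE (inj₁ tt) (e ∷ [])

  -- The remainder only serves to bound the numbers.

  private
    gatherBody : Vec (Ex (Fin 4)) 4
    gatherBody = remE (v₀ ⊕ v₀ ⊕ queryE v₁) v₃ ∷ v₁ ⊕ v₂ ∷ v₂ ∷ v₃ ∷ []

    Gathered : ℕ → ℕ → ℕ → Vec ℕ 4 → ℕ → Vec ℕ 4 → Set
    Gathered p s n xs k ys = Vec.lookup ys zero ≤ Vec.lookup xs zero + n × ∃ λ a → ys ≡ a ∷ p + k * s ∷ s ∷
        n ∷ []

    gathering : ∀ I a p s n k → Gathered p s n (a ∷ p ∷ s ∷ n ∷ []) k (iterate (stepFn gatherBody I)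
        (a ∷ p ∷ s ∷ n ∷ []) k)
    gathering I a p s n zero = m≤m+n a n , a , cong (λ x → a ∷ x ∷ s ∷ n ∷ []) (sym (+-identityʳ p))
    gathering I a p s n (suc k) with iterate (stepFn gatherBody I) (a ∷ p ∷ s ∷ n ∷ []) k | gathering I a p
        s n k
    ... | _ | l , a′ , refl = ≤-trans
        (rem-≤ (a′ + a′ + sem (queryE v₁) I (Vec.lookup (a′ ∷ p + k * s ∷ s ∷ n ∷ []))) n) (m≤n+m n a) ,
      rem (a′ + a′ + sem (queryE v₁) I (Vec.lookup (a′ ∷ p + k * s ∷ s ∷ n ∷ []))) n ,
      cong (λ x → rem (a′ + a′ + sem (queryE v₁) I (Vec.lookup (a′ ∷ p + k * s ∷ s ∷ n ∷ []))) n ∷ x ∷ s ∷ n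
          ∷ []) (trans (+-assoc p (k * s) s) (cong (p +_) (+-comm (k * s) s)))
      where
      rem-≤ : ∀ x y → rem x y ≤ y
      rem-≤ zero    y = z≤n
      rem-≤ (suc x) y with y ∸ suc (rem x y) in eq
      ... | zero  = z≤n
      ... | suc _ = <⇒≤ (≰⇒> λ y≤ → case trans (sym eq) (m≤n⇒m∸n≡0 y≤) of λ ())

    gatherLoop : Loop 4
    gatherLoop = record { body = gatherBody ; growth = 2 ; bound = bound }
      where
      bound : ∀ I B xs k → Bounded I B → (∀ i → Vec.lookup xs i ≤ B) → k ≤ B →
              ∀ i → Vec.lookup (iterate (stepFn gatherBody I) xs k) i ≤ B ^ 3
      bound I B (a ∷ p ∷ s ∷ n ∷ []) k (h , _) l k≤ i =
        let x , a′ , e = gathering I a p s n k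
        in cases i (iterate (stepFn gatherBody I) (a ∷ p ∷ s ∷ n ∷ []) k) x e
        where
        cases : ∀ i ys {a′} → Vec.lookup ys zero ≤ a + n → ys ≡ a′ ∷ p + k * s ∷ s ∷ n ∷ [] → Vec.lookup ys
            i ≤ B ^ 3
        cases zero ys x e = ≤-trans x (+≤^ 2 h (≤^ 1 h (l zero)) (≤^ 1 h (l (suc (suc (suc zero))))))
        cases (suc zero) _ x refl = +≤^ 2 h (≤^ 1 h (l (suc zero)))
            (≤-trans (*-mono-≤ k≤ (l (suc (suc zero)))) (≤-reflexive (cong (B *_) (sym (*-identityʳ B)))))
        cases (suc (suc zero)) _ x refl = ≤-trans (m≤m+n s 0) (+≤^ 2 h (≤^ 1 h (l (suc (suc zero)))) z≤n)
        cases (suc (suc (suc zero))) _ x refl = ≤-trans (m≤m+n n 0)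
            (+≤^ 2 h (≤^ 1 h (l (suc (suc (suc zero))))) z≤n)

  gatherE : ∀ {V} → Ex V → Ex V → Ex V → Ex V → Ex V
  gatherE L p s n = loopE gatherLoop L (constE 0 ∷ p ∷ s ∷ n ∷ []) zero

  -- The `L` bits of one number stand at `p`, `p + s`, `p + 2 * s` and so on, beginning with the
  -- most significant one. A stride covers both constants, with `s` equal to 1, and function values,
  -- whose bits lie in different blocks.
  sem-gatherE : ∀ {V} (L p s n : Ex V) w ρ v → let I = inputInterpretation w in v < sem n I ρ → v < 2 ^ sem L I ρ →
    (∀ j → j < sem L I ρ → bitAt w (sem p I ρ + j * sem s I ρ) ≡ bitℕ (testBit v (sem L I ρ ∸ suc j))) →
    sem (gatherE L p s n) I ρ ≡ v
  sem-gatherE Le pe se ne w ρ v v<n v<2^L bits = trans (cong (λ ys → Vec.lookup ys zero) (closed L ≤-refl))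
      (cong (half v) (n∸n≡0 L))
    where
    I = inputInterpretation w
    L p s n : ℕ
    L = sem Le I ρ
    p = sem pe I ρ
    s = sem se I ρ
    n = sem ne I ρ
    -- After `k` bits the accumulator holds the leading part of `v`, that is `v` shifted to the
    -- right. It is at most `v`, hence below `n`, and the remainder by `n` leaves it unchanged.
    closed : ∀ k → k ≤ L → iterate (stepFn gatherBody I) (0 ∷ p ∷ s ∷ n ∷ []) k ≡ half v (L ∸ k) ∷ p + k * s
        ∷ s ∷ n ∷ []
    closed zero    k≤ = cong₂ (λ a p → a ∷ p ∷ s ∷ n ∷ []) (sym (half-0 v L v<2^L)) (sym (+-identityʳ p))
    closed (suc k) k< = trans (cong (stepFn gatherBody I) (closed k (<⇒≤ k<)))
      (cong₂ (λ a p → a ∷ p ∷ s ∷ n ∷ []) (trans (cong (λ x → rem x n) sum≡)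
          (trans (cong (λ x → rem x n) (sym (+-identityʳ (half v (L ∸ suc k)))))
          (proj₂ (quotRem-unique {n} 0 (≤-<-trans (half-≤ v (L ∸ suc k)) v<n)))))
        (trans (+-assoc p (k * s) s) (cong (p +_) (+-comm (k * s) s))))
      where
      L∸k : L ∸ k ≡ suc (L ∸ suc k)
      L∸k = +-∸-assoc 1 k<
      sum≡ : half v (L ∸ k) + half v (L ∸ k) + bitAt w (p + k * s) ≡ half v (L ∸ suc k)
      sum≡ = trans (cong₂ (λ m b → half v m + half v m + b) L∸k (bits k k<)) (sym (half-step v (L ∸ suc k)))

  module _ {V : Set} where

    sumE : ∀ m → (Fin m → Ex V) → Ex V
    sumE zero    f = constE 0
    sumE (suc m) f = f zero ⊕ sumE m (f ∘ suc)

    sem-sumE : ∀ m f I ρ → sem (sumE m f) I ρ ≡ sumFin (λ i → sem (f i) I ρ)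
    sem-sumE zero    f I ρ = refl
    sem-sumE (suc m) f I ρ = cong (sem (f zero) I ρ +_) (sem-sumE m (f ∘ suc) I ρ)

    offsetE : ∀ {m} → (Fin m → Ex V) → Fin m → Ex V
    offsetE f zero    = constE 0
    offsetE f (suc i) = f zero ⊕ offsetE (f ∘ suc) i

    sem-offsetE : ∀ {m} (f : Fin m → Ex V) i I ρ → sem (offsetE f i) I ρ ≡ offset (λ i → sem (f i) I ρ) i
    sem-offsetE f zero    I ρ = refl
    sem-offsetE f (suc i) I ρ = cong (sem (f zero) I ρ +_) (sem-offsetE (f ∘ suc) i I ρ)

    rankE : ∀ {r} → Ex V → Vec (Ex V) r → Ex V
    rankE         n []       = constE 0
    rankE {suc r} n (v ∷ vs) = rankE n vs ⊕ v ⊗ powE n r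

    sem-rankE : ∀ {r} n (vs : Vec (Ex V) r) I ρ → sem (rankE n vs) I ρ ≡ rank (sem n I ρ)
        (Vec.map (λ e → sem e I ρ) vs)
    sem-rankE         n []       I ρ = refl
    sem-rankE {suc r} n (v ∷ vs) I ρ = cong₂ _+_ (sem-rankE n vs I ρ) (cong (sem v I ρ *_) (sem-powE n r I ρ))

    -- A summand vanishes exactly if its number is below `n`, so one test for 0 covers all addresses
    -- of a query.
    outsideE : ∀ {r} → Ex V → Vec (Ex V) r → Ex V
    outsideE n []       = constE 0
    outsideE n (v ∷ vs) = (sucE v ⊖ n) ⊕ outsideE n vs

    sem-outsideE : ∀ {r} n (vs : Vec (Ex V) r) I ρ → let xs = Vec.map (λ e → sem e I ρ) vs in
      (sem (outsideE n vs) I ρ ≡ 0 × (∀ i → Vec.lookup xs i < sem n I ρ)) ⊎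
      ((∃ λ k → sem (outsideE n vs) I ρ ≡ suc k) × elements (sem n I ρ) xs ≡ nothing)
    sem-outsideE n []       I ρ = inj₁ (refl , λ ())
    sem-outsideE n (v ∷ vs) I ρ = combine (sem n I ρ) (sem v I ρ) (sem v I ρ <? sem n I ρ)
        (sem-outsideE n vs I ρ)
      where
      xs = Vec.map (λ e → sem e I ρ) vs
      combine : ∀ n x {o} → Dec (x < n) → (o ≡ 0 × (∀ i → Vec.lookup xs i < n)) ⊎
          ((∃ λ k → o ≡ suc k) × elements n xs ≡ nothing) →
        (suc x ∸ n + o ≡ 0 × (∀ i → Vec.lookup (x ∷ xs) i < n)) ⊎ ((∃ λ k → suc x ∸ n + o ≡ suc k) ×
            elements n (x ∷ xs) ≡ nothing)
      combine n x (yes x<n) (inj₁ (refl , h)) = inj₁ (trans (+-identityʳ _) (m≤n⇒m∸n≡0 x<n) ,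
          λ { zero → x<n ; (suc i) → h i })
      combine n x (yes x<n) (inj₂ ((k , refl) , e)) = inj₂ ((k , cong (_+ suc k) (m≤n⇒m∸n≡0 x<n)) , cong₂
          (Maybe.zipWith _∷_) (element-< n x x<n) e)
      combine n x {o} (no x≮n) h = inj₂ ((_ , cong (_+ o) (+-∸-assoc 1 (≮⇒≥ x≮n))) , cong
          (λ m → Maybe.zipWith _∷_ m (elements n xs)) (element-≥ n x (≮⇒≥ x≮n)))

    relationLengths : Ex V → Fin (length rels) → Ex V
    relationLengths n i = powE n (List.lookup rels i)

    constantLengths : Ex V → Fin (#constants σ) → Ex V
    constantLengths n _ = clogE n

    functionLengths : Ex V → Fin (length funs) → Ex V
    functionLengths n f = clogE n ⊗ powE n (List.lookup funs f)

    relationsE constantsE functionsE lengthE : Ex V → Ex V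
    relationsE n = sumE (length rels) (relationLengths n)
    constantsE n = sumE (#constants σ) (constantLengths n)
    functionsE n = sumE (length funs) (functionLengths n)
    lengthE n = relationsE n ⊕ (constantsE n ⊕ functionsE n)

    answerE : Ex V → ∀ i → Vec (Ex V) (List.lookup rels i) → Ex V
    answerE n i vs = ifE (outsideE n vs) (queryE (offsetE (relationLengths n) i ⊕ rankE n vs)) (constE 0)

    constantE : Ex V → Fin (#constants σ) → Ex V
    constantE n c = gatherE (clogE n) (relationsE n ⊕ offsetE (constantLengths n) c) (constE 1) n

    functionE : Ex V → ∀ f → Vec (Ex V) (List.lookup funs f) → Ex V
    functionE n f vs = gatherE (clogE n)
        (relationsE n ⊕ (constantsE n ⊕ (offsetE (functionLengths n) f ⊕ rankE n vs)))
        (powE n (List.lookup funs f)) n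

    module _ (n : Ex V) (I : Interpretation inputSignature) (ρ : V → ℕ) where
      private
        N : ℕ
        N = sem n I ρ

      sem-relationLengths : ∀ i → sem (relationLengths n i) I ρ ≡ N ^ List.lookup rels i
      sem-relationLengths i = sem-powE n (List.lookup rels i) I ρ

      sem-functionLengths : ∀ f → sem (functionLengths n f) I ρ ≡ ⌈log₂ N ⌉ * N ^ List.lookup funs f
      sem-functionLengths f = cong₂ _*_ (sem-clogE n I ρ) (sem-powE n (List.lookup funs f) I ρ)

      sem-lengthE : sem (lengthE n) I ρ ≡ encodingLength σ N
      sem-lengthE = cong₂ _+_ (trans (sem-sumE (length rels) (relationLengths n) I ρ)
          (sumFin-cong sem-relationLengths))
        (cong₂ _+_ (trans (sem-sumE (#constants σ) (constantLengths n) I ρ) (sumFin-cong {#constants σ} λ _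
            → sem-clogE n I ρ))
          (trans (sem-sumE (length funs) (functionLengths n) I ρ) (sumFin-cong sem-functionLengths)))

    module _ (A : OrderedStructure σ) (n : Ex V) (ρ : V → ℕ) (n≡ : sem n (inputInterpretation (bin A)) ρ ≡
        OrderedStructure.size A) where
      open OrderedStructure A
      private
        module SI = Interpretation (structureInterpretation σ A)
        I : Interpretation inputSignature
        I = inputInterpretation (bin A)
        L : ℕ
        L = ⌈log₂ size ⌉
        Rs = concatFin (length rels) (relationSegment A)
        Cs = concatFin (#constants σ) (constantSegment A)
        Fs = concatFin (length funs) (functionSegment A)

        at-relation : ∀ i j → j < length (relationSegment A i) →
                      bitAt (bin A) (offset (length ∘ relationSegment A) i + j) ≡ bitAt
                          (relationSegment A i) j
        at-relation i j l = trans (cong (λ w → bitAt w (offset (length ∘ relationSegment A) i + j))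
            (bin-segments A))
          (bitAt-offset _ (relationSegment A) (Cs ++ (Fs ++ [])) i j l)

        at-constant : ∀ c j → j < length (constantSegment A c) →
                      bitAt (bin A) (length Rs + (offset (length ∘ constantSegment A) c + j)) ≡ bitAt
                          (constantSegment A c) j
        at-constant c j l = trans (cong
            (λ w → bitAt w (length Rs + (offset (length ∘ constantSegment A) c + j))) (bin-segments A))
          (trans (bitAt-≥ Rs (Cs ++ (Fs ++ [])) _) (bitAt-offset _ (constantSegment A) (Fs ++ []) c j l))

        at-function : ∀ f j → j < length (functionSegment A f) →
                      bitAt (bin A) (length Rs + (length Cs + (offset (length ∘ functionSegment A) f + j)))
                          ≡ bitAt (functionSegment A f) j
        at-function f j l = trans (cong
            (λ w → bitAt w (length Rs + (length Cs + (offset (length ∘ functionSegment A) f + j))))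
            (bin-segments A))
          (trans (bitAt-≥ Rs (Cs ++ (Fs ++ [])) _) (trans (bitAt-≥ Cs (Fs ++ []) _)
              (bitAt-offset _ (functionSegment A) [] f j l)))

        L≡ : sem (clogE n) I ρ ≡ L
        L≡ = trans (sem-clogE n I ρ) (cong ⌈log₂_⌉ n≡)

        relLen : ∀ i → sem (relationLengths n i) I ρ ≡ length (relationSegment A i)
        relLen i = trans (sem-relationLengths n I ρ i) (trans (cong (_^ List.lookup rels i) n≡)
            (sym (length-relation A i)))

        conLen : ∀ c → sem (constantLengths n c) I ρ ≡ length (constantSegment A c)
        conLen c = trans L≡ (sym (length-constant A c))

        funLen : ∀ f → sem (functionLengths n f) I ρ ≡ length (functionSegment A f)
        funLen f = trans (sem-functionLengths n I ρ f)
            (trans (cong (λ N → ⌈log₂ N ⌉ * N ^ List.lookup funs f) n≡) (sym (length-function A f)))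

        Rs≡ : sem (relationsE n) I ρ ≡ length Rs
        Rs≡ = trans (sem-sumE (length rels) (relationLengths n) I ρ) (trans (sumFin-cong relLen)
            (sym (length-concatFin _ (relationSegment A))))

        Cs≡ : sem (constantsE n) I ρ ≡ length Cs
        Cs≡ = trans (sem-sumE (#constants σ) (constantLengths n) I ρ) (trans (sumFin-cong conLen)
            (sym (length-concatFin _ (constantSegment A))))

        values : ∀ {r} → Vec (Ex V) r → Vec ℕ r
        values = Vec.map (λ e → sem e I ρ)

        rank≡ : ∀ {r} (vs : Vec (Ex V) r) → sem (rankE n vs) I ρ ≡ rank size (values vs)
        rank≡ vs = trans (sem-rankE n vs I ρ) (cong (λ N → rank N (values vs)) n≡)

      sem-answerE : ∀ i vs → sem (answerE n i vs) I ρ ≡ SI.askᴵ i (values vs)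
      sem-answerE i vs = decide (sem-outsideE n vs I ρ)
        where
        chosen : ℕ → ℕ
        chosen o = ifz o (sem (queryE (offsetE (relationLengths n) i ⊕ rankE n vs)) I ρ) 0
        decide : _ → sem (answerE n i vs) I ρ ≡ SI.askᴵ i (values vs)
        decide (inj₁ (e , h)) = trans (cong chosen e)
          (trans (cong (bitAt (bin A)) (cong₂ _+_ (trans (sem-offsetE (relationLengths n) i I ρ)
              (offset-cong relLen i)) (rank≡ vs)))
            (trans (at-relation i (rank size (values vs)) (≤-trans (rank-< size (values vs) h′)
                (≤-reflexive (sym (length-relation A i)))))
              (bitAt-relation A i (values vs) h′)))
          where
          h′ : ∀ j → Vec.lookup (values vs) j < size
          h′ j = subst (Vec.lookup (values vs) j <_) n≡ (h j)
        decide (inj₂ ((k , e) , none)) = trans (cong chosen e)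
          (sym (cong (Maybe.maybe (bitℕ ∘ component relᴵ i) 0)
              (subst (λ N → elements N (values vs) ≡ nothing) n≡ none)))

      sem-constantE : ∀ c → sem (constantE n c) I ρ ≡ toℕ (Vec.lookup constᴵ c)
      sem-constantE c = sem-gatherE (clogE n) (relationsE n ⊕ offsetE (constantLengths n) c) (constE 1) n
          (bin A) ρ v
        (subst (v <_) (sym n≡) (toℕ<n (Vec.lookup constᴵ c)))
        (subst (λ l → v < 2 ^ l) (sym L≡) (<-≤-trans (toℕ<n (Vec.lookup constᴵ c)) (⌈log₂⌉-≥ size)))
        λ j j<L → let j<L′ = subst (j <_) L≡ j<L in
          trans (cong (bitAt (bin A)) (trans
              (cong₂ _+_ (cong₂ _+_ Rs≡ (trans (sem-offsetE (constantLengths n) c I ρ)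
              (offset-cong conLen c))) (*-identityʳ j))
                  (+-assoc (length Rs) _ j)))
          (trans (at-constant c j (≤-trans j<L′ (≤-reflexive (sym (length-constant A c)))))
          (trans (bitAt-constant A c j j<L′) (cong (λ l → bitℕ (testBit v (l ∸ suc j))) (sym L≡))))
        where
        v = toℕ (Vec.lookup constᴵ c)

      -- The bits of one value are found at the rank of the arguments in each of the blocks,
      -- `size ^ k` positions apart. They suffice to recover the value because it is below `size`,
      -- which is at most `2 ^ L`.
      sem-functionE : ∀ f vs → (∀ j → Vec.lookup (values vs) j < size) → sem (functionE n f vs) I ρ ≡ SI.⟦
          inj₂ (inj₂ f) ⟧ᵒ (values vs)
      sem-functionE f vs h = sem-gatherE (clogE n)
          (relationsE n ⊕ (constantsE n ⊕ (offsetE (functionLengths n) f ⊕ rankE n vs)))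
        (powE n k) n (bin A) ρ v
        (subst (v <_) (sym n≡) v<size)
        (subst (λ l → v < 2 ^ l) (sym L≡) (<-≤-trans v<size (⌈log₂⌉-≥ size)))
        λ j j<L → let j<L′ = subst (j <_) L≡ j<L in
          trans (cong (bitAt (bin A)) (trans
            (cong₂ _+_ (cong₂ _+_ Rs≡ (cong₂ _+_ Cs≡
                (cong₂ _+_ (trans (sem-offsetE (functionLengths n) f I ρ) (offset-cong funLen f))
                (rank≡ vs))))
              (cong (j *_) (trans (sem-powE n k I ρ) (cong (_^ k) n≡))))
            (shuffle (length Rs) (length Cs) (offset (length ∘ functionSegment A) f) (rank size (values vs))
                (j * size ^ k))))
          (trans (at-function f (rank size (values vs) + j * size ^ k) (inside j j<L′))
          (trans (bitAt-function A f (values vs) j h j<L′) (cong (λ l → bitℕ (testBit v (l ∸ suc j)))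
              (sym L≡))))
        where
        k = List.lookup funs f
        v = SI.⟦ inj₂ (inj₂ f) ⟧ᵒ (values vs)
        v<size : v < size
        v<size = let xs , _ , e = rank-elements size (values vs) h
                 in subst (_< size) (sym (function-value A f (values vs) e)) (toℕ<n (component funᴵ f xs))
        shuffle : ∀ a b c d e → a + (b + (c + d)) + e ≡ a + (b + (c + (d + e)))
        shuffle = solve-∀
        inside : ∀ j → j < L → rank size (values vs) + j * size ^ k < length (functionSegment A f)
        inside j j<L = ≤-trans (+-monoˡ-< (j * size ^ k) (rank-< size (values vs) h))
          (≤-trans (*-monoˡ-≤ (size ^ k) j<L) (≤-reflexive (sym (length-function A f))))

-- Families given by their components, and the coding of read-only tapes

enum-Σ-⊎ : ∀ {A B : Set} {F : A ⊎ B → Set} → Enumeration (Σ A (F ∘ inj₁)) → Enumeration (Σ B (F ∘ inj₂)) →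
    Enumeration (Σ (A ⊎ B) F)
enum-Σ-⊎ E E′ = enum-image (λ { (inj₁ (a , x)) → inj₁ a , x ; (inj₂ (b , x)) → inj₂ b , x })
  (λ { (inj₁ a , x) → inj₁ (a , x) ; (inj₂ b , x) → inj₂ (b , x) })
      (λ { (inj₁ a , x) → refl ; (inj₂ b , x) → refl }) (enum-⊎ E E′)

assemble-ext : ∀ {A : Set} {P : A → Set} {xs : List A} (ps : All P xs) {f : ∀ i → P (List.lookup xs i)} →
               (∀ i → f i ≡ component ps i) → assemble {P = P} xs f ≡ ps
assemble-ext []       h = refl
assemble-ext (p ∷ ps) h = cong₂ _∷_ (h zero) (assemble-ext ps (h ∘ suc))

tabulate-ext : ∀ {A : Set} {n} (v : Vec A n) {f : Fin n → A} → (∀ i → f i ≡ Vec.lookup v i) → Vec.tabulate f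
    ≡ v
tabulate-ext []      h = refl
tabulate-ext (x ∷ v) h = cong₂ _∷_ (h zero) (tabulate-ext v (h ∘ suc))

-- The transition function takes whole records of tapes, whereas the decision tree knows their
-- entries one by one; agreement of the entries has to become equality of the records.
build-ext : ∀ {σ k} {X Y : Set} (t : PerTape σ k X Y) {f g} → (∀ x → f x ≡ DirectAccessTapes.writable σ k t
    x) →
            (∀ y → g y ≡ DirectAccessTapes.readable σ k t y) → DirectAccessTapes.build σ k f g ≡ t
build-ext {σ} {k} (perTape ra fa vs cs ws) h h′ = perTape-cong
  (assemble-ext ra λ i → tabulate-ext (component ra i) λ j → h (inj₂ (inj₁ i , j)))
  (assemble-ext fa λ i → tabulate-ext (component fa i) λ j → h (inj₂ (inj₂ (inj₂ i) , j)))
  (assemble-ext vs λ i → h′ (inj₂ i)) (tabulate-ext cs λ c → h′ (inj₁ c)) (tabulate-ext ws λ j → h (inj₁ j))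
  where
  perTape-cong : ∀ {ra ra′ fa fa′ vs vs′ cs cs′ ws ws′} → ra ≡ ra′ → fa ≡ fa′ → vs ≡ vs′ → cs ≡ cs′ → ws ≡
      ws′ →
          (PerTape σ k _ _ ∋ perTape ra fa vs cs ws) ≡ perTape ra′ fa′ vs′ cs′ ws′
  perTape-cong refl refl refl refl refl = refl

digit-bit : ∀ b → digit (bit b) ≡ suc (bitℕ b)
digit-bit true  = refl
digit-bit false = refl

-- The content of a read-only tape is represented by 0 if it is empty and by
-- 1 + v if it is the numeral of v.

data Encodes : ℕ → List Symbol → Set where
  empty   : Encodes 0 []
  numeralOf : ∀ v → Encodes (suc v) (holding (numeral v))

scanNumeral : ℕ → ℕ → ℕ
scanNumeral zero    p = 0
scanNumeral (suc v) p = ifz (suc p ∸ suc ⌊log₂ v ⌋) (suc (bitℕ (testBit v (suc ⌊log₂ v ⌋ ∸ suc p)))) 0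

scanNumeral-correct : ∀ {v xs} p → Encodes v xs → scanNumeral v p ≡ digit (cell xs p)
scanNumeral-correct p empty       = refl
scanNumeral-correct p (numeralOf v) = within (suc p ∸ suc ⌊log₂ v ⌋) refl
  where
  l = suc ⌊log₂ v ⌋
  within : ∀ d → suc p ∸ l ≡ d → ifz d (suc (bitℕ (testBit v (l ∸ suc p)))) 0 ≡ digit
      (cell (holding (binary l v)) p)
  within zero    e = trans (sym (digit-bit _)) (cong digit (sym (cell-binary-< l v p (m∸n≡0⇒m≤n e))))
  within (suc d) e = cong digit (sym (cell-binary-≥ l v p (≮⇒≥ λ p<l → case trans (sym e) (m≤n⇒m∸n≡0 p<l) of
      λ ())))

cell-bit-< : ∀ xs i {b} → cell xs i ≡ bit b → i < length xs
cell-bit-< (x ∷ xs) zero    e = s≤s z≤n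
cell-bit-< (x ∷ xs) (suc i) e = s≤s (cell-bit-< xs i e)

encodes-length : ∀ {v xs} → Encodes v xs → length xs ≤ v
encodes-length empty       = z≤n
encodes-length (numeralOf v) = ≤-trans (≤-reflexive (length-map bit (numeral v)))
  (≤-trans (numeral-compact v) (≤-reflexive (cong suc (horner-numeral v))))

-- A right move leaves a bit, so it ends at most at the length of the content, which is bounded by
-- the code `v`. The content of a value-tape may shrink under its head; therefore the position is
-- compared with a common bound `m` instead of the current length.
moveReadOnly-≤ : ∀ {v xs m} d p → Encodes v xs → v ≤ m → p ≤ m → head (moveReadOnly d (tape xs p)) ≤ m
moveReadOnly-≤ left  p e l l′ = ≤-trans (pred[n]≤n {p}) l′
moveReadOnly-≤ stay  p e l l′ = l′
moveReadOnly-≤ {xs = xs} right p e l l′ with cell xs p in eq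
... | bit _ = ≤-trans (cell-bit-< xs p eq) (≤-trans (encodes-length e) l)
... | blank = l′

record Shows (v p : ℕ) (t : Tape) : Set where
  constructor shows
  field
    encoded : Encodes v (content t)
    head≡   : p ≡ head t

open Shows public

module ReadOnlyTerms (Sg : Signature) where
  open Toolbox Sg

  module _ {V : Set} where

    scanNumeralE : Ex V → Ex V → Ex V
    scanNumeralE v p = ifE v (constE 0)
      (ifE (sucE p ⊖ bitsE (v ⊖ constE 1)) (sucE (testBitE (v ⊖ constE 1) (bitsE (v ⊖ constE 1) ⊖ sucE p)))
          (constE 0))

    sem-scanNumeralE : ∀ v p I ρ → sem (scanNumeralE v p) I ρ ≡ scanNumeral (sem v I ρ) (sem p I ρ)
    sem-scanNumeralE v p I ρ = trans
      (cong₂ (λ l b → ifz (sem v I ρ) 0 (ifz (suc (sem p I ρ) ∸ l) (suc b) 0)) bits≡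
        (trans (sem-testBitE (v ⊖ constE 1) (bitsE (v ⊖ constE 1) ⊖ sucE p) I ρ)
            (cong (λ l → bitℕ (testBit (sem v I ρ ∸ 1) (l ∸ suc (sem p I ρ)))) bits≡)))
      (unfolded (sem v I ρ))
      where
      bits≡ = sem-bitsE (v ⊖ constE 1) I ρ
      unfolded : ∀ v → ifz v 0 (ifz (suc (sem p I ρ) ∸ suc ⌊log₂ v ∸ 1 ⌋)
          (suc (bitℕ (testBit (v ∸ 1) (suc ⌊log₂ v ∸ 1 ⌋ ∸ suc (sem p I ρ))))) 0) ≡
                       scanNumeral v (sem p I ρ)
      unfolded zero    = refl
      unfolded (suc v) = refl

    sem-scanReadE : ∀ {v p I ρ t} → Shows (sem v I ρ) (sem p I ρ) t → sem (scanNumeralE v p) I ρ ≡ digit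
        (scan t)
    sem-scanReadE {v} {p} {I} {ρ} {t} (shows e h) = trans (sem-scanNumeralE v p I ρ)
      (trans (scanNumeral-correct (sem p I ρ) e) (cong (λ i → digit (cell (content t) i)) h))

    moveReadE : Move → Ex V → Ex V → Ex V
    moveReadE left  v p = p ⊖ constE 1
    moveReadE right v p = ifE (scanNumeralE v p) p (sucE p)
    moveReadE stay  v p = p

    sem-moveReadE : ∀ d {v p I ρ t} → Shows (sem v I ρ) (sem p I ρ) t → sem (moveReadE d v p) I ρ ≡ head
        (moveReadOnly d t)
    sem-moveReadE left  (shows e h) = cong pred h
    sem-moveReadE stay  (shows e h) = h
    sem-moveReadE right {v} {p} {I} {ρ} {t} r = trans (cong₂ (λ c x → ifz c x (suc x))
        (sem-scanReadE {v} {p} r) (head≡ r)) (moved-right t)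
      where
      moved-right : ∀ t → ifz (digit (scan t)) (head t) (suc (head t)) ≡ head (moveReadOnly right t)
      moved-right t with scan t
      ... | bit true  = refl
      ... | bit false = refl
      ... | blank     = refl

-- A random-access machine simulates a direct-access machine.  In phase 0 it
-- determines the size n, as the least n whose encodings reach the end-marker.

module SimulateDirectAccess (σ : Vocabulary) (M : DirectAccessMachine σ) where
  open DirectAccessMachine M
  open Plans inputSignature
  open Toolbox inputSignature
  open TapeTerms inputSignature
  open ReadOnlyTerms inputSignature
  open QueryTerms σ
  open DirectAccessTapes σ k
  open Signature (structureSignature σ) using (Op; arity; Address; Read)
  private
    rels = relations σ
    funs = functions σ

  data Var : Set where
    phase size st : Var
    nm pos        : Writable → Var
    rv rp         : Read → Var

  enum-Address : Enumeration Address
  enum-Address = enum-Σ-⊎ (enum-Σ λ i → enum-Fin (List.lookup rels i))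
    (enum-Σ-⊎ (enum-Σ λ _ → enum-Fin 0) (enum-Σ λ f → enum-Fin (List.lookup funs f)))

  enum-Writable : Enumeration Writable
  enum-Writable = enum-⊎ (enum-Fin k) enum-Address

  enum-Read : Enumeration Read
  enum-Read = enum-⊎ (enum-Fin (suc (#constants σ))) (enum-Fin (length funs))

  vars : Enumeration Var
  vars = enum-image to from (λ { phase → refl ; size → refl ; st → refl ; (nm _) → refl ; (pos _) → refl ;
      (rv _) → refl ; (rp _) → refl })
    (enum-⊎ (enum-Fin 3) (enum-⊎ (enum-⊎ enum-Writable enum-Writable) (enum-⊎ enum-Read enum-Read)))
    where
    to : Fin 3 ⊎ ((Writable ⊎ Writable) ⊎ (Read ⊎ Read)) → Var
    to (inj₁ zero)             = phase
    to (inj₁ (suc zero))       = size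
    to (inj₁ (suc (suc zero))) = st
    to (inj₂ (inj₁ (inj₁ x)))  = nm x
    to (inj₂ (inj₁ (inj₂ x)))  = pos x
    to (inj₂ (inj₂ (inj₁ y)))  = rv y
    to (inj₂ (inj₂ (inj₂ y)))  = rp y
    from : Var → Fin 3 ⊎ ((Writable ⊎ Writable) ⊎ (Read ⊎ Read))
    from phase   = inj₁ zero
    from size    = inj₁ (suc zero)
    from st      = inj₁ (suc (suc zero))
    from (nm x)  = inj₂ (inj₁ (inj₁ x))
    from (pos x) = inj₂ (inj₁ (inj₂ x))
    from (rv y)  = inj₂ (inj₂ (inj₁ y))
    from (rp y)  = inj₂ (inj₂ (inj₂ y))

  toQ : Fin #Q → Q
  toQ = Inverse.from finite

  fromQ : Q → Fin #Q
  fromQ = Inverse.to finite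

  toQ-fromQ : ∀ q → toQ (fromQ q) ≡ q
  toQ-fromQ q = Inverse.strictlyInverseʳ finite q

  -- The answers to queries are treated as scanned symbols `bit b`, so that a single decision tree
  -- covers everything on which the transition function depends besides the state.
  Observable : Set
  Observable = Writable ⊎ (Read ⊎ Fin (length rels))

  enum-Observable : Enumeration Observable
  enum-Observable = enum-⊎ enum-Writable (enum-⊎ enum-Read (enum-Fin (length rels)))

  open Enumeration enum-Observable using () renaming (elem to observable; index to position; elem-index to
      observable-position)

  numbersE : ∀ o → Vec (Ex Var) (arity o)
  numbersE o = Vec.tabulate λ i → numberE (varE (nm (inj₂ (o , i))))

  observeE : Observable → Ex Var
  observeE (inj₁ x)        = scanE (varE (nm x)) (varE (pos x))
  observeE (inj₂ (inj₁ y)) = scanNumeralE (varE (rv y)) (varE (rp y))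
  observeE (inj₂ (inj₂ i)) = sucE (answerE (varE size) i (numbersE (inj₁ i)))

  applied : ∀ {A : Set} → (PerTape σ k Symbol Symbol → All (λ _ → Bool) rels → A) → (Observable → Symbol) → A
  applied f o = f (build (o ∘ inj₁) (o ∘ inj₂ ∘ inj₁)) (assemble rels (is1 ∘ o ∘ inj₂ ∘ inj₂))

  tree : (Q → PerTape σ k Symbol Symbol → All (λ _ → Bool) rels → Ex Var) → Ex Var
  tree f = caseFin #Q (varE st) λ q → caseVec (Vec.tabulate (observeE ∘ observable)) λ ss → applied
      (f (toQ q)) (Vec.lookup ss ∘ position)

  Actions : Set
  Actions = Maybe (Q × PerTape σ k (Symbol × Move) Move)

  goingOn : Q → Actions → Ex Var
  goingOn q m = if accepting q then constE 0 else constE (Maybe.maybe′ (λ _ → 1) 0 m)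

  actedTape : PerTape σ k (Symbol × Move) Move → Writable → Ex Var × Ex Var
  actedTape as x = actedE (varE (nm x)) (varE (pos x)) (writable as x)

  actedNumbers : PerTape σ k (Symbol × Move) Move → ∀ o → Vec (Ex Var) (arity o)
  actedNumbers as o = Vec.tabulate λ i → numberE (proj₁ (actedTape as (inj₂ (o , i))))

  valueE : ∀ f → Vec (Ex Var) (List.lookup funs f) → Ex Var
  valueE f vs = ifE (outsideE (varE size) vs) (sucE (functionE (varE size) f vs)) (constE 0)

  nextOf : Var → Actions → Ex Var
  nextOf v             nothing         = constE 0
  nextOf phase         (just (q , as)) = constE 1
  nextOf size          (just (q , as)) = varE size
  nextOf st            (just (q , as)) = constE (toℕ (fromQ q))
  nextOf (nm x)        (just (q , as)) = proj₁ (actedTape as x)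
  nextOf (pos x)       (just (q , as)) = proj₂ (actedTape as x)
  nextOf (rv (inj₁ c)) (just (q , as)) = varE (rv (inj₁ c))
  -- Value-tapes are updated after the writing, so the arguments are read from the terms for the
  -- tapes after the step.
  nextOf (rv (inj₂ f)) (just (q , as)) = valueE f (actedNumbers as (inj₂ (inj₂ f)))
  nextOf (rp y)        (just (q , as)) = moveReadE (readable as y) (varE (rv y)) (varE (rp y))

  startOf : Var → Ex Var
  startOf phase               = constE 1
  startOf size                = varE size
  startOf st                  = constE (toℕ (fromQ q₀))
  startOf (nm x)              = constE 0
  startOf (pos x)             = constE 1
  startOf (rv (inj₁ zero))    = sucE (varE size)
  startOf (rv (inj₁ (suc c))) = sucE (constantE (varE size) c)
  startOf (rv (inj₂ f))       = constE 0
  startOf (rp y)              = constE 0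

  searchOf : Var → Ex Var
  searchOf size = sucE (varE size)
  searchOf _    = constE 0

  initialOf : Var → ℕ
  initialOf size = 1
  initialOf _    = 0

  -- The answer is 2 for the end-marker and at most 1 for a bit of the input; subtracting 1 leaves a
  -- positive number just for the end-marker.
  foundE : Ex Var
  foundE = queryE (lengthE (varE size)) ⊖ constE 1

  plan : Plan
  plan = record
    { Var      = Var
    ; vars     = vars
    ; initE    = constE ∘ initialOf
    ; stepE    = λ v → ifE (varE phase) (ifE foundE (searchOf v) (startOf v)) (tree λ q ss as → nextOf v
        (δ q ss as))
    ; goingE   = ifE (varE phase) (constE 1) (tree λ q ss as → goingOn q (δ q ss as))
    ; verdictE = caseFin #Q (varE st) λ q → constE (bitℕ (accepting (toQ q)))
    }

  open Plan plan using (Path; stop; go; goingE; verdictE; stepE)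

  module _ (A : OrderedStructure σ) where
    open DirectAccessStep M A
    private
      module D = DirectAccess M A
      module SI = Interpretation (structureInterpretation σ A)
      n = OrderedStructure.size A
      I : Interpretation inputSignature
      I = inputInterpretation (bin A)

    record Sim (s : Var → ℕ) (q : Q) (t : PerTape σ k Tape Tape) : Set where
      constructor sim
      field
        phase≡    : s phase ≡ 1
        size≡     : s size ≡ n
        state≡    : s st ≡ toℕ (fromQ q)
        writable≡ : ∀ x → Represents (s (nm x)) (s (pos x)) (writable t x)
        readable≡ : ∀ y → Shows (s (rv y)) (s (rp y)) (readable t y)
        value≤    : ∀ y → s (rv y) ≤ suc n
        position≤ : ∀ y → s (rp y) ≤ suc n
        constants : Constants t

    open Sim

    observation : PerTape σ k Tape Tape → Observable → Symbol
    observation t (inj₁ x)        = scan (writable t x)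
    observation t (inj₂ (inj₁ y)) = scan (readable t y)
    observation t (inj₂ (inj₂ i)) = bit (component (D.answers t) i)

    numbers≡ : ∀ {s q t} → Sim s q t → ∀ o → Vec.map (λ e → sem e I s) (numbersE o) ≡ tapeNumbers o t
    numbers≡ {s} {t = t} r o = trans
        (sym (tabulate-∘ (λ e → sem e I s) (λ i → numberE (varE (nm (inj₂ (o , i)))))))
      (tabulate-cong λ i → sem-numberE {N = varE (nm (inj₂ (o , i)))} {I} {s} (writable t (inj₂ (o , i)))
          (number≡ (writable≡ r (inj₂ (o , i)))))

    sem-observeE : ∀ {s q t} → Sim s q t → ∀ x → sem (observeE x) I s ≡ digit (observation t x)
    sem-observeE {s} r (inj₁ x) = sem-scanE {N = varE (nm x)} {varE (pos x)} {I} {s} (writable≡ r x)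
    sem-observeE {s} r (inj₂ (inj₁ y)) = sem-scanReadE {v = varE (rv y)} {varE (rp y)} {I} {s} (readable≡ r y)
    sem-observeE {s} {t = t} r (inj₂ (inj₂ i)) = trans
      (cong suc (trans (sem-answerE A (varE size) s (size≡ r) i (numbersE (inj₁ i)))
          (cong (SI.askᴵ i) (numbers≡ r (inj₁ i)))))
      (trans (cong suc (distribute (elements n (tapeNumbers (inj₁ i) t))))
          (trans (cong (suc ∘ bitℕ) (sym (answers-ask t i))) (sym (digit-bit _))))
      where
      open OrderedStructure A using (relᴵ)
      distribute : ∀ m → Maybe.maybe (bitℕ ∘ component relᴵ i) 0 m ≡ bitℕ (Maybe.maybe (component relᴵ i)
          false m)
      distribute (just _) = refl
      distribute nothing  = refl

    sem-tree : ∀ {s q t} f → Sim s q t → sem (tree f) I s ≡ sem (f q (D.scanAll t) (D.answers t)) I s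
    sem-tree {s} {q} {t} f r = trans
      (sem-caseFin #Q {varE st} {λ q → caseVec (Vec.tabulate (observeE ∘ observable)) λ ss → applied
          (f (toQ q)) (Vec.lookup ss ∘ position)} {I} {s} (fromQ q) (state≡ r))
      (trans (sem-caseVec (Vec.tabulate (observeE ∘ observable)) {λ ss → applied (f (toQ (fromQ q)))
          (Vec.lookup ss ∘ position)} {I} {s}
          (Vec.tabulate (observation t ∘ observable)) symbols)
        (cong (λ e → sem e I s) (trans (cong₂ (f (toQ (fromQ q))) scans≡ answers≡)
            (cong (λ q → f q (D.scanAll t) (D.answers t)) (toQ-fromQ q)))))
      where
      symbols : ∀ i → sem (Vec.lookup (Vec.tabulate (observeE ∘ observable)) i) I s ≡ digit
          (Vec.lookup (Vec.tabulate (observation t ∘ observable)) i)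
      symbols i = trans (cong (λ e → sem e I s) (lookup∘tabulate (observeE ∘ observable) i))
        (trans (sem-observeE r (observable i))
            (cong digit (sym (lookup∘tabulate (observation t ∘ observable) i))))
      seen : ∀ x → Vec.lookup (Vec.tabulate (observation t ∘ observable)) (position x) ≡ observation t x
      seen x = trans (lookup∘tabulate (observation t ∘ observable) (position x))
          (cong (observation t) (observable-position x))
      scans≡ = build-ext (D.scanAll t)
        {λ x → Vec.lookup (Vec.tabulate (observation t ∘ observable)) (position (inj₁ x))}
        {λ y → Vec.lookup (Vec.tabulate (observation t ∘ observable)) (position (inj₂ (inj₁ y)))}
        (λ x → trans (seen (inj₁ x)) (sym (writable-scan t x))) (λ y → trans (seen (inj₂ (inj₁ y)))
            (sym (readable-scan t y)))
      answers≡ = assemble-ext (D.answers t)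
          {λ i → is1 (Vec.lookup (Vec.tabulate (observation t ∘ observable)) (position (inj₂ (inj₂ i))))}
        (λ i → cong is1 (seen (inj₂ (inj₂ i))))

    sem-valueE : ∀ {s q t} → Sim s q t → ∀ f vs → let xs = Vec.map (λ e → sem e I s) vs in
      Encodes (sem (valueE f vs) I s) (holding (SI.readᴵ (inj₂ f) xs)) × sem (valueE f vs) I s ≤ suc n
    sem-valueE {s} r f vs = decide (sem-outsideE (varE size) vs I s)
      where
      open OrderedStructure A using (funᴵ)
      xs = Vec.map (λ e → sem e I s) vs
      chosen : ℕ → ℕ
      chosen o = ifz o (suc (sem (functionE (varE size) f vs) I s)) 0
      Goal : ℕ → Set
      Goal v = Encodes v (holding (SI.readᴵ (inj₂ f) xs)) × v ≤ suc n
      decide : (sem (outsideE (varE size) vs) I s ≡ 0 × (∀ i → Vec.lookup xs i < s size)) ⊎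
               ((∃ λ k → sem (outsideE (varE size) vs) I s ≡ suc k) × elements (s size) xs ≡ nothing) → Goal
                   (sem (valueE f vs) I s)
      decide (inj₁ (e , h)) =
        let h′ = λ j → subst (Vec.lookup xs j <_) (size≡ r) (h j)
            ys , _ , e′ = rank-elements n xs h′
            u = toℕ (component funᴵ f ys)
            v≡ = trans (sem-functionE A (varE size) s (size≡ r) f vs h′) (function-value A f xs e′)
        in subst Goal (sym (cong chosen e)) (subst (λ v → Goal (suc v)) (sym v≡)
             (subst (λ bs → Encodes (suc u) (holding bs))
                 (sym (cong (Maybe.maybe (numeral ∘ toℕ ∘ component funᴵ f) []) e′)) (numeralOf u) ,
              s≤s (<⇒≤ (toℕ<n (component funᴵ f ys)))))
      decide (inj₂ ((k , e) , none)) =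
        let e′ = subst (λ m → elements m xs ≡ nothing) (size≡ r) none
        in subst Goal (sym (cong chosen e))
             (subst (λ bs → Encodes 0 (holding bs))
                 (sym (cong (Maybe.maybe (numeral ∘ toℕ ∘ component funᴵ f) []) e′)) empty , z≤n)

    module _ (T : ℕ) where
      private
        S = D.system
        -- Codes and positions of read-only tapes reach `suc n`, one more than the elements and
        -- constants of the structure, which costs one further bit.
        β = (T + T) + (#Q + suc ⌈log₂ n ⌉)

        1+n≤ : suc n ≤ 2 ^ suc ⌈log₂ n ⌉
        1+n≤ = ≤-trans (+-mono-≤ (m^n>0 2 ⌈log₂ n ⌉) (⌈log₂⌉-≥ n))
            (≤-reflexive (cong (2 ^ ⌈log₂ n ⌉ +_) (sym (+-identityʳ _))))

        1+n≤2^β : suc n ≤ 2 ^ β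
        1+n≤2^β = ≤-trans 1+n≤ (^-monoʳ-≤ 2 (≤-trans (m≤n+m _ #Q) (m≤n+m _ (T + T))))

      Short : PerTape σ k Tape Tape → Set
      Short t = ∀ x → length (content (writable t x)) ≤ T

      sim-≤ : ∀ {s q t} → Sim s q t → Short t → cells (D.charged t) ≤ T → ∀ v → s v ≤ 2 ^ β
      sim-≤ r l h phase = ≤-trans (≤-reflexive (phase≡ r)) (m^n>0 2 β)
      sim-≤ r l h size  = ≤-trans (≤-reflexive (size≡ r)) (≤-trans (n≤1+n n) 1+n≤2^β)
      sim-≤ {q = q} r l h st = ≤-trans (≤-reflexive (state≡ r)) (≤-trans (<⇒≤ (toℕ<n (fromQ q)))
        (≤-trans (n≤2^n #Q) (^-monoʳ-≤ 2 (≤-trans (m≤m+n #Q _) (m≤n+m _ (T + T))))))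
      sim-≤ {t = t} r l h (nm x)  = ≤-trans
          (proj₁ (represents-≤ (writable≡ r x) (l x) (heads-charged t h x))) (^-monoʳ-≤ 2 (m≤m+n (T + T) _))
      sim-≤ {t = t} r l h (pos x) = ≤-trans
          (proj₂ (represents-≤ (writable≡ r x) (l x) (heads-charged t h x))) (^-monoʳ-≤ 2 (m≤m+n (T + T) _))
      sim-≤ r l h (rv y) = ≤-trans (value≤ r y) 1+n≤2^β
      sim-≤ r l h (rp y) = ≤-trans (position≤ r y) 1+n≤2^β

      verdict-sem : ∀ {s q t} → Sim s q t → sem verdictE I s ≡ bitℕ (accepting q)
      verdict-sem {s} {q} r = trans (sem-caseFin #Q {varE st} {λ q → constE (bitℕ (accepting (toQ q)))} {I}
          {s} (fromQ q) (state≡ r)) (cong (bitℕ ∘ accepting) (toQ-fromQ q))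

      observed : Q → PerTape σ k Tape Tape → Actions
      observed q t = δ q (D.scanAll t) (D.answers t)

      going-sem : ∀ {s q t} → Sim s q t → sem goingE I s ≡ sem (goingOn q (observed q t)) I s
      going-sem {s} r = trans (cong (λ p → ifz p 1 (sem (tree λ q ss as → goingOn q (δ q ss as)) I s))
          (phase≡ r))
        (sem-tree (λ q ss as → goingOn q (δ q ss as)) r)

      going-on : ∀ q m s → accepting q ≡ false → sem (goingOn q m) I s ≡ Maybe.maybe′ (λ _ → 1) 0 m
      going-on q m s e = cong (λ b → sem (if b then constE 0 else constE (Maybe.maybe′ (λ _ → 1) 0 m)) I s) e

      step-sim : ∀ {s q t q′ as} → Sim s q t → observed q t ≡ just (q′ , as) →
                 Sim (λ v → sem (stepE v) I s) q′ (after as t)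
      step-sim {s} {q} {t} {q′} {as} r e = sim (stepped phase) (trans (stepped size) (size≡ r)) (stepped st)
          written
        (λ y → shows (subst (λ v → Encodes v _) (sym (stepped (rv y))) (proj₁ (value y)))
                 (trans (stepped (rp y)) (trans (sem-moveReadE (readable as y) {varE (rv y)} {varE (rp y)}
                     {I} {s} (readable≡ r y)) (sym (head-after as t y)))))
        (λ y → subst (_≤ suc n) (sym (stepped (rv y))) (proj₂ (value y)))
        (λ y → subst (_≤ suc n) (sym (stepped (rp y)))
                 (subst (_≤ suc n) (sym (sem-moveReadE (readable as y) {varE (rv y)} {varE (rp y)} {I} {s}
                     (readable≡ r y)))
                   (subst (λ p → head (moveReadOnly (readable as y) (tape (content (readable t y)) p)) ≤ suc
                       n) (head≡ (readable≡ r y))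
                     (moveReadOnly-≤ (readable as y) (s (rp y)) (encoded (readable≡ r y)) (value≤ r y)
                         (position≤ r y)))))
        (constants-after as t (constants r))
        where
        stepped : ∀ v → sem (stepE v) I s ≡ sem (nextOf v (just (q′ , as))) I s
        stepped v = trans (cong (λ p → ifz p (sem (ifE foundE (searchOf v) (startOf v)) I s)
            (sem (tree λ q ss as → nextOf v (δ q ss as)) I s)) (phase≡ r))
          (trans (sem-tree (λ q ss as → nextOf v (δ q ss as)) r) (cong (λ m → sem (nextOf v m) I s) e))

        acted : ∀ x → Represents (sem (proj₁ (actedTape as x)) I s) (sem (proj₂ (actedTape as x)) I s)
            (writable (after as t) x)
        acted x = subst (Represents _ _) (sym (writable-after as t x)) (sem-actedE {N = varE (nm x)}
            {varE (pos x)} {I} {s} (writable as x) (writable≡ r x))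

        written : ∀ x → Represents (sem (stepE (nm x)) I s) (sem (stepE (pos x)) I s)
            (writable (after as t) x)
        written x = represents (trans (stepped (nm x)) (number≡ (acted x)))
            (trans (stepped (pos x)) (power≡ (acted x)))

        acted-numbers : ∀ o → Vec.map (λ e → sem e I s) (actedNumbers as o) ≡ tapeNumbers o (after as t)
        acted-numbers o = trans (sym (tabulate-∘ (λ e → sem e I s)
            (λ i → numberE (proj₁ (actedTape as (inj₂ (o , i)))))))
          (tabulate-cong λ i → sem-numberE {N = proj₁ (actedTape as (inj₂ (o , i)))} {I} {s}
              (writable (after as t) (inj₂ (o , i))) (number≡ (acted (inj₂ (o , i)))))

        value : ∀ y → Encodes (sem (nextOf (rv y) (just (q′ , as))) I s) (content (readable (after as t) y))
            × sem (nextOf (rv y) (just (q′ , as))) I s ≤ suc n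
        value (inj₁ c) = subst (Encodes (s (rv (inj₁ c))))
            (trans (constants r c) (sym (constants-after as t (constants r) c)))
            (encoded (readable≡ r (inj₁ c))) , value≤ r (inj₁ c)
        value (inj₂ f) = let e , l = sem-valueE r f (actedNumbers as (inj₂ (inj₂ f))) in
          subst (Encodes _) (sym (trans (contents-after as t (constants r) (inj₂ f))
              (cong (holding ∘ SI.readᴵ (inj₂ f)) (sym (acted-numbers (inj₂ (inj₂ f))))))) e , l

      short-step : ∀ {t} as → Short t → cells (D.charged t) ≤ T → Short (after as t)
      short-step {t} as l h x = subst (λ u → length (content u) ≤ T) (sym (writable-after as t x))
        (length-overwrite (content (writable t x)) (head (writable t x)) (proj₁ (writable as x)) (l x)
            (heads-charged t h x))

      path : ∀ {q t s b} (v : Verdict S (D.config q t) b) → space S v ≤ T → Sim s q t → Short t → Path I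
          (2 ^ β) s b
      path {q} {t} {s} d@(accept a) l r sh = stop (sim-≤ r sh (≤-trans (cells≤space d) l))
        (trans (going-sem r) (cong (λ b → sem (if b then constE 0 else constE (Maybe.maybe′ (λ _ → 1) 0
            (observed q t))) I s) a))
        (cong (0 <ᵇ_) (trans (verdict-sem r) (cong bitℕ a)))
      path {q} {t} {s} d@(reject a h) l r sh = stop (sim-≤ r sh (≤-trans (cells≤space d) l))
        (trans (going-sem r) (trans (going-on q (observed q t) s a) (halted (observed q t) h)))
        (cong (0 <ᵇ_) (trans (verdict-sem r) (cong bitℕ a)))
        where
        halted : ∀ m → Maybe.map (λ (q′ , as) → D.config q′ (after as t)) m ≡ nothing → Maybe.maybe′
            (λ _ → 1) 0 m ≡ 0
        halted nothing _ = refl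
      path {q} {t} {s} {b} d@(continue a h v) l r sh = goes (observed q t) refl h v (≤-trans (m≤n⊔m _ _) l)
        where
        here≤ = ≤-trans (cells≤space d) l
        goes : ∀ m {c} → observed q t ≡ m → Maybe.map (λ (q′ , as) → D.config q′ (after as t)) m ≡ just c →
               (v : Verdict S c b) → space S v ≤ T → Path I (2 ^ β) s b
        goes (just (q′ , as)) e refl v l′ = go (sim-≤ r sh here≤)
          (trans (going-sem r) (trans (going-on q (observed q t) s a) (cong (Maybe.maybe′ (λ _ → 1) 0) e)))
          (path v l′ (step-sim r e) (short-step as sh here≤))

      started : ∀ {s} → s phase ≡ 0 → s size ≡ n → sem foundE I s ≡ 1 → Sim (λ v → sem (stepE v) I s) q₀
          initialTapes
      started {s} p m f = sim (begun phase) (trans (begun size) m) (begun st)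
        (λ x → represents (trans (begun (nm x)) (cong (code ∘ content) (sym (initial-writable x))))
            (trans (begun (pos x)) (cong (λ u → 3 ^ head u) (sym (initial-writable x)))))
        (λ y → shows (subst (λ v → Encodes v _) (sym (begun (rv y))) (proj₁ (value y)))
            (trans (begun (rp y)) (sym (zero-head y))))
        (λ y → subst (_≤ suc n) (sym (begun (rv y))) (proj₂ (value y)))
        (λ y → subst (_≤ suc n) (sym (begun (rp y))) z≤n)
        initial-constants
        where
        open OrderedStructure A using (constᴵ)
        begun : ∀ v → sem (stepE v) I s ≡ sem (startOf v) I s
        begun v = trans (cong (λ p → ifz p (sem (ifE foundE (searchOf v) (startOf v)) I s)
            (sem (tree λ q ss as → nextOf v (δ q ss as)) I s)) p)
          (cong (λ f → ifz f (sem (searchOf v) I s) (sem (startOf v) I s)) f)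

        zero-head : ∀ y → head (readable initialTapes y) ≡ 0
        zero-head (inj₁ c) = cong head (initial-constant c)
        zero-head (inj₂ f) = cong head (initial-value f)

        value : ∀ y → Encodes (sem (startOf (rv y)) I s) (content (readable initialTapes y)) × sem
            (startOf (rv y)) I s ≤ suc n
        value (inj₁ zero) = subst₂ Encodes (cong suc (sym m)) (sym (cong content (initial-constant zero)))
            (numeralOf n) , ≤-reflexive (cong suc m)
        value (inj₁ (suc c)) =
          subst₂ Encodes (cong suc (sym c≡)) (sym (trans (cong content (initial-constant (suc c)))
              (cong (holding ∘ numeral) (lookup-map c toℕ constᴵ)))) (numeralOf (toℕ (Vec.lookup constᴵ c))) ,
          ≤-trans (≤-reflexive (cong suc c≡)) (s≤s (<⇒≤ (toℕ<n (Vec.lookup constᴵ c))))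
          where c≡ = sem-constantE A (varE size) s m c
        value (inj₂ f) = subst (Encodes 0) (sym (cong content (initial-value f))) empty , z≤n

      bitAt-end : ∀ w → bitAt w (length w) ≡ 2
      bitAt-end []      = refl
      bitAt-end (b ∷ w) = bitAt-end w

      bitAt-inside : ∀ w i → i < length w → bitAt w i ∸ 1 ≡ 0
      bitAt-inside (true ∷ w)  zero    l       = refl
      bitAt-inside (false ∷ w) zero    l       = refl
      bitAt-inside (x ∷ w)     (suc i) (s≤s l) = bitAt-inside w i l

      sem-foundE : ∀ {s m} → s size ≡ m → sem foundE I s ≡ bitAt (bin A) (encodingLength σ m) ∸ 1
      sem-foundE {s} e = cong (λ i → bitAt (bin A) i ∸ 1) (trans (sem-lengthE (varE size) I s)
          (cong (encodingLength σ) e))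

      -- Induction on the distance `d` from the candidate `m` to `n`. By strict monotonicity a
      -- smaller candidate points at a bit inside the input, so the end-marker is met at `n` and not
      -- before. This is where a symbol of positive arity is indispensable to the search.
      search : (∀ m → 1 ≤ m → m < n → encodingLength σ m < encodingLength σ n) → ∀ d m {s b} → d + m ≡ n → 1
          ≤ m →
               s phase ≡ 0 → s size ≡ m → (∀ v → s v ≤ 2 ^ β) → Short initialTapes →
               (v : Verdict S D.initial b) → space S v ≤ T → Path I (2 ^ β) s b
      search mono zero m {s} refl 1≤m p e l sh v sp = go l
          (cong (λ p → ifz p 1 (sem (tree λ q ss as → goingOn q (δ q ss as)) I s)) p)
        (path v sp (started {s} p e (trans (sem-foundE {s} e) found)) sh)
        where
        found : bitAt (bin A) (encodingLength σ n) ∸ 1 ≡ 1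
        found = trans (cong (λ i → bitAt (bin A) i ∸ 1) (sym (length-bin A)))
            (cong (_∸ 1) (bitAt-end (bin A)))
      search mono (suc d) m {s} {b} eq 1≤m p e l sh v sp = go l
          (cong (λ p → ifz p 1 (sem (tree λ q ss as → goingOn q (δ q ss as)) I s)) p)
        (search mono d (suc m) (trans (+-suc d m) eq) (s≤s z≤n) (searched phase)
            (trans (searched size) (cong suc e)) bounded sh v sp)
        where
        m<n : m < n
        m<n = ≤-trans (s≤s (m≤n+m m d)) (≤-reflexive eq)
        missed : sem foundE I s ≡ 0
        missed = trans (sem-foundE {s} e) (bitAt-inside (bin A) (encodingLength σ m)
            (subst (encodingLength σ m <_) (sym (length-bin A)) (mono m 1≤m m<n)))
        searched : ∀ v → sem (stepE v) I s ≡ sem (searchOf v) I s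
        searched v = trans (cong (λ p → ifz p (sem (ifE foundE (searchOf v) (startOf v)) I s)
            (sem (tree λ q ss as → nextOf v (δ q ss as)) I s)) p)
          (cong (λ f → ifz f (sem (searchOf v) I s) (sem (startOf v) I s)) missed)
        bounded : ∀ v → sem (stepE v) I s ≤ 2 ^ β
        bounded v = ≤-trans (≤-reflexive (searched v)) (small v)
          where
          small : ∀ v → sem (searchOf v) I s ≤ 2 ^ β
          small phase   = z≤n
          small size    = ≤-trans (≤-trans (≤-reflexive (cong suc e)) m<n) (≤-trans (n≤1+n n) 1+n≤2^β)
          small st      = z≤n
          small (nm _)  = z≤n
          small (pos _) = z≤n
          small (rv _)  = z≤n
          small (rp _)  = z≤n

  simulation : (∀ {m n} → 1 ≤ m → m < n → encodingLength σ m < encodingLength σ n) →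
    ∀ A {b} (v : Verdict (DirectAccess.system M A) (DirectAccess.initial M A) b) →
    let S = space (DirectAccess.system M A) v ; β = (S + S) + (#Q + suc ⌈log₂ OrderedStructure.size A ⌉) in
    Σ (Verdict (RandomAccess.system (planMachineʳ plan) (bin A)) (RandomAccess.initial (planMachineʳ plan)
        (bin A)) b) λ d →
      space (RandomAccess.system (planMachineʳ plan) (bin A)) d ≤ 3 + β * Plan.degree plan
  simulation mono A v = plan-decidesʳ plan (bin A) β 1≤β
    (search A S (λ m → mono) (n ∸ 1) 1 (m∸n+n≡m 0<n) ≤-refl refl refl small short v ≤-refl)
    where
    n S β : ℕ
    n = OrderedStructure.size A
    S = space (DirectAccess.system M A) v
    β = (S + S) + (#Q + suc ⌈log₂ n ⌉)
    0<n : 0 < n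
    0<n = >-nonZero⁻¹ n {{OrderedStructure.nonEmpty A}}
    1≤β : 1 ≤ β
    1≤β = ≤-trans (s≤s z≤n) (≤-trans (m≤n+m _ #Q) (m≤n+m _ (S + S)))
    small : ∀ v → initialOf v ≤ 2 ^ β
    small phase   = z≤n
    small size    = m^n>0 2 β
    small st      = z≤n
    small (nm _)  = z≤n
    small (pos _) = z≤n
    small (rv _)  = z≤n
    small (rp _)  = z≤n
    short : Short A S (DirectAccess.Config.tapes (DirectAccess.initial M A))
    short x = subst (λ t → length (content t) ≤ S) (sym (DirectAccessStep.initial-writable M A x)) z≤n

-- Growth of the length of the encoding

sumFin-mono : ∀ {m} {f g : Fin m → ℕ} → (∀ i → f i ≤ g i) → sumFin f ≤ sumFin g
sumFin-mono {zero}  h = z≤n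
sumFin-mono {suc m} h = +-mono-≤ (h zero) (sumFin-mono (h ∘ suc))

sumFin-strict : ∀ {m} {f g : Fin m → ℕ} → (∀ i → f i ≤ g i) → ∀ i → f i < g i → sumFin f < sumFin g
sumFin-strict h zero    l = +-mono-<-≤ l (sumFin-mono (h ∘ suc))
sumFin-strict h (suc i) l = +-mono-≤-< (h zero) (sumFin-strict (h ∘ suc) i l)

≤-sumFin : ∀ {m} (f : Fin m → ℕ) i → f i ≤ sumFin f
≤-sumFin f zero    = m≤m+n (f zero) _
≤-sumFin f (suc i) = ≤-trans (≤-sumFin (f ∘ suc) i) (m≤n+m _ (f zero))

1≤⌈log₂⌉ : ∀ {n} → 2 ≤ n → 1 ≤ ⌈log₂ n ⌉
1≤⌈log₂⌉ = ⌈log₂⌉-mono-≤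

^-mono-< : ∀ {m n} r → 0 < r → m < n → m ^ r < n ^ r
^-mono-< (suc zero)    _ l = subst₂ _<_ (sym (*-identityʳ _)) (sym (*-identityʳ _)) l
^-mono-< (suc (suc r)) _ l = *-mono-< l (^-mono-< (suc r) (s≤s z≤n) l)

n≤n^r : ∀ {n} r → 1 ≤ n → 0 < r → n ≤ n ^ r
n≤n^r {n} (suc r) l _ = ≤-trans (≤-reflexive (sym (*-identityʳ n))) (*-monoʳ-≤ n (m^n>0 n {{>-nonZero l}} r))

module _ (σ : Vocabulary) (positive : HasPositiveArity σ) where
  private
    rels = relations σ
    funs = functions σ

    positive-symbol : (∃ λ i → 0 < List.lookup rels i) ⊎ (∃ λ f → 0 < List.lookup funs f)
    positive-symbol = Sum.map (λ p → Any.index p , Anyₚ.lookup-index p)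
        (λ p → Any.index p , Anyₚ.lookup-index p) (Anyₚ.++⁻ rels positive)

    function-length-mono : ∀ {m n} → m ≤ n → ∀ f → ⌈log₂ m ⌉ * m ^ List.lookup funs f ≤ ⌈log₂ n ⌉ * n ^
        List.lookup funs f
    function-length-mono l f = *-mono-≤ (⌈log₂⌉-mono-≤ l) (^-monoˡ-≤ (List.lookup funs f) l)

  -- All summands are monotone, and the one of a symbol of positive arity is strictly so. For a
  -- function symbol the factor `⌈log₂ n ⌉` must not vanish, which `2 ≤ n` ensures.
  encodingLength-< : ∀ {m n} → 1 ≤ m → m < n → encodingLength σ m < encodingLength σ n
  encodingLength-< {m} {n} 1≤m m<n with positive-symbol
  ... | inj₁ (i , p) = +-mono-<-≤
    (sumFin-strict (λ i → ^-monoˡ-≤ (List.lookup rels i) (<⇒≤ m<n)) i (^-mono-< (List.lookup rels i) p m<n))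
    (+-mono-≤ (sumFin-mono {#constants σ} λ _ → ⌈log₂⌉-mono-≤ (<⇒≤ m<n))
        (sumFin-mono (function-length-mono (<⇒≤ m<n))))
  ... | inj₂ (f , p) = +-mono-≤-<
    (sumFin-mono λ i → ^-monoˡ-≤ (List.lookup rels i) (<⇒≤ m<n))
    (+-mono-≤-< (sumFin-mono {#constants σ} λ _ → ⌈log₂⌉-mono-≤ (<⇒≤ m<n))
      (sumFin-strict (function-length-mono (<⇒≤ m<n)) f
        (≤-<-trans (*-monoˡ-≤ (m ^ List.lookup funs f) (⌈log₂⌉-mono-≤ (<⇒≤ m<n)))
          (*-monoʳ-< ⌈log₂ n ⌉ {{>-nonZero (1≤⌈log₂⌉ (≤-trans (s≤s 1≤m) m<n))}}
              (^-mono-< (List.lookup funs f) p m<n)))))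

  encodingLength-mono : ∀ m n → 1 ≤ m → m ≤ n → encodingLength σ m ≤ encodingLength σ n
  encodingLength-mono m n 1≤m l with m≤n⇒m<n∨m≡n l
  ... | inj₁ m<n  = <⇒≤ (encodingLength-< 1≤m m<n)
  ... | inj₂ refl = ≤-refl

  -- For `n` equal to 1 the logarithm is 0 and function values take no bits, so the encoding may
  -- even be empty; hence the lower bound on `n`.
  n≤encodingLength : ∀ n → 2 ≤ n → n ≤ encodingLength σ n
  n≤encodingLength n l with positive-symbol
  ... | inj₁ (i , p) = ≤-trans (n≤n^r (List.lookup rels i) (≤-trans (s≤s z≤n) l) p)
    (≤-trans (≤-sumFin (λ i → n ^ List.lookup rels i) i) (m≤m+n _ _))
  ... | inj₂ (f , p) = ≤-trans (n≤n^r (List.lookup funs f) (≤-trans (s≤s z≤n) l) p)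
    (≤-trans (≤-trans (≤-reflexive (sym (*-identityˡ _))) (*-monoˡ-≤ (n ^ List.lookup funs f) (1≤⌈log₂⌉ l)))
      (≤-trans (≤-sumFin (λ f → ⌈log₂ n ⌉ * n ^ List.lookup funs f) f)
          (≤-trans (m≤n+m _ (sumFin {#constants σ} λ _ → ⌈log₂ n ⌉))
          (m≤n+m _ (sumFin λ i → n ^ List.lookup rels i)))))

  size≤n̂ : (A : OrderedStructure σ) → 2 ≤ OrderedStructure.size A → OrderedStructure.size A ≤ n̂ A
  size≤n̂ A l = ≤-trans (n≤encodingLength (OrderedStructure.size A) l) (≤-reflexive (sym (length-bin A)))

-- Polynomials appear as powers of 2 with exponent `c * ⌈log₂ n ⌉`, from which `⌈log₂⌉-≤` gives a
-- linear bound between the logarithms. For `2 ≤ n` the logarithm is positive and absorbs constant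
-- factors.
PolynomiallyBounded : (ℕ → ℕ) → Set
PolynomiallyBounded f = ∃ λ c → ∀ n → 2 ≤ n → f n ≤ 2 ^ (c * ⌈log₂ n ⌉)

bounded-+ : ∀ {f g} → PolynomiallyBounded f → PolynomiallyBounded g → PolynomiallyBounded (λ n → f n + g n)
bounded-+ {f} {g} (c , h) (d , k) = suc (c + d) , λ n l → begin
  f n + g n                           ≤⟨ +-mono-≤
      (≤-trans (h n l) (^-monoʳ-≤ 2 (*-monoˡ-≤ ⌈log₂ n ⌉ (m≤m+n c d))))
                                                   (≤-trans (k n l) (^-monoʳ-≤ 2 (*-monoˡ-≤ ⌈log₂ n ⌉
                                                       (m≤n+m d c)))) ⟩
  2 ^ ((c + d) * ⌈log₂ n ⌉) + 2 ^ ((c + d) * ⌈log₂ n ⌉) ≡⟨ cong (2 ^ ((c + d) * ⌈log₂ n ⌉) +_)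
      (sym (+-identityʳ _)) ⟩
  2 ^ suc ((c + d) * ⌈log₂ n ⌉)       ≤⟨ ^-monoʳ-≤ 2 (+-monoˡ-≤ ((c + d) * ⌈log₂ n ⌉) (1≤⌈log₂⌉ l)) ⟩
  2 ^ (suc (c + d) * ⌈log₂ n ⌉)       ∎
  where open ≤-Reasoning

bounded-* : ∀ {f g} → PolynomiallyBounded f → PolynomiallyBounded g → PolynomiallyBounded (λ n → f n * g n)
bounded-* (c , h) (d , k) = c + d , λ n l → ≤-trans (*-mono-≤ (h n l) (k n l))
  (≤-reflexive (trans (sym (^-distribˡ-+-* 2 (c * ⌈log₂ n ⌉) (d * ⌈log₂ n ⌉)))
      (cong (2 ^_) (sym (*-distribʳ-+ ⌈log₂ n ⌉ c d)))))

bounded-^ : ∀ r → PolynomiallyBounded (_^ r)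
bounded-^ zero    = 0 , λ n l → ≤-refl
bounded-^ (suc r) = bounded-* {id} (1 , λ n l → ≤-trans (⌈log₂⌉-≥ n)
    (≤-reflexive (cong (2 ^_) (sym (+-identityʳ ⌈log₂ n ⌉))))) (bounded-^ r)

bounded-log : PolynomiallyBounded ⌈log₂_⌉
bounded-log = 1 , λ n l → ≤-trans (n≤2^n ⌈log₂ n ⌉) (≤-reflexive (cong (2 ^_) (sym (+-identityʳ ⌈log₂ n ⌉))))

bounded-sum : ∀ {m} (f : Fin m → ℕ → ℕ) → (∀ i → PolynomiallyBounded (f i)) → PolynomiallyBounded
    (λ n → sumFin (λ i → f i n))
bounded-sum {zero}  f h = 0 , λ n l → z≤n
bounded-sum {suc m} f h = bounded-+ (h zero) (bounded-sum (f ∘ suc) (h ∘ suc))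

encodingLength-bounded : ∀ σ → PolynomiallyBounded (encodingLength σ)
encodingLength-bounded σ = bounded-+ (bounded-sum _ λ i → bounded-^ (List.lookup (relations σ) i))
  (bounded-+ (bounded-sum {#constants σ} _ λ _ → bounded-log)
    (bounded-sum _ λ f → bounded-* bounded-log (bounded-^ (List.lookup (functions σ) f))))

*-^ : ∀ m n k → (m * n) ^ k ≡ m ^ k * n ^ k
*-^ m n zero    = refl
*-^ m n (suc k) = trans (cong (m * n *_) (*-^ m n k)) ([m*n]*[o*p]≡[m*o]*[n*p] m n (m ^ k) (n ^ k))

-- Deciders can be transferred along simulations with linear overhead.

open System

Simulation : {Input : Set} → (Input → System) → (Input → System) → (Input → ℕ) → Set
Simulation run run′ size = ∃ λ c → ∀ x {b} (v : Verdict (run x) (initial (run x)) b) →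
  Σ (Verdict (run′ x) (initial (run′ x)) b) λ v′ → space (run′ x) v′ ≤ c * (1 + space (run x) v + ⌈log₂ size
      x ⌉)

-- The last hypothesis relates the measures: where `μ′` is large, `μ` is large as well, its
-- logarithm is at most `c` times that of `μ′`, and the overhead of the simulation is logarithmic in
-- `μ′`.
transfer : ∀ {ℓ} {Input : Set} {run run′ : Input → System} {μ μ′ size : Input → ℕ} {𝒞 : Pred Input ℓ} →
  Simulation run run′ size → DecidesInPolylogSpace run μ 𝒞 →
  (c : ℕ) → (∀ t → ∃ λ t′ → ∀ x → t′ ≤ μ′ x → t ≤ μ x × 2 ≤ μ′ x × ⌈log₂ μ x ⌉ ≤ c * ⌈log₂ μ′ x ⌉ × ⌈log₂
      size x ⌉ ≤ ⌈log₂ μ′ x ⌉) →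
  DecidesInPolylogSpace run′ μ′ 𝒞
transfer {run = run} {run′} {μ} {μ′} {size} (k , simulate) D c large = record
  -- The simulation adds a logarithm to the space, which the old exponent would not cover if it were
  -- 0.
  { exponent  = suc exponent
  ; factor    = k * (2 + factor * c ^ exponent)
  ; threshold = proj₁ (large threshold)
  ; halts     = λ x → let b , v = halts x in b , proj₁ (simulate x v)
  ; correct   = λ x → mk⇔
      -- The original machine has some verdict; its image under the simulation must coincide with
      -- the given acceptance, so it was acceptance too.
      (λ v′ → let b , v = halts x in Equivalence.to (correct x)
        (subst (Verdict (run x) (initial (run x))) (verdict-unique (proj₁ (simulate x v)) v′) v))
      (λ p → proj₁ (simulate x (Equivalence.from (correct x) p)))
  ; bounded   = λ x l v′ → let b , v = halts x ; d , s = simulate x v in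
      ≤-trans (≤-reflexive (space-unique v′ d)) (≤-trans s (estimate x l v))
  }
  where
  open DecidesInPolylogSpace D
  estimate : ∀ x → proj₁ (large threshold) ≤ μ′ x → ∀ {b} (v : Verdict (run x) (initial (run x)) b) →
             k * (1 + space (run x) v + ⌈log₂ size x ⌉) ≤ k * (2 + factor * c ^ exponent) * ⌈log₂ μ′ x ⌉ ^
                 suc exponent
  estimate x l v = begin
    k * (1 + space (run x) v + ⌈log₂ size x ⌉)    ≤⟨ *-monoʳ-≤ k (+-mono-≤ (s≤s S≤) size≤) ⟩
    k * (1 + F * P + L)                           ≤⟨ *-monoʳ-≤ k
        (+-mono-≤ (+-mono-≤ (m^n>0 L {{L≢0}} (suc exponent)) (*-monoʳ-≤ F (m≤n*m P L {{L≢0}})))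
        (m≤m*n L P {{m^n≢0 L exponent {{L≢0}}}})) ⟩
    k * (L * P + F * (L * P) + L * P)             ≡⟨ rearrange k F (L * P) ⟩
    k * (2 + F) * (L * P)                         ∎
    where
    open ≤-Reasoning
    L = ⌈log₂ μ′ x ⌉
    P = L ^ exponent
    F = factor * c ^ exponent
    t≤ = proj₁ (proj₂ (large threshold) x l)
    log≤ = proj₁ (proj₂ (proj₂ (proj₂ (large threshold) x l)))
    size≤ = proj₂ (proj₂ (proj₂ (proj₂ (large threshold) x l)))
    L≢0 : NonZero L
    L≢0 = >-nonZero (1≤⌈log₂⌉ (proj₁ (proj₂ (proj₂ (large threshold) x l))))
    S≤ : space (run x) v ≤ F * P
    S≤ = ≤-trans (bounded x t≤ v) (≤-trans (*-monoʳ-≤ factor (^-monoˡ-≤ exponent log≤))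
      (≤-reflexive (trans (cong (factor *_) (*-^ c L exponent)) (sym (*-assoc factor (c ^ exponent) P)))))
    rearrange : ∀ k F x → k * (x + F * x + x) ≡ k * (2 + F) * x
    rearrange = solve-∀

linear : ∀ S L q G → 3 + ((S + S) + (q + suc L)) * G ≤ (3 + (3 + q) * G) * (1 + S + L)
linear S L q G = ≤-trans (m≤m+n _ (S + S + S + (L + L + L) + (2 + S + L + L + q * S + q * L) * G))
    (≤-reflexive (expand S L q G))
  where
  expand : ∀ S L q G → 3 + ((S + S) + (q + suc L)) * G + (S + S + S + (L + L + L) +
      (2 + S + L + L + q * S + q * L) * G) ≡ (3 + (3 + q) * G) * (1 + S + L)
  expand = solve-∀

corollary1 : ∀ {ℓ : Level} (σ : Vocabulary) → HasPositiveArity σ →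
    (𝒞 : Pred (OrderedStructure σ) ℓ) →
    RandomAccessDecidable 𝒞 ⇔ DirectAccessDecidable 𝒞
corollary1 σ positive 𝒞 = mk⇔ toDirectAccess toRandomAccess
  where
  open OrderedStructure
  toDirectAccess : RandomAccessDecidable 𝒞 → DirectAccessDecidable 𝒞
  toDirectAccess (M , D) = planMachineᵈ σ plan , transfer {μ = n̂} {size} {size}
    (3 + (3 + #Q) * Plans.Plan.degree plan , λ A v → let d , s = simulation A v in
      d , ≤-trans s (≤-trans (+-monoʳ-≤ 3 (*-monoˡ-≤ (Plans.Plan.degree plan)
          (+-monoʳ-≤ (space (RandomAccess.system M (bin A)) v + space (RandomAccess.system M (bin A)) v)
          (+-monoʳ-≤ #Q (n≤1+n _)))))
            (linear (space (RandomAccess.system M (bin A)) v) ⌈log₂ size A ⌉ #Q (Plans.Plan.degree plan))))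
    -- From `2 ≤ n` on, `n` is at most the length of the encoding, so that the original threshold
    -- `t` is reached as well.
    D c λ t → t ⊔ 2 , λ A l → let 2≤ : 2 ≤ size A
                                  2≤ = m⊔n≤o⇒n≤o t 2 l in
      ≤-trans (m⊔n≤o⇒m≤o t 2 l) (size≤n̂ σ positive A 2≤) , 2≤ ,
      ⌈log₂⌉-≤ {L = c * ⌈log₂ size A ⌉} (≤-trans (≤-reflexive (length-bin A)) (c-bounds (size A) 2≤)) , ≤-refl
    where
    open SimulateRandomAccess σ M using (plan; simulation)
    open RandomAccessMachine M using (#Q)
    c = proj₁ (encodingLength-bounded σ)
    c-bounds = proj₂ (encodingLength-bounded σ)
  toRandomAccess : DirectAccessDecidable 𝒞 → RandomAccessDecidable 𝒞
  toRandomAccess (M , D) = planMachineʳ plan , transfer {μ = size} {n̂} {size}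
    (3 + (3 + #Q) * Plans.Plan.degree plan , λ A v → let d , s = simulation (encodingLength-< σ positive) A v in
      d , ≤-trans s (linear (space (DirectAccess.system M A) v) ⌈log₂ size A ⌉ #Q (Plans.Plan.degree plan)))
    -- An encoding longer than that for size `t ⊔ 2` cannot come from a smaller structure, as the
    -- length is monotone in the size.
    D 1 λ t → suc (encodingLength σ (t ⊔ 2)) , λ A l →
      let t⊔2≤ : t ⊔ 2 ≤ size A
          t⊔2≤ = ≮⇒≥ λ size< → <⇒≱ (≤-trans l (≤-reflexive (length-bin A)))
            (encodingLength-mono σ positive (size A) (t ⊔ 2) (>-nonZero⁻¹ (size A) {{nonEmpty A}})
                (<⇒≤ size<))
          2≤ : 2 ≤ size A
          2≤ = m⊔n≤o⇒n≤o t 2 t⊔2≤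
          log≤ : ⌈log₂ size A ⌉ ≤ ⌈log₂ n̂ A ⌉
          log≤ = ⌈log₂⌉-mono-≤ {size A} {n̂ A} (size≤n̂ σ positive A 2≤)
      in m⊔n≤o⇒m≤o t 2 t⊔2≤ , ≤-trans 2≤ (size≤n̂ σ positive A 2≤) , ≤-trans log≤
              (≤-reflexive (sym (*-identityˡ ⌈log₂ n̂ A ⌉))) , log≤
    where
    open SimulateDirectAccess σ M using (plan; simulation)
    open DirectAccessMachine M using (#Q)
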